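{- Let \(P\) be a rational polygon of denominator \(k \geq 4\) with \(i \geq 1\) interior lattice points and \(b\) boundary lattice points. Set \(b_{\max} := (k+1)(i+1)+3\) and \(\tilde b := b_{\max}-b\). Then \[2k^2\operatorname{area}(P) \leq k(k+1)^2(i+1) - \begin{cases} \tilde b, & b \in \{b_{\max}, b_{\max}-1\},\\ 2 + k(\tilde b-2), & 1 \leq b \leq b_{\max}-2,\\ 3 + k(\tilde b - 2), & b = 0.\end{cases}\] Equality holds if and only if \(P\) is equivalent to one of the following polygons: (0a) \(\operatorname{conv}\left((0,\tfrac1k),(\tfrac1k,-1),((k+1)(i+1)-\tfrac1k,-1)\right)\), for \(b = b_{\max}-4\); (0b) \(\operatorname{conv}\left((0,\tfrac1k),(\tfrac1k,-1),(1-\tfrac1k,-1),(k(i+1)-\tfrac1k,\tfrac1k-1)\right)\), for \(b=0\); (1a) \(\operatorname{conv}\left((0,\tfrac1k),(\tfrac1k,-1),(b-\tfrac1k,-1),(k(i+1),\tfrac1k-1)\right)\), for \(1 \leq b \leq b_{\max}-3\); (2a) \(\operatorname{conv}\left((0,\tfrac1k),(0,\tfrac1k-1),(x+\tfrac1k,-1),(x+b-1-\tfrac1k,-1),(k(i+1),\tfrac1k-1)\right)\), for \(2 \leq b \leq b_{\max}-2\) and \(x = 0,\dots,\lfloor \tfrac{\tilde b}{2}\rfloor - 1\); (2b) \(\operatorname{conv}\left((0,\tfrac1k),(0,\tfrac1k-1),(\tfrac1k,-1),((k+1)(i+1),-1)\right)\), for \(b = b_{\max}-1\); (2c) \(\operatorname{conv}\left((0,\tfrac1k),(0,-1),((k+1)(i+1),-1)\right)\),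 for \(b = b_{\max}\). All polygons listed above are pairwise non-equivalent.
   Context: A rational polygon is the convex hull of finitely many points of \(\mathbb{Q}^2\). Its denominator is the smallest positive integer \(k\) such that \(kP\) has integral vertices. Lattice points are the points of \(\mathbb{Z}^2\); interior and boundary refer to \(P\) in \(\mathbb{R}^2\). \(\operatorname{area}\) is the Euclidean area. Two polygons \(P,Q\) are equivalent if \(P = UQ+z\) for some unimodular matrix \(U \in \mathbb{Z}^{2\times 2}\) and some \(z\in\mathbb{Z}^2\). -}

module Defs where

open import Data.Nat as ℕ using (ℕ; zero; suc; _∸_)
open import Data.Nat.DivMod as ℕD using ()
open import Data.Integer as ℤ using (ℤ; +_; -[1+_])
open import Data.Rational as ℚ using (ℚ; _+_; _*_; _-_; -_; _/_; 0ℚ; 1ℚ; ∣_∣; _≤_; _<_)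
open import Data.Product using (Σ; ∃; ∃-syntax; _×_; _,_; proj₁; proj₂)
open import Data.Sum using (_⊎_)
open import Data.List using (List; []; _∷_; length; map; zipWith; foldr)
open import Data.Bool using (true; false)
open import Data.Unit using (⊤)
open import Data.List.Relation.Unary.All using (All)
open import Data.List.Membership.Propositional using (_∈_)
open import Data.List.Relation.Unary.Unique.Propositional using (Unique)
open import Relation.Binary.PropositionalEquality using (_≡_; _≢_)
open import Relation.Nullary using (¬_)

Point : Set
Point = ℚ × ℚ

ℕ→ℚ : ℕ → ℚ
ℕ→ℚ n = + n / 1

ℤ→ℚ : ℤ → ℚ
ℤ→ℚ z = z / 1

-- 1/k  (k ≥ 4 in all uses; the value at k = 0 is irrelevant)
inv : ℕ → ℚ
inv zero    = 0ℚ
inv (suc k) = + 1 / suc k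

_⊕_ : Point → Point → Point
(a , b) ⊕ (c , d) = (a + c , b + d)

_⊖_ : Point → Point → Point
(a , b) ⊖ (c , d) = (a - c , b - d)

_·_ : ℚ → Point → Point
r · (a , b) = (r * a , r * b)

cross : Point → Point → ℚ
cross (a , b) (c , d) = a * d - b * c

lat : ℤ × ℤ → Point
lat (x , y) = (ℤ→ℚ x , ℤ→ℚ y)

sum : List ℚ → ℚ
sum = foldr _+_ 0ℚ

wsum : List ℚ → List Point → Point
wsum cs ps = foldr _⊕_ (0ℚ , 0ℚ) (zipWith _·_ cs ps)

InConv : List Point → Point → Set
InConv ps q = ∃[ cs ] (All (0ℚ ≤_) cs × length cs ≡ length ps
                       × sum cs ≡ 1ℚ × wsum cs ps ≡ q)

Interior : List Point → Point → Set
Interior ps z = ∃[ ε ] (0ℚ < ε × ((q : Point) →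
                 ∣ proj₁ q - proj₁ z ∣ ≤ ε → ∣ proj₂ q - proj₂ z ∣ ≤ ε → InConv ps q))

Boundary : List Point → Point → Set
Boundary ps z = InConv ps z × ¬ Interior ps z

HasCard : (ℤ × ℤ → Set) → ℕ → Set
HasCard P n = ∃[ zs ] (Unique zs × length zs ≡ n
                       × ((z : ℤ × ℤ) → (z ∈ zs → P z) × (P z → z ∈ zs)))

edgesFrom : Point → List Point → List (Point × Point)
edgesFrom f []            = []
edgesFrom f (x ∷ [])      = (x , f) ∷ []
edgesFrom f (x ∷ y ∷ r)   = (x , y) ∷ edgesFrom f (y ∷ r)

edges : List Point → List (Point × Point)
edges []       = []
edges (p ∷ ps) = edgesFrom p (p ∷ ps)

-- The list is the vertex list of a convex polygon with nonempty interior,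
-- in counterclockwise order: ≥ 3 distinct points, and every vertex not on
-- an edge lies strictly to the left of that edge.
ConvexCCW : List Point → Set
ConvexCCW ps = 3 ℕ.≤ length ps × Unique ps
  × ((e : Point × Point) → e ∈ edges ps → (v : Point) → v ∈ ps →
       v ≢ proj₁ e → v ≢ proj₂ e →
       0ℚ < cross (proj₂ e ⊖ proj₁ e) (v ⊖ proj₁ e))

-- Euclidean area of the convex polygon with CCW vertex list ps (shoelace)
area : List Point → ℚ
area ps = (+ 1 / 2) * sum (map (λ e → cross (proj₁ e) (proj₂ e)) (edges ps))

IsIntegral : ℚ → Set
IsIntegral r = ∃[ z ] (r ≡ ℤ→ℚ z)

IntegralMultiple : ℕ → List Point → Set
IntegralMultiple k ps = All (λ v → IsIntegral (ℕ→ℚ k * proj₁ v) × IsIntegral (ℕ→ℚ k * proj₂ v)) ps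

Denominator : List Point → ℕ → Set
Denominator ps k = 1 ℕ.≤ k × IntegralMultiple k ps
  × ((m : ℕ) → 1 ℕ.≤ m → IntegralMultiple m ps → k ℕ.≤ m)

applyAff : ℤ → ℤ → ℤ → ℤ → ℤ × ℤ → Point → Point
applyAff a b c d (t₁ , t₂) (x , y) =
  (ℤ→ℚ a * x + ℤ→ℚ b * y + ℤ→ℚ t₁ , ℤ→ℚ c * x + ℤ→ℚ d * y + ℤ→ℚ t₂)

Equivalent : List Point → List Point → Set
Equivalent ps qs = ∃[ a ] ∃[ b ] ∃[ c ] ∃[ d ] ∃[ t ]
  ((a ℤ.* d ℤ.- b ℤ.* c ≡ + 1 ⊎ a ℤ.* d ℤ.- b ℤ.* c ≡ -[1+ 0 ])
   × ((q : Point) → (InConv ps q → ∃[ q' ] (InConv qs q' × q ≡ applyAff a b c d t q'))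
                  × (∃[ q' ] (InConv qs q' × q ≡ applyAff a b c d t q') → InConv ps q)))

bmax : ℕ → ℕ → ℕ
bmax k i = (suc k) ℕ.* (suc i) ℕ.+ 3

-- the subtracted case term (b̃ = bmax - b, assuming b ≤ bmax)
correction : ℕ → ℕ → ℕ → ℕ
correction k i zero = 3 ℕ.+ k ℕ.* (bmax k i ∸ 2)
correction k i (suc b) with bmax k i ℕ.≤ᵇ suc (suc b)
... | true  = bmax k i ∸ suc b
... | false = 2 ℕ.+ k ℕ.* ((bmax k i ∸ suc b) ∸ 2)

rhs : ℕ → ℕ → ℕ → ℚ
rhs k i b = ℕ→ℚ (k ℕ.* (suc k ℕ.* suc k) ℕ.* suc i) - ℕ→ℚ (correction k i b)

data Shape : Set where
  s0a s0b : Shape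
  s1a     : (b : ℕ) → Shape
  s2a     : (b x : ℕ) → Shape
  s2b s2c : Shape

Admissible : ℕ → ℕ → Shape → Set
Admissible k i s0a       = 4 ℕ.≤ bmax k i
Admissible k i s0b       = ⊤
Admissible k i (s1a b)   = 1 ℕ.≤ b × b ℕ.≤ bmax k i ∸ 3
Admissible k i (s2a b x) = 2 ℕ.≤ b × b ℕ.≤ bmax k i ∸ 2 × x ℕ.< (bmax k i ∸ b) ℕD./ 2
Admissible k i s2b       = ⊤
Admissible k i s2c       = ⊤

bOf : ℕ → ℕ → Shape → ℕ
bOf k i s0a       = bmax k i ∸ 4
bOf k i s0b       = 0
bOf k i (s1a b)   = b
bOf k i (s2a b x) = b
bOf k i s2b       = bmax k i ∸ 1
bOf k i s2c       = bmax k i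

shape : ℕ → ℕ → Shape → List Point
shape k i s0a =
  (0ℚ , inv k) ∷ (inv k , - 1ℚ) ∷ (ℕ→ℚ (suc k ℕ.* suc i) - inv k , - 1ℚ) ∷ []
shape k i s0b =
  (0ℚ , inv k) ∷ (inv k , - 1ℚ) ∷ (1ℚ - inv k , - 1ℚ)
    ∷ (ℕ→ℚ (k ℕ.* suc i) - inv k , inv k - 1ℚ) ∷ []
shape k i (s1a b) =
  (0ℚ , inv k) ∷ (inv k , - 1ℚ) ∷ (ℕ→ℚ b - inv k , - 1ℚ)
    ∷ (ℕ→ℚ (k ℕ.* suc i) , inv k - 1ℚ) ∷ []
shape k i (s2a b x) =
  (0ℚ , inv k) ∷ (0ℚ , inv k - 1ℚ) ∷ (ℕ→ℚ x + inv k , - 1ℚ)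
    ∷ (ℕ→ℚ (x ℕ.+ b) - 1ℚ - inv k , - 1ℚ) ∷ (ℕ→ℚ (k ℕ.* suc i) , inv k - 1ℚ) ∷ []
shape k i s2b =
  (0ℚ , inv k) ∷ (0ℚ , inv k - 1ℚ) ∷ (inv k , - 1ℚ) ∷ (ℕ→ℚ (suc k ℕ.* suc i) , - 1ℚ) ∷ []
shape k i s2c =
  (0ℚ , inv k) ∷ (0ℚ , - 1ℚ) ∷ (ℕ→ℚ (suc k ℕ.* suc i) , - 1ℚ) ∷ []

{-# OPTIONS --safe #-}
module Submission where

-- Write K = k, κ = 1/k, I = i + 1 and N = (k+1)(i+1). The theorem holds because a polygon of nearly
-- maximal area must have all its interior lattice points on one line and reach distance exactly 1/k
-- beyond that line on one side and exactly 1 on the other. Every other polygon misses the bound by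
-- a definite amount.
--
-- Long chord. Take a segment of P in a primitive lattice direction, of lattice length ℓ. If a
-- vertex lies at lattice height at least (1 + 1/k) ℓ over it, the triangle they span contains a
-- segment in another primitive direction that is longer by the factor (2k+2)/(2k+1). Since P is
-- bounded, this stops (`Descent`), and after a unimodular map P contains a horizontal segment of
-- length ℓ from which no vertex departs vertically by (1 + 1/k) ℓ or more (`Wide`). Coordinates of
-- vertices are multiples of 1/k, so by similar triangles P meets every integer level, other than
-- the lowest and the highest one in its interior, in a section longer than 1, which contains an
-- interior lattice point (`nonempty`).
--
-- Coarse bound. On an integer level with c interior lattice points, the nearest non-interior
-- lattice points on both sides yield two lines that enclose P, so the horizontal width of P is at
-- most an affine function of the height with value c + 1 on that level (`level-width`). Twice the
-- area is bounded by trapezoids with these widths (`area≤`, `slab`, `glue`). Unless there is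
-- exactly one interior level and the heights beyond it are 1/k and 1, suitable strips give twice
-- the area at most N - 1/2. For k at least 4 one has k²/2 > k + 3, so this lies strictly below the
-- smallest right-hand side, the one for b = 0 (`coarse`).
--
-- Thin polygons. The remaining P are normalised to lie in -1 ≤ y ≤ κ with leftmost top vertex (0,
-- κ) and interior lattice points (1, 0), ..., (i, 0). A top edge of positive length loses too much
-- area (`second-top`). Otherwise the two sides are treated separately. Each side reaches the
-- lattice point at the end of the row ("touching"), or it does not and its bottom corner is one
-- grid step away from the reference line ("sharp"), or at least two steps away ("gap"). In the
-- scaled area these cost 0, K and K + 1, and a touching side adds one boundary lattice point. If
-- the bottom edge carries n lattice points, its length is at most n + 1 - 2κ. Comparing with b,
-- which is at least n plus the number of touching sides, gives the inequality in each range of b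
-- (`Weigh`). Equality makes every slack vanish and forces the corners of one of the listed
-- polygons, directly or after the reflection that exchanges the sides (`Placement`).
--
-- Non-equivalence. An equivalence maps vertices to vertices and edges to edges, so area, number of
-- vertices and the areas of corner triangles are invariants (`equivalent⇒congruent`). The area
-- determines b, the number of vertices separates the families that can share b, and corner
-- triangles separate the pentagons with the same b (`2a-distinct`).

-- Ring identities over the rationals, decided by comparing normal forms.

module RingIdentities where

 open import Defs using (ℕ→ℚ)
 open import Data.Nat as ℕ using (ℕ; zero; suc)
 open import Data.Integer using (ℤ; +_)
 open import Data.Rational as ℚ using (ℚ)
 import Data.Rational.Properties as ℚP
 open import Data.Fin using (Fin; zero; suc)
 open import Data.Maybe using (Maybe; just; nothing; map; maybe)
 open import Data.Product using (_×_; _,_; proj₁; proj₂)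
 open import Data.Vec using (Vec; []; _∷_; lookup)
 import Relation.Binary.PropositionalEquality as E
 open import Relation.Nullary.Decidable using (dec⇒maybe)
 open import Tactic.RingSolver.Core.AlmostCommutativeRing using (AlmostCommutativeRing; fromCommutativeRing)

 ringℚ : AlmostCommutativeRing _ _
 ringℚ = fromCommutativeRing ℚP.+-*-commutativeRing (λ x → dec⇒maybe (ℚ.0ℚ ℚP.≟ x))

 open import Tactic.RingSolver.NonReflective ringℚ using (Expr; Κ; Ι; _⊕_; _⊗_; ⊝_; module Ops)

 -- Terms without indices or hidden arguments: the reflective ring solver creates so many metavariables
 -- that several hundred calls in one file exhaust the memory.
 data Term : Set where
  var : ℕ → Term
  con : ℚ → Term
  add mul : Term → Term → Term
  neg : Term → Term

 -- An index out of range has the value 0, in agreement with the constant 0 that `expr` puts there,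
 -- so variables need no bound on their index.
 at : ∀ {n} → Vec ℚ n → ℕ → ℚ
 at [] _ = ℚ.0ℚ
 at (x ∷ _) zero = x
 at (_ ∷ ρ) (suc i) = at ρ i

 value : ∀ {n} → Vec ℚ n → Term → ℚ
 value ρ (var i) = at ρ i
 value ρ (con c) = c
 value ρ (add s t) = value ρ s ℚ.+ value ρ t
 value ρ (mul s t) = value ρ s ℚ.* value ρ t
 value ρ (neg t) = ℚ.- value ρ t

 index : ∀ n → ℕ → Maybe (Fin n)
 index zero _ = nothing
 index (suc n) zero = just zero
 index (suc n) (suc i) = map suc (index n i)

 expr : ∀ n → Term → Expr ℚ n
 expr n (var i) = maybe Ι (Κ ℚ.0ℚ) (index n i)
 expr n (con c) = Κ c
 expr n (add s t) = expr n s ⊕ expr n t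
 expr n (mul s t) = expr n s ⊗ expr n t
 expr n (neg t) = ⊝ expr n t

 expr-var : ∀ {n} (ρ : Vec ℚ n) i → Ops.⟦ maybe Ι (Κ ℚ.0ℚ) (index n i) ⟧ ρ E.≡ at ρ i
 expr-var [] i = E.refl
 expr-var (x ∷ ρ) zero = E.refl
 expr-var {suc n} (x ∷ ρ) (suc i) = shift (index n i) (expr-var ρ i) where
  shift : ∀ m {a} → Ops.⟦ maybe Ι (Κ ℚ.0ℚ) m ⟧ ρ E.≡ a → Ops.⟦ maybe Ι (Κ ℚ.0ℚ) (map suc m) ⟧ (x ∷ ρ) E.≡ a
  shift (just _) e = e
  shift nothing e = e

 expr-value : ∀ {n} (ρ : Vec ℚ n) t → Ops.⟦ expr n t ⟧ ρ E.≡ value ρ t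
 expr-value ρ (var i) = expr-var ρ i
 expr-value ρ (con c) = E.refl
 expr-value ρ (add s t) = E.cong₂ ℚ._+_ (expr-value ρ s) (expr-value ρ t)
 expr-value ρ (mul s t) = E.cong₂ ℚ._*_ (expr-value ρ s) (expr-value ρ t)
 expr-value ρ (neg t) = E.cong ℚ.-_ (expr-value ρ t)

 -- An identity is written as a function of its variables; `sides` applies it to `var 0`, `var 1`,
 -- ... and thereby recovers two first-order terms.
 Equation : ℕ → Set
 Equation zero = Term × Term
 Equation (suc n) = Term → Equation n

 sides : ∀ n → ℕ → Equation n → Term × Term
 sides zero i e = e
 sides (suc n) i e = sides n (suc i) (e (var i))

 ∀ℚ : ∀ n → (Vec ℚ n → Set) → Set
 ∀ℚ zero P = P []
 ∀ℚ (suc n) P = ∀ x → ∀ℚ n (λ ρ → P (x ∷ ρ))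

 ∀ℚ-intro : ∀ n {P : Vec ℚ n → Set} → (∀ ρ → P ρ) → ∀ℚ n P
 ∀ℚ-intro zero h = h []
 ∀ℚ-intro (suc n) h x = ∀ℚ-intro n (λ ρ → h (x ∷ ρ))

 -- Each side equals the value of its normal form, so coincidence of the normal forms, which `refl`
 -- checks at every use, gives the identity for all rationals.
 ring : ∀ n (e : Equation n) → Ops.norm (expr n (proj₁ (sides n 0 e))) E.≡ Ops.norm (expr n (proj₂ (sides n 0 e))) → ∀ℚ n (λ ρ → value ρ (proj₁ (sides n 0 e)) E.≡ value ρ (proj₂ (sides n 0 e)))
 ring n e h = ∀ℚ-intro n λ ρ → E.trans (E.sym (sound ρ (proj₁ (sides n 0 e)))) (E.trans (E.cong (λ p → Semantics.⟦ p ⟧ ρ) h) (sound ρ (proj₂ (sides n 0 e)))) where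
  import Tactic.RingSolver.Core.Polynomial.Semantics Ops.homo as Semantics
  sound : ∀ {n} (ρ : Vec ℚ n) t → Ops.⟦ expr n t ⇓⟧ ρ E.≡ value ρ t
  sound {n} ρ t = E.trans (Ops.correct (expr n t) ρ) (expr-value ρ t)

 infix 4 _≡_
 infixl 6 _+_ _-_
 infixl 7 _*_ _/_
 infix 8 -_
 _≡_ : Term → Term → Term × Term
 _≡_ = _,_
 _+_ _-_ _*_ : Term → Term → Term
 _+_ = add
 s - t = add s (neg t)
 _*_ = mul
 -_ : Term → Term
 -_ = neg
 _/_ : ℤ → (n : ℕ) → .{{ℕ.NonZero n}} → Term
 z / n = con (z ℚ./ n)
 ν : ℕ → Term
 ν n = con (ℕ→ℚ n)
 0# 1# ½ : Term
 0# = ν 0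
 1# = ν 1
 ½ = + 1 / 2

-- Polynomial identities that certify the later equations and inequalities.

module Identities where
 open import Data.Integer using (+_)
 open import Relation.Binary.PropositionalEquality using (refl)
 open RingIdentities

 c¾ = + 3 / 4
 c²⁷⁄₈ = + 27 / 8
 c³⁄₂ = + 3 / 2
 c⁷⁄₄ = + 7 / 4

 cancel-sub = ring 2 (λ a b → b - a + a ≡ b) refl
 *-neg = ring 2 (λ a b → a * - b ≡ - (a * b)) refl
 neg-neg = ring 1 (λ b → - - b ≡ b) refl
 add-sub = ring 2 (λ x y → x ≡ x + y - y) refl
 id1 = ring 4 (λ a1 a2 b1 b2 → (b1 - a1) * (a2 - a2) - (b2 - a2) * (a1 - a1) ≡ 0#) refl
 id2 = ring 4 (λ a1 a2 b1 b2 → (b1 - a1) * (b2 - a2) - (b2 - a2) * (b1 - a1) ≡ 0#) refl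
 id3 = ring 4 (λ a1 a2 b1 b2 → (a1 - a1) * (b2 - a2) - (a2 - a2) * (b1 - a1) ≡ 0#) refl
 id4 = ring 6 (λ a1 a2 b1 b2 c1 c2 → (b1 - a1) * (c2 - a2) - (b2 - a2) * (c1 - a1) ≡ (c1 - b1) * (a2 - b2) - (c2 - b2) * (a1 - b1)) refl
 id5 = ring 6 (λ a1 a2 b1 b2 c1 c2 → (c1 - a1) * (b2 - a2) - (c2 - a2) * (b1 - a1) ≡ - ((b1 - a1) * (c2 - a2) - (b2 - a2) * (c1 - a1))) refl
 id6 = ring 8 (λ a1 a2 b1 b2 c1 c2 x y → ((c1 - b1) * (y - b2) - (c2 - b2) * (x - b1)) + ((b1 - a1) * (y - a2) - (b2 - a2) * (x - a1)) - ((c1 - a1) * (y - a2) - (c2 - a2) * (x - a1)) ≡ (b1 - a1) * (c2 - a2) - (b2 - a2) * (c1 - a1)) refl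
 id7 = ring 8 (λ a1 a2 b1 b2 c1 c2 x y → ((c1 - b1) * (y - b2) - (c2 - b2) * (x - b1)) * a1 + ((- ((c1 - a1) * (y - a2) - (c2 - a2) * (x - a1))) * b1 + ((b1 - a1) * (y - a2) - (b2 - a2) * (x - a1)) * c1) ≡ ((b1 - a1) * (c2 - a2) - (b2 - a2) * (c1 - a1)) * x) refl
 id8 = ring 8 (λ a1 a2 b1 b2 c1 c2 x y → ((c1 - b1) * (y - b2) - (c2 - b2) * (x - b1)) * a2 + ((- ((c1 - a1) * (y - a2) - (c2 - a2) * (x - a1))) * b2 + ((b1 - a1) * (y - a2) - (b2 - a2) * (x - a1)) * c2) ≡ ((b1 - a1) * (c2 - a2) - (b2 - a2) * (c1 - a1)) * y) refl
 id9 = ring 10 (λ a1 a2 b1 b2 s t x y u v → (b1 - a1) * ((s * y + t * v) - a2) - (b2 - a2) * ((s * x + t * u) - a1) ≡ s * ((b1 - a1) * (y - a2) - (b2 - a2) * (x - a1)) + t * ((b1 - a1) * (v - a2) - (b2 - a2) * (u - a1)) + (s + t - 1#) * ((b1 - a1) * a2 - (b2 - a2) * a1)) refl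
 id10 = ring 2 (λ z w → z + (1# - 1#) * w ≡ z) refl
 id11 = ring 1 (λ x → 0# ≡ 0# * x + 0#) refl
 id12 = ring 1 (λ x → x ≡ 1# * x + 0#) refl
 id13 = ring 2 (λ x y → y ≡ 0# * x + y) refl
 id14 = ring 4 (λ c u d u' → (c + u) + (d + u') ≡ (c + d) + (u + u')) refl
 id15 = ring 5 (λ c d p x x' → (c * p + x) + (d * p + x') ≡ (c + d) * p + (x + x')) refl
 id16 = ring 4 (λ t c p x → t * (c * p + x) ≡ (t * c) * p + t * x) refl
 id17 = ring 3 (λ α β γ → 0# ≡ α * 0# + β * 0# + γ * 0#) refl
 id18 = ring 9 (λ α β γ c u p1 p2 x1 x2 → c * (α * p1 + β * p2 + γ) + (α * x1 + β * x2 + γ * u) ≡ α * (c * p1 + x1) + β * (c * p2 + x2) + γ * (c + u)) refl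
 id19 = ring 6 (λ a1 a2 b1 b2 x y → (b1 - a1) * (y - a2) - (b2 - a2) * (x - a1) ≡ (- (b2 - a2)) * x + (b1 - a1) * y + (a1 * (b2 - a2) - a2 * (b1 - a1))) refl
 id20 = ring 4 (λ i x y z → i * (x * 1# + (- y * 1# + z * 1#)) ≡ (x + z - y) * i) refl
 id21 = ring 3 (λ i D x → i * (D * x) ≡ (D * i) * x) refl
 id22 = ring 6 (λ a1 a2 b1 b2 x y → ((b1 - a1) * (y - a2) - (b2 - a2) * (x - a1)) + ((a1 - b1) * (y - b2) - (a2 - b2) * (x - b1)) ≡ 0#) refl
 id23 = ring 8 (λ a1 a2 b1 b2 x y s t → (b1 - a1) * (y + t - a2) - (b2 - a2) * (x + s - a1) ≡ (b1 - a1) * (y - a2) - (b2 - a2) * (x - a1) + ((b1 - a1) * t - (b2 - a2) * s)) refl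
 shift-sub = ring 2 (λ x s → (x + s) - x ≡ s) refl
 id24 = ring 4 (λ L u v ε → - L ≡ (L + (u * 0# - v * ε)) + ε * v + (- L - L)) refl
 id25 = ring 4 (λ L u v ε → ε * v ≡ - (L + (u * 0# - v * ε)) + L) refl
 id26 = ring 4 (λ L u v ε → - (ε * v) ≡ - (L + (u * 0# - v * - ε)) + L) refl
 id27 = ring 4 (λ L u v ε → ε * u ≡ - (L + (u * - ε - v * 0#)) + L) refl
 id28 = ring 4 (λ L u v ε → - (ε * u) ≡ - (L + (u * ε - v * 0#)) + L) refl
 id29 = ring 2 (λ s t → 0# * s - 0# * t ≡ 0#) refl
 rearr = ring 9 (λ L r m n s t u v w → L + (u * t - v * s) ≡ (n * w - v * s) + (u * t + m * w) + (L * r - w) * (m + n) + L * (1# - (m + n + 1#) * r) + L * r) refl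
 id30 = ring 4 (λ m u s w → m * w - u * - s ≡ u * s + m * w) refl
 id31 = ring 2 (λ p q → p + (q - p) ≡ q) refl
 id32 = ring 4 (λ p1 p2 q1 q2 → (p1 * q2 - p2 * q1) + 0# ≡ (p1 + q1) * (q2 - p2) + (p1 * p2 - q1 * q2)) refl
 id33 = ring 7 (λ p1 p2 q1 q2 x y s → (p1 * y - p2 * x) + (s + (x * y - q1 * q2)) ≡ ((p1 + x) * (y - p2) + s) + (p1 * p2 - q1 * q2)) refl
 id34 = ring 2 (λ s z → s + (z - z) ≡ s) refl
 id35 = ring 4 (λ a b c d → (c + a) * (b - d) ≡ - ((a + c) * (d - b))) refl
 neg-sub = ring 2 (λ a b → - (a - b) ≡ b - a) refl
 id36 = ring 8 (λ t1 t2 u1 u2 x1 x2 m1 m2 → ((u1 - t1) * (x2 - t2) - (u2 - t2) * (x1 - t1)) * (m2 - u2) ≡ ((x1 - u1) * (m2 - u2) - (x2 - u2) * (m1 - u1)) * (t2 - u2) + ((u1 - t1) * (m2 - t2) - (u2 - t2) * (m1 - t1)) * (x2 - u2)) refl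
 neg-diff = ring 2 (λ a b → (a - b) + (b - a) ≡ 0#) refl
 id37 = ring 5 (λ u1 x1 x2 m1 m2 → (x1 - u1) * (m2 - m2) - (x2 - m2) * (m1 - u1) ≡ (x2 - m2) * (u1 - m1)) refl
 add-diff = ring 3 (λ a b c → (b - a) + (c - b) ≡ c - a) refl
 id38 = ring 4 (λ a b c d → (c - d) - (a - b) ≡ (c - a) - (d - b)) refl
 id39 = ring 4 (λ θ a b c → (θ - a + c) - (c - b) ≡ θ - (a - b)) refl
 id40 = ring 4 (λ θ a b c → (b - a) + (θ - b + c) ≡ θ - a + c) refl
 id41 = ring 4 (λ a b c d → (a - c) - (b - d) ≡ (a - b) - c + d) refl
 id42 = ring 4 (λ a b d r → (b - d) * r + (d - a) * r ≡ (b - a) * r) refl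
 id43 = ring 4 (λ a b d r → ((b - d) * r) * a + ((d - a) * r) * b ≡ ((b - a) * r) * d) refl
 id44 = ring 6 (λ p1 p2 q1 q2 d r → (((q2 - d) * r) * p1 + ((d - p2) * r) * q1) * (q2 - p2) ≡ ((q2 - p2) * r) * ((q2 - d) * p1 + (d - p2) * q1)) refl
 id45 = ring 2 (λ a b → a ≡ a + (b - b)) refl
 id46 = ring 4 (λ a b y z → (a + (z - b)) - (a + (y - b)) ≡ z - y) refl
 id47 = ring 4 (λ a b c e → (a + (c - e)) - b ≡ (a - b) + (c - e)) refl
 id48 = ring 6 (λ p1 p2 q1 q2 d w → (p1 + w) * (d - p2) + (w + q1) * (q2 - d) ≡ p1 * (d - p2) + q1 * (q2 - d) + w * (q2 - p2)) refl
 id49 = ring 5 (λ p1 p2 q1 q2 d → p1 * (d - p2) + q1 * (q2 - d) + ((q2 - d) * p1 + (d - p2) * q1) ≡ (p1 + q1) * (q2 - p2)) refl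
 id50 = ring 4 (λ a b x y → (a + b) - (x + y) ≡ (a - x) + (b - y)) refl
 id51 = ring 7 (λ p1 p2 q1 q2 r t j → ((ν 2 * r + t * (q2 - j)) * (q2 - j) - (ν 2 * r + t * (p2 - j)) * (p2 - j)) - (p1 + q1) * (q2 - p2) ≡ (((r + t * (p2 - j)) - p1) + ((r + t * (q2 - j)) - q1)) * (q2 - p2)) refl
 id52 = ring 7 (λ p1 p2 q1 q2 r t j → (p1 + q1) * (q2 - p2) - ((ν 2 * r + t * (q2 - j)) * (q2 - j) - (ν 2 * r + t * (p2 - j)) * (p2 - j)) ≡ ((p1 - (r + t * (p2 - j))) + (q1 - (r + t * (q2 - j)))) * (q2 - p2)) refl
 id53 = ring 7 (λ c d r t l s j → ((ν 2 * r + t * (d - j)) * (d - j) - (ν 2 * r + t * (c - j)) * (c - j)) - ((ν 2 * l + s * (d - j)) * (d - j) - (ν 2 * l + s * (c - j)) * (c - j)) ≡ (d - c) * (ν 2 * (r - l) + (t - s) * ((c - j) + (d - j)))) refl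
 id54 = ring 12 (λ A B C D e f p1 p2 q1 q2 r1 r2 → ((A * q1 + B * q2 + e) - (A * p1 + B * p2 + e)) * ((C * r1 + D * r2 + f) - (C * p1 + D * p2 + f)) - ((C * q1 + D * q2 + f) - (C * p1 + D * p2 + f)) * ((A * r1 + B * r2 + e) - (A * p1 + B * p2 + e)) ≡ (A * D - B * C) * ((q1 - p1) * (r2 - p2) - (q2 - p2) * (r1 - p1))) refl
 id55 = ring 10 (λ A B C D e f p1 p2 q1 q2 → ((A * p1 + B * p2 + e) * (C * q1 + D * q2 + f) - (C * p1 + D * p2 + f) * (A * q1 + B * q2 + e)) + 0# ≡ (A * D - B * C) * ((p1 * q2 - p2 * q1) + 0#) + ((e * (C * q1 + D * q2) - f * (A * q1 + B * q2)) - (e * (C * p1 + D * p2) - f * (A * p1 + B * p2)))) refl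
 id56 = ring 12 (λ A B C D e f p1 p2 x y s g → ((A * p1 + B * p2 + e) * (C * x + D * y + f) - (C * p1 + D * p2 + f) * (A * x + B * y + e)) + ((A * D - B * C) * s + (g - (e * (C * x + D * y) - f * (A * x + B * y)))) ≡ (A * D - B * C) * ((p1 * y - p2 * x) + s) + (g - (e * (C * p1 + D * p2) - f * (A * p1 + B * p2)))) refl
 id57 = ring 4 (λ u v p q → u * (p - p) - v * (q - q) ≡ 0#) refl
 id58 = ring 10 (λ a b c d e f x y x' y' → (a * d - b * c) * (x - x') ≡ d * ((a * x + b * y + e) - (a * x' + b * y' + e)) - b * ((c * x + d * y + f) - (c * x' + d * y' + f))) refl
 id59 = ring 10 (λ a b c d e f x y x' y' → (a * d - b * c) * (y - y') ≡ a * ((c * x + d * y + f) - (c * x' + d * y' + f)) - c * ((a * x + b * y + e) - (a * x' + b * y' + e))) refl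
 id60 = ring 2 (λ x x' → x ≡ (x - x') + x') refl
 id61 = ring 6 (λ k a b t x y → k * (a * x + b * y + t) ≡ a * (k * x) + b * (k * y) + k * t) refl
 id62 = ring 10 (λ d b a2 b2 c2 d2 u v x y → (d * a2 - b * c2) * x + (d * b2 - b * d2) * y + (d * u - b * v) ≡ d * (a2 * x + b2 * y + u) - b * (c2 * x + d2 * y + v)) refl
 id63 = ring 7 (λ a b c d u v t → a * (d * u - b * v) + b * (a * v - c * u) + t ≡ (a * d - b * c) * u + t) refl
 id64 = ring 7 (λ a b c d u v t → c * (d * u - b * v) + d * (a * v - c * u) + t ≡ (a * d - b * c) * v + t) refl
 id65 = ring 4 (λ p q s t → 1# * (p + q + (s - t)) + t ≡ p + q + s) refl
 id66 = ring 2 (λ a b → (a + b) - b ≡ a) refl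
 id67 = ring 4 (λ a b c d → (- a) * (- d) - (- b) * (- c) ≡ a * d - b * c) refl
 id68 = ring 3 (λ p l v → p ≡ p + l * v + l * (- v)) refl
 id69 = ring 7 (λ v1 v2 t1 t2 p1 p2 l → (- v1) * (t2 - (p2 + l * v2)) - (- v2) * (t1 - (p1 + l * v1)) ≡ - (v1 * (t2 - p2) - v2 * (t1 - p1))) refl
 expand = ring 8 (λ v1 v2 w1 w2 t1 t2 p1 p2 → (v1 * w2 - v2 * w1) * (t1 - p1) ≡ ((t1 - p1) * w2 - (t2 - p2) * w1) * v1 + (v1 * (t2 - p2) - v2 * (t1 - p1)) * w1) refl
 expand2 = ring 8 (λ v1 v2 w1 w2 t1 t2 p1 p2 → (v1 * w2 - v2 * w1) * (t2 - p2) ≡ ((t1 - p1) * w2 - (t2 - p2) * w1) * v2 + (v1 * (t2 - p2) - v2 * (t1 - p1)) * w2) refl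
 id70 = ring 2 (λ t p → t ≡ p + (t - p)) refl
 id71 = ring 5 (λ a b c d m → (c + m * a) * (- b) - (d + m * b) * (- a) ≡ a * d - b * c) refl
 id72 = ring 4 (λ α r M h → h * (α * r - M) ≡ α * (h * r) - M * h) refl
 id73 = ring 4 (λ α r M h → h * ((M + 1#) - α * r) ≡ M * h + h - α * (h * r)) refl
 id74 = ring 3 (λ α M h → M * h + h - α * 1# ≡ h - (α - M * h)) refl
 id75 = ring 6 (λ α h v w p m → p + (α * v + h * w) ≡ (p + (α - m * h) * v) + h * (w + m * v)) refl
 complement = ring 1 (λ x → (1# - x) + x ≡ 1#) refl
 sub-* = ring 3 (λ ℓ β s → (ℓ - β) * s ≡ ℓ * s - β * s) refl
 scale = ring 5 (λ k l h s β → β * ((ν 2 * k + 1#) * (h * (l * s)) - (ν 2 * k + ν 2) * l) ≡ l * ((ν 2 * k + 1#) * h * (β * s) - (ν 2 * k + ν 2) * β)) refl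
 id76 = ring 3 (λ k l h → ((ν 2 * k + 1#) * h) - ((ν 2 * k + ν 2) * l) ≡ (k * h - (k + 1#) * l) + (k * h - (k + 1#) * l) + h) refl
 id77 = ring 5 (λ β s ℓ p v → (1# - β * s) * p + (β * s) * (p + ℓ * v) ≡ p + β * (ℓ * s) * v) refl
 id78 = ring 4 (λ k l h β → (h + l - ν 2 * β) * (k + 1#) + (k * h - (k + 1#) * l) ≡ (ν 2 * k + 1#) * h * 1# - (ν 2 * k + ν 2) * β) refl
 id79 = ring 3 (λ s p d → (1# - s) * p + s * (p + d) ≡ p + s * d) refl
 id80 = ring 8 (λ p ℓ s α h v w m → p + ℓ * s * (α * v + h * w) ≡ p + ℓ * ((α - m * h) * s) * v + h * (ℓ * s) * (w + m * v)) refl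
 id81 = ring 4 (λ k l h β → (ν 2 * β - (h + l)) * (k + 1#) + (k * h - (k + 1#) * l) ≡ (ν 2 * k + 1#) * h * 1# - (ν 2 * k + ν 2) * ((h - β) + l)) refl
 id82 = ring 8 (λ p ℓ s α h v w m → (1# - ℓ * s) * (p + ℓ * v) + (ℓ * s) * (p + (α * v + h * w)) ≡ p + h * (ℓ * s) * (w + (m + 1#) * v) + ℓ * (1# - ((h - (α - m * h)) + ℓ) * s) * v) refl
 id83 = ring 3 (λ z ℓ v → z + ℓ * (1# - 1#) * v ≡ z) refl
 cancel-+ = ring 3 (λ g ℓ s → g * s ≡ (g + ℓ) * s - ℓ * s) refl
 id84 = ring 3 (λ x y Q → x - - Q ≡ 1# * x + 0# * y + Q) refl
 id85 = ring 3 (λ x y Q → 1# * x + 0# * y + Q ≡ x + Q) refl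
 id86 = ring 3 (λ x y Q → Q - x ≡ (- 1#) * x + 0# * y + Q) refl
 id87 = ring 3 (λ x y Q → (- 1#) * x + 0# * y + Q ≡ Q - x) refl
 id88 = ring 3 (λ x y Q → y - - Q ≡ 0# * x + 1# * y + Q) refl
 id89 = ring 3 (λ x y Q → 0# * x + 1# * y + Q ≡ y + Q) refl
 id90 = ring 3 (λ x y Q → Q - y ≡ 0# * x + (- 1#) * y + Q) refl
 id91 = ring 3 (λ x y Q → 0# * x + (- 1#) * y + Q ≡ Q - y) refl
 id92 = ring 4 (λ ℓ v p Q → (Q + Q) - ℓ ≡ ℓ * (v - 1#) + (Q - (p + ℓ * v)) + (p + Q)) refl
 id93 = ring 4 (λ ℓ v p Q → (Q + Q) - ℓ ≡ ℓ * (- v - 1#) + ((p + ℓ * v) + Q) + (Q - p)) refl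
 id94 = ring 2 (λ ℓ δ → ℓ ≡ ℓ + 0# * δ) refl
 id95 = ring 4 (λ k ℓ ℓ' δ → (ν 2 * k + 1#) * (ℓ' - (ℓ + δ)) ≡ ((ν 2 * k + 1#) * ℓ' - (ν 2 * k + ν 2) * ℓ) + (ℓ - (ν 2 * k + 1#) * δ)) refl
 id96 = ring 4 (λ ℓ ℓ' n δ → (ℓ' + n * δ) - (ℓ + (1# + n) * δ) ≡ ℓ' - (ℓ + δ)) refl
 id97 = ring 3 (λ D ℓ r → D * (ℓ * r) ≡ ℓ * (D * r)) refl
 id98 = ring 4 (λ q ℓ n d → (ℓ + n * d) - q ≡ d * n - q * 1# + ℓ) refl
 id99 = ring 5 (λ d n q s ℓ → d * n - q * (d * s) + ℓ ≡ d * (n - q * s) + ℓ) refl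
 id100 = ring 2 (λ z e → z + e ≡ z + e * 1#) refl
 id101 = ring 2 (λ z e → z + 0# ≡ z + e * 0#) refl
 id102 = ring 6 (λ v1 v2 x y p1 p2 → ((- v2) * x + v1 * y + 0#) - ((- v2) * p1 + v1 * p2 + 0#) ≡ v1 * (y - p2) - v2 * (x - p1)) refl
 id103 = ring 7 (λ v1 v2 w1 w2 p1 p2 ℓ → w2 * (p1 + ℓ * v1) + (- w1) * (p2 + ℓ * v2) + 0# ≡ w2 * p1 + (- w1) * p2 + 0# + ℓ * (v1 * w2 - v2 * w1)) refl
 id104 = ring 5 (λ v1 v2 p1 p2 ℓ → (- v2) * (p1 + ℓ * v1) + v1 * (p2 + ℓ * v2) + 0# ≡ (- v2) * p1 + v1 * p2 + 0#) refl
 id105 = ring 2 (λ q f → q - (- f - 1#) ≡ (f + 1#) - - q) refl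
 id106 = ring 2 (λ q f → - f - 1# + 1# - q ≡ - q - f) refl
 id107 = ring 5 (λ x u m r y → ((u - m) * r) * y + ((m - x) * r) * y ≡ ((u - x) * r) * y) refl
 id108 = ring 4 (λ x u m r → ((m - u) * r) * x + ((x - m) * r) * u ≡ ((x - u) * r) * m) refl
 id109 = ring 5 (λ x u m r y → ((m - u) * r) * y + ((x - m) * r) * y ≡ ((x - u) * r) * y) refl
 id110 = ring 4 (λ x u m r → (m - u) * r + (x - m) * r ≡ (x - u) * r) refl
 id111 = ring 3 (λ x y B → y - B ≡ 0# * x + 1# * y + - B) refl
 id112 = ring 3 (λ y B e → y - B ≡ e + ((y + - e) - B)) refl
 id113 = ring 3 (λ y T e → T - y ≡ e + (T - (y + e))) refl
 id114 = ring 7 (λ a1 a2 b1 b2 x r j → (r - x) * (b2 - a2) ≡ ((b1 - a1) * (j - a2) - (b2 - a2) * (x - a1)) - ((b1 - a1) * (j - a2) - (b2 - a2) * (r - a1))) refl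
 id115 = ring 6 (λ dx ρ r j x y → (r + dx * ρ * (y - j)) - x ≡ dx * ρ * (y - j) - 1# * (x - r)) refl
 id116 = ring 9 (λ a1 a2 dx dy ρ r j x y → dx * ρ * (y - j) - (dy * ρ) * (x - r) ≡ ρ * ((dx * (y - a2) - dy * (x - a1)) - (dx * (j - a2) - dy * (r - a1)))) refl
 id117 = ring 7 (λ a1 a2 b1 b2 x r j → (x - r) * (- (b2 - a2)) ≡ ((b1 - a1) * (j - a2) - (b2 - a2) * (x - a1)) - ((b1 - a1) * (j - a2) - (b2 - a2) * (r - a1))) refl
 id118 = ring 6 (λ dx ρ r j x y → x - (r + (- dx) * ρ * (y - j)) ≡ 1# * (x - r) - (- dx) * ρ * (y - j)) refl
 id119 = ring 9 (λ a1 a2 dx dy ρ r j x y → ((- dy) * ρ) * (x - r) - (- dx) * ρ * (y - j) ≡ ρ * ((dx * (y - a2) - dy * (x - a1)) - (dx * (j - a2) - dy * (r - a1)))) refl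
 id120 = ring 2 (λ a n → a + 1# + n - a ≡ n + 1#) refl
 id121 = ring 4 (λ s p ℓ t → ((1# - s) * (p + ℓ) + s * t) - (((1# - s) * p + s * t) + 1#) ≡ (1# - s) * ℓ - 1#) refl
 id122 = ring 3 (λ K x y → K * y - K * x ≡ K * (y - x)) refl
 id123 = ring 1 (λ j → (j + 1#) - j ≡ 1#) refl
 id124 = ring 4 (λ T p J r → (T - p) * r - (J - p) * r ≡ (T - J) * r) refl
 id125 = ring 4 (λ T p J r → (T - J) * r * p + (J - p) * r * T ≡ ((T - p) * r) * J) refl
 id126 = ring 6 (λ K T J p r ℓ → K * ((T - J) * r * ℓ - (T - p) * r) ≡ r * (((K + 1#) * ℓ - K * (T - p)) + (K * T - (K * (J + 1#) + 1#)) * ℓ)) refl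
 id127 = ring 1 (λ j → j - (j - 1#) ≡ 1#) refl
 id128 = ring 4 (λ B p J r → (p - B) * r - (p - J) * r ≡ (J - B) * r) refl
 id129 = ring 4 (λ B p J r → (J - B) * r * p + (p - J) * r * B ≡ ((p - B) * r) * J) refl
 id130 = ring 6 (λ K B J p r ℓ → K * ((J - B) * r * ℓ - (p - B) * r) ≡ r * (((K + 1#) * ℓ - K * (p - B)) + (K * (J - 1#) - (K * B + 1#)) * ℓ)) refl
 id131 = ring 3 (λ α s τ → ν 3 * α - (τ + ½) * (ν 2 * α + s * (τ - ½)) ≡ ν 2 * α * (1# - τ) + (0# - s) * ((τ + ½) * (τ - ½))) refl
 id132 = ring 3 (λ α s τ → ν 3 * α + c¾ * s - (τ + ½) * (ν 2 * α + s * (τ - ½)) ≡ ν 2 * α * (1# - τ) + s * ((1# - τ) * (1# + τ))) refl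
 id133 = ring 3 (λ s τ μ → (ν 3 - c¾ * μ) - (τ + ½) * (ν 2 * 1# + s * (τ - ½)) ≡ (1# - τ) * (ν 2 * (1# - μ) + μ * (1# - τ)) + (- μ - s) * ((τ - ½) * (τ + ½))) refl
 id134 = ring 5 (λ α β s1 τ E → E - (ν 4 * α * τ + (½ - τ) * (ν 2 * β + s1 * (c³⁄₂ - τ))) ≡ (ν 2 * τ * (E - ν 2 * α) + ν 2 * (½ - τ) * (E - β)) + (½ - τ) * ((1# + (½ - τ)) * (0# - s1))) refl
 id135 = ring 5 (λ α β s1 τ E → E - (ν 4 * α * τ + (½ - τ) * (ν 2 * β + s1 * (c³⁄₂ - τ))) ≡ (ν 2 * τ * (E - ν 2 * α) + ν 2 * (½ - τ) * (E - (β + c¾ * s1))) + (½ - τ) * (s1 * τ)) refl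
 id136 = ring 2 (λ α β → (ν 3 * β + ν 5 * α - + 31 / 4) - ν 3 * α ≡ ν 3 * (β - ν 2) + ν 2 * (α - 1#) + + 1 / 4) refl
 id137 = ring 3 (λ α s β → (ν 3 * β + ν 5 * α - + 31 / 4) - (ν 3 * α + c¾ * s) ≡ ν 3 * (β - ν 2) + c⁷⁄₄ * (α - 1#) + + 1 / 4 * (α - ν 3 * s)) refl
 id138 = ring 2 (λ α β → (ν 3 * β + ν 5 * α - + 31 / 4) - ν 2 * α ≡ ν 3 * (β - ν 2) + ν 3 * (α - 1#) + + 5 / 4) refl
 id139 = ring 2 (λ α β → (ν 3 * β + ν 5 * α - + 31 / 4) - β ≡ ν 2 * (β - ν 2) + ν 5 * (α - 1#) + + 5 / 4) refl
 id140 = ring 3 (λ α β s1 → (ν 3 * β + ν 5 * α - + 31 / 4) - (β + c¾ * s1) ≡ + 13 / 8 * (β - ν 2) + ν 5 * (α - 1#) + + 3 / 8 * (β - ν 2 * s1) + + 1 / 2) refl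
 id141 = ring 1 (λ α → c²⁷⁄₈ * α - ν 3 * α ≡ + 3 / 8 * α) refl
 id142 = ring 2 (λ α s → c²⁷⁄₈ * α - (ν 3 * α + c¾ * s) ≡ + 3 / 8 * (α - ν 2 * s)) refl
 id143 = ring 3 (λ α β α' → (ν 3 * β + ν 5 * α + ν 5 * α' - + 21 / 2) - (c²⁷⁄₈ * α + c²⁷⁄₈ * α') ≡ + 13 / 8 * (β + α + α' - ν 5) + + 11 / 8 * (β - ν 2) + + 3 / 8) refl
 id144 = ring 2 (λ s β → ν 2 * β - ν 3 * s ≡ ν 2 * (β - ν 2) + ν 4 + ν 3 * (0# - s)) refl
 id145 = ring 3 (λ s τ β → ν 2 * β - ν 3 * s ≡ ν 2 * (β - s * (1# + τ)) + ν 2 * (s * (τ - ½))) refl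
 id146 = ring 3 (λ α β α' → (ν 3 * β + + 13 / 8 * α + ν 5 * α' - + 21 / 2) - ν 2 * α' ≡ + 13 / 8 * (β + α + α' - ν 5) + + 11 / 8 * (β - ν 2) + + 11 / 8 * (α' - 1#) + + 7 / 4) refl
 id147 = ring 3 (λ α β α' → (ν 3 * β + + 13 / 8 * α + ν 5 * α' - + 21 / 2) - β ≡ + 13 / 8 * (β + α + α' - ν 5) + + 3 / 8 * (β - ν 2) + + 27 / 8 * (α' - 1#) + + 7 / 4) refl
 id148 = ring 4 (λ α β α' s → (ν 3 * β + + 13 / 8 * α + ν 5 * α' - + 21 / 2) - (β + c¾ * s) ≡ + 3 / 2 * (β + α + α' - ν 5) + + 7 / 2 * (α' - 1#) + + 1 / 8 * (α - 1#) + + 1 / 4 * (ν 2 * β - ν 3 * s) + + 5 / 8) refl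
 id149 = ring 3 (λ α β α' → c²⁷⁄₈ * α + (ν 3 * β + + 13 / 8 * α + ν 5 * α' - + 21 / 2) ≡ ν 3 * β + ν 5 * α + ν 5 * α' - + 21 / 2) refl
 id150 = ring 3 (λ α α' β → β + α + α' - ν 5 ≡ β + α' + α - ν 5) refl
 id151 = ring 3 (λ α α' β → ν 3 * β + ν 5 * α + ν 5 * α' - + 21 / 2 ≡ ν 3 * β + ν 5 * α' + ν 5 * α - + 21 / 2) refl
 id152 = ring 2 (λ β s → β - (β + c¾ * s) ≡ c¾ * (0# - s)) refl
 id153 = ring 3 (λ α β α' → (ν 2 * β + ν 5 * α + ν 5 * α' - + 21 / 2) - ν 2 * α ≡ ν 2 * (β + α + α' - ν 5) + (α - 1#) + ν 3 * (α' - 1#) + + 7 / 2) refl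
 id154 = ring 3 (λ α β α' → (ν 2 * β + ν 5 * α + ν 5 * α' - + 21 / 2) - β ≡ ν 1 * (β + α + α' - ν 5) + (ν 4 * (α - 1#) + ν 4 * (α' - 1#)) + + 5 / 2) refl
 id155 = ring 4 (λ α β α' s → (ν 2 * β + ν 5 * α + ν 5 * α' - + 21 / 2) - (β + c¾ * s) ≡ ν 5 * (α - 1#) + ν 5 * (α' - 1#) + + 1 / 4 * (β - ν 2) + c¾ * (β - s)) refl
 id156 = ring 3 (λ α β α' → (ν 2 * β + ν 5 * α + ν 5 * α' - + 21 / 2) + β ≡ ν 3 * β + ν 5 * α + ν 5 * α' - + 21 / 2) refl
 id157 = ring 3 (λ α β α' → (ν 3 * β + ν 5 * α + ν 3 * α' - + 21 / 2) - ν 2 * α ≡ ν 3 * (β + α + α' - ν 5) + + 9 / 2) refl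
 id158 = ring 3 (λ α β α' → (ν 3 * β + ν 5 * α + ν 3 * α' - + 21 / 2) - β ≡ ν 2 * (β + α + α' - ν 5) + (ν 3 * (α - 1#) + (α' - 1#)) + + 7 / 2) refl
 id159 = ring 4 (λ α β α' s → (ν 3 * β + ν 5 * α + ν 3 * α' - + 21 / 2) - (β + c¾ * s) ≡ + 5 / 4 * (β + α + α' - ν 5) + (+ 15 / 4 * (α - 1#) + + 7 / 4 * (α' - 1#)) + c¾ * (β - s) + + 5 / 4) refl
 id160 = ring 3 (λ α β α' → (ν 3 * β + ν 5 * α + ν 3 * α' - + 21 / 2) + ν 2 * α' ≡ ν 3 * β + ν 5 * α + ν 5 * α' - + 21 / 2) refl
 id161 = ring 2 (λ s τ → s * (1# + τ) - s ≡ s * τ) refl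
 id162 = ring 1 (λ s → + 25 / 4 - (ν 2 * (1# - s) + (ν 3 * 1# + c¾ * s)) ≡ + 5 / 4 * s + + 5 / 4) refl
 id163 = ring 1 (λ s → + 25 / 4 - (ν 2 * (1# - s) + (ν 3 - c¾ * - s)) ≡ + 5 / 4 * (1# - - s)) refl
 id164 = ring 1 (λ s → ν 5 - (ν 2 * (1# - s) + (ν 3 * 1# + c¾ * s)) ≡ + 5 / 4 * s) refl
 id165 = ring 1 (λ s → c²⁷⁄₈ - (ν 3 * 1# + c¾ * s) ≡ + 3 / 8 * (1# - ν 2 * s)) refl
 id166 = ring 1 (λ c → (1# + c) - 1# ≡ c) refl
 id167 = ring 4 (λ c d s τ → ((1# + c) * d - s * (1# + τ)) + s * (τ - c) ≡ (1# + c) * (d - s)) refl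
 id168 = ring 2 (λ τ τ' → (1# - τ) + τ' ≡ 1# + τ' - τ) refl
 id169 = ring 1 (λ τ → (+ 5 / 8 - τ) * (+ 5 / 8 - τ) ≡ (τ - + 5 / 8) * (τ - + 5 / 8)) refl
 id170 = ring 5 (λ α β s τ τ' → (1# + τ) * (ν 5 * (α + β - 1#) - ½ - (ν 4 * α * τ + (1# + τ' - τ) * (ν 2 * β + s * (τ + τ' - 1#)))) ≡ (((1# + τ' - τ) * (τ + τ' - 1#) * (β - s * (1# + τ)) + (β * (1# - τ')) * (ν 3 + ν 2 * τ + τ')) + ((α - 1#) * (1# + τ)) * (1# + ν 4 * (1# - τ)) + (β - ν 2) * (1# + τ + ν 3 * (τ * τ))) + ν 2 * ((τ - + 5 / 8) * (τ - + 5 / 8)) + + 23 / 32) refl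
 id171 = ring 2 (λ K κ → (K - ν 4) * κ ≡ K * κ - ν 4 * κ) refl
 id172 = ring 4 (λ K κ α β → (((K - ν 4) * ((α - 1#) + (β - ν 2) + ν 2) + ν 5 * (α - 1#)) + (β - ν 2) + + 3 / 2) + (ν 4 * (β - α)) * κ ≡ (K + 1#) * (α + β - 1#) - ½ - ν 4 * β + ν 4 * (β - α) * κ) refl
 id173 = ring 4 (λ K κ α β → ((((α - 1#) + (K - ν 4) * ((β - ν 2) + 1#)) + β * (1# - ν 4 * κ)) + ν 4 * (β - ν 2)) + + 7 / 2 ≡ (K + 1#) * (α + β - 1#) - ½ - ν 4 * β * κ - α * K) refl
 id174 = ring 2 (λ κ z → 1# - z - κ ≡ 1# - κ - z) refl
 id175 = ring 1 (λ κ → (κ + κ) + (1# - ν 4 * κ) ≡ 1# - ν 2 * κ) refl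
 id176 = ring 6 (λ V K κ α β z → (1# - ν 2 * κ) * (V - ν 4 * β * (1# - z) - ν 4 * α * z - α * (K - ν 2) * (z - κ)) ≡ ((1# - κ - z) * (V - ν 4 * β + ν 4 * (β - α) * κ) + (z - κ) * (V - ν 4 * β * κ - α * K)) + (K * κ - 1#) * (ν 2 * α * (z - κ))) refl
 id177 = ring 1 (λ K → K - ν 4 + ν 3 ≡ K - 1#) refl
 id178 = ring 4 (λ K κ τ z → τ * (K - ν 2) * (z - κ) - (z - τ) * (z - τ) ≡ ((z - κ) * ((K - 1#) * (τ - κ) + (1# - κ - z)) + (z - τ) * (τ - κ)) + (K * κ - 1#) * (z - κ)) refl
 id179 = ring 8 (λ V α β s τ z κ K → τ * (V - (ν 4 * β * (1# - z) + (z + τ) * (ν 2 * α + s * (τ - z)))) ≡ ((τ + z) * (z - τ)) * (α + s * τ) + (τ * (V - ν 4 * β * (1# - z) - ν 4 * α * z - α * (K - ν 2) * (z - κ)) + α * (τ * (K - ν 2) * (z - κ) - (z - τ) * (z - τ)))) refl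
 id180 = ring 2 (λ K I → K * ((K + 1#) * (K + 1#)) * I - (ν 3 + K * ((K + 1#) * I + ν 3 - ν 2)) ≡ K * K * (K + 1#) * I - K - ν 3) refl
 id181 = ring 3 (λ K I b → K * ((K + 1#) * (K + 1#)) * I - (ν 2 + K * ((K + 1#) * I + ν 3 - b - ν 2)) ≡ K * K * (K + 1#) * I + K * b - K - ν 2) refl
 id182 = ring 2 (λ b m → b - (m + ν 2) ≡ b + 1# - (m + ν 3)) refl
 id183 = ring 3 (λ K I b → (K * K * (K + 1#) * I + K * b - K - ν 2) - (K * K * (K + 1#) * I - K - ν 3) ≡ K * b + 1#) refl
 id184 = ring 3 (λ K I b → (K * ((K + 1#) * (K + 1#)) * I - ((K + 1#) * I + ν 3 - b)) - (K * K * (K + 1#) * I - K - ν 3) ≡ ((K * (K + 1#)) * I + K) + ((b - ((K + 1#) * I + ν 2)) + ν 2)) refl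
 id185 = ring 4 (λ K I S A → (K * K * (K + 1#) * I - K - ν 3) - K * K * A ≡ (1# + (K - ν 4) * (½ * K + 1#)) + ((K * K) * ((K + 1#) * S - ½ - A) + ((K * K) * (K + 1#)) * (I - S))) refl
 id186 = ring 5 (λ l r a t y → (l + a + t * y) - (r + t * y) ≡ a - (r - l)) refl
 id187 = ring 7 (λ l a t s u v j → (v - u) * (ν 2 * (l + a - l) + (t - s) * ((u - j) + (v - j))) ≡ (v - u) * (ν 2 * a + (t - s) * ((u - j) + (v - j)))) refl
 id188 = ring 7 (λ l a t s x y j → (l + a + t * (y - j) - x) + (x - (l + s * (y - j))) ≡ a + (t - s) * (y - j)) refl
 id189 = ring 1 (λ c → c + 1# - 1# ≡ c) refl
 id190 = ring 1 (λ c → c + 1# - ν 2 ≡ c - 1#) refl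
 id191 = ring 3 (λ s c α → α - c * s ≡ α + c * (0# - s)) refl
 id192 = ring 4 (λ s c d α → α - c * s ≡ (α - s * d) + s * (d - c)) refl
 id193 = ring 4 (λ f a A A' → (A' - A + 1#) - (f - a) ≡ (A' - f) + (a + 1# - A)) refl
 id194 = ring 2 (λ x y → x * (y - y) ≡ 0#) refl
 id195 = ring 4 (λ T j a σ → (T - (j - ½)) * (ν 2 * a + σ * ((j - ½ - j) + (T - j))) ≡ (T - j + ½) * (ν 2 * a + σ * (T - j - ½))) refl
 id196 = ring 4 (λ B j a σ → (j + ½ - B) * (ν 2 * a + σ * ((B - j) + (j + ½ - j))) ≡ (j - B + ½) * (ν 2 * a + - σ * (j - B - ½))) refl
 id197 = ring 2 (λ T j → (j - (T - j)) - (j - ½) ≡ ½ - (T - j)) refl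
 id198 = ring 2 (λ T j → T - (j - (T - j)) ≡ (T - j) + (T - j)) refl
 id199 = ring 6 (λ T j a σ b σ1 → ((j - (T - j)) - (j - ½)) * (ν 2 * b + σ1 * ((j - ½ - (j - 1#)) + (j - (T - j) - (j - 1#)))) + (T - (j - (T - j))) * (ν 2 * a + σ * ((j - (T - j) - j) + (T - j))) ≡ ν 4 * a * (T - j) + (½ - (T - j)) * (ν 2 * b + σ1 * (c³⁄₂ - (T - j)))) refl
 id200 = ring 2 (λ B j → (j + ½) - (j + (j - B)) ≡ ½ - (j - B)) refl
 id201 = ring 2 (λ B j → (j + (j - B)) - B ≡ (j - B) + (j - B)) refl
 id202 = ring 6 (λ B j a σ b σ1 → ((j + (j - B)) - B) * (ν 2 * a + σ * ((B - j) + (j + (j - B) - j))) + ((j + ½) - (j + (j - B))) * (ν 2 * b + σ1 * ((j + (j - B) - (j + 1#)) + (j + ½ - (j + 1#)))) ≡ ν 4 * a * (j - B) + (½ - (j - B)) * (ν 2 * b + - σ1 * (c³⁄₂ - (j - B)))) refl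
 id203 = ring 2 (λ T j → 1# - (T - j) ≡ j + 1# - T) refl
 id204 = ring 2 (λ B j → 1# - (j - B) ≡ B + 1# - j) refl
 id205 = ring 3 (λ K T j → K * (T - j) - 1# ≡ K * T - (K * j + 1#)) refl
 id206 = ring 3 (λ K B j → K * (j - B) - 1# ≡ K * j - (K * B + 1#)) refl
 id207 = ring 5 (λ a s n j B → a - s * (n + (j - B)) ≡ a + s * (B - (j + n))) refl
 id208 = ring 5 (λ a s n j T → a - - s * (n + (T - (j + n))) ≡ a + s * (T - j)) refl
 id209 = ring 3 (λ l s j → l + s * (j - j) ≡ l) refl
 id210 = ring 3 (λ l s j → l + s * (j + 1# - j) ≡ l + s) refl
 id211 = ring 5 (λ a r l t s → (a + (t - s) + 1#) - ((r + t) - (l + s) + 1#) ≡ a - (r - l)) refl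
 id212 = ring 3 (λ l s j → l + s * (j - 1# - j) ≡ l - s) refl
 id213 = ring 5 (λ a r l t s → (a - (t - s) + 1#) - ((r - t) - (l - s) + 1#) ≡ a - (r - l)) refl
 id214 = ring 2 (λ j B → B - (j - 1#) ≡ B + 1# - j) refl
 id215 = ring 4 (λ i a b c → (i + 1#) - (a + 1# + (b + 1#) + c - 1#) ≡ i - (b + (c + a))) refl
 id216 = ring 3 (λ a b c → (a + 1# + (b + 1#) + c - 1#) - ν 2 ≡ (b + (c + a)) - 1#) refl
 cancelJ = ring 2 (λ x t → x + t - x ≡ t) refl
 id217 = ring 2 (λ a s → ν 2 * a + 1# - (a + s + 1#) ≡ a - 1# * s) refl
 id218 = ring 2 (λ a s → ν 2 * a + 1# - (a - s + 1#) ≡ a - 1# * - s) refl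
 id219 = ring 8 (λ K I a a' μ m t b → (K + 1#) * I + ν 3 - (b + (ν 2 * (m + 1# + 1#) + t)) ≡ ((((K - ν 4) * I + ν 5 * (I - (a + a' + μ - 1#))) + (ν 3 * ((a + a' + μ - 1#) - ν 2) + ν 1)) + ν 2 * (μ - m)) + ((ν 2 * a + 1# - t) + (ν 2 * a' + 1# - b))) refl
 id220 = ring 2 (λ K S → ((K + 1#) * S - ½) - (ν 5 * S - ½) ≡ (K - ν 4) * S) refl
 id221 = ring 2 (λ j n → j + (n + 1#) ≡ j + 1# + n) refl
 id222 = ring 3 (λ j a σ → (j + ½ - (j - ½)) * (ν 2 * a + σ * ((j - ½ - j) + (j + ½ - j))) ≡ ν 2 * a) refl
 id223 = ring 1 (λ a → a + ½ - (a - ½) ≡ 1#) refl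
 id224 = ring 1 (λ a → a + 1# - ½ ≡ a + ½) refl
 id225 = ring 2 (λ a q → a + ½ + q ≡ a - ½ + (q + 1#)) refl
 id226 = ring 3 (λ c r q → ν 2 * (c + 1#) + ν 2 * (r + q) ≡ ν 2 * ((c + r) + (q + 1#))) refl
 id227 = ring 2 (λ a n → a + ½ + n ≡ a + 1# + n - ½) refl
 id228 = ring 2 (λ j B → j + ½ - B ≡ (j - B) + ½) refl
 id229 = ring 2 (λ j n → j + 1# + n - ½ - (j + ½) ≡ n) refl
 id230 = ring 2 (λ j T → T - (j - ½) ≡ (T - j) + ½) refl
 id231 = ring 1 (λ x → x ≡ x + 1# - 1#) refl
 id232 = ring 1 (λ n → n + 1# + 1# + 1# - ν 3 ≡ n) refl
 id233 = ring 2 (λ n t → n + ν 2 + t - ν 2 ≡ n + t) refl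
 id234 = ring 5 (λ b s n j B → b - s * (n + ν 2 + (j - B)) ≡ b + s * (B - (j + 1# + (n + 1# + 1#) - 1#))) refl
 id235 = ring 5 (λ b s n j T → b - (- s) * (n + ν 2 + (T - (j + 1# + (n + 1# + 1#)))) ≡ b + s * (T - (j + 1#))) refl
 id236 = ring 6 (λ a a' g g' r n → (ν 5 * (a + a' + (g' + (r + g)) - 1#) - ½) - (((ν 3 * (g' + 1#) + ν 5 * a' - + 31 / 4) + ν 2 * ((g' + (r + g)) + (n + 1# + 1#))) + (ν 3 * (g + 1#) + ν 5 * a - + 31 / 4)) ≡ n + ν 3 * (r - n)) refl
 id237 = ring 1 (λ j → j + 1# ≡ j + 1# + 1# - 1#) refl
 id238 = ring 4 (λ a s j B → a - s * (ν 2 + (j - B)) ≡ a + s * (B - (j + 1# + 1#))) refl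
 id239 = ring 4 (λ a s j T → a - (- s) * (ν 2 + (T - (j + 1# + 1#))) ≡ a + s * (T - j)) refl
 id240 = ring 1 (λ t → ν 2 + t - ν 2 ≡ t) refl
 id241 = ring 4 (λ a s j B → a - s * (1# + (j - B)) ≡ a + s * (B - (j + 1#))) refl
 id242 = ring 4 (λ a s j T → a - (- s) * (1# + (T - (j + 1# + 1#))) ≡ a + s * (T - (j + 1#))) refl
 id243 = ring 1 (λ j → j + 1# + ½ ≡ j + 1# + 1# - ½) refl
 id244 = ring 3 (λ j a s → (j + 1# + 1# - ½ - (j + ½)) * (ν 2 * a + s * ((j + ½ - (j + 1# + 1#)) + (j + 1# + 1# - ½ - (j + 1# + 1#)))) ≡ ν 2 * (a - s)) refl
 id245 = ring 3 (λ j a s → (j + 1# + 1# - ½ - (j + ½)) * (ν 2 * a + s * ((j + ½ - j) + (j + 1# + 1# - ½ - j))) ≡ ν 2 * (a - - s)) refl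
 id246 = ring 3 (λ a b c → (c + a) + b ≡ (a + b) + c) refl
 id247 = ring 2 (λ s d → ν 2 + c¾ * d - (ν 2 + c¾ * s) ≡ c¾ * (d - s)) refl
 id248 = ring 3 (λ a b c → (c + b) + a ≡ (a + b) + c) refl
 id249 = ring 1 (λ S → (ν 5 * S - ½) - + 19 / 2 ≡ ν 5 * (S - ν 2)) refl
 id250 = ring 3 (λ a a' c → (ν 3 * (c + 1#) + ν 5 * a + ν 5 * a' - + 21 / 2) + ν 2 * (c + 1#) ≡ ν 5 * (a + a' + c - 1#) - ½) refl
 id251 = ring 3 (λ a a' c → (c + 1#) + (a + 1#) + (a' + 1#) - ν 5 ≡ a + a' + c - ν 2) refl
 id252 = ring 2 (λ κ t → t - κ ≡ 1# * t - κ) refl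
 id253 = ring 3 (λ K κ t → K * κ * t - κ ≡ κ * (K * t - 1#)) refl
 id254 = ring 2 (λ j B → j + (j - B) - B ≡ (j - B) + (j - B)) refl
 id255 = ring 3 (λ j B T → T - (j + (j - B)) ≡ (T - (j + 1#)) + (1# - (j - B))) refl
 id256 = ring 7 (λ j B T a' a σb σt → (j + (j - B) - B) * (ν 2 * a' + σb * ((B - j) + (j + (j - B) - j))) + (T - (j + (j - B))) * (ν 2 * a + σt * ((j + (j - B) - (j + 1#)) + (T - (j + 1#)))) ≡ ν 4 * a' * (j - B) + (1# + (T - (j + 1#)) - (j - B)) * (ν 2 * a + σt * ((j - B) + (T - (j + 1#)) - 1#))) refl
 id257 = ring 2 (λ j T → T - (j - (T - j)) ≡ (T - j) + (T - j)) refl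
 id258 = ring 3 (λ j B t → j + 1# - t - B ≡ (j - B) + (1# - t)) refl
 id259 = ring 7 (λ j B T a' a σb σt → (((j + 1#) - (T - (j + 1#))) - B) * (ν 2 * a' + σb * ((B - j) + ((j + 1#) - (T - (j + 1#)) - j))) + (T - ((j + 1#) - (T - (j + 1#)))) * (ν 2 * a + σt * (((j + 1#) - (T - (j + 1#)) - (j + 1#)) + (T - (j + 1#)))) ≡ ν 4 * a * (T - (j + 1#)) + (1# + (j - B) - (T - (j + 1#))) * (ν 2 * a' + - σb * ((T - (j + 1#)) + (j - B) - 1#))) refl
 id260 = ring 2 (λ a a' → a + a' + 0# - 1# ≡ a + a' - 1#) refl
 id261 = ring 1 (λ t → 1# - (1# - t) ≡ t) refl
 id262 = ring 5 (λ a a' s t t' → ν 4 * a' * t' + (1# + t - t') * (ν 2 * a + s * (t' + t - 1#)) ≡ ν 4 * a' * (1# - (1# - t')) + ((1# - t') + t) * (ν 2 * a + s * (t - (1# - t')))) refl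
 id263 = ring 2 (λ t t' → 1# - (t + t') ≡ (1# - t') - t) refl
 id264 = ring 5 (λ a a' s t t' → ν 4 * a * t + (1# + t' - t) * (ν 2 * a' + - s * (t + t' - 1#)) ≡ ν 4 * a * (1# - (1# - t)) + ((1# - t) + t') * (ν 2 * a' + - s * (t' - (1# - t)))) refl
 id265 = ring 2 (λ t t' → 1# - (t + t') ≡ (1# - t) - t') refl
 id266 = ring 4 (λ a s j B → a + s * (B - j) ≡ a + - s * (j - B)) refl
 id267 = ring 1 (λ κ → ½ * (1# - ν 4 * κ) + κ ≡ ½ - κ) refl
 id268 = ring 3 (λ K κ α → ½ * (K - ν 4) * α + (½ * (1# - ν 4 * κ) * α + ½ * (α - 1#)) ≡ (½ * K - 1# - ν 2 * κ) * α - ½) refl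
 id269 = ring 6 (λ K κ α σ τ τ' → τ * (((K + 1#) * α - ½) - (τ + τ') * (ν 2 * α + σ * (τ - τ'))) ≡ ((((τ + τ') * (τ' - τ)) * (α + σ * τ) + α * ((1# - τ') * (1# + τ' + ν 2 * τ))) + (α * ((κ * (K * τ - ν 2)) * (1# - τ) + (K * τ - ν 2) * (½ - κ)) + τ * ((½ * K - 1# - ν 2 * κ) * α - ½))) + (K * κ - 1#) * (α * τ * τ)) refl
 id270 = ring 5 (λ K α σ τ τ' → τ * (((K + 1#) * α - ½) - (τ + τ') * (ν 2 * α + σ * (τ - τ'))) ≡ ((((τ + τ') * (τ' - τ)) * (α + σ * τ) + α * ((1# - (τ + τ')) * (1# + τ + τ'))) + τ * ((α - 1#) + ½)) + (K * τ - 1#) * α) refl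
 id271 = ring 5 (λ T B j a σ → (T - B) * (ν 2 * a + σ * ((B - j) + (T - j))) ≡ (T - j + (j - B)) * (ν 2 * a + σ * (T - j - (j - B)))) refl
 id272 = ring 4 (λ a s B j → a + s * (B - j) ≡ a + - s * (j - B)) refl
 id273 = ring 4 (λ K a s t → K * a - s ≡ K * (a + - s * t) + s * (K * t - 1#)) refl
 id274 = ring 1 (λ x → x + ν 3 - (0# + (ν 2 * (0# + 1#) + 0#)) ≡ x + 1#) refl
 id275 = ring 5 (λ K I a s n → (K + 1#) * I + ν 3 - (0# + (ν 2 * (0# + 1#) + n)) ≡ ((K + 1#) * (I - a) + (K * a - s)) + (a + s + 1# - n)) refl
 id276 = ring 5 (λ K I a s n → (K + 1#) * I + ν 3 - (n + (ν 2 * (0# + 1#) + 0#)) ≡ ((K + 1#) * (I - a) + (K * a - - s)) + (a - s + 1# - n)) refl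
 id277 = ring 6 (λ K I a s n m → (K + 1#) * I + ν 3 - (m + (ν 2 * (0# + 1#) + n)) ≡ ((((K + 1#) * (I - a) + (K - ν 4) * a) + (ν 3 * (a - 1#) + ν 2)) + ((a + s + 1# - n) + (a - s + 1# - m)))) refl
 id278 = ring 3 (λ x l ε → x - l ≡ (x - ε - l) + ε) refl
 id279 = ring 3 (λ x r ε → r - x ≡ (r - (x + ε)) + ε) refl
 id280 = ring 3 (λ l r i → l + (1# + i) - r ≡ i + 1# - (r - l)) refl
 id281 = ring 3 (λ l r i → r - (l + (1# + i)) ≡ (r - 1#) - (l + 1#) + 1# - i) refl
 id282 = ring 2 (λ x r → r - 1# - x ≡ r - (x + 1#)) refl
 id283 = ring 1 (λ x → x ≡ 1# * x) refl
 id284 = ring 2 (λ B j → B ≡ j - (j - B)) refl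
 id285 = ring 2 (λ x y → - 1# * x + 0# * y + 0# ≡ - x) refl
 id286 = ring 2 (λ x y → 0# * x + - 1# * y + 0# ≡ - y) refl
 id287 = ring 2 (λ T j → - T ≡ - j - (T - j)) refl
 id288 = ring 2 (λ B j → - B ≡ - j + (j - B)) refl
 id289 = ring 3 (λ K T j → K * T - K * j ≡ K * (T - j)) refl
 id290 = ring 3 (λ K x y → K * 1# - (K * y + K * x) ≡ K * (1# - (x + y))) refl
 id291 = ring 4 (λ τ τ' α σ → (τ + τ') * (ν 2 * α + σ * (τ - τ')) ≡ (τ' + τ) * (ν 2 * α + - σ * (τ' - τ))) refl
 id292 = ring 3 (λ x y j → 0# * x + 1# * y + - j ≡ y - j) refl
 id293 = ring 5 (λ x y a j l → 1# * x + - a * y + (a * j - l) ≡ x - a * (y - j) - l) refl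
 id294 = ring 4 (λ K κ x l → (K * x - K * l) * κ ≡ (K * κ) * (x - l)) refl
 id295 = ring 3 (λ x m l → x - (m - l) - l ≡ x - m) refl
 id296 = ring 2 (λ y j → (y - j) - - 1# ≡ y - (j - 1#)) refl
 id297 = ring 3 (λ y j κ → κ - (y - j) ≡ j + κ - y) refl
 id298 = ring 1 (λ j → j - 1# - j ≡ - 1#) refl
 id299 = ring 9 (λ α β γ s t x y x' y' → α * (s * x + t * x') + β * (s * y + t * y') + γ ≡ s * (α * x + β * y + γ) + t * (α * x' + β * y' + γ) + (1# - (s + t)) * γ) refl
 id300 = ring 1 (λ κ → (1# - ν 4 * κ) + ν 3 * κ ≡ 1# - κ) refl
 id301 = ring 2 (λ κ c → κ - (κ - c) ≡ c) refl
 id302 = ring 2 (λ u κ → 1# + κ - (u + κ) ≡ 1# - u) refl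
 id303 = ring 2 (λ u κ → 1# - κ - u ≡ 1# - (u + κ)) refl
 id304 = ring 4 (λ K κ a e → a + K * (e - a) * (1# + κ - 1#) ≡ e + (K * κ - 1#) * (e - a)) refl
 id305 = ring 4 (λ K κ ρ e → K * (e - ρ * (1# + κ)) ≡ K * (e - ρ) - ρ + (K * κ - 1#) * - ρ) refl
 id306 = ring 5 (λ K e ρ u x → x - (ρ + K * (e - ρ) * (u - 1#)) ≡ (x - ρ * u) + (1# - u) * (K * (e - ρ) - ρ)) refl
 id307 = ring 3 (λ u h r → (u - h) * r + h * r ≡ u * r) refl
 id308 = ring 2 (λ s t → s * 0# + t * 0# ≡ 0#) refl
 id309 = ring 3 (λ x y κ → κ - y ≡ 0# * x + - 1# * y + κ) refl
 id310 = ring 4 (λ s h r u → s * 0# + h * r * u ≡ h * (u * r)) refl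
 id311 = ring 1 (λ κ → 1# + κ - κ ≡ 1#) refl
 id312 = ring 1 (λ κ → 1# - κ ≡ 1# - ν 4 * κ + ν 3 * κ) refl
 id313 = ring 1 (λ κ → 1# + κ - 1# ≡ κ) refl
 id314 = ring 1 (λ κ → κ + κ ≡ ν 2 * κ) refl
 id315 = ring 3 (λ K κ ρ → ρ * (1# + κ) ≡ (K + 1#) * ρ * κ + (K * κ - 1#) * - ρ) refl
 id316 = ring 3 (λ κ u x → x - κ * u ≡ (x - κ) + κ * (1# - u)) refl
 id317 = ring 2 (λ κ x → x - κ * (1# + κ) ≡ (x - ν 2 * κ) + κ * (1# - κ)) refl
 id318 = ring 3 (λ K κ x → K * (1# - κ - x) ≡ K * (1# - x) - 1# + (K * κ - 1#) * - 1#) refl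
 id319 = ring 3 (λ K a e → a + K * (e - a) * (1# - 1#) ≡ a) refl
 id320 = ring 5 (λ K κ e u x → x - (+ 1 / 4 * κ + K * (e - + 1 / 4 * κ) * (u - 1#)) ≡ (x + ((e - κ) + + 3 / 4 * κ) * (K * (1# - u) - 1#)) + ((e - κ) + ½ * κ)) refl
 id321 = ring 1 (λ κ → κ - + 1 / 4 * κ ≡ + 3 / 4 * κ) refl
 id322 = ring 1 (λ κ → 1# - κ - 0# ≡ 1# - ν 4 * κ + ν 3 * κ) refl
 id323 = ring 1 (λ κ → κ + κ - + 5 / 4 * κ ≡ + 3 / 4 * κ) refl
 id324 = ring 5 (λ K κ e u x → x - (+ 5 / 4 * κ + K * (e - + 5 / 4 * κ) * (u - 1#)) ≡ ((x - κ) + ((e - ν 2 * κ) + + 3 / 4 * κ) * (K * (1# - u) - 1#)) + ((e - ν 2 * κ) + ½ * κ)) refl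
 id325 = ring 4 (λ K κ e x → x - (+ 5 / 4 * κ + K * (e - + 5 / 4 * κ) * (0# - 1#)) ≡ ((x + K * (e - ν 2 * κ)) + (+ 5 / 16 * (1# - ν 4 * κ) + + 7 / 16)) + (K * κ - 1#) * (+ 3 / 4)) refl
 id326 = ring 2 (λ κ y → 1# + κ - (κ - y) ≡ y - - 1#) refl
 id327 = ring 2 (λ s κ → 0# - (0# + s * (κ - 0#)) ≡ κ * - s) refl
 id328 = ring 3 (λ s x y → (x - (0# + s * (y - 0#))) + - s * (0# - y) ≡ x) refl
 id329 = ring 2 (λ x y → x - y ≡ - y - - x) refl
 y-back = ring 2 (λ κ y → y ≡ κ - (κ - y)) refl
 id330 = ring 1 (λ κ → κ - (1# + κ) ≡ - 1#) refl
 id331 = ring 1 (λ κ → κ - - 1# ≡ 1# + κ) refl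
 id332 = ring 2 (λ x y → 1# * x + 0# * y + 0# ≡ x) refl
 id333 = ring 5 (λ x y q D κ → - 1# * x + - D * y + (q + D * κ) ≡ q + D * (κ - y) - x) refl
 id334 = ring 3 (λ q D κ → q ≡ q + D * (κ - κ)) refl
 id335 = ring 5 (λ K κ I q t → K * (I + t * (κ - 0#) - q) ≡ t + K * (I - q) + (K * κ - 1#) * t) refl
 id336 = ring 7 (λ K κ I q t x y → q + K * (I - q) * (κ - y) - x ≡ (I + t * (y - 0#) - x) + (t + K * (I - q)) * (0# - y) + (K * κ - 1#) * (I - q)) refl
 cancel-right = ring 5 (λ q D κ x y → q + D * (1# + κ) - x - (q + D * (1# + κ) - y) ≡ y - x) refl
 id337 = ring 1 (λ κ → κ - 1# - - 1# ≡ κ) refl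
 id338 = ring 4 (λ x y ρ κ → x - ρ * (κ - y) ≡ 1# * x + ρ * y + - (ρ * κ)) refl
 id339 = ring 4 (λ x y ρ κ → x - (0# + - ρ * (y - κ)) ≡ 1# * x + ρ * y + - (ρ * κ)) refl
 id340 = ring 6 (λ x y q D μ κ → q + D * (κ - y) - x - μ * (κ - y) ≡ - 1# * x + (μ - D) * y + (q + (D - μ) * κ)) refl
 id341 = ring 6 (λ x y q D μ κ → q + - (D - μ) * (y - κ) - x ≡ - 1# * x + (μ - D) * y + (q + (D - μ) * κ)) refl
 id342 = ring 5 (λ x y a S κ → x - (a + S * (κ - y - 1#)) ≡ 1# * x + S * y + - (a + S * (κ - 1#))) refl
 id343 = ring 5 (λ x y a S κ → x - (a + - S * (y - (κ - 1#))) ≡ 1# * x + S * y + - (a + S * (κ - 1#))) refl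
 id344 = ring 7 (λ x y q D V a κ → q + D * (κ - y) - x - (a + V * (κ - y - 1#)) ≡ - 1# * x + (V - D) * y + (q + D * κ - a - V * (κ - 1#))) refl
 id345 = ring 7 (λ x y q D V a κ → q + D - a + (V - D) * (y - (κ - 1#)) - x ≡ - 1# * x + (V - D) * y + (q + D * κ - a - V * (κ - 1#))) refl
 id346 = ring 5 (λ κ q D ρ μ → (κ - (κ - 1#)) * (ν 2 * (q - 0#) + (- (D - μ) - - ρ) * ((κ - 1# - κ) + (κ - κ))) ≡ ν 2 * q + D - ρ - μ) refl
 id347 = ring 8 (λ K κ q D a a' xl xr → (κ - 1# - - 1#) * (ν 2 * (q + D - a' - a) + (K * (q + D * (1# + κ) - xr - a') - D - - (K * (xl - a))) * ((- 1# - (κ - 1#)) + (κ - 1# - (κ - 1#)))) ≡ κ * (xr - xl + q + D - a - a') + (K * κ - 1#) * - (κ * ((q + D * (1# + κ) - xr - a') + (xl - a)))) refl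
 id348 = ring 4 (λ K κ X Y → K * K * (κ * X + Y) ≡ K * X + K * K * Y + (K * κ - 1#) * (K * X)) refl
 id349 = ring 3 (λ κ x y → (0# - 0#) * (y - κ) - (κ - 1# - κ) * (x - 0#) ≡ x) refl
 id350 = ring 4 (λ κ p x y → (p - 0#) * (y - (κ - 1#)) - (- 1# - (κ - 1#)) * (x - 0#) ≡ κ * x - p * (κ - y - 1#)) refl
 id351 = ring 4 (λ κ p x y → (p - 0#) * (y - κ) - (- 1# - κ) * (x - 0#) ≡ (1# + κ) * x - p * (κ - y)) refl
 id352 = ring 4 (λ p q x y → (q - p) * (y - - 1#) - (- 1# - - 1#) * (x - p) ≡ (q - p) * (y + 1#)) refl
 id353 = ring 5 (λ κ q X x y → (X - q) * (y - - 1#) - (κ - 1# - - 1#) * (x - q) ≡ κ * (X * (κ - y) - x) - (X * (1# + κ) - q) * (κ - y - 1#)) refl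
 id354 = ring 4 (λ κ X x y → (0# - X) * (y - (κ - 1#)) - (κ - (κ - 1#)) * (x - X) ≡ X * (κ - y) - x) refl
 id355 = ring 4 (λ κ q x y → (0# - q) * (y - - 1#) - (κ - - 1#) * (x - q) ≡ q * (κ - y) - (1# + κ) * x) refl
 id356 = ring 3 (λ κ p q → (q - p) * (κ - 1# + 1#) ≡ (q - p) * κ) refl
 id357 = ring 3 (λ κ p q → (1# + κ) * q - p * (κ - - 1#) ≡ (1# + κ) * (q - p)) refl
 id358 = ring 3 (λ κ p q → q * (κ - - 1#) - (1# + κ) * p ≡ (1# + κ) * (q - p)) refl
 id359 = ring 2 (λ κ p → κ * 0# - p * (κ - κ - 1#) ≡ p) refl
 id360 = ring 3 (λ κ p q → κ * q - p * (κ - - 1# - 1#) ≡ κ * (q - p)) refl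
 id361 = ring 2 (λ κ q → q * (κ - (κ - 1#)) - (1# + κ) * 0# ≡ q) refl
 id362 = ring 3 (λ κ q X → κ * (X * (κ - κ) - 0#) - (X * (1# + κ) - q) * (κ - κ - 1#) ≡ X * (1# + κ) - q) refl
 id363 = ring 4 (λ κ p q X → κ * (X * (κ - - 1#) - p) - (X * (1# + κ) - q) * (κ - - 1# - 1#) ≡ κ * (q - p)) refl
 id364 = ring 4 (λ κ p q X → X * (1# + κ) - p ≡ (X * (1# + κ) - q) + (q - p)) refl
 id365 = ring 3 (λ κ X z → X * (κ - - 1#) - z ≡ X * (1# + κ) - z) refl
 id366 = ring 3 (λ κ p X → (1# + κ) * X - p * (κ - (κ - 1#)) ≡ X * (1# + κ) - p) refl
 id367 = ring 3 (λ κ p X → κ * X - p * (κ - (κ - 1#) - 1#) ≡ κ * X) refl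
 id368 = ring 3 (λ κ q X → κ * (X * (κ - (κ - 1#)) - 0#) - (X * (1# + κ) - q) * (κ - (κ - 1#) - 1#) ≡ κ * X) refl
 id369 = ring 2 (λ κ X → X * (κ - (κ - 1#)) - 0# ≡ X) refl
 id370 = ring 4 (λ κ p q X → (0# * (κ - 1#) - κ * 0#) + ((0# * - 1# - (κ - 1#) * p) + ((p * - 1# - - 1# * q) + ((q * (κ - 1#) - - 1# * X) + ((X * κ - (κ - 1#) * 0#) + 0#)))) ≡ X + κ * (X + q - p)) refl
 id371 = ring 4 (λ κ p q X → (0# * - 1# - κ * p) + ((p * - 1# - - 1# * q) + ((q * (κ - 1#) - - 1# * X) + ((X * κ - (κ - 1#) * 0#) + 0#))) ≡ X + κ * (X + q - p) - p) refl
 id372 = ring 3 (λ κ p q → (0# * (κ - 1#) - κ * 0#) + ((0# * - 1# - (κ - 1#) * p) + ((p * - 1# - - 1# * q) + ((q * κ - - 1# * 0#) + 0#))) ≡ q + κ * (q - p)) refl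
 id373 = ring 3 (λ κ p q → (0# * - 1# - κ * p) + ((p * - 1# - - 1# * q) + ((q * κ - - 1# * 0#) + 0#)) ≡ (1# + κ) * (q - p)) refl
 id374 = ring 11 (λ α β γ A B C D e f x y → α * (A * x + B * y + e) + β * (C * x + D * y + f) + γ ≡ (α * A + β * C) * x + (α * B + β * D) * y + (α * e + β * f + γ)) refl
 id375 = ring 6 (λ α β γ ε x y → α * x + β * y + γ - ε ≡ α * x + β * y + (γ - ε)) refl
 id376 = ring 1 (λ ε → 0# - ε + ε ≡ 0#) refl
 id377 = ring 8 (λ α β γ α' β' γ' x y → α * x + β * y + γ + (α' * x + β' * y + γ') ≡ (α + α') * x + (β + β') * y + (γ + γ')) refl
 id378 = ring 1 (λ x → - x ≡ 0# + 0# - x) refl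
 id379 = ring 5 (λ Δ x y a c → Δ * (x - y) ≡ Δ * x - (0# * a + (Δ * y + 0# * c))) refl
 id380 = ring 3 (λ a b c → a + (b + c) ≡ b + (a + c)) refl
 id381 = ring 5 (λ a b c d s → c * b - d * a + - s ≡ - (a * d - b * c + s)) refl
 id382 = ring 9 (λ σ A B C D e f x y → σ * D * (A * x + B * y + e) + - (σ * B) * (C * x + D * y + f) + - (σ * (D * e - B * f)) ≡ σ * (A * D - B * C) * x) refl
 id383 = ring 9 (λ σ A B C D e f x y → - (σ * C) * (A * x + B * y + e) + σ * A * (C * x + D * y + f) + - (σ * (A * f - C * e)) ≡ σ * (A * D - B * C) * y) refl
 neg-one = ring 1 (λ x → x ≡ - 1# * - x) refl
 id384 = ring 1 (λ x → - (- 1# * x) ≡ x) refl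
 id385 = ring 2 (λ κ X → (0# - X) * (κ - 1# - (κ - 1#)) - (κ - (κ - 1#)) * (0# - X) ≡ X) refl
 id386 = ring 2 (λ κ p → (0# - 0#) * (- 1# - κ) - (κ - 1# - κ) * (p - 0#) ≡ p) refl
 id387 = ring 3 (λ κ p q → (p - 0#) * (- 1# - (κ - 1#)) - (- 1# - (κ - 1#)) * (q - 0#) ≡ κ * (q - p)) refl
 id388 = ring 4 (λ κ p q X → (q - p) * (κ - 1# - - 1#) - (- 1# - - 1#) * (X - p) ≡ κ * (q - p)) refl
 id389 = ring 3 (λ κ q X → (X - q) * (κ - - 1#) - (κ - 1# - - 1#) * (0# - q) ≡ X * (1# + κ) - q) refl
 id390 = ring 2 (λ K I → (K + 1#) * (I - 1#) + (K - ν 4) ≡ (K + 1#) * I - ν 5) refl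
 id391 = ring 1 (λ N → N - ν 5 + ν 5 ≡ N) refl
 id392 = ring 1 (λ κ → 1# - ν 4 * κ + ν 2 * κ ≡ 1# - ν 2 * κ) refl
 id393 = ring 1 (λ N → N + ν 3 - ν 3 ≡ N) refl
 id394 = ring 3 (λ N b x → N + ν 3 - b - (x + 1#) * ν 2 ≡ N + 1# - b - ν 2 * x) refl
 id395 = ring 2 (λ N κ → N - ν 5 + (ν 4 + (1# - ν 2 * κ)) ≡ N - κ - κ) refl
 id396 = ring 1 (λ κ → 1# - ν 2 * κ ≡ 1# - κ - κ) refl
 id397 = ring 3 (λ K κ I → (K * I - κ) * (1# + κ) - (1# - κ) ≡ (K + 1#) * I - ν 5 + (ν 3 + (1# - κ) * (1# + κ)) + (K * κ - 1#) * I) refl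
 id398 = ring 2 (λ κ b → b - 1# + (1# - ν 2 * κ) ≡ b - κ - κ) refl
 id399 = ring 4 (λ K κ I b → K * I * (1# + κ) - (b - κ) ≡ (K + 1#) * I - b + κ + (K * κ - 1#) * I) refl
 id400 = ring 3 (λ κ b x → b - ν 2 + (1# - ν 2 * κ) ≡ x + b - 1# - κ - (x + κ)) refl
 id401 = ring 5 (λ K κ I b x → K * I * (1# + κ) - (x + b - 1# - κ) ≡ (K + 1#) * I + 1# - b - ν 2 * x + x + κ + (K * κ - 1#) * I) refl
 id402 = ring 2 (λ N κ → N - ν 5 + (ν 4 + (1# - κ)) ≡ N - κ) refl
 id403 = ring 1 (λ N → N ≡ N - 0#) refl
 id404 = ring 3 (λ K κ I → K * K * ((1# + κ) * ((K + 1#) * I - κ - κ)) ≡ K * K * (K + 1#) * I + K * ((K + 1#) * I + ν 3 - ν 4) - K - ν 2 + (K * κ - 1#) * (K * (K + 1#) * I - ν 2 * K * κ - ν 2 - ν 2 * K)) refl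
 id405 = ring 3 (λ K κ I → K * K * ((K * I - κ) + κ * ((K * I - κ) + (1# - κ) - κ) - κ) ≡ K * K * (K + 1#) * I - K - ν 3 + (K * κ - 1#) * (K * K * I - K - ν 3 * K * κ - ν 3)) refl
 id406 = ring 4 (λ K κ I b → K * K * (K * I + κ * (K * I + (b - κ) - κ) - κ) ≡ K * K * (K + 1#) * I + K * b - K - ν 2 + (K * κ - 1#) * (K * K * I + K * b - K - ν 2 * K * κ - ν 2)) refl
 id407 = ring 5 (λ K κ I b x → K * K * (K * I + κ * (K * I + (x + b - 1# - κ) - (x + κ))) ≡ K * K * (K + 1#) * I + K * b - K - ν 2 + (K * κ - 1#) * (K * K * I + K * b - K - ν 2 * K * κ - ν 2)) refl
 id408 = ring 3 (λ K κ I → K * K * ((K + 1#) * I + κ * ((K + 1#) * I - κ)) ≡ K * ((K + 1#) * (K + 1#)) * I - ((K + 1#) * I + ν 3 - ((K + 1#) * I + ν 3 - 1#)) + (K * κ - 1#) * (K * (K + 1#) * I - K * κ - 1#)) refl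
 id409 = ring 3 (λ K κ I → K * K * ((1# + κ) * ((K + 1#) * I - 0#)) ≡ K * ((K + 1#) * (K + 1#)) * I - ((K + 1#) * I + ν 3 - ((K + 1#) * I + ν 3)) + (K * κ - 1#) * (K * (K + 1#) * I)) refl
 id410 = ring 3 (λ K I b → K * K * (K + 1#) * I + K * b - K - ν 2 - (K * K * (K + 1#) * I - K - ν 3) ≡ K * b + 1#) refl
 id411 = ring 3 (λ K I b → K * ((K + 1#) * (K + 1#)) * I - ((K + 1#) * I + ν 3 - b) - (K * K * (K + 1#) * I - K - ν 3) ≡ (K * ((K + 1#) * I) + K) + (ν 2 + (b - ((K + 1#) * I + ν 2)))) refl
 id412 = ring 4 (λ K I b b' → K * K * (K + 1#) * I + K * b' - K - ν 2 - (K * K * (K + 1#) * I + K * b - K - ν 2) ≡ K * (b' - b)) refl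
 id413 = ring 2 (λ N b → N + ν 3 - (ν 2 + b) ≡ N + 1# - b) refl
 id414 = ring 4 (λ K I b b' → K * ((K + 1#) * (K + 1#)) * I - ((K + 1#) * I + ν 3 - b') - (K * K * (K + 1#) * I + K * b - K - ν 2) ≡ K * ((K + 1#) * I + 1# - b) + (1# + (b' - ((K + 1#) * I + ν 2)))) refl
 id415 = ring 4 (λ K I b b' → K * ((K + 1#) * (K + 1#)) * I - ((K + 1#) * I + ν 3 - b') - (K * ((K + 1#) * (K + 1#)) * I - ((K + 1#) * I + ν 3 - b)) ≡ b' - b) refl
 id416 = ring 3 (λ κ b x → κ * (b - 1# - ν 2 * κ) ≡ κ * (x + b - 1# - κ - (x + κ))) refl
 id417 = ring 4 (λ K κ b x' → b - ν 2 - K * x' ≡ ν 2 * κ + K * (κ * (b - 1# - ν 2 * κ) - (x' + κ)) + (K * κ - 1#) * (ν 2 * κ + ν 2 - b)) refl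
 id418 = ring 2 (λ K κ → ν 2 * κ + K * 0# ≡ ν 2 * κ) refl
 id419 = ring 2 (λ x x' → x' - x ≡ (x + x') - ν 2 * x) refl
 id420 = ring 4 (λ N b x κ → N + 1# - b ≡ x + (N + 1# - b - x + κ - κ)) refl
 id421 = ring 5 (λ K κ I b x → K * I * (1# + κ) - (x + b - 1# - κ) ≡ (K + 1#) * I + 1# - b - x + κ + (K * κ - 1#) * I) refl
 id422 = ring 3 (λ x x' κ → x + (x' + κ - κ) ≡ x + x') refl
 id423 = ring 6 (λ K κ a e x z → κ * (z - (a + K * (e - a) * x)) ≡ κ * z - κ * a - (e - a) * x + (K * κ - 1#) * - ((e - a) * x)) refl
 id424 = ring 4 (λ K κ I e → K * I * (1# + κ) - ((K + 1#) * I - e) ≡ e + (K * κ - 1#) * I) refl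
 id425 = ring 2 (λ κ z → κ * z - κ * 0# ≡ κ * z) refl
 id426 = ring 2 (λ z u → z ≡ z - 0# * u) refl
 id427 = ring 4 (λ κ ρ x z → (1# + κ) * z - ρ * (1# + κ) * x ≡ (1# + κ) * (z - ρ * x)) refl
 id428 = ring 6 (λ K κ I c u x → (1# + κ) * (K * I * u - x) - c * u ≡ ((K + 1#) * I - c) * u - (1# + κ) * x + (K * κ - 1#) * (I * u)) refl
 id429 = ring 5 (λ K κ I u x → (K * I - κ) * u - x ≡ K * I * u - x - κ * u) refl
 id430 = ring 6 (λ K κ I e u x → κ * ((K * I - κ) * u - x) - ((K * I - κ) * (1# + κ) - ((K + 1#) * I - e)) * (u - 1#) ≡ κ * (K * I * u - x) - κ * κ - (e - κ) * (u - 1#) + (K * κ - 1#) * - (I * (u - 1#))) refl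
 id431 = ring 3 (λ κ u z → (1# + κ) * z - 0# * u ≡ (1# + κ) * (z - 0# * u)) refl
 id432 = ring 3 (λ κ u x → (1# + κ) * x - 0# * u ≡ (1# + κ) * x) refl
 id433 = ring 4 (λ x x' m ρ → (x' - m) * ρ * x + (m - x) * ρ * x' ≡ (x' - x) * ρ * m) refl
 id434 = ring 5 (λ x x' m ρ y → (x' - m) * ρ * y + (m - x) * ρ * y ≡ (x' - x) * ρ * y) refl
 id435 = ring 5 (λ f z xl xr κ → f - z + 1# - ν 2 * κ - (xr - xl) ≡ (f + 1# - (xr + κ)) + (xl - (z + κ))) refl
 id436 = ring 2 (λ z m → z + 1# + m - (z + 1#) ≡ m) refl
 id437 = ring 3 (λ f z m → f - (z + 1# + m) ≡ f - z - (1# + m)) refl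
 id438 = ring 2 (λ Y K → Y - K - ν 3 ≡ Y + K * 0# - K - ν 3) refl
 id439 = ring 3 (λ K κ q → K * (q - (0# + κ)) ≡ K * q - 1# + (K * κ - 1#) * - 1#) refl
 id440 = ring 8 (λ K κ I q w n b A → K * K * (K + 1#) * I + K * b - K - ν 3 - A ≡ ((K * (w + q + K * (I - q) - 0# - 0#) + K * K * (ν 2 * q + K * (I - q) - 0# - 0#) - A) + (K * (n + 1# - ν 2 * κ - w) + (K * (b - n) + (K * q - 1#) * ((K - ν 4) * (K - ν 4) + (ν 7 * (K - ν 4) + ν 11))))) + (((K - ν 4) * (K - ν 4) + ν 5 * (K - ν 4)) + ν 2) + (K * κ - 1#) * ν 2) refl
 id441 = ring 8 (λ K κ I q w n b A → K * K * (K + 1#) * I + K * b - K - ν 2 - A ≡ ((K * (w + q + K * (I - q) - 0# - 0#) + K * K * (ν 2 * q + K * (I - q) - 0# - 0#) - A) + (K * (n + 1# - ν 2 * κ - w) + (K * (b - n) + (K * q - 1#) * ((K - ν 4) * (K - ν 4) + (ν 7 * (K - ν 4) + ν 11))))) + (((K - ν 4) * (K - ν 4) + ν 5 * (K - ν 4)) + ν 3) + (K * κ - 1#) * ν 2) refl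
 id442 = ring 3 (λ x y z → x - y + z ≡ x - (y - z)) refl
 id443 = ring 7 (λ K κ I q w b A → K * ((K + 1#) * (K + 1#)) * I - ((K + 1#) * I + ν 3 - b) - A ≡ ((K * (w + q + K * (I - q) - 0# - 0#) + K * K * (ν 2 * q + K * (I - q) - 0# - 0#) - A) + K * (q + K * (I - q) * (1# + κ) - w)) + (((K * q - 1#) * ((K - ν 4) * ((K - ν 4) + ν 8) + ν 15) + (b - ((K + 1#) * I + ν 2))) + ((K - ν 4) * ((K - ν 4) + ν 8) + ν 14)) + (K * κ - 1#) * - (K * (I - q))) refl
 id444 = ring 2 (λ K I → K * (I - 0#) ≡ K * I) refl
 id445 = ring 7 (λ K I w a a' ρ ρ' → K * (w + 0# + K * I - a - a') + K * K * (ν 2 * 0# + K * I - ρ - ρ') ≡ K * K * (K + 1#) * I + K * w - ((K * a + K * K * ρ) + (K * a' + K * K * ρ'))) refl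
 id446 = ring 3 (λ d h x → 0# + d * h - x ≡ d * h - x) refl
 id447 = ring 3 (λ K I u → K * (K * I * u) ≡ (K * I) * (K * u)) refl
 zero-right = ring 1 (λ D → 0# + D * 0# - 0# ≡ 0#) refl
 id448 = ring 3 (λ K κ I → K * I * κ - 0# ≡ I + (K * κ - 1#) * I) refl
 id449 = ring 9 (λ Y K κ w n t b c A → Y + K * b - K - ν 3 - A ≡ ((Y + K * w - c - A) + (K * (n + 1# - ν 2 * κ - w) + K * (b - (t + n)))) + (K * t + c - ν 2 * K - 1#) + (K * κ - 1#) * ν 2) refl
 id450 = ring 9 (λ Y K κ w n t b c A → Y + K * b - K - ν 2 - A ≡ ((Y + K * w - c - A) + (K * (n + 1# - ν 2 * κ - w) + K * (b - (t + n)))) + (K * t + c - ν 2 * K) + (K * κ - 1#) * ν 2) refl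
 id451 = ring 2 (λ x y → x + y - y ≡ x) refl
 id452 = ring 4 (λ K κ I x → 0# + K * I * (1# + κ) - x ≡ (K + 1#) * I - x + (K * κ - 1#) * I) refl
 id453 = ring 6 (λ K I w c b A → K * ((K + 1#) * (K + 1#)) * I - ((K + 1#) * I + ν 3 - b) - A ≡ ((K * K * (K + 1#) * I + K * w - c - A) + (b - ((K + 1#) * I + ν 2))) + (K * ((K + 1#) * I - w) + c - 1#)) refl
 id454 = ring 2 (λ x y → 0# * x + 1# * y + 0# ≡ y) refl
 id455 = ring 5 (λ K κ I x y → K * I * (κ - y) - x ≡ - 1# * x + - (K * I) * y + I + (K * κ - 1#) * I) refl
 id456 = ring 2 (λ a x → 0# + a - x ≡ a - x) refl
 id457 = ring 4 (λ K κ I x → K * I * (κ - - 1#) - ((K + 1#) * I - x) ≡ x + (K * κ - 1#) * I) refl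
 id458 = ring 4 (λ K κ I x → K * I * (κ - (κ - 1#)) - x ≡ K * I - x) refl
 id459 = ring 2 (λ a κ → a * (κ - κ) - 0# ≡ 0#) refl
 id460 = ring 3 (λ N x y → N - x - (N - y) ≡ y - x) refl
 id461 = ring 1 (λ x → x - 0# ≡ x) refl
 id462 = ring 1 (λ K → K * 0# + K * K * 0# ≡ 0#) refl
 id463 = ring 2 (λ K κ → K * (+ 1 / 4 * κ) + K * K * 0# ≡ + 1 / 4 + (K * κ - 1#) * (+ 1 / 4)) refl
 id464 = ring 2 (λ K ρ → K * ρ + K * K * ρ ≡ K * ((K + 1#) * ρ)) refl
 id465 = ring 2 (λ K κ → K * κ + K * K * κ ≡ K + 1# + (K * κ - 1#) * (K + 1#)) refl
 id466 = ring 2 (λ K κ → K * (+ 5 / 4 * κ) + K * K * κ ≡ K + + 5 / 4 + (K * κ - 1#) * (K + + 5 / 4)) refl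
 id467 = ring 2 (λ x y → x ≡ x - y + y) refl
 id468 = ring 3 (λ N b κ → 1# + N - b ≡ N - (b - κ) + (1# - κ)) refl
 id469 = ring 1 (λ K → K * ν 2 + (0# + 0#) - ν 2 * K ≡ 0#) refl
 id470 = ring 2 (λ z κ → z - - 1# ≡ z + κ + (1# - κ)) refl
 id471 = ring 3 (λ N f κ → N - f ≡ N - (f + 1# - κ) + (1# - κ)) refl
 id472 = ring 3 (λ N f z → N + ν 3 - (ν 2 + (f - z)) - (ν 2 + z) ≡ N - (f + 1#)) refl
 id473 = ring 3 (λ f z κ → z + (ν 2 + (f - z)) - 1# - κ ≡ f + 1# - κ) refl
 id474 = ring 3 (λ N f z → N + ν 3 - (ν 2 + (f - z)) - (ν 2 + z) ≡ N - 1# - f) refl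
 id475 = ring 3 (λ N f κ → N - 1# - f + κ ≡ N - (f + 1# - κ)) refl
 id476 = ring 4 (λ N f z κ → N - 1# - f + (ν 2 + (f - z)) - 1# - κ ≡ N - (z + κ)) refl
 id477 = ring 4 (λ s b N x → (s + (b - (N + ν 2))) + (x + (0# + 0#) - 1#) ≡ (s + (b - (N + ν 3))) + x) refl
 id478 = ring 3 (λ b n N → b - (N + ν 3) ≡ (b - (ν 2 + n)) + (n - N - 1#)) refl
 id479 = ring 4 (λ s f z N → s + (f - z - N - 1#) ≡ (s + (f - N)) + (0# - (z + 1#))) refl
 id480 = ring 3 (λ K κ x → K * (x - κ) ≡ K * x - 1# + (K * κ - 1#) * - 1#) refl
 id481 = ring 3 (λ s r x → (s + r) + (x + (0# + 0#) - 1#) ≡ s + (r + (x - 1#))) refl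
 id482 = ring 4 (λ s r x c → (s + r) + (x + c - 1#) ≡ (s + (r + (x - 1#))) + c) refl
 id483 = ring 1 (λ N → N + ν 3 - 1# ≡ N + ν 2) refl
 id484 = ring 3 (λ x y κ → x + (y - κ) ≡ x + y - κ) refl
 id485 = ring 1 (λ x → x ≡ x + 0#) refl
 id486 = ring 1 (λ K → + 1 / 4 ≡ K * ν 2 + (+ 1 / 4 + 0#) - ν 2 * K) refl
 id487 = ring 1 (λ K → + 1 / 4 ≡ K * ν 2 + (0# + + 1 / 4) - ν 2 * K) refl
 id488 = ring 2 (λ K c → K * 1# + c - ν 2 * K ≡ c - K) refl
 id489 = ring 2 (λ K c → K * 0# + c - ν 2 * K ≡ c - ν 2 * K) refl
 id490 = ring 3 (λ t n κ → t + n - t + 1# - κ ≡ n + 1# - ν 2 * κ + κ) refl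
 id491 = ring 3 (λ N x y → N - y ≡ x - y + (N - x)) refl
 drop1 = ring 2 (λ b κ → b - κ ≡ b - 1# + 1# - κ) refl
 id492 = ring 1 (λ K → K * 1# + (0# + K) - ν 2 * K ≡ 0#) refl
 id493 = ring 1 (λ K → K * 1# + (+ 1 / 4 + K) - ν 2 * K ≡ + 1 / 4) refl
 id494 = ring 1 (λ K → K * 1# + (K + 0#) - ν 2 * K ≡ 0#) refl
 id495 = ring 1 (λ K → K * 1# + (K + + 1 / 4) - ν 2 * K ≡ + 1 / 4) refl
 id496 = ring 1 (λ K → K * 0# + (K + K) - ν 2 * K ≡ 0#) refl
 id497 = ring 3 (λ N x y → x - y ≡ N - (N - x) - y) refl
 id498 = ring 3 (λ n κ N → (n + 1# - ν 2 * κ - (N - κ - κ) + (0# - n)) + (N - ν 5) + ν 4 ≡ 0#) refl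
 id499 = ring 2 (λ N κ → N + ν 3 - ν 4 ≡ N - κ - κ - 1# + ν 2 * κ) refl
 id500 = ring 2 (λ n κ → n + 1# - ν 2 * κ - 1# + ν 2 * κ ≡ 0# + n) refl
 id501 = ring 1 (λ K → K * 0# + (K + (K + 1#)) - ν 2 * K - 1# ≡ 0#) refl
 id502 = ring 1 (λ κ → 1# - κ ≡ 0# - 0# + 1# - κ) refl
 id503 = ring 1 (λ K → K * 0# + (K + (K + 1#)) - ν 2 * K ≡ 1#) refl
 id504 = ring 1 (λ K → K + (K + 1#) - 1# ≡ K + K) refl
 id505 = ring 1 (λ K → K * 0# + (K + (K + + 5 / 4)) - ν 2 * K - 1# ≡ + 1 / 4) refl
 id506 = ring 1 (λ K → K * 0# + (K + 1# + K) - ν 2 * K - 1# ≡ 0#) refl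
 id507 = ring 1 (λ K → K * 0# + (K + 1# + K) - ν 2 * K ≡ 1#) refl
 id508 = ring 1 (λ K → K + 1# + K - 1# ≡ K + K) refl
 id509 = ring 1 (λ K → K * 0# + (K + + 5 / 4 + K) - ν 2 * K - 1# ≡ + 1 / 4) refl
 id510 = ring 1 (λ K → K * 1# + (0# + (K + 1#)) - ν 2 * K ≡ 1#) refl
 id511 = ring 1 (λ K → 0# + (K + 1#) - 1# ≡ K) refl
 id512 = ring 1 (λ K → K * 1# + (K + 1# + 0#) - ν 2 * K ≡ 1#) refl
 id513 = ring 1 (λ K → K + 1# + 0# - 1# ≡ K) refl
 id514 = ring 1 (λ K → K * 0# + (K + 1# + (K + 1#)) - ν 2 * K - 1# ≡ 1#) refl
 id515 = ring 1 (λ K → K * 0# + (K + 1# + (K + 1#)) - ν 2 * K ≡ ν 2) refl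
 id516 = ring 1 (λ K → K + 1# + (K + 1#) - 1# ≡ K + K + 1#) refl
 id517 = ring 2 (λ x y → (ν 2 * x) * (+ 1 / 2 * y) ≡ x * y) refl

module ThinPolygons where

 open import Defs renaming (ℕ→ℚ to ν; ℤ→ℚ to ι)
 open import Data.Nat as N using (ℕ; zero; suc; _∸_)
 import Data.Nat.Properties as NP
 import Data.Nat.DivMod as ℕDM
 open import Data.Integer as Z using (ℤ; +_; -[1+_])
 import Data.Integer.Properties as ZP
 import Data.Integer.DivMod as ℤDM
 open import Data.Rational as ℚ using (ℚ; _+_; _*_; _-_; -_; _/_; ½; ∣_∣; _≤_; _<_; toℚᵘ; fromℚᵘ) renaming (0ℚ to 0#; 1ℚ to 1#)
 open import Data.Rational.Properties as QP using (≤-refl; ≤-trans; ≤-antisym; ≤-reflexive; ≤-total; <⇒≤; <-trans; <-≤-trans; ≤-<-trans; <-irrefl; ≰⇒>; ≮⇒≥; _≤?_; _<?_; _≟_)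
 import Data.Rational.Unnormalised as ℚᵘ
 import Data.Rational.Unnormalised.Properties as ℚᵘP
 open import Data.Product using (Σ; ∃; ∃-syntax; _×_; _,_) renaming (proj₁ to fst; proj₂ to snd)
 open import Data.Product.Properties using (≡-dec)
 open import Data.Sum using (_⊎_; inj₁; inj₂; [_,_]′)
 open import Data.Bool using (Bool; true; false; T)
 open import Data.Unit using (⊤; tt)
 open import Data.Empty using (⊥; ⊥-elim)
 open import Data.List using (List; []; _∷_; length; map; zipWith; foldr; _++_; filter; replicate)
 import Data.List.Properties as LP
 open import Data.List.Relation.Unary.All as All using (All)
 import Data.List.Relation.Unary.All.Properties as AllP
 open import Data.List.Relation.Unary.Any as Any using (Any; here; there)
 open import Data.List.Membership.Propositional using (_∈_; _∉_; find; lose)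
 import Data.List.Membership.Propositional.Properties as ∈P
 open import Data.List.Relation.Unary.Unique.Propositional using (Unique)
 import Data.List.Relation.Unary.AllPairs as AP
 import Data.List.Relation.Unary.Unique.Propositional.Properties as UP
 open import Data.List.Relation.Binary.Permutation.Propositional as Perm using (_↭_)
 import Data.List.Relation.Binary.Permutation.Propositional.Properties as PermP
 open import Relation.Binary using (Tri; tri<; tri≈; tri>)
 open import Relation.Binary.PropositionalEquality using (_≡_; _≢_; refl; sym; trans; cong; cong₂; subst; subst₂; module ≡-Reasoning)
 open import Relation.Nullary using (¬_; Dec; yes; no; contradiction)
 open import Relation.Nullary.Decidable using (True; toWitness; dec⇒maybe; _×-dec_; ¬?)
 open import Function using (_∘_; id; case_of_)
 import Data.Integer.Tactic.RingSolver as ℤS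
 open import Data.List.Relation.Binary.BagAndSetEquality using (∼bag⇒↭)
 open import Data.List.Membership.Propositional.Properties.WithK using (unique∧set⇒bag)
 open import Function.Bundles using (mk⇔)
 open Identities hiding (c¾; c²⁷⁄₈; c³⁄₂; c⁷⁄₄)

 pattern ∈0 = here refl
 pattern ∈1 = there ∈0
 pattern ∈2 = there ∈1
 pattern ∈3 = there ∈2
 pattern ∈4 = there ∈3

 -- Ordered arithmetic on the rationals; embedded integers and naturals.

 infixr 6 _⊞_ _⊞<_ _⊞≤<_
 infixr 7 _⊠_ _⊠<_

 abstract
  _⊞_ : ∀ {a b} → 0# ≤ a → 0# ≤ b → 0# ≤ a + b
  p ⊞ q = QP.+-mono-≤ p q

  _⊞<_ : ∀ {a b} → 0# < a → 0# ≤ b → 0# < a + b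
  p ⊞< q = QP.+-mono-<-≤ p q

  _⊞≤<_ : ∀ {a b} → 0# ≤ a → 0# < b → 0# < a + b
  p ⊞≤< q = QP.+-mono-≤-< p q

  _⊠_ : ∀ {a b} → 0# ≤ a → 0# ≤ b → 0# ≤ a * b
  _⊠_ {a} {b} p q = QP.nonNegative⁻¹ (a * b) {{QP.nonNeg*nonNeg⇒nonNeg a {{ℚ.nonNegative p}} b {{ℚ.nonNegative q}}}}

  _⊠<_ : ∀ {a b} → 0# < a → 0# < b → 0# < a * b
  _⊠<_ {a} {b} p q = QP.positive⁻¹ (a * b) {{QP.pos*pos⇒pos a {{ℚ.positive p}} b {{ℚ.positive q}}}}

  diff≥ : ∀ {a b} → a ≤ b → 0# ≤ b - a
  diff≥ {a} {b} p = subst (_≤ b - a) (QP.+-inverseʳ a) (QP.+-monoˡ-≤ (- a) p)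

  diff> : ∀ {a b} → a < b → 0# < b - a
  diff> {a} {b} p = subst (_< b - a) (QP.+-inverseʳ a) (QP.+-monoˡ-< (- a) p)

  -- The certificate form of an inequality: the difference of the sides is rewritten, by a ring
  -- identity, as an expression that is visibly nonnegative. Nearly every numerical estimate below
  -- has this form.
  ≤-by : ∀ {a b c} → 0# ≤ c → b - a ≡ c → a ≤ b
  ≤-by {a} {b} p refl = subst₂ _≤_ (QP.+-identityˡ a) (cancel-sub a b) (QP.+-monoˡ-≤ a p)

  <-by : ∀ {a b c} → 0# < c → b - a ≡ c → a < b
  <-by {a} {b} p refl = subst₂ _<_ (QP.+-identityˡ a) (cancel-sub a b) (QP.+-monoˡ-< a p)

  -- The certificate form of ¬ (0 < c) when c is a combination of nonnegatives that should be negative.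
  absurd-by : ∀ {c d} {A : Set} → 0# ≤ c → 0# < d → c + d ≡ 0# → A
  absurd-by {c} {d} p q e = ⊥-elim (<-irrefl (sym e) (p ⊞≤< q))

  0≤-cancel : ∀ {a b} → 0# < a → 0# ≤ a * b → 0# ≤ b
  0≤-cancel {a} {b} p q with 0# ≤? b
  ... | yes r = r
  ... | no ¬r = ⊥-elim (<-irrefl refl (≤-<-trans q (subst (a * b <_) (QP.*-zeroʳ a) (QP.*-monoʳ-<-pos a {{ℚ.positive p}} (≰⇒> ¬r)))))

  0<-cancel : ∀ {a b} → 0# < a → 0# < a * b → 0# < b
  0<-cancel {a} {b} p q with 0# <? b
  ... | yes r = r
  ... | no ¬r = ⊥-elim (<-irrefl refl (<-≤-trans q (subst (a * b ≤_) (QP.*-zeroʳ a) (QP.*-monoˡ-≤-nonNeg a {{ℚ.nonNegative (<⇒≤ p)}} (≮⇒≥ ¬r)))))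

  ≡0-cancel : ∀ {a b} → 0# < a → a * b ≡ 0# → b ≡ 0#
  ≡0-cancel {a} {b} p e = ≤-antisym
   (subst₂ _≤_ (neg-neg b) refl (QP.neg-antimono-≤ (0≤-cancel {a} { - b} p (≤-reflexive (sym (trans (*-neg a b) (cong -_ e)))))))
   (0≤-cancel p (≤-reflexive (sym e)))

 -- Comparisons of closed rationals hold by evaluation: the implicit argument is solved when the
 -- decision computes to `yes`.
 ≤-lit : (p q : ℚ) {w : True (p ≤? q)} → p ≤ q
 ≤-lit p q {w} = toWitness w

 <-lit : (p q : ℚ) {w : True (p <? q)} → p < q
 <-lit p q {w} = toWitness w

 abstract
  recip : ∀ a → 0# < a → ∃[ b ] (0# < b × a * b ≡ 1#)
  recip a p = (ℚ.1/ a) {{QP.pos⇒nonZero a {{ℚ.positive p}}}} , QP.positive⁻¹ _ {{QP.1/pos⇒pos a {{ℚ.positive p}}}} , QP.*-inverseʳ a {{QP.pos⇒nonZero a {{ℚ.positive p}}}}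

  ι-+ : ∀ a b → ι (a Z.+ b) ≡ ι a + ι b
  ι-+ a b = QP.toℚᵘ-injective (ℚᵘP.≃-trans (QP.toℚᵘ-fromℚᵘ (ℚᵘ.mkℚᵘ (a Z.+ b) 0))
   (ℚᵘP.≃-sym (ℚᵘP.≃-trans (QP.toℚᵘ-homo-+ (ι a) (ι b))
    (ℚᵘP.≃-trans (ℚᵘP.+-cong (QP.toℚᵘ-fromℚᵘ (ℚᵘ.mkℚᵘ a 0)) (QP.toℚᵘ-fromℚᵘ (ℚᵘ.mkℚᵘ b 0)))
     (ℚᵘ.*≡* (cong (Z._* + 1) (cong₂ Z._+_ (ZP.*-identityʳ a) (ZP.*-identityʳ b))))))))

  ι-* : ∀ a b → ι (a Z.* b) ≡ ι a * ι b
  ι-* a b = QP.toℚᵘ-injective (ℚᵘP.≃-trans (QP.toℚᵘ-fromℚᵘ (ℚᵘ.mkℚᵘ (a Z.* b) 0))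
   (ℚᵘP.≃-sym (ℚᵘP.≃-trans (QP.toℚᵘ-homo-* (ι a) (ι b))
    (ℚᵘP.*-cong (QP.toℚᵘ-fromℚᵘ (ℚᵘ.mkℚᵘ a 0)) (QP.toℚᵘ-fromℚᵘ (ℚᵘ.mkℚᵘ b 0))))))

  ι-neg : ∀ a → ι (Z.- a) ≡ - ι a
  ι-neg a = trans (add-sub (ι (Z.- a)) (ι a)) (trans (cong (_- ι a) (trans (sym (ι-+ (Z.- a) a)) (cong ι (ZP.+-inverseˡ a)))) (QP.+-identityˡ _))

  ι-- : ∀ a b → ι (a Z.- b) ≡ ι a - ι b
  ι-- a b = trans (ι-+ a (Z.- b)) (cong (λ z → ι a + z) (ι-neg b))

  ι-≤ : ∀ a b → a Z.≤ b → ι a ≤ ι b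
  ι-≤ a b p = QP.toℚᵘ-cancel-≤ (ℚᵘP.≤-respˡ-≃ (ℚᵘP.≃-sym (QP.toℚᵘ-fromℚᵘ (ℚᵘ.mkℚᵘ a 0)))
   (ℚᵘP.≤-respʳ-≃ (ℚᵘP.≃-sym (QP.toℚᵘ-fromℚᵘ (ℚᵘ.mkℚᵘ b 0))) (ℚᵘ.*≤* (ZP.*-monoʳ-≤-nonNeg (+ 1) p))))

  ι-< : ∀ a b → a Z.< b → ι a < ι b
  ι-< a b p = QP.toℚᵘ-cancel-< (ℚᵘP.<-respˡ-≃ (ℚᵘP.≃-sym (QP.toℚᵘ-fromℚᵘ (ℚᵘ.mkℚᵘ a 0)))
   (ℚᵘP.<-respʳ-≃ (ℚᵘP.≃-sym (QP.toℚᵘ-fromℚᵘ (ℚᵘ.mkℚᵘ b 0))) (ℚᵘ.*<* (ZP.*-monoʳ-<-pos (+ 1) p))))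

  ι-≤⁻ : ∀ a b → ι a ≤ ι b → a Z.≤ b
  ι-≤⁻ a b p with a ZP.≤? b
  ... | yes q = q
  ... | no ¬q = ⊥-elim (<-irrefl refl (<-≤-trans (ι-< b a (ZP.≰⇒> ¬q)) p))

  ι-<⁻ : ∀ a b → ι a < ι b → a Z.< b
  ι-<⁻ a b p with a ZP.<? b
  ... | yes q = q
  ... | no ¬q = ⊥-elim (<-irrefl refl (<-≤-trans p (ι-≤ b a (ZP.≮⇒≥ ¬q))))

  ι-inj : ∀ a b → ι a ≡ ι b → a ≡ b
  ι-inj a b e = ZP.≤-antisym (ι-≤⁻ a b (≤-reflexive e)) (ι-≤⁻ b a (≤-reflexive (sym e)))

  ι-suc : ∀ a → ι (Z.suc a) ≡ ι a + 1#
  ι-suc a = trans (ι-+ (+ 1) a) (QP.+-comm 1# (ι a))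

  ι-discrete : ∀ a b → ι a < ι b → ι a + 1# ≤ ι b
  ι-discrete a b p = subst (_≤ ι b) (ι-suc a) (ι-≤ (Z.suc a) b (ZP.i<j⇒suc[i]≤j (ι-<⁻ a b p)))

 floorℚ : ∀ q → ∃[ z ] (ι z ≤ q × q < ι z + 1#)
 floorℚ q@record{} = z , lower , subst (q <_) (ι-suc z) upper where
  d : ℤ
  d = ℚ.↧ q
  n : ℤ
  n = ℚ.↥ q
  z : ℤ
  z = n Z./ d
  nn : n ≡ + (n Z.% d) Z.+ z Z.* d
  nn = ℤDM.a≡a%n+[a/n]*n n d
  lower : ι z ≤ q
  lower = QP.toℚᵘ-cancel-≤ (ℚᵘP.≤-respˡ-≃ (ℚᵘP.≃-sym (QP.toℚᵘ-fromℚᵘ (ℚᵘ.mkℚᵘ z 0)))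
   (ℚᵘ.*≤* (subst (z Z.* d Z.≤_) (trans (sym nn) (sym (ZP.*-identityʳ n))) (ZP.i≤j+i (z Z.* d) (+ (n Z.% d))))))
  upper : q < ι (Z.suc z)
  upper = QP.toℚᵘ-cancel-< (ℚᵘP.<-respʳ-≃ (ℚᵘP.≃-sym (QP.toℚᵘ-fromℚᵘ (ℚᵘ.mkℚᵘ (Z.suc z) 0)))
   (ℚᵘ.*<* (subst₂ Z._<_ (trans (sym nn) (sym (ZP.*-identityʳ n))) (sym (ZP.suc-* z d)) (ZP.+-monoˡ-< (z Z.* d) (Z.+<+ (ℤDM.n%d<d n d))))))

 abstract
  ν-+ : ∀ a b → ν (a N.+ b) ≡ ν a + ν b
  ν-+ a b = ι-+ (+ a) (+ b)

  ν-* : ∀ a b → ν (a N.* b) ≡ ν a * ν b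
  ν-* a b = trans (cong ι (ZP.pos-* a b)) (ι-* (+ a) (+ b))

  ν-suc : ∀ a → ν (suc a) ≡ 1# + ν a
  ν-suc a = ν-+ 1 a

  ν-≤ : ∀ a b → a N.≤ b → ν a ≤ ν b
  ν-≤ a b p = ι-≤ (+ a) (+ b) (Z.+≤+ p)

  ν-< : ∀ a b → a N.< b → ν a < ν b
  ν-< a b p = ι-< (+ a) (+ b) (Z.+<+ p)

  ν-≤⁻ : ∀ a b → ν a ≤ ν b → a N.≤ b
  ν-≤⁻ a b p = ZP.drop‿+≤+ (ι-≤⁻ (+ a) (+ b) p)

  ν-<⁻ : ∀ a b → ν a < ν b → a N.< b
  ν-<⁻ a b p = ZP.drop‿+<+ (ι-<⁻ (+ a) (+ b) p)

  ν-inj : ∀ a b → ν a ≡ ν b → a ≡ b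
  ν-inj a b e = ZP.+-injective (ι-inj (+ a) (+ b) e)

  ν-0≤ : ∀ a → 0# ≤ ν a
  ν-0≤ a = ν-≤ 0 a N.z≤n

  archimedean : ∀ q → ∃[ n ] (q < ν n)
  archimedean q with floorℚ q
  ... | + z , _ , u = suc z , subst (q <_) (trans (QP.+-comm (ν z) 1#) (sym (ν-suc z))) u
  ... | -[1+ z ] , _ , u = 0 , <-≤-trans u (subst (_≤ 0#) (ι-suc -[1+ z ]) (ι-≤ (Z.suc -[1+ z ]) (+ 0) (ZP.i<j⇒suc[i]≤j {i = -[1+ z ]} {j = + 0} Z.-<+)))

  inv-* : ∀ k → 1 N.≤ k → ν k * inv k ≡ 1#
  inv-* (suc k) _ = QP.toℚᵘ-injective (ℚᵘP.≃-trans (QP.toℚᵘ-homo-* (ν (suc k)) (inv (suc k)))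
   (ℚᵘP.≃-trans (ℚᵘP.*-cong (QP.toℚᵘ-fromℚᵘ (ℚᵘ.mkℚᵘ (+ suc k) 0)) (QP.toℚᵘ-fromℚᵘ (ℚᵘ.mkℚᵘ (+ 1) k)))
    (ℚᵘ.*≡* (trans (ZP.*-identityʳ _) (trans (ZP.*-identityʳ _) (sym (trans (ZP.*-identityˡ _) (cong (λ z → + suc z) (NP.+-identityʳ k)))))))))

 -- Convex polygons as intersections of half-planes.

 _≟ₚ_ : (p q : Point) → Dec (p ≡ q)
 _≟ₚ_ = ≡-dec _≟_ _≟_

 -- Twice the signed area of the triangle `p`, `q`, `r`; it is positive when `r` lies to the left of
 -- the directed line from `p` to `q`.
 orient : Point → Point → Point → ℚ
 orient p q r = cross (q ⊖ p) (r ⊖ p)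

 pathE : Point → List Point → Point → List (Point × Point)
 pathE p [] q = (p , q) ∷ []
 pathE p (x ∷ xs) q = (p , x) ∷ pathE x xs q

 edgesFrom≡pathE : ∀ f x xs → edgesFrom f (x ∷ xs) ≡ pathE x xs f
 edgesFrom≡pathE f x [] = refl
 edgesFrom≡pathE f x (y ∷ xs) = cong ((x , y) ∷_) (edgesFrom≡pathE f y xs)

 edges≡pathE : ∀ p ps → edges (p ∷ ps) ≡ pathE p ps p
 edges≡pathE p ps = edgesFrom≡pathE p p ps

 pathE-fst : ∀ p xs q {e} → e ∈ pathE p xs q → fst e ∈ p ∷ xs
 pathE-fst p [] q ∈0 = here refl
 pathE-fst p (x ∷ xs) q ∈0 = here refl
 pathE-fst p (x ∷ xs) q (there m) = there (pathE-fst x xs q m)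

 pathE-snd : ∀ p xs q {e} → e ∈ pathE p xs q → snd e ∈ xs ⊎ snd e ≡ q
 pathE-snd p [] q ∈0 = inj₂ refl
 pathE-snd p (x ∷ xs) q ∈0 = inj₁ ∈0
 pathE-snd p (x ∷ xs) q (there m) with pathE-snd x xs q m
 ... | inj₁ n = inj₁ (there n)
 ... | inj₂ n = inj₂ n

 edge-fst : ∀ P {e} → e ∈ edges P → fst e ∈ P
 edge-fst (p ∷ ps) m = pathE-fst p ps p (subst (_ ∈_) (edges≡pathE p ps) m)

 edge-snd : ∀ P {e} → e ∈ edges P → snd e ∈ P
 edge-snd (p ∷ ps) m with pathE-snd p ps p (subst (_ ∈_) (edges≡pathE p ps) m)
 ... | inj₁ n = there n
 ... | inj₂ refl = here refl

 pathE-out : ∀ p xs q {v} → v ∈ p ∷ xs → ∃[ w ] ((v , w) ∈ pathE p xs q)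
 pathE-out p [] q ∈0 = q , here refl
 pathE-out p (x ∷ xs) q ∈0 = x , here refl
 pathE-out p (x ∷ xs) q (there m) with pathE-out x xs q m
 ... | w , n = w , there n

 pathE-in : ∀ p xs q {v} → v ∈ xs → ∃[ u ] ((u , v) ∈ pathE p xs q)
 pathE-in p (x ∷ xs) q ∈0 = p , here refl
 pathE-in p (x ∷ xs) q (there m) with pathE-in x xs q m
 ... | w , n = w , there n

 pathE-last : ∀ p xs q → ∃[ u ] ((u , q) ∈ pathE p xs q)
 pathE-last p [] q = p , here refl
 pathE-last p (x ∷ xs) q with pathE-last x xs q
 ... | w , n = w , there n

 edge-out : ∀ P {v} → v ∈ P → ∃[ w ] ((v , w) ∈ edges P)
 edge-out (p ∷ ps) m with pathE-out p ps p m
 ... | w , n = w , subst (_ ∈_) (sym (edges≡pathE p ps)) n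

 edge-in : ∀ P {v} → v ∈ P → ∃[ u ] ((u , v) ∈ edges P)
 edge-in (p ∷ ps) ∈0 with pathE-last p ps p
 ... | w , n = w , subst (_ ∈_) (sym (edges≡pathE p ps)) n
 edge-in (p ∷ ps) (there m) with pathE-in p ps p m
 ... | w , n = w , subst (_ ∈_) (sym (edges≡pathE p ps)) n

 -- The polygon as an intersection of the half-planes of its edges. This form is decidable and
 -- transports along affine maps; for `ConvexCCW` lists it agrees with `InConv`, and `HInt` agrees
 -- with `Interior`.
 record HIn (P : List Point) (q : Point) : Set where
  constructor hin
  field left : ∀ {a b} → (a , b) ∈ edges P → 0# ≤ orient a b q
 open HIn public

 record HInt (P : List Point) (q : Point) : Set where
  constructor hint
  field left< : ∀ {a b} → (a , b) ∈ edges P → 0# < orient a b q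
 open HInt public

 HInt⇒HIn : ∀ {P q} → HInt P q → HIn P q
 HInt⇒HIn h = hin λ m → <⇒≤ (left< h m)

 orient-left : ∀ a b → orient a b a ≡ 0#
 orient-left (a1 , a2) (b1 , b2) = id1 a1 a2 b1 b2

 orient-right : ∀ a b → orient a b b ≡ 0#
 orient-right (a1 , a2) (b1 , b2) = id2 a1 a2 b1 b2

 orient-degenerate : ∀ a b → orient a a b ≡ 0#
 orient-degenerate (a1 , a2) (b1 , b2) = id3 a1 a2 b1 b2

 orient-rotate : ∀ a b c → orient a b c ≡ orient b c a
 orient-rotate (a1 , a2) (b1 , b2) (c1 , c2) = id4 a1 a2 b1 b2 c1 c2

 orient-swap : ∀ a b c → orient a c b ≡ - orient a b c
 orient-swap (a1 , a2) (b1 , b2) (c1 , c2) = id5 a1 a2 b1 b2 c1 c2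

 orient-split : ∀ a b c q → orient b c q + orient a b q - orient a c q ≡ orient a b c
 orient-split (a1 , a2) (b1 , b2) (c1 , c2) (x , y) = id6 a1 a2 b1 b2 c1 c2 x y

 -- Barycentric coordinates of q with respect to a, b, c, multiplied by orient a b c.
 orient-bary : ∀ a b c q → ((orient b c q · a) ⊕ (((- orient a c q) · b) ⊕ (orient a b q · c))) ≡ orient a b c · q
 orient-bary (a1 , a2) (b1 , b2) (c1 , c2) (x , y) = cong₂ _,_ (id7 a1 a2 b1 b2 c1 c2 x y) (id8 a1 a2 b1 b2 c1 c2 x y)

 orient-affine : ∀ a b s t p q → s + t ≡ 1# → orient a b ((s · p) ⊕ (t · q)) ≡ s * orient a b p + t * orient a b q
 orient-affine (a1 , a2) (b1 , b2) s t (x , y) (u , v) e = trans (id9 a1 a2 b1 b2 s t x y u v) (trans (cong (λ z → s * ((b1 - a1) * (y - a2) - (b2 - a2) * (x - a1)) + t * ((b1 - a1) * (v - a2) - (b2 - a2) * (u - a1)) + (z - 1#) * ((b1 - a1) * a2 - (b2 - a2) * a1)) e) (id10 (s * ((b1 - a1) * (y - a2) - (b2 - a2) * (x - a1)) + t * ((b1 - a1) * (v - a2) - (b2 - a2) * (u - a1))) ((b1 - a1) * a2 - (b2 - a2) * a1)))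

 HIn-convex : ∀ P {p q} s t → 0# ≤ s → 0# ≤ t → s + t ≡ 1# → HIn P p → HIn P q → HIn P ((s · p) ⊕ (t · q))
 HIn-convex P {p} {q} s t hs ht e hp hq = hin λ {a} {b} m → subst (0# ≤_) (sym (orient-affine a b s t p q e)) ((hs ⊠ left hp m) ⊞ (ht ⊠ left hq m))

 HInt-convex : ∀ P {p q} s t → 0# < s → 0# ≤ t → s + t ≡ 1# → HInt P p → HIn P q → HInt P ((s · p) ⊕ (t · q))
 HInt-convex P {p} {q} s t hs ht e hp hq = hint λ {a} {b} m → subst (0# <_) (sym (orient-affine a b s t p q e)) ((hs ⊠< left< hp m) ⊞< (ht ⊠ left hq m))

 module _ {P : List Point} (cv : ConvexCCW P) where

  strictly-left : ∀ {a b v} → (a , b) ∈ edges P → v ∈ P → v ≢ a → v ≢ b → 0# < orient a b v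
  strictly-left m n = snd (snd cv) _ m _ n

  vertex-HIn : ∀ {v} → v ∈ P → HIn P v
  vertex-HIn {v} n = hin go where
   go : ∀ {a b} → (a , b) ∈ edges P → 0# ≤ orient a b v
   go {a} {b} m with v ≟ₚ a | v ≟ₚ b
   ... | yes refl | _ = ≤-reflexive (sym (orient-left a b))
   ... | no _ | yes refl = ≤-reflexive (sym (orient-right a b))
   ... | no x | no y = <⇒≤ (strictly-left m n x y)

 -- Nonnegative combinations of the points of a list, indexed by the total weight.
 Conic : List Point → ℚ → Point → Set
 Conic [] w q = w ≡ 0# × q ≡ (0# , 0#)
 Conic (p ∷ P) w q = ∃[ c ] ∃[ w' ] ∃[ q' ] (0# ≤ c × Conic P w' q' × w ≡ c + w' × q ≡ ((c · p) ⊕ q'))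

 Conic⇒InConv : ∀ P {q} → Conic P 1# q → InConv P q
 Conic⇒InConv P = go P where
  go : ∀ P {w q} → Conic P w q → ∃[ cs ] (All (0# ≤_) cs × length cs ≡ length P × sum cs ≡ w × wsum cs P ≡ q)
  go [] (refl , refl) = [] , All.[] , refl , refl , refl
  go (p ∷ P) (c , w' , q' , hc , h , refl , refl) with go P h
  ... | cs , h1 , h2 , refl , refl = c ∷ cs , hc All.∷ h1 , cong suc h2 , refl , refl

 InConv⇒Conic : ∀ P {q} → InConv P q → Conic P 1# q
 InConv⇒Conic P (cs , h1 , h2 , h3 , h4) = go P cs h1 h2 h3 h4 where
  go : ∀ P cs {w q} → All (0# ≤_) cs → length cs ≡ length P → sum cs ≡ w → wsum cs P ≡ q → Conic P w q
  go [] [] _ _ refl refl = refl , refl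
  go (p ∷ P) (c ∷ cs) (hc All.∷ h1) h2 refl refl = c , _ , _ , hc , go P cs h1 (NP.suc-injective h2) refl refl , refl , refl

 Conic-zero : ∀ P → Conic P 0# (0# , 0#)
 Conic-zero [] = refl , refl
 Conic-zero (p ∷ P) = 0# , 0# , (0# , 0#) , ≤-refl , Conic-zero P , refl , cong₂ _,_ (id11 (fst p)) (id11 (snd p))

 Conic-vertex : ∀ {P v} → v ∈ P → Conic P 1# v
 Conic-vertex {p ∷ P} ∈0 = 1# , 0# , (0# , 0#) , ≤-lit 0# 1# , Conic-zero P , refl , cong₂ _,_ (id12 (fst p)) (id12 (snd p))
 Conic-vertex {p ∷ P} {v} (there m) = 0# , 1# , v , ≤-refl , Conic-vertex m , refl , cong₂ _,_ (id13 (fst p) (fst v)) (id13 (snd p) (snd v))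

 Conic-add : ∀ P {w q w' q'} → Conic P w q → Conic P w' q' → Conic P (w + w') (q ⊕ q')
 Conic-add [] (refl , refl) (refl , refl) = refl , refl
 Conic-add (p ∷ P) (c , u , x , hc , h , refl , refl) (d , u' , x' , hd , h' , refl , refl) =
  c + d , u + u' , x ⊕ x' , hc ⊞ hd , Conic-add P h h' , id14 c u d u' , cong₂ _,_ (id15 c d (fst p) (fst x) (fst x')) (id15 c d (snd p) (snd x) (snd x'))

 Conic-scale : ∀ P {w q} t → 0# ≤ t → Conic P w q → Conic P (t * w) (t · q)
 Conic-scale [] t ht (refl , refl) = QP.*-zeroʳ t , cong₂ _,_ (QP.*-zeroʳ t) (QP.*-zeroʳ t)
 Conic-scale (p ∷ P) t ht (c , u , x , hc , h , refl , refl) =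
  t * c , t * u , t · x , ht ⊠ hc , Conic-scale P t ht h , QP.*-distribˡ-+ t c u , cong₂ _,_ (id16 t c (fst p) (fst x)) (id16 t c (snd p) (snd x))

 affine : ℚ → ℚ → ℚ → Point → ℚ
 affine α β γ (x , y) = α * x + β * y + γ

 Conic-affine : ∀ α β γ P {w q} → (∀ {v} → v ∈ P → 0# ≤ affine α β γ v) → Conic P w q → 0# ≤ affine α β (γ * w) q
 Conic-affine α β γ [] _ (refl , refl) = ≤-reflexive (id17 α β γ)
 Conic-affine α β γ (p ∷ P) h (c , u , x , hc , h' , refl , refl) =
  subst (0# ≤_) (id18 α β γ c u (fst p) (snd p) (fst x) (snd x)) ((hc ⊠ h ∈0) ⊞ Conic-affine α β γ P (λ m → h (there m)) h')

 InConv-affine : ∀ α β γ P {q} → (∀ {v} → v ∈ P → 0# ≤ affine α β γ v) → InConv P q → 0# ≤ affine α β γ q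
 InConv-affine α β γ P {q} h i = subst (λ z → 0# ≤ affine α β z q) (QP.*-identityʳ γ) (Conic-affine α β γ P h (InConv⇒Conic P i))

 orient-as-affine : ∀ a b q → orient a b q ≡ affine (- (snd b - snd a)) (fst b - fst a) (fst a * (snd b - snd a) - snd a * (fst b - fst a)) q
 orient-as-affine (a1 , a2) (b1 , b2) (x , y) = id19 a1 a2 b1 b2 x y

 module _ {P : List Point} (cv : ConvexCCW P) where

  InConv⇒HIn : ∀ {q} → InConv P q → HIn P q
  InConv⇒HIn {q} i = hin λ {a} {b} m → subst (0# ≤_) (sym (orient-as-affine a b q))
   (InConv-affine (- (snd b - snd a)) (fst b - fst a) (fst a * (snd b - snd a) - snd a * (fst b - fst a)) P
    (λ {v} n → subst (0# ≤_) (orient-as-affine a b v) (left (vertex-HIn cv n) m)) i)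

 -- A point of the polygon lies in one of the triangles of the fan with apex o.
 module _ {P : List Point} {q : Point} (o : Point) (hq : HIn P q)
      (pos : ∀ {a b v} → (a , b) ∈ edges P → v ∈ P → v ≢ a → v ≢ b → 0# < orient a b v) (o∈ : o ∈ P) where

  FanTriangle : Set
  FanTriangle = ∃[ a ] ∃[ b ] (a ∈ P × b ∈ P × 0# < orient o a b × 0# ≤ orient o a q × orient o b q ≤ 0# × 0# ≤ orient a b q)

  fan-here : ∀ a b → (a , b) ∈ edges P → o ≢ a → o ≢ b → 0# ≤ orient o a q → orient o b q ≤ 0# → FanTriangle
  fan-here a b m n1 n2 h1 h2 = a , b , edge-fst P m , edge-snd P m , subst (0# <_) (sym (orient-rotate o a b)) (pos m o∈ n1 n2) , h1 , h2 , left hq m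

  -- As `v` runs through the vertices after `o`, `orient o v q` starts nonnegative and ends
  -- nonpositive, because `q` is to the left of both edges at `o`. The triangle at the first change
  -- of sign contains `q`.
  fan-scan : ∀ a xs → (∀ {e} → e ∈ pathE a xs o → e ∈ edges P) → (∀ {v} → v ∈ a ∷ xs → o ≢ v) → 0# < orient o a q → FanTriangle
  fan-scan a [] sub ne h = ⊥-elim (<-irrefl refl (<-≤-trans h (subst (_≤ 0#) (sym (trans (orient-rotate o a q) (orient-swap a o q))) (QP.neg-antimono-≤ (left hq (sub ∈0))))))
  fan-scan a (b ∷ xs) sub ne h with orient o b q ≤? 0#
  ... | yes l = fan-here a b (sub ∈0) (ne ∈0) (ne ∈1) (<⇒≤ h) l
  ... | no l = fan-scan b xs (λ m → sub (there m)) (λ m → ne (there m)) (≰⇒> l)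

 fan : ∀ {P q} → ConvexCCW P → HIn P q → ∃[ o ] (o ∈ P × ∃[ a ] ∃[ b ] (a ∈ P × b ∈ P × 0# < orient o a b × 0# ≤ orient o a q × orient o b q ≤ 0# × 0# ≤ orient a b q))
 fan {[]} (() , _) h
 fan {_ ∷ []} (N.s≤s () , _) h
 fan {_ ∷ _ ∷ []} (N.s≤s (N.s≤s ()) , _) h
 fan {o ∷ a ∷ b ∷ xs} {q} cv@(_ , un AP.∷ _ , _) h with orient o b q ≤? 0#
 ... | yes l = o , here refl , fan-here {o ∷ a ∷ b ∷ xs} {q} o h (strictly-left cv) ∈0 a b ∈1 (All.lookup un ∈0) (All.lookup un ∈1) (left h ∈0) l
 ... | no l = o , here refl , fan-scan {o ∷ a ∷ b ∷ xs} {q} o h (strictly-left cv) ∈0 b xs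
  (λ m → there (there (subst (_ ∈_) (sym (edgesFrom≡pathE o b xs)) m))) (λ m → All.lookup un (there m)) (≰⇒> l)

 -- The barycentric coordinates of `q` in the fan triangle that contains it are nonnegative; they
 -- are the weights.
 HIn⇒InConv : ∀ {P q} → ConvexCCW P → HIn P q → InConv P q
 HIn⇒InConv {P} {q} cv h with fan cv h
 ... | o , o∈ , a , b , a∈ , b∈ , D , h1 , h2 , h3 with recip (orient o a b) D
 ... | i , i>0 , e = Conic⇒InConv P (subst₂ (Conic P) weq qeq (Conic-scale P i (<⇒≤ i>0)
    (Conic-add P (Conic-scale P (orient a b q) h3 (Conic-vertex o∈))
     (Conic-add P (Conic-scale P (- orient o b q) (QP.neg-antimono-≤ h2) (Conic-vertex a∈)) (Conic-scale P (orient o a q) h1 (Conic-vertex b∈)))))) where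
  weq : i * (orient a b q * 1# + (- orient o b q * 1# + orient o a q * 1#)) ≡ 1#
  weq = trans (id20 i (orient a b q) (orient o b q) (orient o a q)) (trans (cong (_* i) (orient-split o a b q)) e)
  qeq : i · ((orient a b q · o) ⊕ (((- orient o b q) · a) ⊕ (orient o a q · b))) ≡ q
  qeq = trans (cong (i ·_) (orient-bary o a b q)) (cong₂ _,_
   (trans (id21 i (orient o a b) (fst q)) (trans (cong (_* fst q) e) (QP.*-identityˡ _)))
   (trans (id21 i (orient o a b) (snd q)) (trans (cong (_* snd q) e) (QP.*-identityˡ _))))

 -- Estimates made at the vertices become lines that bound the whole polygon; every bounding line
 -- below is obtained in this way or from an edge.
 HIn-affine : ∀ {P q} → ConvexCCW P → ∀ α β γ → (∀ {v} → v ∈ P → 0# ≤ affine α β γ v) → HIn P q → 0# ≤ affine α β γ q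
 HIn-affine {P} cv α β γ h hq = InConv-affine α β γ P h (HIn⇒InConv cv hq)

 edge-split : ∀ (P : List Point) q (es : List (Point × Point)) →
  (∀ {a b} → (a , b) ∈ es → 0# < orient a b q) ⊎ ∃[ a ] ∃[ b ] ((a , b) ∈ es × orient a b q ≤ 0#)
 edge-split P q [] = inj₁ λ ()
 edge-split P q ((a , b) ∷ es) with 0# <? orient a b q
 ... | no ¬h = inj₂ (a , b , here refl , ≮⇒≥ ¬h)
 ... | yes h with edge-split P q es
 ...   | inj₂ (a' , b' , m , h') = inj₂ (a' , b' , there m , h')
 ...   | inj₁ f = inj₁ λ { ∈0 → h ; (there m) → f m }

 HInt? : ∀ P q → HInt P q ⊎ ∃[ a ] ∃[ b ] ((a , b) ∈ edges P × orient a b q ≤ 0#)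
 HInt? P q with edge-split P q (edges P)
 ... | inj₁ f = inj₁ (hint f)
 ... | inj₂ x = inj₂ x

 edge-split≤ : ∀ q (es : List (Point × Point)) →
  (∀ {a b} → (a , b) ∈ es → 0# ≤ orient a b q) ⊎ ∃[ a ] ∃[ b ] ((a , b) ∈ es × orient a b q < 0#)
 edge-split≤ q [] = inj₁ λ ()
 edge-split≤ q ((a , b) ∷ es) with 0# ≤? orient a b q
 ... | no ¬h = inj₂ (a , b , here refl , ≰⇒> ¬h)
 ... | yes h with edge-split≤ q es
 ...   | inj₂ (a' , b' , m , h') = inj₂ (a' , b' , there m , h')
 ...   | inj₁ f = inj₁ λ { ∈0 → h ; (there m) → f m }

 HIn? : ∀ P q → HIn P q ⊎ ¬ HIn P q
 HIn? P q with edge-split≤ q (edges P)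
 ... | inj₁ f = inj₁ (hin f)
 ... | inj₂ (a , b , m , h) = inj₂ λ g → <-irrefl refl (<-≤-trans h (left g m))

 third-vertex : ∀ {P} → ConvexCCW P → ∀ a b → ∃[ v ] (v ∈ P × v ≢ a × v ≢ b)
 third-vertex {[]} (() , _)
 third-vertex {_ ∷ []} (N.s≤s () , _)
 third-vertex {_ ∷ _ ∷ []} (N.s≤s (N.s≤s ()) , _)
 third-vertex {x ∷ y ∷ z ∷ P} (_ , (xy All.∷ xz All.∷ _) AP.∷ (yz All.∷ _) AP.∷ _ , _) a b with x ≟ₚ a | x ≟ₚ b | y ≟ₚ a | y ≟ₚ b
 ... | no p | no q | _ | _ = x , here refl , p , q
 ... | yes p | _ | _ | no r = y , there ∈0 , (λ e → xy (trans p (sym e))) , r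
 ... | yes p | _ | _ | yes r = z , there ∈1 , (λ e → xz (trans p (sym e))) , (λ e → yz (trans r (sym e)))
 ... | no _ | yes q | no r | _ = y , there ∈0 , r , (λ e → xy (trans q (sym e)))
 ... | no _ | yes q | yes r | _ = z , there ∈1 , (λ e → yz (trans r (sym e))) , (λ e → xz (trans q (sym e)))

 edge-nondegenerate : ∀ {P} → ConvexCCW P → ∀ {a b} → (a , b) ∈ edges P → ∃[ v ] (v ∈ P × 0# < orient a b v)
 edge-nondegenerate cv {a} {b} m with third-vertex cv a b
 ... | v , v∈ , n1 , n2 = v , v∈ , strictly-left cv m v∈ n1 n2

 no-2-cycle : ∀ {P} → ConvexCCW P → ∀ {a b} → (a , b) ∈ edges P → ¬ (b , a) ∈ edges P
 no-2-cycle cv {a} {b} m n with third-vertex cv a b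
 ... | v , v∈ , n1 , n2 = absurd-by (<⇒≤ (strictly-left cv m v∈ n1 n2)) (strictly-left cv n v∈ n2 n1) (lem a b v) where
  lem : ∀ a b v → orient a b v + orient b a v ≡ 0#
  lem (a1 , a2) (b1 , b2) (x , y) = id22 a1 a2 b1 b2 x y

 orient-shift : ∀ a b x y s t → orient a b (x + s , y + t) ≡ orient a b (x , y) + ((fst b - fst a) * t - (snd b - snd a) * s)
 orient-shift (a1 , a2) (b1 , b2) x y s t = id23 a1 a2 b1 b2 x y s t

 ∣∣-≤ : ∀ {p e} → p ≤ e → - p ≤ e → ∣ p ∣ ≤ e
 ∣∣-≤ {p} h1 h2 with QP.∣p∣≡p∨∣p∣≡-p p
 ... | inj₁ e = subst (_≤ _) (sym e) h1
 ... | inj₂ e = subst (_≤ _) (sym e) h2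

 p≤∣p∣ : ∀ p → p ≤ ∣ p ∣
 p≤∣p∣ p with ≤-total 0# p
 ... | inj₁ h = ≤-reflexive (sym (QP.0≤p⇒∣p∣≡p h))
 ... | inj₂ h = ≤-trans h (QP.0≤∣p∣ p)

 -p≤∣p∣ : ∀ p → - p ≤ ∣ p ∣
 -p≤∣p∣ p = subst (- p ≤_) (QP.∣-p∣≡∣p∣ p) (p≤∣p∣ (- p))

 Interior⇒box : ∀ {P x y} (i : Interior P (x , y)) → ConvexCCW P → ∀ s t → - fst i ≤ s → s ≤ fst i → - fst i ≤ t → t ≤ fst i → HIn P (x + s , y + t)
 Interior⇒box {P} {x} {y} (ε , ε>0 , f) cv s t h1 h2 h3 h4 = InConv⇒HIn cv (f (x + s , y + t)
  (subst (λ z → ∣ z ∣ ≤ ε) (sym (shift-sub x s)) (∣∣-≤ h2 (subst (- s ≤_) (neg-neg ε) (QP.neg-antimono-≤ h1))))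
  (subst (λ z → ∣ z ∣ ≤ ε) (sym (shift-sub y t)) (∣∣-≤ h4 (subst (- t ≤_) (neg-neg ε) (QP.neg-antimono-≤ h3)))))

 -- If the point were not strictly left of an edge, moving it by ε in each of the four axis
 -- directions would still have to give a nonnegative orientation. This forces both components of
 -- the edge vector to be 0, against nondegeneracy.
 Interior⇒HInt : ∀ {P z} → ConvexCCW P → Interior P z → HInt P z
 Interior⇒HInt {P} {x , y} cv i@(ε , ε>0 , f) = hint go where
  nε≤ε : - ε ≤ ε
  nε≤ε = ≤-trans (QP.neg-antimono-≤ (<⇒≤ ε>0)) (<⇒≤ ε>0)
  nε≤0 : - ε ≤ 0#
  nε≤0 = QP.neg-antimono-≤ (<⇒≤ ε>0)
  zero-by : ∀ {w} → ε * w ≤ 0# → - (ε * w) ≤ 0# → w ≡ 0#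
  zero-by {w} h1 h2 = ≡0-cancel ε>0 (≤-antisym h1 (subst (0# ≤_) (neg-neg (ε * w)) (QP.neg-antimono-≤ h2)))
  go : ∀ {a b} → (a , b) ∈ edges P → 0# < orient a b (x , y)
  go {a} {b} m with 0# <? orient a b (x , y)
  ... | yes h = h
  ... | no ¬h with edge-nondegenerate cv m
  ...   | v , _ , v>0 = ⊥-elim (<-irrefl (sym flat) v>0) where
   L≤0 : orient a b (x , y) ≤ 0#
   L≤0 = ≮⇒≥ ¬h
   L = orient a b (x , y)
   dx = fst b - fst a
   dy = snd b - snd a
   box : ∀ s t → - ε ≤ s → s ≤ ε → - ε ≤ t → t ≤ ε → 0# ≤ L + (dx * t - dy * s)
   box s t h1 h2 h3 h4 = subst (0# ≤_) (orient-shift a b x y s t) (left (Interior⇒box i cv s t h1 h2 h3 h4) m)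
   nonpos : ∀ {z w} → 0# ≤ z → w ≡ - z + L → w ≤ 0#
   nonpos h e = subst (_≤ 0#) (sym e) (QP.+-mono-≤ (QP.neg-antimono-≤ h) L≤0)
   dy0 : dy ≡ 0#
   dy0 = zero-by (nonpos (box ε 0# nε≤ε ≤-refl nε≤0 (<⇒≤ ε>0)) (id25 L dx dy ε)) (nonpos (box (- ε) 0# ≤-refl nε≤ε nε≤0 (<⇒≤ ε>0)) (id26 L dx dy ε))
   dx0 : dx ≡ 0#
   dx0 = zero-by (nonpos (box 0# (- ε) nε≤0 (<⇒≤ ε>0) ≤-refl nε≤ε) (id27 L dx dy ε)) (nonpos (box 0# ε nε≤0 (<⇒≤ ε>0) nε≤ε ≤-refl) (id28 L dx dy ε))
   flat : orient a b v ≡ 0#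
   flat = trans (cong₂ (λ p q → p * (snd v - snd a) - q * (fst v - fst a)) dx0 dy0) (id29 (snd v - snd a) (fst v - fst a))

 -- A displacement of at most δ in each coordinate changes the orientation by at most δ times the
 -- sum of the absolute values of the edge components. So `L * r`, with `r` the reciprocal of that
 -- sum plus 1, is a safe radius for one edge, and the minimum over all edges is taken.
 box-radius : ∀ x y (es : List (Point × Point)) → (∀ {a b} → (a , b) ∈ es → 0# < orient a b (x , y)) →
  ∃[ ε ] (0# < ε × (∀ q → ∣ fst q - x ∣ ≤ ε → ∣ snd q - y ∣ ≤ ε → ∀ {a b} → (a , b) ∈ es → 0# ≤ orient a b q))
 box-radius x y [] h = 1# , <-lit 0# 1# , λ _ _ _ ()
 box-radius x y ((a , b) ∷ es) h with box-radius x y es (λ m → h (there m)) | recip (∣ fst b - fst a ∣ + ∣ snd b - snd a ∣ + 1#) ((QP.0≤∣p∣ (fst b - fst a) ⊞ QP.0≤∣p∣ (snd b - snd a)) ⊞≤< <-lit 0# 1#)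
 ... | ε , ε>0 , f | r , r>0 , re = ε ℚ.⊓ (L * r) , min>0 , g where
  dx = fst b - fst a
  dy = snd b - snd a
  L = orient a b (x , y)
  min>0 : 0# < ε ℚ.⊓ (L * r)
  min>0 with ≤-total ε (L * r)
  ... | inj₁ le = subst (0# <_) (sym (QP.p≤q⇒p⊓q≡p le)) ε>0
  ... | inj₂ ge = subst (0# <_) (sym (QP.p≥q⇒p⊓q≡q ge)) (h ∈0 ⊠< r>0)
  prod : ∀ u s w → ∣ s ∣ ≤ w → 0# ≤ ∣ u ∣ * w - u * s
  prod u s w hs = diff≥ (≤-trans (p≤∣p∣ (u * s)) (subst (_≤ ∣ u ∣ * w) (sym (QP.∣p*q∣≡∣p∣*∣q∣ u s)) (QP.*-monoˡ-≤-nonNeg ∣ u ∣ {{QP.∣-∣-nonNeg u}} hs)))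
  prod' : ∀ u s w → ∣ s ∣ ≤ w → 0# ≤ u * s + ∣ u ∣ * w
  prod' u s w hs = subst (0# ≤_) (id30 ∣ u ∣ u s w) (prod u (- s) w (subst (_≤ w) (sym (QP.∣-p∣≡∣p∣ s)) hs))
  zero-part : L * (1# - (∣ dx ∣ + ∣ dy ∣ + 1#) * r) ≡ 0#
  zero-part = trans (cong (λ z → L * (1# - z)) re) (QP.*-zeroʳ L)
  g : ∀ q → ∣ fst q - x ∣ ≤ ε ℚ.⊓ (L * r) → ∣ snd q - y ∣ ≤ ε ℚ.⊓ (L * r) → ∀ {a' b'} → (a' , b') ∈ (a , b) ∷ es → 0# ≤ orient a' b' q
  g q h1 h2 (there m) = f q (≤-trans h1 (QP.p⊓q≤p ε (L * r))) (≤-trans h2 (QP.p⊓q≤p ε (L * r))) m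
  g (q1 , q2) h1 h2 ∈0 = subst (0# ≤_) (sym eq)
   ((((prod dy s w h1 ⊞ prod' dx t w h2) ⊞ (diff≥ (QP.p⊓q≤q ε (L * r)) ⊠ (QP.0≤∣p∣ dx ⊞ QP.0≤∣p∣ dy))) ⊞ ≤-reflexive (sym zero-part)) ⊞ <⇒≤ (h ∈0 ⊠< r>0)) where
   s = q1 - x
   t = q2 - y
   w = ε ℚ.⊓ (L * r)
   eq : orient a b (q1 , q2) ≡ _
   eq = trans (cong₂ (λ p q → orient a b (p , q)) (sym (id31 x q1)) (sym (id31 y q2))) (trans (orient-shift a b x y s t) (rearr L r ∣ dx ∣ ∣ dy ∣ s t dx dy w))

 HInt⇒Interior : ∀ {P z} → ConvexCCW P → HInt P z → Interior P z
 HInt⇒Interior {P} {x , y} cv h with box-radius x y (edges P) (left< h)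
 ... | ε , ε>0 , f = ε , ε>0 , λ q h1 h2 → HIn⇒InConv cv (hin (f q h1 h2))

 unique-⊆-length : ∀ {A : Set} {xs ys : List A} → Unique xs → (∀ {x} → x ∈ xs → x ∈ ys) → length xs N.≤ length ys
 unique-⊆-length {xs = []} _ _ = N.z≤n
 unique-⊆-length {xs = x ∷ xs} (u AP.∷ us) sub with ∈P.∈-∃++ (sub ∈0)
 ... | as , bs , refl = subst (suc (length xs) N.≤_) (sym eq) (N.s≤s (unique-⊆-length us sub')) where
  eq : length (as ++ x ∷ bs) ≡ suc (length (as ++ bs))
  eq = trans (LP.length-++ as) (trans (NP.+-suc (length as) (length bs)) (cong suc (sym (LP.length-++ as))))
  sub' : ∀ {y} → y ∈ xs → y ∈ as ++ bs
  sub' {y} m with ∈P.∈-++⁻ as (sub (there m))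
  ... | inj₁ n = ∈P.∈-++⁺ˡ n
  ... | inj₂ ∈0 = ⊥-elim (All.lookup u m refl)
  ... | inj₂ (there n) = ∈P.∈-++⁺ʳ as n

 -- Area as the integral of x dy along the boundary.

 area2 : List Point → ℚ
 area2 P = sum (map (λ e → cross (fst e) (snd e)) (edges P))

 -- Twice the integral of x dy along the segment.
 trap : Point → Point → ℚ
 trap (x1 , y1) (x2 , y2) = (x1 + x2) * (y2 - y1)

 -- Twice the integral of x dy along a broken line.
 trapSum : Point → List Point → Point → ℚ
 trapSum p [] q = trap p q
 trapSum p (x ∷ xs) q = trap p x + trapSum x xs q

 crossSum : List (Point × Point) → ℚ
 crossSum es = sum (map (λ e → cross (fst e) (snd e)) es)

 crossSum-++ : ∀ es fs → crossSum (es ++ fs) ≡ crossSum es + crossSum fs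
 crossSum-++ [] fs = sym (QP.+-identityˡ _)
 crossSum-++ (e ∷ es) fs = trans (cong (λ z → cross (fst e) (snd e) + z) (crossSum-++ es fs)) (sym (QP.+-assoc (cross (fst e) (snd e)) (crossSum es) (crossSum fs)))

 -- The shoelace term of an edge differs from `trap` by a difference of the products of coordinates
 -- at its ends; these differences telescope and vanish for a closed path.
 crossSum-path : ∀ p xs q → crossSum (pathE p xs q) ≡ trapSum p xs q + (fst p * snd p - fst q * snd q)
 crossSum-path (p1 , p2) [] (q1 , q2) = id32 p1 p2 q1 q2
 crossSum-path (p1 , p2) ((x , y) ∷ xs) (q1 , q2) = trans (cong (λ z → (p1 * y - p2 * x) + z) (crossSum-path (x , y) xs (q1 , q2))) (id33 p1 p2 q1 q2 x y (trapSum (x , y) xs (q1 , q2)))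

 crossSum-closed : ∀ p xs → crossSum (pathE p xs p) ≡ trapSum p xs p
 crossSum-closed p xs = trans (crossSum-path p xs p) (id34 (trapSum p xs p) (fst p * snd p))

 pathE-++ : ∀ p xs m ys q → pathE p (xs ++ m ∷ ys) q ≡ pathE p xs m ++ pathE m ys q
 pathE-++ p [] m ys q = refl
 pathE-++ p (x ∷ xs) m ys q = cong ((p , x) ∷_) (pathE-++ x xs m ys q)

 record Rotation (P : List Point) (m : Point) : Set where
  field
   rest : List Point
   rest⊆ : ∀ {v} → v ∈ rest → v ∈ P
   fresh : ∀ {v} → v ∈ rest → v ≢ m
   edges⊆ : ∀ {e} → e ∈ pathE m rest m → e ∈ edges P
   area≡ : area2 P ≡ trapSum m rest m

 rotate : ∀ {P m} → Unique P → m ∈ P → Rotation P m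
 rotate {p ∷ ps} (u AP.∷ us) ∈0 = record
  { rest = ps ; rest⊆ = there ; fresh = λ n e → All.lookup u n (sym e)
  ; edges⊆ = subst (_ ∈_) (sym (edges≡pathE p ps))
  ; area≡ = trans (cong crossSum (edges≡pathE p ps)) (crossSum-closed p ps) }
 rotate {p ∷ ps} {m} (u AP.∷ us) (there n) with ∈P.∈-∃++ n
 ... | xs , ys , refl = record
  { rest = ys ++ p ∷ xs
  ; rest⊆ = λ k → [ (λ k → there (∈P.∈-++⁺ʳ xs (there k))) , (λ { (here e) → here e ; (there k) → there (∈P.∈-++⁺ˡ k) }) ]′ (∈P.∈-++⁻ ys k)
  ; fresh = λ k → [ (λ k e → All.lookup (uhead xs us) k (sym e)) , (λ { ∈0 e → All.lookup u (∈P.∈-++⁺ʳ xs ∈0) e ; (there k) e → ufront xs us k e }) ]′ (∈P.∈-++⁻ ys k)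
  ; edges⊆ = λ {e} k → subst (e ∈_) (sym eqP) ([ ∈P.∈-++⁺ʳ (pathE p xs m) , ∈P.∈-++⁺ˡ ]′ (∈P.∈-++⁻ (pathE m ys p) (subst (e ∈_) (pathE-++ m ys p xs m) k)))
  ; area≡ = trans (cong crossSum eqP) (trans (crossSum-++ (pathE p xs m) (pathE m ys p)) (trans (QP.+-comm (crossSum (pathE p xs m)) _)
    (trans (sym (crossSum-++ (pathE m ys p) (pathE p xs m))) (trans (cong crossSum (sym (pathE-++ m ys p xs m))) (crossSum-closed m (ys ++ p ∷ xs)))))) } where
  eqP : edges (p ∷ xs ++ m ∷ ys) ≡ pathE p xs m ++ pathE m ys p
  eqP = trans (edges≡pathE p (xs ++ m ∷ ys)) (pathE-++ p xs m ys p)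
  uhead : ∀ xs → Unique (xs ++ m ∷ ys) → All (m ≢_) ys
  uhead [] (u AP.∷ _) = u
  uhead (x ∷ xs) (_ AP.∷ us) = uhead xs us
  ufront : ∀ xs → Unique (xs ++ m ∷ ys) → ∀ {v} → v ∈ xs → v ≢ m
  ufront (x ∷ xs) (u AP.∷ us) ∈0 e = All.lookup u (∈P.∈-++⁺ʳ xs ∈0) e
  ufront (x ∷ xs) (_ AP.∷ us) (there k) e = ufront xs us k e

 -- Functions Φ, Ψ dominating twice the integral of x dy along any segment of the polygon
 -- between the levels c and d, from above on the right boundary and from below on the left one.
 record AreaBound (P : List Point) (c d M : ℚ) : Set where
  field
   Φ Ψ : ℚ → ℚ
   upper : ∀ p q → HIn P p → HIn P q → c ≤ snd p → snd p ≤ snd q → snd q ≤ d → trap p q ≤ Φ (snd q) - Φ (snd p)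
   lower : ∀ p q → HIn P p → HIn P q → c ≤ snd p → snd p ≤ snd q → snd q ≤ d → Ψ (snd q) - Ψ (snd p) ≤ trap p q
   total : (Φ d - Φ c) - (Ψ d - Ψ c) ≤ M

 weaken : ∀ {P c d M M'} → M ≤ M' → AreaBound P c d M → AreaBound P c d M'
 weaken h A = record { Φ = Φ ; Ψ = Ψ ; upper = upper ; lower = lower ; total = ≤-trans total h }
  where open AreaBound A

 -- Among the lowest vertices the rightmost is chosen: a counterclockwise walk from it first rises,
 -- then descends, and a horizontal bottom edge comes last.
 LexMin : List Point → Point → Set
 LexMin P m = ∀ {v} → v ∈ P → snd m < snd v ⊎ (snd m ≡ snd v × fst v ≤ fst m)

 lexMin : ∀ p ps → ∃[ m ] (m ∈ p ∷ ps × LexMin (p ∷ ps) m)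
 lexMin p [] = p , here refl , λ { ∈0 → inj₂ (refl , ≤-refl) }
 lexMin p (x ∷ ps) with lexMin x ps
 ... | m , m∈ , f with QP.<-cmp (snd m) (snd p)
 ...   | tri< lt _ _ = m , there m∈ , λ { ∈0 → inj₁ lt ; (there n) → f n }
 ...   | tri> _ _ gt = p , here refl , λ { ∈0 → inj₂ (refl , ≤-refl) ; (there n) → inj₁ ([ (λ l → <-trans gt l) , (λ { (e , _) → subst (snd p <_) e gt }) ]′ (f n)) }
 ...   | tri≈ _ eq _ with ≤-total (fst p) (fst m)
 ...     | inj₁ le = m , there m∈ , λ { ∈0 → inj₂ (eq , le) ; (there n) → f n }
 ...     | inj₂ ge = p , here refl , λ { ∈0 → inj₂ (refl , ≤-refl) ; (there n) → [ (λ l → inj₁ (subst (_< _) eq l)) , (λ { (e , l) → inj₂ (trans (sym eq) e , ≤-trans l ge) }) ]′ (f n) }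

 trap-swap : ∀ p q → trap q p ≡ - trap p q
 trap-swap (a , b) (c , d) = id35 a b c d

 module AreaProof {P : List Point} (cv : ConvexCCW P) (m top : Point) (m∈ : m ∈ P) (lex : LexMin P m)
          (top∈ : top ∈ P) (top-max : ∀ {v} → v ∈ P → snd v ≤ snd top)
          {M : ℚ} (A : AreaBound P (snd m) (snd top) M) where
  open AreaBound A

  min-level : ∀ {v} → v ∈ P → snd m ≤ snd v
  min-level n with lex n
  ... | inj₁ l = <⇒≤ l
  ... | inj₂ (e , _) = ≤-reflexive e

  up-edge : ∀ {u x} → u ∈ P → x ∈ P → snd u ≤ snd x → trap u x ≤ Φ (snd x) - Φ (snd u)
  up-edge u∈ x∈ h = upper _ _ (vertex-HIn cv u∈) (vertex-HIn cv x∈) (min-level u∈) h (top-max x∈)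

  down-edge : ∀ {u x} → u ∈ P → x ∈ P → snd x ≤ snd u → trap u x ≤ Ψ (snd x) - Ψ (snd u)
  down-edge {u} {x} u∈ x∈ h = subst₂ _≤_ (sym (trap-swap x u)) (neg-sub (Ψ (snd u)) (Ψ (snd x)))
   (QP.neg-antimono-≤ (lower _ _ (vertex-HIn cv x∈) (vertex-HIn cv u∈) (min-level x∈) h (top-max u∈)))

  -- A vertex entered downwards and left upwards is a lowest one; since m is the rightmost lowest vertex, it is m.
  no-local-min : ∀ {t u x} → (t , u) ∈ edges P → (u , x) ∈ edges P → snd u ≤ snd t → snd u < snd x → u ≡ m
  no-local-min {t} {u} {x} tu ux h1 h2 = done (lex u∈) where
   u∈ : u ∈ P
   u∈ = edge-fst P ux
   D>0 : 0# < orient t u x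
   D>0 = strictly-left cv tu (edge-snd P ux) (λ { refl → no-2-cycle cv tu ux }) (λ { refl → <-irrefl refl h2 })
   α≥0 : 0# ≤ orient t u m
   α≥0 = left (vertex-HIn cv m∈) tu
   γ≥0 : 0# ≤ orient u x m
   γ≥0 = left (vertex-HIn cv m∈) ux
   above : 0# ≤ snd m - snd u
   above = 0≤-cancel D>0 (subst (0# ≤_) (sym (id36 (fst t) (snd t) (fst u) (snd u) (fst x) (snd x) (fst m) (snd m))) ((γ≥0 ⊠ diff≥ h1) ⊞ (α≥0 ⊠ diff≥ (<⇒≤ h2))))
   done : snd m < snd u ⊎ (snd m ≡ snd u × fst u ≤ fst m) → u ≡ m
   done (inj₁ l) = absurd-by above (diff> l) (neg-diff (snd m) (snd u))
   done (inj₂ (e , le)) = cong₂ _,_ (≤-antisym le (≤-by {c = fst u - fst m} (0≤-cancel (diff> h2') (subst (0# ≤_) (id37 (fst u) (fst x) (snd x) (fst m) (snd m)) γ')) refl)) (sym e) where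
    h2' : snd m < snd x
    h2' = subst (_< snd x) (sym e) h2
    γ' : 0# ≤ (fst x - fst u) * (snd m - snd m) - (snd x - snd m) * (fst m - fst u)
    γ' = subst (λ z → 0# ≤ (fst x - fst u) * (snd m - z) - (snd x - z) * (fst m - fst u)) (sym e) γ≥0

  -- Once the walk has gone down it cannot rise before it is back at `m`, by `no-local-min`, so all
  -- remaining edges are bounded through Ψ alone.
  down-phase : ∀ t u zs → (t , u) ∈ edges P → snd u ≤ snd t → (∀ {e} → e ∈ pathE u zs m → e ∈ edges P) →
   (∀ {v} → v ∈ u ∷ zs → v ≢ m) → trapSum u zs m ≤ Ψ (snd m) - Ψ (snd u)
  down-phase t u [] tu h sub fr = down-edge (edge-snd P tu) m∈ (min-level (edge-snd P tu))
  down-phase t u (x ∷ zs) tu h sub fr with snd x ≤? snd u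
  ... | yes l = subst (_ ≤_) (add-diff (Ψ (snd u)) (Ψ (snd x)) (Ψ (snd m)))
     (QP.+-mono-≤ (down-edge (edge-snd P tu) (edge-snd P ux) l) (down-phase u x zs ux l (λ k → sub (there k)) (λ k → fr (there k)))) where
   ux : (u , x) ∈ edges P
   ux = sub ∈0
  ... | no ¬l = ⊥-elim (fr ∈0 (no-local-min tu (sub ∈0) h (≰⇒> ¬l)))

  Θ : ℚ → ℚ
  Θ y = Φ y - Ψ y

  -- The segment from `u` to `top` lies in the polygon and its `trap` is squeezed between the
  -- increments of Ψ and Φ. This pays for turning from Φ to Ψ at a vertex below the top.
  Θ-mono : ∀ {u} → u ∈ P → Θ (snd u) ≤ Θ (snd top)
  Θ-mono {u} u∈ = ≤-by (diff≥ (≤-trans (lower _ _ hu ht (min-level u∈) (top-max u∈) ≤-refl) (upper _ _ hu ht (min-level u∈) (top-max u∈) ≤-refl)))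
    (id38 (Φ (snd u)) (Ψ (snd u)) (Φ (snd top)) (Ψ (snd top))) where
   hu = vertex-HIn cv u∈
   ht = vertex-HIn cv top∈

  turn : ∀ {u s} → u ∈ P → s ≤ Ψ (snd m) - Ψ (snd u) → s ≤ Θ (snd top) - Φ (snd u) + Ψ (snd m)
  turn {u} u∈ h = ≤-trans h (≤-by (diff≥ (Θ-mono u∈)) (id39 (Θ (snd top)) (Φ (snd u)) (Ψ (snd u)) (Ψ (snd m))))

  up-phase : ∀ u zs → u ∈ P → (∀ {e} → e ∈ pathE u zs m → e ∈ edges P) → (∀ {v} → v ∈ zs → v ≢ m) →
   trapSum u zs m ≤ Θ (snd top) - Φ (snd u) + Ψ (snd m)
  up-phase u [] u∈ sub fr = turn u∈ (down-edge u∈ m∈ (min-level u∈))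
  up-phase u (x ∷ zs) u∈ sub fr with snd u ≤? snd x
  ... | yes l = subst (_ ≤_) (id40 (Θ (snd top)) (Φ (snd u)) (Φ (snd x)) (Ψ (snd m)))
     (QP.+-mono-≤ (up-edge u∈ (edge-snd P (sub ∈0)) l) (up-phase x zs (edge-snd P (sub ∈0)) (λ k → sub (there k)) (λ k → fr (there k))))
  ... | no ¬l = turn u∈ (subst (_ ≤_) (add-diff (Ψ (snd u)) (Ψ (snd x)) (Ψ (snd m)))
     (QP.+-mono-≤ (down-edge u∈ (edge-snd P (sub ∈0)) (<⇒≤ (≰⇒> ¬l)))
      (down-phase u x zs (sub ∈0) (<⇒≤ (≰⇒> ¬l)) (λ k → sub (there k)) fr)))

  area-bound : area2 P ≤ M
  area-bound = ≤-trans (subst (_≤ _) (sym area≡) (up-phase m rest m∈ edges⊆ fresh)) (subst (_≤ M) (id41 (Φ (snd top)) (Ψ (snd top)) (Φ (snd m)) (Ψ (snd m))) total) where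
   open Rotation (rotate (fst (snd cv)) m∈)

 record Levels (P : List Point) (B T : ℚ) : Set where
  field
   bot top : Point
   bot∈ : bot ∈ P
   top∈ : top ∈ P
   bot≡ : snd bot ≡ B
   top≡ : snd top ≡ T
   ≥bot : ∀ {v} → v ∈ P → B ≤ snd v
   ≤top : ∀ {v} → v ∈ P → snd v ≤ T

 area≤ : ∀ {P B T M} → ConvexCCW P → Levels P B T → AreaBound P B T M → area2 P ≤ M
 area≤ {[]} (() , _) L A
 area≤ {p ∷ ps} {B} {T} {M} cv L A with lexMin p ps
 ... | m , m∈ , lex = AreaProof.area-bound cv m top m∈ lex top∈ (λ n → subst (_ ≤_) (sym top≡) (≤top n))
   (subst₂ (λ b t → AreaBound (p ∷ ps) b t M) (≤-antisym (≥bot m∈) (subst (snd m ≤_) bot≡ ([ <⇒≤ , (λ z → ≤-reflexive (fst z)) ]′ (lex bot∈)))) (sym top≡) A)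
  where open Levels L

 levels : ∀ p ps → ∃[ B ] ∃[ T ] Levels (p ∷ ps) B T
 levels p [] = snd p , snd p , record { bot = p ; top = p ; bot∈ = here refl ; top∈ = here refl ; bot≡ = refl ; top≡ = refl
  ; ≥bot = λ { ∈0 → ≤-refl } ; ≤top = λ { ∈0 → ≤-refl } }
 levels p (x ∷ ps) with levels x ps
 ... | B , T , L = B' , T' , record { bot = fst lo ; top = fst hi ; bot∈ = fst (snd lo) ; top∈ = fst (snd hi) ; bot≡ = refl ; top≡ = refl
  ; ≥bot = snd (snd lo) ; ≤top = snd (snd hi) } where
  open Levels L
  lo : ∃[ b ] (b ∈ p ∷ x ∷ ps × (∀ {v} → v ∈ p ∷ x ∷ ps → snd b ≤ snd v))
  lo with ≤-total (snd p) B
  ... | inj₁ h = p , here refl , λ { ∈0 → ≤-refl ; (there n) → ≤-trans h (≥bot n) }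
  ... | inj₂ h = bot , there bot∈ , λ { ∈0 → subst (_≤ snd p) (sym bot≡) h ; (there n) → subst (_≤ _) (sym bot≡) (≥bot n) }
  hi : ∃[ b ] (b ∈ p ∷ x ∷ ps × (∀ {v} → v ∈ p ∷ x ∷ ps → snd v ≤ snd b))
  hi with ≤-total T (snd p)
  ... | inj₁ h = p , here refl , λ { ∈0 → ≤-refl ; (there n) → ≤-trans (≤top n) h }
  ... | inj₂ h = top , there top∈ , λ { ∈0 → subst (snd p ≤_) (sym top≡) h ; (there n) → subst (_ ≤_) (sym top≡) (≤top n) }
  B' = snd (fst lo)
  T' = snd (fst hi)

 -- The point of the segment pq at level d, where r is the inverse of the height difference.
 at-level : Point → Point → ℚ → ℚ → Point
 at-level p q d r = (((snd q - d) * r) · p) ⊕ (((d - snd p) * r) · q)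

 at-level-weights : ∀ (p q : Point) d r → (snd q - snd p) * r ≡ 1# → (snd q - d) * r + (d - snd p) * r ≡ 1#
 at-level-weights p q d r e = trans (id42 (snd p) (snd q) d r) e

 at-level-y : ∀ p q d r → (snd q - snd p) * r ≡ 1# → snd (at-level p q d r) ≡ d
 at-level-y p q d r e = trans (id43 (snd p) (snd q) d r) (trans (cong (_* d) e) (QP.*-identityˡ d))

 at-level-x : ∀ p q d r → (snd q - snd p) * r ≡ 1# → fst (at-level p q d r) * (snd q - snd p) ≡ (snd q - d) * fst p + (d - snd p) * fst q
 at-level-x p q d r e = trans (id44 (fst p) (snd p) (fst q) (snd q) d r) (trans (cong (_* ((snd q - d) * fst p + (d - snd p) * fst q)) e) (QP.*-identityˡ _))

 at-level-HIn : ∀ {P} p q d r → HIn P p → HIn P q → (snd q - snd p) * r ≡ 1# → 0# ≤ r → snd p ≤ d → d ≤ snd q → HIn P (at-level p q d r)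
 at-level-HIn {P} p q d r hp hq e r≥0 h1 h2 = HIn-convex P ((snd q - d) * r) ((d - snd p) * r) (diff≥ h2 ⊠ r≥0) (diff≥ h1 ⊠ r≥0) (at-level-weights p q d r e) hp hq

 -- The potentials of two adjacent strips are concatenated without a jump at `d`, and a segment
 -- crossing `d` is cut there, `trap` being additive over the cut.
 module Glue {P : List Point} {c d e M1 M2 : ℚ} (c≤d : c ≤ d) (d≤e : d ≤ e) (A1 : AreaBound P c d M1) (A2 : AreaBound P d e M2) where
  private
   module A1 = AreaBound A1
   module A2 = AreaBound A2

  join : (ℚ → ℚ) → (ℚ → ℚ) → ℚ → ℚ
  join f g y with y ≤? d
  ... | yes _ = f y
  ... | no _ = f d + (g y - g d)

  join-low : ∀ f g y → y ≤ d → join f g y ≡ f y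
  join-low f g y h with y ≤? d
  ... | yes _ = refl
  ... | no ¬h = ⊥-elim (¬h h)

  join-high : ∀ f g y → d ≤ y → join f g y ≡ f d + (g y - g d)
  join-high f g y h with y ≤? d
  ... | yes l = trans (cong f (≤-antisym l h)) (trans (id45 (f d) (g d)) (cong (λ z → f d + (g z - g d)) (≤-antisym h l)))
  ... | no _ = refl

  diff-high : ∀ f g y z → d ≤ y → d ≤ z → g z - g y ≡ join f g z - join f g y
  diff-high f g y z h1 h2 = sym (trans (cong₂ _-_ (join-high f g z h2) (join-high f g y h1)) (id46 (f d) (g d) (g y) (g z)))

  diff-low : ∀ f g y z → y ≤ d → z ≤ d → f z - f y ≡ join f g z - join f g y
  diff-low f g y z h1 h2 = sym (cong₂ _-_ (join-low f g z h2) (join-low f g y h1))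

  diff-mid : ∀ f g y z → y ≤ d → d ≤ z → (f d - f y) + (g z - g d) ≡ join f g z - join f g y
  diff-mid f g y z h1 h2 = sym (trans (cong₂ _-_ (join-high f g z h2) (join-low f g y h1)) (id47 (f d) (f y) (g z) (g d)))

  data Position (p q : Point) : Set where
   below : snd p ≤ d → snd q ≤ d → Position p q
   above : d ≤ snd p → d ≤ snd q → Position p q
   across : snd p ≤ d → d ≤ snd q → (w : Point) → HIn P w → snd w ≡ d → trap p w + trap w q ≡ trap p q → Position p q

  position : ∀ p q → HIn P p → HIn P q → snd p ≤ snd q → Position p q
  position p q hp hq h with snd q ≤? d | d ≤? snd p
  ... | yes l | _ = below (≤-trans h l) l
  ... | no _ | yes g = above g (≤-trans g h)
  ... | no q>d | no p<d with recip (snd q - snd p) (diff> (<-trans (≰⇒> p<d) (≰⇒> q>d)))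
  ...   | r , r>0 , re = across (<⇒≤ (≰⇒> p<d)) (<⇒≤ (≰⇒> q>d)) w (at-level-HIn p q d r hp hq re (<⇒≤ r>0) (<⇒≤ (≰⇒> p<d)) (<⇒≤ (≰⇒> q>d))) (at-level-y p q d r re)
    (trans (cong (λ z → (fst p + fst w) * (z - snd p) + (fst w + fst q) * (snd q - z)) (at-level-y p q d r re))
     (trans (id48 (fst p) (snd p) (fst q) (snd q) d (fst w)) (trans (cong (λ z → fst p * (d - snd p) + fst q * (snd q - d) + z) (at-level-x p q d r re)) (id49 (fst p) (snd p) (fst q) (snd q) d)))) where
   w = at-level p q d r

  glue : AreaBound P c e (M1 + M2)
  glue = record
   { Φ = join A1.Φ A2.Φ ; Ψ = join A1.Ψ A2.Ψ
   ; upper = up ; lower = lo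
   ; total = ≤-trans (≤-reflexive (trans (cong₂ _-_ (sym (diff-mid A1.Φ A2.Φ c e c≤d d≤e)) (sym (diff-mid A1.Ψ A2.Ψ c e c≤d d≤e)))
     (id50 (A1.Φ d - A1.Φ c) (A2.Φ e - A2.Φ d) (A1.Ψ d - A1.Ψ c) (A2.Ψ e - A2.Ψ d)))) (QP.+-mono-≤ A1.total A2.total) } where
   up : ∀ p q → HIn P p → HIn P q → c ≤ snd p → snd p ≤ snd q → snd q ≤ e → trap p q ≤ join A1.Φ A2.Φ (snd q) - join A1.Φ A2.Φ (snd p)
   up p q hp hq h1 h2 h3 with position p q hp hq h2
   ... | below a b = subst (trap p q ≤_) (diff-low A1.Φ A2.Φ (snd p) (snd q) a b) (A1.upper p q hp hq h1 h2 b)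
   ... | above a b = subst (trap p q ≤_) (diff-high A1.Φ A2.Φ (snd p) (snd q) a b) (A2.upper p q hp hq a h2 h3)
   ... | across a b w hw refl eq = subst₂ _≤_ eq (diff-mid A1.Φ A2.Φ (snd p) (snd q) a b) (QP.+-mono-≤ (A1.upper p w hp hw h1 a ≤-refl) (A2.upper w q hw hq ≤-refl b h3))
   lo : ∀ p q → HIn P p → HIn P q → c ≤ snd p → snd p ≤ snd q → snd q ≤ e → join A1.Ψ A2.Ψ (snd q) - join A1.Ψ A2.Ψ (snd p) ≤ trap p q
   lo p q hp hq h1 h2 h3 with position p q hp hq h2
   ... | below a b = subst (_≤ trap p q) (diff-low A1.Ψ A2.Ψ (snd p) (snd q) a b) (A1.lower p q hp hq h1 h2 b)
   ... | above a b = subst (_≤ trap p q) (diff-high A1.Ψ A2.Ψ (snd p) (snd q) a b) (A2.lower p q hp hq a h2 h3)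
   ... | across a b w hw refl eq = subst₂ _≤_ (diff-mid A1.Ψ A2.Ψ (snd p) (snd q) a b) eq (QP.+-mono-≤ (A1.lower p w hp hw h1 a ≤-refl) (A2.lower w q hw hq ≤-refl b h3))

 open Glue using (glue) public

 record Lines (P : List Point) (j l s r t : ℚ) : Set where
  field
   on-left : ∀ {q} → HIn P q → l + s * (snd q - j) ≤ fst q
   on-right : ∀ {q} → HIn P q → fst q ≤ r + t * (snd q - j)

 -- The potentials are primitives of twice the abscissae of the two lines, so the bound is twice the
 -- area of the trapezoid that the lines cut out between the levels `c` and `d`.
 slab : ∀ {P j l s r t} → Lines P j l s r t → ∀ c d → AreaBound P c d ((d - c) * (ν 2 * (r - l) + (t - s) * ((c - j) + (d - j))))
 slab {P} {j} {l} {s} {r} {t} LN c d = record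
  { Φ = λ y → (ν 2 * r + t * (y - j)) * (y - j) ; Ψ = λ y → (ν 2 * l + s * (y - j)) * (y - j)
  ; upper = λ p q hp hq _ h _ → ≤-by ((diff≥ (on-right hp) ⊞ diff≥ (on-right hq)) ⊠ diff≥ h) (id51 (fst p) (snd p) (fst q) (snd q) r t j)
  ; lower = λ p q hp hq _ h _ → ≤-by ((diff≥ (on-left hp) ⊞ diff≥ (on-left hq)) ⊠ diff≥ h) (id52 (fst p) (snd p) (fst q) (snd q) l s j)
  ; total = ≤-reflexive (id53 c d r t l s j) } where
  open Lines LN

 -- Transport of the problem along unimodular maps.

 aff : ℚ → ℚ → ℚ → ℚ → ℚ → ℚ → Point → Point
 aff A B C D e f (x , y) = (A * x + B * y + e , C * x + D * y + f)

 orient-aff : ∀ A B C D e f p q r → orient (aff A B C D e f p) (aff A B C D e f q) (aff A B C D e f r) ≡ (A * D - B * C) * orient p q r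
 orient-aff A B C D e f (p1 , p2) (q1 , q2) (r1 , r2) = id54 A B C D e f p1 p2 q1 q2 r1 r2

 pathE-map : ∀ (U : Point → Point) p xs q → pathE (U p) (map U xs) (U q) ≡ map (λ e → U (fst e) , U (snd e)) (pathE p xs q)
 pathE-map U p [] q = refl
 pathE-map U p (x ∷ xs) q = cong ((U p , U x) ∷_) (pathE-map U x xs q)

 edges-map : ∀ (U : Point → Point) P → edges (map U P) ≡ map (λ e → U (fst e) , U (snd e)) (edges P)
 edges-map U [] = refl
 edges-map U (p ∷ ps) = trans (edges≡pathE (U p) (map U ps)) (trans (pathE-map U p ps p) (cong (map _) (sym (edges≡pathE p ps))))

 edges-map⁻ : ∀ (U : Point → Point) P {a b} → (a , b) ∈ edges (map U P) → ∃[ p ] ∃[ q ] ((p , q) ∈ edges P × a ≡ U p × b ≡ U q)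
 edges-map⁻ U P m with ∈P.∈-map⁻ _ (subst (_ ∈_) (edges-map U P) m)
 ... | (p , q) , n , refl = p , q , n , refl , refl

 edges-map⁺ : ∀ (U : Point → Point) P {a b} → (a , b) ∈ edges P → (U a , U b) ∈ edges (map U P)
 edges-map⁺ U P m = subst (_ ∈_) (sym (edges-map U P)) (∈P.∈-map⁺ _ m)

 crossSum-aff : ∀ A B C D e f p xs q → crossSum (pathE (aff A B C D e f p) (map (aff A B C D e f) xs) (aff A B C D e f q))
  ≡ (A * D - B * C) * crossSum (pathE p xs q) + ((e * (C * fst q + D * snd q) - f * (A * fst q + B * snd q)) - (e * (C * fst p + D * snd p) - f * (A * fst p + B * snd p)))
 crossSum-aff A B C D e f (p1 , p2) [] (q1 , q2) = id55 A B C D e f p1 p2 q1 q2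
 crossSum-aff A B C D e f (p1 , p2) ((x , y) ∷ xs) (q1 , q2) =
  trans (cong (λ z → ((A * p1 + B * p2 + e) * (C * x + D * y + f) - (C * p1 + D * p2 + f) * (A * x + B * y + e)) + z) (crossSum-aff A B C D e f (x , y) xs (q1 , q2)))
   (id56 A B C D e f p1 p2 x y (crossSum (pathE (x , y) xs (q1 , q2))) (e * (C * q1 + D * q2) - f * (A * q1 + B * q2)))

 area2-aff : ∀ A B C D e f P → area2 (map (aff A B C D e f) P) ≡ (A * D - B * C) * area2 P
 area2-aff A B C D e f [] = sym (QP.*-zeroʳ (A * D - B * C))
 area2-aff A B C D e f (p ∷ ps) = trans (cong crossSum (edges≡pathE (aff A B C D e f p) (map (aff A B C D e f) ps)))
  (trans (crossSum-aff A B C D e f p ps p) (trans (id34 ((A * D - B * C) * crossSum (pathE p ps p)) (e * (C * fst p + D * snd p) - f * (A * fst p + B * snd p)))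
   (cong ((A * D - B * C) *_) (cong crossSum (sym (edges≡pathE p ps))))))

 -- The hypotheses in half-plane form, in which unimodular maps transport them directly.
 record Prob (k i b : ℕ) (P : List Point) : Set where
  field
   cv : ConvexCCW P
   integral : ∀ {v} → v ∈ P → IsIntegral (ν k * fst v) × IsIntegral (ν k * snd v)
   ints : HasCard (λ z → HInt P (lat z)) i
   bds : HasCard (λ z → HIn P (lat z) × ¬ HInt P (lat z)) b

 Extremal : ℕ → ℕ → ℕ → List Point → Set
 Extremal k i b P = ∃[ s ] (Admissible k i s × bOf k i s ≡ b × Equivalent P (shape k i s))

 -- The inequality `b ≤ bmax k i` is carried along because the truncated subtractions in `rhs` are
 -- faithful only in that range. The converse of the equality statement is a computation on the
 -- listed polygons, done separately.
 Concl : ℕ → ℕ → ℕ → List Point → Set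
 Concl k i b P = b N.≤ bmax k i × ν (k N.* k) * area2 P ≤ rhs k i b × (ν (k N.* k) * area2 P ≡ rhs k i b → Extremal k i b P)

 det2 : ∀ a b c d → ι (a Z.* b Z.- c Z.* d) ≡ ι a * ι b - ι c * ι d
 det2 a b c d = trans (ι-- (a Z.* b) (c Z.* d)) (cong₂ _-_ (ι-* a b) (ι-* c d))

 -- The normalising maps have determinant 1, so the image of a counterclockwise vertex list is again
 -- counterclockwise.
 module Transform (a b c d t1 t2 : ℤ) (det : a Z.* d Z.- b Z.* c ≡ + 1) where

  U : Point → Point
  U = applyAff a b c d (t1 , t2)

  Uz : ℤ × ℤ → ℤ × ℤ
  Uz (x , y) = (a Z.* x Z.+ b Z.* y Z.+ t1 , c Z.* x Z.+ d Z.* y Z.+ t2)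

  Vz : ℤ × ℤ → ℤ × ℤ
  Vz (x , y) = (d Z.* (x Z.- t1) Z.- b Z.* (y Z.- t2) , a Z.* (y Z.- t2) Z.- c Z.* (x Z.- t1))

  detℚ : ι a * ι d - ι b * ι c ≡ 1#
  detℚ = trans (sym (det2 a d b c)) (cong ι det)

  ι-lin : ∀ a b t x y → ι (a Z.* x Z.+ b Z.* y Z.+ t) ≡ ι a * ι x + ι b * ι y + ι t
  ι-lin a b t x y = trans (ι-+ (a Z.* x Z.+ b Z.* y) t) (cong (_+ ι t) (trans (ι-+ (a Z.* x) (b Z.* y)) (cong₂ _+_ (ι-* a x) (ι-* b y))))

  lat-U : ∀ z → lat (Uz z) ≡ U (lat z)
  lat-U (x , y) = cong₂ _,_ (ι-lin a b t1 x y) (ι-lin c d t2 x y)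

  UV : ∀ z → Uz (Vz z) ≡ z
  UV (x , y) = cong₂ _,_ (trans (l1 a b c d x y t1 t2) (trans (cong (λ z → z Z.* (x Z.- t1) Z.+ t1) det) (l3 x t1)))
              (trans (l2 a b c d x y t1 t2) (trans (cong (λ z → z Z.* (y Z.- t2) Z.+ t2) det) (l3 y t2))) where
   l1 : ∀ a b c d x y t1 t2 → a Z.* (d Z.* (x Z.- t1) Z.- b Z.* (y Z.- t2)) Z.+ b Z.* (a Z.* (y Z.- t2) Z.- c Z.* (x Z.- t1)) Z.+ t1 ≡ (a Z.* d Z.- b Z.* c) Z.* (x Z.- t1) Z.+ t1
   l1 = ℤS.solve-∀
   l2 : ∀ a b c d x y t1 t2 → c Z.* (d Z.* (x Z.- t1) Z.- b Z.* (y Z.- t2)) Z.+ d Z.* (a Z.* (y Z.- t2) Z.- c Z.* (x Z.- t1)) Z.+ t2 ≡ (a Z.* d Z.- b Z.* c) Z.* (y Z.- t2) Z.+ t2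
   l2 = ℤS.solve-∀
   l3 : ∀ x t → + 1 Z.* (x Z.- t) Z.+ t ≡ x
   l3 = ℤS.solve-∀

  U-inj : ∀ {p q} → U p ≡ U q → p ≡ q
  U-inj {x , y} {x' , y'} e = cong₂ _,_ (inj1' x x' (trans (id58 (ι a) (ι b) (ι c) (ι d) (ι t1) (ι t2) x y x' y') (zz (ι d) (ι b) (cong fst e) (cong snd e))))
                     (inj1' y y' (trans (id59 (ι a) (ι b) (ι c) (ι d) (ι t1) (ι t2) x y x' y') (zz (ι a) (ι c) (cong snd e) (cong fst e)))) where
   zz : ∀ u v {p q p' q'} → p ≡ p' → q ≡ q' → u * (p - p') - v * (q - q') ≡ 0#
   zz u v {p} {q} refl refl = id57 u v p q
   inj1' : ∀ x x' → (ι a * ι d - ι b * ι c) * (x - x') ≡ 0# → x ≡ x'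
   inj1' x x' h = trans (id60 x x') (trans (cong (_+ x') (trans (sym (QP.*-identityˡ (x - x'))) (trans (cong (_* (x - x')) (sym detℚ)) h))) (QP.+-identityˡ x'))

  Uz-inj : ∀ {z w} → Uz z ≡ Uz w → z ≡ w
  Uz-inj {x , y} {x' , y'} e = cong₂ _,_ (ι-inj x x' (cong fst h)) (ι-inj y y' (cong snd h)) where
   h : lat (x , y) ≡ lat (x' , y')
   h = U-inj {lat (x , y)} {lat (x' , y')} (trans (sym (lat-U (x , y))) (trans (cong lat e) (lat-U (x' , y'))))

  orient-U : ∀ p q r → orient (U p) (U q) (U r) ≡ orient p q r
  orient-U p q r = trans (orient-aff (ι a) (ι b) (ι c) (ι d) (ι t1) (ι t2) p q r) (trans (cong (_* orient p q r) detℚ) (QP.*-identityˡ _))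

  area2-U : ∀ P → area2 (map U P) ≡ area2 P
  area2-U P = trans (area2-aff (ι a) (ι b) (ι c) (ι d) (ι t1) (ι t2) P) (trans (cong (_* area2 P) detℚ) (QP.*-identityˡ _))

  module _ {P : List Point} where

   HIn⁺ : ∀ {q} → HIn P q → HIn (map U P) (U q)
   HIn⁺ {q} h = hin go where
    go : ∀ {p r} → (p , r) ∈ edges (map U P) → 0# ≤ orient p r (U q)
    go m with edges-map⁻ U P m
    ... | p , r , n , refl , refl = subst (0# ≤_) (sym (orient-U p r q)) (left h n)

   HIn⁻ : ∀ {q} → HIn (map U P) (U q) → HIn P q
   HIn⁻ {q} h = hin λ {p} {r} m → subst (0# ≤_) (orient-U p r q) (left h (edges-map⁺ U P m))

   HInt⁺ : ∀ {q} → HInt P q → HInt (map U P) (U q)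
   HInt⁺ {q} h = hint go where
    go : ∀ {p r} → (p , r) ∈ edges (map U P) → 0# < orient p r (U q)
    go m with edges-map⁻ U P m
    ... | p , r , n , refl , refl = subst (0# <_) (sym (orient-U p r q)) (left< h n)

   HInt⁻ : ∀ {q} → HInt (map U P) (U q) → HInt P q
   HInt⁻ {q} h = hint λ {p} {r} m → subst (0# <_) (orient-U p r q) (left< h (edges-map⁺ U P m))

   ConvexCCW⁺ : ConvexCCW P → ConvexCCW (map U P)
   ConvexCCW⁺ (len , un , f) = subst (3 N.≤_) (sym (LP.length-map U P)) len , UP.map⁺ U-inj un , g where
    g : (e : Point × Point) → e ∈ edges (map U P) → (v : Point) → v ∈ map U P → v ≢ fst e → v ≢ snd e → 0# < cross (snd e ⊖ fst e) (v ⊖ fst e)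
    g e m v n h1 h2 with edges-map⁻ U P m | ∈P.∈-map⁻ U n
    ... | p , r , m' , refl , refl | w , n' , refl = subst (0# <_) (sym (orient-U p r w)) (f (p , r) m' w n' (λ { refl → h1 refl }) (λ { refl → h2 refl }))

   HasCard⁺ : ∀ {n} {Q Q' : ℤ × ℤ → Set} → (∀ z → Q z → Q' (Uz z)) → (∀ z → Q' (Uz z) → Q z) → HasCard Q n → HasCard Q' n
   HasCard⁺ {n} {Q} {Q'} f g (zs , un , len , h) = map Uz zs , UP.map⁺ Uz-inj un , trans (LP.length-map Uz zs) len , λ z → to z , from z where
    to : ∀ z → z ∈ map Uz zs → Q' z
    to z m with ∈P.∈-map⁻ Uz m
    ... | w , w∈ , refl = f w (fst (h w) w∈)
    from : ∀ z → Q' z → z ∈ map Uz zs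
    from z q = subst (_∈ map Uz zs) (UV z) (∈P.∈-map⁺ Uz (snd (h (Vz z)) (g (Vz z) (subst Q' (sym (UV z)) q))))

  Prob⁺ : ∀ {k i b' P} → Prob k i b' P → Prob k i b' (map U P)
  Prob⁺ {k} {i} {b'} {P} pr = record
   { cv = ConvexCCW⁺ cv ; integral = int
   ; ints = HasCard⁺ {P} {i} {λ z → HInt P (lat z)} {λ z → HInt (map U P) (lat z)} (λ z h → subst (HInt (map U P)) (sym (lat-U z)) (HInt⁺ {P} {lat z} h)) (λ z h → HInt⁻ {P} {lat z} (subst (HInt (map U P)) (lat-U z) h)) ints
   ; bds = HasCard⁺ {P} {b'} {λ z → HIn P (lat z) × ¬ HInt P (lat z)} {λ z → HIn (map U P) (lat z) × ¬ HInt (map U P) (lat z)} (λ z h → subst (HIn (map U P)) (sym (lat-U z)) (HIn⁺ {P} {lat z} (fst h)) , λ g → snd h (HInt⁻ {P} {lat z} (subst (HInt (map U P)) (lat-U z) g)))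
            (λ z h → HIn⁻ {P} {lat z} (subst (HIn (map U P)) (lat-U z) (fst h)) , λ g → snd h (subst (HInt (map U P)) (sym (lat-U z)) (HInt⁺ {P} {lat z} g))) bds } where
   open Prob pr
   lin : ∀ a b t {x y} → IsIntegral (ν k * x) → IsIntegral (ν k * y) → IsIntegral (ν k * (ι a * x + ι b * y + ι t))
   lin a b t {x} {y} (zx , ex) (zy , ey) = a Z.* zx Z.+ b Z.* zy Z.+ + k Z.* t ,
    trans (id61 (ν k) (ι a) (ι b) (ι t) x y) (trans (cong₂ (λ u v → ι a * u + ι b * v + ν k * ι t) ex ey)
     (trans (cong (λ z → ι a * ι zx + ι b * ι zy + z) (sym (ι-* (+ k) t))) (sym (ι-lin a b (+ k Z.* t) zx zy))))
   int : ∀ {v} → v ∈ map U P → IsIntegral (ν k * fst v) × IsIntegral (ν k * snd v)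
   int m with ∈P.∈-map⁻ U m
   ... | w , n , refl with integral n
   ...   | ix , iy = lin a b t1 ix iy , lin c d t2 ix iy

  -- The witness is the inverse of `U` composed with the given equivalence of the image.
  Equivalent⁻ : ∀ {P S} → ConvexCCW P → Equivalent (map U P) S → Equivalent P S
  Equivalent⁻ {P} {S} cv (a2 , b2 , c2 , d2 , (s1 , s2) , dt , f) =
   (d Z.* a2 Z.- b Z.* c2) , (d Z.* b2 Z.- b Z.* d2) , (a Z.* c2 Z.- c Z.* a2) , (a Z.* d2 Z.- c Z.* b2)
    , (d Z.* (s1 Z.- t1) Z.- b Z.* (s2 Z.- t2) , a Z.* (s2 Z.- t2) Z.- c Z.* (s1 Z.- t1))
    , [ (λ e → inj₁ (trans dets e)) , (λ e → inj₂ (trans dets e)) ]′ dt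
    , λ q → to q , from q where
   dets : (d Z.* a2 Z.- b Z.* c2) Z.* (a Z.* d2 Z.- c Z.* b2) Z.- (d Z.* b2 Z.- b Z.* d2) Z.* (a Z.* c2 Z.- c Z.* a2) ≡ a2 Z.* d2 Z.- b2 Z.* c2
   dets = trans (l a b c d a2 b2 c2 d2) (trans (cong (Z._* (a2 Z.* d2 Z.- b2 Z.* c2)) det) (ZP.*-identityˡ _)) where
    l : ∀ a b c d a2 b2 c2 d2 → (d Z.* a2 Z.- b Z.* c2) Z.* (a Z.* d2 Z.- c Z.* b2) Z.- (d Z.* b2 Z.- b Z.* d2) Z.* (a Z.* c2 Z.- c Z.* a2) ≡ (a Z.* d Z.- b Z.* c) Z.* (a2 Z.* d2 Z.- b2 Z.* c2)
    l = ℤS.solve-∀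
   W : Point → Point
   W = applyAff (d Z.* a2 Z.- b Z.* c2) (d Z.* b2 Z.- b Z.* d2) (a Z.* c2 Z.- c Z.* a2) (a Z.* d2 Z.- c Z.* b2) (d Z.* (s1 Z.- t1) Z.- b Z.* (s2 Z.- t2) , a Z.* (s2 Z.- t2) Z.- c Z.* (s1 Z.- t1))
   U2 : Point → Point
   U2 = applyAff a2 b2 c2 d2 (s1 , s2)
   UW : ∀ p → U (W p) ≡ U2 p
   UW (x , y) = trans (cong U (cong₂ _,_ (trans wx (id62 D B A2 B2 C2 D2 (ι s1 - ι t1) (ι s2 - ι t2) x y)) (trans wy (id62 A C C2 D2 A2 B2 (ι s2 - ι t2) (ι s1 - ι t1) x y)))) (cong₂ _,_
     (trans (id63 A B C D u v (ι t1)) (trans (cong (λ z → z * u + ι t1) detℚ) (id65 (A2 * x) (B2 * y) (ι s1) (ι t1))))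
     (trans (id64 A B C D u v (ι t2)) (trans (cong (λ z → z * v + ι t2) detℚ) (id65 (C2 * x) (D2 * y) (ι s2) (ι t2))))) where
    A = ι a
    B = ι b
    C = ι c
    D = ι d
    A2 = ι a2
    B2 = ι b2
    C2 = ι c2
    D2 = ι d2
    tr : ∀ p q u v w z → ι (p Z.* (u Z.- v) Z.- q Z.* (w Z.- z)) ≡ ι p * (ι u - ι v) - ι q * (ι w - ι z)
    tr p q u v w z = trans (det2 p (u Z.- v) q (w Z.- z)) (cong₂ (λ m n → ι p * m - ι q * n) (ι-- u v) (ι-- w z))
    row : ∀ (m n e m' n' e' : ℚ) → m ≡ m' → n ≡ n' → e ≡ e' → m * x + n * y + e ≡ m' * x + n' * y + e'
    row m n e m' n' e' refl refl refl = refl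
    wx : fst (W (x , y)) ≡ (D * A2 - B * C2) * x + (D * B2 - B * D2) * y + (D * (ι s1 - ι t1) - B * (ι s2 - ι t2))
    wx = row (ι (d Z.* a2 Z.- b Z.* c2)) (ι (d Z.* b2 Z.- b Z.* d2)) (ι (d Z.* (s1 Z.- t1) Z.- b Z.* (s2 Z.- t2))) (D * A2 - B * C2) (D * B2 - B * D2) (D * (ι s1 - ι t1) - B * (ι s2 - ι t2)) (det2 d a2 b c2) (det2 d b2 b d2) (tr d b s1 t1 s2 t2)
    wy : snd (W (x , y)) ≡ (A * C2 - C * A2) * x + (A * D2 - C * B2) * y + (A * (ι s2 - ι t2) - C * (ι s1 - ι t1))
    wy = row (ι (a Z.* c2 Z.- c Z.* a2)) (ι (a Z.* d2 Z.- c Z.* b2)) (ι (a Z.* (s2 Z.- t2) Z.- c Z.* (s1 Z.- t1))) (A * C2 - C * A2) (A * D2 - C * B2) (A * (ι s2 - ι t2) - C * (ι s1 - ι t1)) (det2 a c2 c a2) (det2 a d2 c b2) (tr a c s2 t2 s1 t1)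
    u = A2 * x + B2 * y + (ι s1 - ι t1)
    v = C2 * x + D2 * y + (ι s2 - ι t2)
   cv' : ConvexCCW (map U P)
   cv' = ConvexCCW⁺ cv
   to : ∀ q → InConv P q → ∃[ q' ] (InConv S q' × q ≡ W q')
   to q h = go (fst (f (U q)) h') where
    h' : InConv (map U P) (U q)
    h' = HIn⇒InConv {map U P} {U q} cv' (HIn⁺ {P} {q} (InConv⇒HIn cv h))
    go : ∃[ q' ] (InConv S q' × U q ≡ U2 q') → ∃[ q' ] (InConv S q' × q ≡ W q')
    go (s , s∈ , e) = s , s∈ , U-inj {q} {W s} (trans e (sym (UW s)))
   from : ∀ q → ∃[ q' ] (InConv S q' × q ≡ W q') → InConv P q
   from q (s , s∈ , e) = subst (InConv P) (sym e) (HIn⇒InConv {P} {W s} cv h2) where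
    h1 : InConv (map U P) (U (W s))
    h1 = snd (f (U (W s))) (s , s∈ , UW s)
    h2 : HIn P (W s)
    h2 = HIn⁻ {P} {W s} (InConv⇒HIn cv' h1)

  Concl⁻ : ∀ {k i b' P} → ConvexCCW P → Concl k i b' (map U P) → Concl k i b' P
  Concl⁻ {k} {i} {b'} {P} cv (h1 , h2 , h3) = h1 , subst (λ z → ν (k N.* k) * z ≤ rhs k i b') (area2-U P) h2 ,
   λ e → case h3 (trans (cong (ν (k N.* k) *_) (area2-U P)) e) of λ { (s , ad , bo , eq) → s , ad , bo , Equivalent⁻ cv eq }

 -- A chord that the polygon does not overshoot.

 bounding-box : ∀ (P : List Point) → ∃[ Q ] (∀ {v} → v ∈ P → (- Q ≤ fst v × fst v ≤ Q) × (- Q ≤ snd v × snd v ≤ Q))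
 bounding-box [] = 0# , λ ()
 bounding-box ((x , y) ∷ P) with bounding-box P
 ... | Q , f = Q ℚ.⊔ (∣ x ∣ + ∣ y ∣) , λ { ∈0 → (lo x h1 , hi x h1) , (lo y h2 , hi y h2)
   ; (there m) → (≤-trans nQ (fst (fst (f m))) , ≤-trans (snd (fst (f m))) mQ) , (≤-trans nQ (fst (snd (f m))) , ≤-trans (snd (snd (f m))) mQ) } where
  mQ : Q ≤ Q ℚ.⊔ (∣ x ∣ + ∣ y ∣)
  mQ = QP.p≤p⊔q Q (∣ x ∣ + ∣ y ∣)
  nQ : - (Q ℚ.⊔ (∣ x ∣ + ∣ y ∣)) ≤ - Q
  nQ = QP.neg-antimono-≤ mQ
  h1 : ∣ x ∣ ≤ Q ℚ.⊔ (∣ x ∣ + ∣ y ∣)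
  h1 = ≤-trans (≤-by (QP.0≤∣p∣ y) (shift-sub ∣ x ∣ ∣ y ∣)) (QP.p≤q⊔p Q (∣ x ∣ + ∣ y ∣))
  h2 : ∣ y ∣ ≤ Q ℚ.⊔ (∣ x ∣ + ∣ y ∣)
  h2 = ≤-trans (≤-by (QP.0≤∣p∣ x) (id66 ∣ x ∣ ∣ y ∣)) (QP.p≤q⊔p Q (∣ x ∣ + ∣ y ∣))
  hi : ∀ z {w} → ∣ z ∣ ≤ w → z ≤ w
  hi z h = ≤-trans (p≤∣p∣ z) h
  lo : ∀ z {w} → ∣ z ∣ ≤ w → - w ≤ z
  lo z h = subst (_ ≤_) (neg-neg z) (QP.neg-antimono-≤ (≤-trans (-p≤∣p∣ z) h))

 -- The normal form reached by the descent: a horizontal chord such that every vertex is less than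
 -- (1 + 1/k) ℓ above or below it. It makes the sections at intermediate integer levels longer than
 -- 1.
 record Wide (k : ℕ) (P : List Point) : Set where
  field
   p1 p2 ℓ : ℚ
   ℓ>0 : 0# < ℓ
   start : HIn P (p1 , p2)
   end : HIn P (p1 + ℓ , p2)
   above : ∀ {v} → v ∈ P → ν k * (snd v - p2) < (ν k + 1#) * ℓ
   below : ∀ {v} → v ∈ P → ν k * (p2 - snd v) < (ν k + 1#) * ℓ

 -- A segment p, p + ℓ v of P in a primitive direction v (completed to a basis by w). As long as P
 -- sticks out of it by more than (1 + 1/k) ℓ, measured in lattice heights, some other primitive
 -- direction has a segment which is longer by the factor (2k+2)/(2k+1).
 module Descent {P : List Point} (cv : ConvexCCW P) (k : ℕ) (1≤k : 1 N.≤ k) where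

  K : ℚ
  K = ν k

  -- The vector `w` certifies that `v` is primitive, and `height` is the signed lattice distance
  -- from the line of the chord.
  record Chord (ℓ : ℚ) : Set where
   field
    v1 v2 w1 w2 : ℤ
    det : ι v1 * ι w2 - ι v2 * ι w1 ≡ 1#
    p1 p2 : ℚ
    start : HIn P (p1 , p2)
    end : HIn P (p1 + ℓ * ι v1 , p2 + ℓ * ι v2)

   height : Point → ℚ
   height t = ι v1 * (snd t - p2) - ι v2 * (fst t - p1)

  point≡ : ∀ {x y x' y' : ℚ} → x ≡ x' → y ≡ y' → HIn P (x , y) → HIn P (x' , y')
  point≡ refl refl h = h

  reverse : ∀ {ℓ} (c : Chord ℓ) → ∃[ c' ] (∀ t → Chord.height {ℓ} c' t ≡ - Chord.height c t)
  reverse {ℓ} c = record { v1 = Z.- v1 ; v2 = Z.- v2 ; w1 = Z.- w1 ; w2 = Z.- w2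
    ; det = trans (cong₂ _-_ (cong₂ _*_ (ι-neg v1) (ι-neg w2)) (cong₂ _*_ (ι-neg v2) (ι-neg w1))) (trans (id67 (ι v1) (ι v2) (ι w1) (ι w2)) det)
    ; p1 = p1 + ℓ * ι v1 ; p2 = p2 + ℓ * ι v2 ; start = end
    ; end = point≡ (trans (id68 p1 ℓ (ι v1)) (cong (λ z → p1 + ℓ * ι v1 + ℓ * z) (sym (ι-neg v1)))) (trans (id68 p2 ℓ (ι v2)) (cong (λ z → p2 + ℓ * ι v2 + ℓ * z) (sym (ι-neg v2)))) start } ,
   λ t → trans (cong₂ (λ a b → a * (snd t - (p2 + ℓ * ι v2)) - b * (fst t - (p1 + ℓ * ι v1))) (ι-neg v1) (ι-neg v2)) (id69 (ι v1) (ι v2) (fst t) (snd t) p1 p2 ℓ) where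
   open Chord c

  K≥0 : 0# ≤ K
  K≥0 = ν-0≤ k

  Longer : ℚ → ℚ → Set
  Longer ℓ ℓ' = (ν 2 * K + ν 2) * ℓ ≤ (ν 2 * K + 1#) * ℓ'

  module Step {ℓ : ℚ} (ℓ>0 : 0# < ℓ) (c : Chord ℓ) (t : Point) (ht : HIn P t) (far : (K + 1#) * ℓ ≤ K * Chord.height c t) where
   open Chord c
   V1 = ι v1
   V2 = ι v2
   W1 = ι w1
   W2 = ι w2
   t1 = fst t
   t2 = snd t
   h = height t
   α = (t1 - p1) * W2 - (t2 - p2) * W1

   K>0 : 0# < K
   K>0 = <-≤-trans (<-lit 0# 1#) (ν-≤ 1 k 1≤k)

   h>0 : 0# < h
   h>0 = 0<-cancel K>0 (<-≤-trans ((K≥0 ⊞≤< <-lit 0# 1#) ⊠< ℓ>0) far)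

   tx : t1 ≡ p1 + (α * V1 + h * W1)
   tx = trans (id70 t1 p1) (cong (λ z → p1 + z) (trans (sym (QP.*-identityˡ (t1 - p1))) (trans (cong (_* (t1 - p1)) (sym det)) (expand V1 V2 W1 W2 t1 t2 p1 p2))))
   ty : t2 ≡ p2 + (α * V2 + h * W2)
   ty = trans (id70 t2 p2) (cong (λ z → p2 + z) (trans (sym (QP.*-identityˡ (t2 - p2))) (trans (cong (_* (t2 - p2)) (sym det)) (expand2 V1 V2 W1 W2 t1 t2 p1 p2))))

   -- new direction w + m v, completed by - v
   module _ (m : ℤ) where
    n1 = w1 Z.+ m Z.* v1
    n2 = w2 Z.+ m Z.* v2
    M = ι m
    en1 : ι n1 ≡ W1 + M * V1
    en1 = trans (ι-+ w1 (m Z.* v1)) (cong (λ z → W1 + z) (ι-* m v1))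
    en2 : ι n2 ≡ W2 + M * V2
    en2 = trans (ι-+ w2 (m Z.* v2)) (cong (λ z → W2 + z) (ι-* m v2))

    newChord : ∀ {q1 q2 : ℚ} {e1 e2 : ℚ} ℓ' → HIn P (q1 , q2) → HIn P (e1 , e2) → e1 ≡ q1 + ℓ' * (W1 + M * V1) → e2 ≡ q2 + ℓ' * (W2 + M * V2) → Chord ℓ'
    newChord {q1} {q2} ℓ' hq he eq1 eq2 = record { v1 = n1 ; v2 = n2 ; w1 = Z.- v1 ; w2 = Z.- v2
     ; det = trans (cong₂ _-_ (cong₂ _*_ en1 (ι-neg v2)) (cong₂ _*_ en2 (ι-neg v1))) (trans (id71 V1 V2 W1 W2 M) det)
     ; p1 = q1 ; p2 = q2 ; start = hq
     ; end = point≡ (trans eq1 (cong (λ z → q1 + ℓ' * z) (sym en1))) (trans eq2 (cong (λ z → q2 + ℓ' * z) (sym en2))) he }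

   Result : Set
   Result = ∃[ ℓ' ] (Longer ℓ ℓ' × Chord ℓ')

   -- With m the floor of α/h, the far point is t = p + β v + h (w + m v), where 0 ≤ β < h. If β ≤
   -- ℓ, the segment from the chord point p + β v to t has direction w + m v and length h. Otherwise
   -- a chord is drawn inside the triangle over the old chord with tip t, in direction w + m v or w
   -- + (m+1) v according to which of them is steeper against its far side.
   module Reduced (r : ℚ) (hr : h * r ≡ 1#) (m : ℤ) (lo : ι m ≤ α * r) (hi : α * r < ι m + 1#) where
    M' = ι m
    β = α - M' * h
    β≥0 : 0# ≤ β
    β≥0 = subst (0# ≤_) (trans (id72 α r M' h) (trans (cong (λ z → α * z - M' * h) hr) (cong (_- M' * h) (QP.*-identityʳ α)))) (<⇒≤ h>0 ⊠ diff≥ lo)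
    β<h : 0# < h - β
    β<h = subst (0# <_) (trans (id73 α r M' h) (trans (cong (λ z → M' * h + h - α * z) hr) (id74 α M' h))) (h>0 ⊠< diff> hi)

    module Foot (β≤ℓ : β ≤ ℓ) (s : ℚ) (s>0 : 0# < s) (ℓs : ℓ * s ≡ 1#) where
     le1 : 0# ≤ 1# - β * s
     le1 = subst (0# ≤_) (trans (sub-* ℓ β s) (cong (_- β * s) ℓs)) (diff≥ β≤ℓ ⊠ <⇒≤ s>0)
     feq : ∀ p v → (1# - β * s) * p + (β * s) * (p + ℓ * v) ≡ p + β * v
     feq p v = trans (id77 β s ℓ p v) (trans (cong (λ z → p + β * z * v) ℓs) (cong (λ z → p + z * v) (QP.*-identityʳ β)))
     foot : HIn P (p1 + β * V1 , p2 + β * V2)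
     foot = point≡ (feq p1 V1) (feq p2 V2) (HIn-convex P (1# - β * s) (β * s) le1 (β≥0 ⊠ <⇒≤ s>0) (complement (β * s)) start end)
     result : Result
     result = h , ≤-by (diff≥ far ⊞ diff≥ far ⊞ <⇒≤ h>0) (trans (id76 K ℓ h) (QP.+-assoc (K * h - (K + 1#) * ℓ) (K * h - (K + 1#) * ℓ) h)) ,
      newChord m {p1 + β * V1} {p2 + β * V2} {t1} {t2} h foot ht (trans tx (id75 α h V1 W1 p1 M')) (trans ty (id75 α h V2 W2 p2 M'))

    -- The ray from the end of the chord in direction w + m v meets the side from p to t at
    -- parameter ℓ/β, so the new length is h ℓ/β. It is at least 2 h ℓ/(h + ℓ), and h ≥ (1 + 1/k) ℓ
    -- turns this into the factor (2k+2)/(2k+1).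
    module Small (ℓ<β : ℓ < β) (small : ν 2 * β ≤ h + ℓ) (s : ℚ) (s>0 : 0# < s) (βs : β * s ≡ 1#) where
     grow : Longer ℓ (h * (ℓ * s))
     grow = ≤-by (0≤-cancel (<-trans ℓ>0 ℓ<β) (subst (0# ≤_) (sym (trans (scale K ℓ h s β) (cong (λ z → ℓ * ((ν 2 * K + 1#) * h * z - (ν 2 * K + ν 2) * β)) βs)))
       (<⇒≤ ℓ>0 ⊠ subst (0# ≤_) (id78 K ℓ h β) ((diff≥ small ⊠ (K≥0 ⊞ ≤-lit 0# 1#)) ⊞ diff≥ far)))) refl
     tip-eq : ∀ t p v w → t ≡ p + (α * v + h * w) → (1# - ℓ * s) * p + (ℓ * s) * t ≡ p + ℓ * s * (α * v + h * w)
     tip-eq t p v w e = trans (cong (λ z → (1# - ℓ * s) * p + (ℓ * s) * z) e) (id79 (ℓ * s) p (α * v + h * w))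
     ex : ∀ v w p {z} → z ≡ p + ℓ * s * (α * v + h * w) → z ≡ (p + ℓ * v) + h * (ℓ * s) * (w + M' * v)
     ex v w p e = trans e (trans (id80 p ℓ s α h v w M') (trans (cong (λ z → p + ℓ * z * v + h * (ℓ * s) * (w + M' * v)) βs) (cong (λ z → p + z * v + h * (ℓ * s) * (w + M' * v)) (QP.*-identityʳ ℓ))))
     tip : HIn P ((1# - ℓ * s) * p1 + (ℓ * s) * t1 , (1# - ℓ * s) * p2 + (ℓ * s) * t2)
     tip = HIn-convex P (1# - ℓ * s) (ℓ * s) (subst (0# ≤_) (trans (sub-* β ℓ s) (cong (_- ℓ * s) βs)) (<⇒≤ (diff> ℓ<β ⊠< s>0))) (<⇒≤ (ℓ>0 ⊠< s>0)) (complement (ℓ * s)) start ht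
     result : Result
     result = h * (ℓ * s) , grow ,
      newChord m {p1 + ℓ * V1} {p2 + ℓ * V2} (h * (ℓ * s)) end tip (ex V1 W1 p1 (tip-eq t1 p1 V1 W1 tx)) (ex V2 W2 p2 (tip-eq t2 p2 V2 W2 ty))

    -- The mirror image of `Small`: the ray from p in direction w + (m+1) v meets the side from the
    -- chord's end to t, and the new length h ℓ/(h - β + ℓ) has a denominator below (h + ℓ)/2.
    module Large (large : h + ℓ < ν 2 * β) (s : ℚ) (s>0 : 0# < s) (gs : ((h - β) + ℓ) * s ≡ 1#) where
     γ = (h - β) + ℓ
     γ>0 : 0# < γ
     γ>0 = β<h ⊞< <⇒≤ ℓ>0
     grow : Longer ℓ (h * (ℓ * s))
     grow = ≤-by (0≤-cancel γ>0 (subst (0# ≤_) (sym (trans (scale K ℓ h s γ) (cong (λ z → ℓ * ((ν 2 * K + 1#) * h * z - (ν 2 * K + ν 2) * γ)) gs)))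
       (<⇒≤ ℓ>0 ⊠ subst (0# ≤_) (id81 K ℓ h β) ((diff≥ (<⇒≤ large) ⊠ (K≥0 ⊞ ≤-lit 0# 1#)) ⊞ diff≥ far)))) refl
     ex : ∀ v w p t → t ≡ p + (α * v + h * w) → (1# - ℓ * s) * (p + ℓ * v) + (ℓ * s) * t ≡ p + h * (ℓ * s) * (w + ι (Z.suc m) * v)
     ex v w p t e = trans (cong (λ z → (1# - ℓ * s) * (p + ℓ * v) + (ℓ * s) * z) e) (trans (id82 p ℓ s α h v w M')
       (trans (cong (λ z → p + h * (ℓ * s) * (w + (M' + 1#) * v) + ℓ * (1# - z) * v) gs) (trans (id83 (p + h * (ℓ * s) * (w + (M' + 1#) * v)) ℓ v) (cong (λ z → p + h * (ℓ * s) * (w + z * v)) (sym (ι-suc m))))))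
     tip : HIn P ((1# - ℓ * s) * (p1 + ℓ * V1) + (ℓ * s) * t1 , (1# - ℓ * s) * (p2 + ℓ * V2) + (ℓ * s) * t2)
     tip = HIn-convex P (1# - ℓ * s) (ℓ * s) (subst (0# ≤_) (trans (cancel-+ (h - β) ℓ s) (cong (_- ℓ * s) gs)) (<⇒≤ (β<h ⊠< s>0))) (<⇒≤ (ℓ>0 ⊠< s>0)) (complement (ℓ * s)) end ht
     result : Result
     result = h * (ℓ * s) , grow , newChord (Z.suc m) {p1} {p2} (h * (ℓ * s)) start tip (ex V1 W1 p1 t1 tx) (ex V2 W2 p2 t2 ty)

    viaFoot : β ≤ ℓ → ∃[ s ] (0# < s × ℓ * s ≡ 1#) → Result
    viaFoot le (s , s>0 , e) = Foot.result le s s>0 e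

    viaSmall : ℓ < β → ν 2 * β ≤ h + ℓ → ∃[ s ] (0# < s × β * s ≡ 1#) → Result
    viaSmall lt le (s , s>0 , e) = Small.result lt le s s>0 e

    viaLarge : h + ℓ < ν 2 * β → ∃[ s ] (0# < s × ((h - β) + ℓ) * s ≡ 1#) → Result
    viaLarge lt (s , s>0 , e) = Large.result lt s s>0 e

    outside : ℓ < β → Dec (ν 2 * β ≤ h + ℓ) → Result
    outside lt (yes le) = viaSmall lt le (recip β (<-trans ℓ>0 lt))
    outside lt (no ¬le) = viaLarge (≰⇒> ¬le) (recip ((h - β) + ℓ) (β<h ⊞< <⇒≤ ℓ>0))

    result : Dec (β ≤ ℓ) → Result
    result (yes le) = viaFoot le (recip ℓ ℓ>0)
    result (no ¬le) = outside (≰⇒> ¬le) (ν 2 * β ≤? h + ℓ)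

   withFloor : ∀ r → h * r ≡ 1# → ∃[ m ] (ι m ≤ α * r × α * r < ι m + 1#) → Result
   withFloor r hr (m , lo , hi) = Reduced.result r hr m lo hi (α - ι m * h ≤? ℓ)

   withRecip : ∃[ r ] (0# < r × h * r ≡ 1#) → Result
   withRecip (r , _ , hr) = withFloor r hr (floorℚ (α * r))

   step : Result
   step = withRecip (recip h h>0)

  Q : ℚ
  Q = fst (bounding-box P)

  in-box : ∀ {x y} → HIn P (x , y) → (0# ≤ x + Q × 0# ≤ Q - x) × (0# ≤ y + Q × 0# ≤ Q - y)
  in-box {x} {y} h = (go 1# 0# (λ v m → subst (0# ≤_) (id84 (fst v) (snd v) Q) (diff≥ (fst (fst (box m))))) (id85 x y Q) ,
            go (- 1#) 0# (λ v m → subst (0# ≤_) (id86 (fst v) (snd v) Q) (diff≥ (snd (fst (box m))))) (id87 x y Q)) ,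
            (go 0# 1# (λ v m → subst (0# ≤_) (id88 (fst v) (snd v) Q) (diff≥ (fst (snd (box m))))) (id89 x y Q) ,
            go 0# (- 1#) (λ v m → subst (0# ≤_) (id90 (fst v) (snd v) Q) (diff≥ (snd (snd (box m))))) (id91 x y Q)) where
   box : ∀ {v} → v ∈ P → (- Q ≤ fst v × fst v ≤ Q) × (- Q ≤ snd v × snd v ≤ Q)
   box = snd (bounding-box P)
   go : ∀ α β {z} → (∀ v → v ∈ P → 0# ≤ affine α β Q v) → affine α β Q (x , y) ≡ z → 0# ≤ z
   go α β f e = subst (0# ≤_) e (HIn-affine cv α β Q (λ {v} m → f v m) h)

  nonzero≥1 : ∀ z → z ≢ + 0 → 1# ≤ ι z ⊎ 1# ≤ - ι z
  nonzero≥1 (+ zero) ne = ⊥-elim (ne refl)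
  nonzero≥1 (+ suc n) ne = inj₁ (ν-≤ 1 (suc n) (N.s≤s N.z≤n))
  nonzero≥1 (-[1+ n ]) ne = inj₂ (subst (1# ≤_) (ι-neg -[1+ n ]) (ν-≤ 1 (suc n) (N.s≤s N.z≤n)))

  -- A primitive integer vector has a coordinate of absolute value at least 1, so a chord of length
  -- ℓ spans at least ℓ of the side 2 Q of the bounding box.
  chord-bounded : ∀ {ℓ} → 0# < ℓ → Chord ℓ → ℓ ≤ Q + Q
  chord-bounded {ℓ} ℓ>0 c with Chord.v1 c ZP.≟ + 0
  ... | no ne = [ (λ h → ≤-by (((<⇒≤ ℓ>0 ⊠ diff≥ h) ⊞ snd (fst (in-box end))) ⊞ fst (fst (in-box start))) (id92 ℓ (ι v1) p1 Q))
         , (λ h → ≤-by (((<⇒≤ ℓ>0 ⊠ diff≥ h) ⊞ fst (fst (in-box end))) ⊞ snd (fst (in-box start))) (id93 ℓ (ι v1) p1 Q)) ]′ (nonzero≥1 v1 ne) where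
   open Chord c
  ... | yes e with Chord.v2 c ZP.≟ + 0
  ...   | no ne = [ (λ h → ≤-by (((<⇒≤ ℓ>0 ⊠ diff≥ h) ⊞ snd (snd (in-box end))) ⊞ fst (snd (in-box start))) (id92 ℓ (ι v2) p2 Q))
         , (λ h → ≤-by (((<⇒≤ ℓ>0 ⊠ diff≥ h) ⊞ fst (snd (in-box end))) ⊞ snd (snd (in-box start))) (id93 ℓ (ι v2) p2 Q)) ]′ (nonzero≥1 v2 ne) where
   open Chord c
  ...   | yes e' = ⊥-elim (QP.1≢0 (trans (sym (Chord.det c)) (trans (cong₂ (λ a b → ι a * ι (Chord.w2 c) - ι b * ι (Chord.w1 c)) e e') (id29 (ι (Chord.w2 c)) (ι (Chord.w1 c))))))

  Saturated : ∀ {ℓ} → Chord ℓ → Set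
  Saturated {ℓ} c = ∀ {t} → t ∈ P → K * Chord.height c t < (K + 1#) * ℓ × K * - Chord.height c t < (K + 1#) * ℓ

  search : ∀ {ℓ} (c : Chord ℓ) (ts : List Point) → (∃[ t ] (t ∈ ts × ((K + 1#) * ℓ ≤ K * Chord.height c t ⊎ (K + 1#) * ℓ ≤ K * - Chord.height c t)))
   ⊎ (∀ {t} → t ∈ ts → K * Chord.height c t < (K + 1#) * ℓ × K * - Chord.height c t < (K + 1#) * ℓ)
  search c [] = inj₂ λ ()
  search {ℓ} c (t ∷ ts) = pick ((K + 1#) * ℓ ≤? K * Chord.height c t) ((K + 1#) * ℓ ≤? K * - Chord.height c t) (search c ts) where
   High Low : Point → Set
   High t = (K + 1#) * ℓ ≤ K * Chord.height c t
   Low t = (K + 1#) * ℓ ≤ K * - Chord.height c t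
   Fine : Point → Set
   Fine t = K * Chord.height c t < (K + 1#) * ℓ × K * - Chord.height c t < (K + 1#) * ℓ
   pick : Dec (High t) → Dec (Low t) → (∃[ t' ] (t' ∈ ts × (High t' ⊎ Low t'))) ⊎ (∀ {t'} → t' ∈ ts → Fine t') → (∃[ t' ] (t' ∈ t ∷ ts × (High t' ⊎ Low t'))) ⊎ (∀ {t'} → t' ∈ t ∷ ts → Fine t')
   pick (yes h) _ _ = inj₁ (t , here refl , inj₁ h)
   pick (no _) (yes h) _ = inj₁ (t , here refl , inj₂ h)
   pick (no _) (no _) (inj₁ (t' , m , h)) = inj₁ (t' , there m , h)
   pick (no h1) (no h2) (inj₂ f) = inj₂ λ { ∈0 → ≰⇒> h1 , ≰⇒> h2 ; (there m) → f m }

  -- Each lengthening adds at least ℓ/(2k+1), hence at least δ, while ℓ stays below 2 Q. So `n`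
  -- steps suffice as soon as ℓ + n δ exceeds 2 Q.
  loop : ∀ (δ : ℚ) (n : ℕ) {ℓ} → 0# < ℓ → (ν 2 * K + 1#) * δ ≤ ℓ → 0# ≤ δ → Q + Q < ℓ + ν n * δ → Chord ℓ → ∃[ ℓ' ] (0# < ℓ' × Σ (Chord ℓ') Saturated)
  loop δ zero {ℓ} ℓ>0 hδ δ≥0 fuel c = ⊥-elim (<-irrefl refl (<-≤-trans fuel (subst (_≤ Q + Q) (id94 ℓ δ) (chord-bounded ℓ>0 c))))
  loop δ (suc n) {ℓ} ℓ>0 hδ δ≥0 fuel c = dispatch (search c P) where
   longer : ∀ t → t ∈ P → ((K + 1#) * ℓ ≤ K * Chord.height c t ⊎ (K + 1#) * ℓ ≤ K * - Chord.height c t) → ∃[ ℓ' ] (Longer ℓ ℓ' × Chord ℓ')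
   longer t t∈ (inj₁ h) = Step.step ℓ>0 c t (vertex-HIn cv t∈) h
   longer t t∈ (inj₂ h) = Step.step ℓ>0 (fst (reverse c)) t (vertex-HIn cv t∈) (subst (λ z → (K + 1#) * ℓ ≤ K * z) (sym (snd (reverse c) t)) h)
   D>0 : 0# < ν 2 * K + 1#
   D>0 = ((≤-lit 0# (ν 2)) ⊠ K≥0) ⊞≤< <-lit 0# 1#
   next : ∃[ ℓ' ] (Longer ℓ ℓ' × Chord ℓ') → ∃[ ℓ' ] (0# < ℓ' × Σ (Chord ℓ') Saturated)
   next (ℓ' , lg , c') = loop δ n (<-≤-trans ℓ>0 ℓ≤ℓ') (≤-trans hδ ℓ≤ℓ') δ≥0 (<-≤-trans fuel (≤-by (diff≥ ℓ+δ≤ℓ') (trans (cong (λ z → (ℓ' + ν n * δ) - (ℓ + z * δ)) (ν-suc n)) (id96 ℓ ℓ' (ν n) δ)))) c' where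
    ℓ+δ≤ℓ' : ℓ + δ ≤ ℓ'
    ℓ+δ≤ℓ' = ≤-by (0≤-cancel D>0 (subst (0# ≤_) (sym (id95 K ℓ ℓ' δ)) (diff≥ lg ⊞ diff≥ hδ))) refl
    ℓ≤ℓ' : ℓ ≤ ℓ'
    ℓ≤ℓ' = ≤-trans (≤-by δ≥0 (shift-sub ℓ δ)) ℓ+δ≤ℓ'
   dispatch : (∃[ t ] (t ∈ P × ((K + 1#) * ℓ ≤ K * Chord.height c t ⊎ (K + 1#) * ℓ ≤ K * - Chord.height c t))) ⊎ Saturated c → ∃[ ℓ' ] (0# < ℓ' × Σ (Chord ℓ') Saturated)
   dispatch (inj₂ f) = ℓ , ℓ>0 , c , f
   dispatch (inj₁ (t , t∈ , far)) = next (longer t t∈ far)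

  saturated-chord : ∀ {ℓ} → 0# < ℓ → Chord ℓ → ∃[ ℓ' ] (0# < ℓ' × Σ (Chord ℓ') Saturated)
  saturated-chord {ℓ} ℓ>0 c with recip (ν 2 * K + 1#) (((≤-lit 0# (ν 2)) ⊠ K≥0) ⊞≤< <-lit 0# 1#)
  ... | r , r>0 , re with recip (ℓ * r) (ℓ>0 ⊠< r>0)
  ...   | s , s>0 , se with archimedean ((Q + Q) * s)
  ...     | n , hn = loop (ℓ * r) n ℓ>0 (≤-reflexive (trans (id97 (ν 2 * K + 1#) ℓ r) (trans (cong (ℓ *_) re) (QP.*-identityʳ ℓ)))) (<⇒≤ (ℓ>0 ⊠< r>0))
     (<-by (((ℓ>0 ⊠< r>0) ⊠< diff> hn) ⊞< <⇒≤ ℓ>0) (trans (id98 (Q + Q) ℓ (ν n) (ℓ * r)) (trans (cong (λ z → ℓ * r * ν n - (Q + Q) * z + ℓ) (sym se)) (id99 (ℓ * r) (ν n) (Q + Q) s ℓ)))) c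

 interior-lattice-point : ∀ {k i b P} → Prob k i b P → 1 N.≤ i → ∃[ z ] HInt P (lat z)
 interior-lattice-point {P = P} pr 1≤i = go (Prob.ints pr) 1≤i where
  go : ∀ {i} → HasCard (λ z → HInt P (lat z)) i → 1 N.≤ i → ∃[ z ] HInt P (lat z)
  go ([] , _ , refl , _) ()
  go (z ∷ zs , _ , _ , f) _ = z , fst (f z) ∈0

 -- A short horizontal segment at an interior lattice point starts the descent; the unimodular map
 -- taking the final direction `v` to (1, 0) makes the saturated chord horizontal.
 reduce-to-wide : ∀ {k i b P} → 1 N.≤ k → 1 N.≤ i → Prob k i b P → (∀ {P'} → Prob k i b P' → Wide k P' → Concl k i b P') → Concl k i b P
 reduce-to-wide {k} {i} {b} {P} 1≤k 1≤i pr goal = conclude (saturated-chord ε>0 chord0) where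
  open Prob pr
  open Descent cv k 1≤k
  z1 = fst (fst (interior-lattice-point pr 1≤i))
  z2 = snd (fst (interior-lattice-point pr 1≤i))
  hz : HInt P (lat (z1 , z2))
  hz = snd (interior-lattice-point pr 1≤i)
  int : Interior P (lat (z1 , z2))
  int = HInt⇒Interior cv hz
  ε = fst int
  ε>0 : 0# < ε
  ε>0 = fst (snd int)
  nε≤0 : - ε ≤ 0#
  nε≤0 = QP.neg-antimono-≤ (<⇒≤ ε>0)
  chord0 : Chord ε
  chord0 = record { v1 = + 1 ; v2 = + 0 ; w1 = + 0 ; w2 = + 1 ; det = refl ; p1 = ι z1 ; p2 = ι z2
   ; start = HInt⇒HIn hz
   ; end = point≡ (id100 (ι z1) ε) (id101 (ι z2) ε) (Interior⇒box int cv ε 0# (≤-trans nε≤0 (<⇒≤ ε>0)) ≤-refl nε≤0 (<⇒≤ ε>0)) }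
  module Frame {ℓ : ℚ} (ℓ>0 : 0# < ℓ) (c : Chord ℓ) (sat : Saturated c) where
   open Chord c
   tdet : w2 Z.* v1 Z.- (Z.- w1) Z.* (Z.- v2) ≡ + 1
   tdet = trans (l w2 v1 w1 v2) (ι-inj (v1 Z.* w2 Z.- v2 Z.* w1) (+ 1) (trans (det2 v1 w2 v2 w1) det)) where
    l : ∀ a b c d → a Z.* b Z.- (Z.- c) Z.* (Z.- d) ≡ b Z.* a Z.- d Z.* c
    l = ℤS.solve-∀
   open Transform w2 (Z.- w1) (Z.- v2) v1 (+ 0) (+ 0) tdet
   q1 = fst (U (p1 , p2))
   q2 = snd (U (p1 , p2))
   hgt : ∀ t → snd (U t) - q2 ≡ height t
   hgt (x , y) = trans (cong (λ z → (z * x + ι v1 * y + 0#) - (z * p1 + ι v1 * p2 + 0#)) (ι-neg v2)) (id102 (ι v1) (ι v2) x y p1 p2)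
   endeq : U (p1 + ℓ * ι v1 , p2 + ℓ * ι v2) ≡ (q1 + ℓ , q2)
   endeq = cong₂ _,_ (trans (cong (λ z → ι w2 * (p1 + ℓ * ι v1) + z * (p2 + ℓ * ι v2) + 0#) (ι-neg w1)) (trans (id103 (ι v1) (ι v2) (ι w1) (ι w2) p1 p2 ℓ) (trans (cong (λ z → ι w2 * p1 + (- ι w1) * p2 + 0# + ℓ * z) det) (trans (cong (λ z → ι w2 * p1 + z * p2 + 0# + ℓ * 1#) (sym (ι-neg w1))) (cong (λ z → q1 + z) (QP.*-identityʳ ℓ))))))
            (trans (cong (λ z → z * (p1 + ℓ * ι v1) + ι v1 * (p2 + ℓ * ι v2) + 0#) (ι-neg v2)) (trans (id104 (ι v1) (ι v2) p1 p2 ℓ) (cong (λ z → z * p1 + ι v1 * p2 + 0#) (sym (ι-neg v2)))))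
   wide : Wide k (map U P)
   wide = record { p1 = q1 ; p2 = q2 ; ℓ = ℓ ; ℓ>0 = ℓ>0 ; start = HIn⁺ {P} {p1 , p2} start ; end = subst (HIn (map U P)) endeq (HIn⁺ {P} {p1 + ℓ * ι v1 , p2 + ℓ * ι v2} end)
    ; above = ab ; below = be } where
    ab' : ∀ {v} → ∃[ t ] (t ∈ P × v ≡ U t) → K * (snd v - q2) < (K + 1#) * ℓ
    ab' (t , t∈ , e) = subst (λ z → K * z < (K + 1#) * ℓ) (sym (trans (cong (λ z → snd z - q2) e) (hgt t))) (fst (sat t∈))
    ab : ∀ {v} → v ∈ map U P → K * (snd v - q2) < (K + 1#) * ℓ
    ab m = ab' (∈P.∈-map⁻ U m)
    be' : ∀ {v} → ∃[ t ] (t ∈ P × v ≡ U t) → K * (q2 - snd v) < (K + 1#) * ℓ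
    be' (t , t∈ , e) = subst (λ z → K * z < (K + 1#) * ℓ) (trans (cong -_ (sym (hgt t))) (trans (neg-sub (snd (U t)) q2) (cong (λ z → q2 - snd z) (sym e)))) (snd (sat t∈))
    be : ∀ {v} → v ∈ map U P → K * (q2 - snd v) < (K + 1#) * ℓ
    be m = be' (∈P.∈-map⁻ U m)
   result : Concl k i b P
   result = Concl⁻ cv (goal (Prob⁺ pr) wide)
  conclude : ∃[ ℓ ] (0# < ℓ × Σ (Chord ℓ) Saturated) → Concl k i b P
  conclude (ℓ , ℓ>0 , c , sat) = Frame.result ℓ>0 c sat

 -- Interior lattice points on horizontal levels.

 ⊕-comm : ∀ p q → p ⊕ q ≡ q ⊕ p
 ⊕-comm (a , b) (c , d) = cong₂ _,_ (QP.+-comm a c) (QP.+-comm b d)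

 weights-comm : ∀ s t → s + t ≡ 1# → t + s ≡ 1#
 weights-comm s t e = trans (QP.+-comm t s) e

 i<suc : ∀ i → i Z.< Z.suc i
 i<suc i = ZP.suc[i]≤j⇒i<j ZP.≤-refl

 +-cancelˡ-<ℤ : ∀ a {m n} → a Z.+ m Z.< a Z.+ n → m Z.< n
 +-cancelˡ-<ℤ a {m} {n} h with m ZP.<? n
 ... | yes p = p
 ... | no ¬p = ⊥-elim (ZP.<-irrefl refl (ZP.<-≤-trans h (ZP.+-monoʳ-≤ a (ZP.≮⇒≥ ¬p))))

 -- The ceiling of `q` minus 1, computed from the floor of `- q`.
 strictly-below : ∀ q → ∃[ z ] (ι z < q × q ≤ ι z + 1#)
 strictly-below q with floorℚ (- q)
 ... | f , lo , hi = Z.- f Z.- + 1 , <-by (diff> hi) (trans (cong (λ z → q - z) eq) (id105 q (ι f))) , ≤-by (diff≥ lo) (trans (cong (λ z → z + 1# - q) eq) (id106 q (ι f))) where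
  eq : ι (Z.- f Z.- + 1) ≡ - ι f - 1#
  eq = trans (ι-- (Z.- f) (+ 1)) (cong (_- 1#) (ι-neg f))

 search-first : ∀ {Q Q' : ℕ → Set} → (∀ n → Q n ⊎ Q' n) → ∀ N → (∃[ n ] (n N.≤ N × Q' n × (∀ {m} → m N.< n → Q m))) ⊎ (∀ {n} → n N.≤ N → Q n)
 search-first dec zero with dec 0
 ... | inj₁ q = inj₂ λ { N.z≤n → q }
 ... | inj₂ q' = inj₁ (0 , N.z≤n , q' , λ ())
 search-first dec (suc N) with search-first dec N
 ... | inj₁ (n , le , q' , f) = inj₁ (n , NP.m≤n⇒m≤1+n le , q' , f)
 ... | inj₂ f with dec (suc N)
 ...   | inj₁ q = inj₂ λ {n} le → [ (λ lt → f (NP.≤-pred lt)) , (λ { refl → q }) ]′ (NP.m≤n⇒m<n∨m≡n le)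
 ...   | inj₂ q' = inj₁ (suc N , NP.≤-refl , q' , λ lt → f (NP.≤-pred lt))

 consecutive : ℤ → ℤ → ℕ → List (ℤ × ℤ)
 consecutive s j zero = []
 consecutive s j (suc n) = (s , j) ∷ consecutive (Z.suc s) j n

 consecutive-bound : ∀ s j n {z} → z ∈ consecutive s j n → ∃[ m ] (m N.< n × z ≡ (s Z.+ + m , j))
 consecutive-bound s j (suc n) ∈0 = 0 , N.s≤s N.z≤n , cong (_, j) (sym (ZP.+-identityʳ s))
 consecutive-bound s j (suc n) (there m) with consecutive-bound (Z.suc s) j n m
 ... | m' , lt , refl = suc m' , N.s≤s lt , cong (_, j) (l s (+ m')) where
  l : ∀ s m → (+ 1 Z.+ s) Z.+ m ≡ s Z.+ (+ 1 Z.+ m)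
  l = ℤS.solve-∀

 consecutive-unique : ∀ s j n → Unique (consecutive s j n)
 consecutive-unique s j zero = AP.[]
 consecutive-unique s j (suc n) = All.tabulate (λ {z} m e → ne m (cong fst e)) AP.∷ consecutive-unique (Z.suc s) j n where
  ne : ∀ {z} → z ∈ consecutive (Z.suc s) j n → s ≢ fst z
  ne m e with consecutive-bound (Z.suc s) j n m
  ... | m' , _ , refl = ZP.<-irrefl e (ZP.<-≤-trans (i<suc s) (ZP.i≤i+j (Z.suc s) (+ m')))

 consecutive-length : ∀ s j n → length (consecutive s j n) ≡ n
 consecutive-length s j zero = refl
 consecutive-length s j (suc n) = cong suc (consecutive-length (Z.suc s) j n)

 count : ℤ → List (ℤ × ℤ) → ℕ
 count j zs = length (filter (λ z → snd z ZP.≟ j) zs)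

 countRange : ℤ → ℕ → List (ℤ × ℤ) → ℕ
 countRange a zero zs = 0
 countRange a (suc n) zs = count a zs N.+ countRange (Z.suc a) n zs

 count-cons-≡ : ∀ j z zs → snd z ≡ j → count j (z ∷ zs) ≡ suc (count j zs)
 count-cons-≡ j z zs e = cong length (LP.filter-accept (λ z → snd z ZP.≟ j) e)

 count-cons-≢ : ∀ j z zs → snd z ≢ j → count j (z ∷ zs) ≡ count j zs
 count-cons-≢ j z zs e = cong length (LP.filter-reject (λ z → snd z ZP.≟ j) e)

 countRange-below : ∀ a n z zs → snd z Z.< a → countRange a n (z ∷ zs) ≡ countRange a n zs
 countRange-below a zero z zs h = refl
 countRange-below a (suc n) z zs h = cong₂ N._+_ (count-cons-≢ a z zs (λ e → ZP.<-irrefl e h)) (countRange-below (Z.suc a) n z zs (ZP.<-trans h (i<suc a)))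

 countRange-cons : ∀ a n z zs → countRange a n (z ∷ zs) N.≤ suc (countRange a n zs)
 countRange-cons a zero z zs = N.z≤n
 countRange-cons a (suc n) z zs = go (snd z ZP.≟ a) where
  go : Dec (snd z ≡ a) → countRange a (suc n) (z ∷ zs) N.≤ suc (countRange a (suc n) zs)
  go (yes e) = NP.≤-reflexive (cong₂ N._+_ (count-cons-≡ a z zs e) (countRange-below (Z.suc a) n z zs (subst (Z._< Z.suc a) (sym e) (i<suc a))))
  go (no ne) = subst₂ N._≤_ (cong (N._+ countRange (Z.suc a) n (z ∷ zs)) (sym (count-cons-≢ a z zs ne))) (NP.+-suc (count a zs) (countRange (Z.suc a) n zs)) (NP.+-monoʳ-≤ (count a zs) (countRange-cons (Z.suc a) n z zs))

 countRange≤ : ∀ a n zs → countRange a n zs N.≤ length zs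
 countRange≤ a n [] = NP.≤-reflexive (go a n) where
  go : ∀ a n → countRange a n [] ≡ 0
  go a zero = refl
  go a (suc n) = go (Z.suc a) n
 countRange≤ a n (z ∷ zs) = NP.≤-trans (countRange-cons a n z zs) (N.s≤s (countRange≤ a n zs))

 HInt-convexʳ : ∀ P {p q} s t → 0# ≤ s → 0# < t → s + t ≡ 1# → HIn P p → HInt P q → HInt P ((s · p) ⊕ (t · q))
 HInt-convexʳ P {p} {q} s t hs ht e hp hq = subst (HInt P) (⊕-comm (t · q) (s · p)) (HInt-convex P t s ht hs (weights-comm s t e) hq hp)

 -- A point between an interior point and a point of the polygon on the same horizontal line.
 HInt-betweenʳ : ∀ P {x u y} m → HInt P (x , y) → HIn P (u , y) → x ≤ m → m < u → HInt P (m , y)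
 HInt-betweenʳ P {x} {u} {y} m hx hu h1 h2 with recip (u - x) (diff> (≤-<-trans h1 h2))
 ... | r , r>0 , e = subst (HInt P) (cong₂ _,_ (trans (id43 x u m r) (trans (cong (_* m) e) (QP.*-identityˡ m))) (trans (id107 x u m r y) (trans (cong (_* y) e) (QP.*-identityˡ y))))
    (HInt-convex P ((u - m) * r) ((m - x) * r) (diff> h2 ⊠< r>0) (diff≥ h1 ⊠ <⇒≤ r>0) (trans (id42 x u m r) e) hx hu)

 HInt-betweenˡ : ∀ P {x u y} m → HInt P (x , y) → HIn P (u , y) → m ≤ x → u < m → HInt P (m , y)
 HInt-betweenˡ P {x} {u} {y} m hx hu h1 h2 with recip (x - u) (diff> (<-≤-trans h2 h1))
 ... | r , r>0 , e = subst (HInt P) (cong₂ _,_ (trans (id108 x u m r) (trans (cong (_* m) e) (QP.*-identityˡ m))) (trans (id109 x u m r y) (trans (cong (_* y) e) (QP.*-identityˡ y))))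
    (HInt-convex P ((m - u) * r) ((x - m) * r) (diff> h2 ⊠< r>0) (diff≥ h1 ⊠ <⇒≤ r>0) (trans (id110 x u m r) e) hx hu)

 HIn-levels : ∀ {P B T} → ConvexCCW P → Levels P B T → ∀ {x y} → HIn P (x , y) → B ≤ y × y ≤ T
 HIn-levels {P} {B} {T} cv L {x} {y} h =
   ≤-by (HIn-affine cv 0# 1# (- B) (λ {v} m → subst (0# ≤_) (id111 (fst v) (snd v) B) (diff≥ (≥bot m))) h) (id111 x y B)
  , ≤-by (HIn-affine cv 0# (- 1#) T (λ {v} m → subst (0# ≤_) (id90 (fst v) (snd v) T) (diff≥ (≤top m))) h) (id90 x y T) where
  open Levels L

 HInt-levels : ∀ {P B T} → ConvexCCW P → Levels P B T → ∀ {x y} → HInt P (x , y) → B < y × y < T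
 HInt-levels {P} {B} {T} cv L {x} {y} h = <-by (ε>0 ⊞< diff≥ (fst (HIn-levels cv L (box 0# (- ε) nε≤0 (<⇒≤ ε>0) ≤-refl (≤-trans nε≤0 (<⇒≤ ε>0)))))) (id112 y B ε)
   , <-by (ε>0 ⊞< diff≥ (snd (HIn-levels cv L (box 0# ε nε≤0 (<⇒≤ ε>0) (≤-trans nε≤0 (<⇒≤ ε>0)) ≤-refl)))) (id113 y T ε) where
  int : Interior P (x , y)
  int = HInt⇒Interior cv h
  ε = fst int
  ε>0 : 0# < ε
  ε>0 = fst (snd int)
  nε≤0 : - ε ≤ 0#
  nε≤0 = QP.neg-antimono-≤ (<⇒≤ ε>0)
  box = Interior⇒box int cv

 -- Here `l` and `r` are the first non-interior lattice points met to the left and to the right on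
 -- level `j`. An edge violated at each of them supplies a line through it that bounds P, so `c`
 -- interior points on the level limit the width of P at every height.
 record LevelData (P : List Point) (j : ℤ) (c : ℕ) : Set where
  field
   l r : ℤ
   s t : ℚ
   lines : Lines P (ι j) (ι l) s (ι r) t
   l<r : l Z.< r
   width : ι r - ι l ≤ ν c + 1#
   between : ∀ m → l Z.< m → m Z.< r → HInt P (lat (m , j))

 module LevelAnalysis {k i b : ℕ} {P : List Point} (pr : Prob k i b P) {B T : ℚ} (L : Levels P B T) (z0 : ℤ × ℤ) (hz0 : HInt P (lat z0)) where
  open Prob pr
  open Levels L

  zs : List (ℤ × ℤ)
  zs = fst ints

  cnt : ℤ → ℕ
  cnt j = count j zs

  run-count : ∀ s j n → (∀ {m} → m N.< n → HInt P (lat (s Z.+ + m , j))) → n N.≤ cnt j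
  run-count s j n f = subst (N._≤ cnt j) (consecutive-length s j n) (unique-⊆-length (consecutive-unique s j n) sub) where
   sub : ∀ {z} → z ∈ consecutive s j n → z ∈ filter (λ z → snd z ZP.≟ j) zs
   sub m with consecutive-bound s j n m
   ... | m' , lt , refl = ∈P.∈-filter⁺ (λ z → snd z ZP.≟ j) (snd (snd (snd (snd ints)) (s Z.+ + m' , j)) (f lt)) refl

  cnt≤i : ∀ j → cnt j N.≤ i
  cnt≤i j = subst (cnt j N.≤_) (fst (snd (snd ints))) (LP.length-filter (λ z → snd z ZP.≟ j) zs)

  interior-on-level : ∀ {j} → B < j → j < T → ∃[ x ] HInt P (x , j)
  interior-on-level {j} h1 h2 = go (QP.<-cmp Z j) where
   Z = ι (snd z0)
   up : Z < j → ∃[ r ] (0# < r × (snd top - Z) * r ≡ 1#) → ∃[ x ] HInt P (x , j)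
   up lt (r , r>0 , e) = fst (at-level (lat z0) top j r) , subst (λ y → HInt P (fst (at-level (lat z0) top j r) , y)) (at-level-y (lat z0) top j r e)
     (HInt-convex P {lat z0} {top} ((snd top - j) * r) ((j - Z) * r) (diff> (subst (j <_) (sym top≡) h2) ⊠< r>0) (diff≥ (<⇒≤ lt) ⊠ <⇒≤ r>0) (at-level-weights (lat z0) top j r e) hz0 (vertex-HIn cv top∈))
   down : j < Z → ∃[ r ] (0# < r × (Z - snd bot) * r ≡ 1#) → ∃[ x ] HInt P (x , j)
   down gt (r , r>0 , e) = fst (at-level bot (lat z0) j r) , subst (λ y → HInt P (fst (at-level bot (lat z0) j r) , y)) (at-level-y bot (lat z0) j r e)
     (HInt-convexʳ P {bot} {lat z0} ((Z - j) * r) ((j - snd bot) * r) (diff≥ (<⇒≤ gt) ⊠ <⇒≤ r>0) (diff> (subst (_< j) (sym bot≡) h1) ⊠< r>0) (at-level-weights bot (lat z0) j r e) (vertex-HIn cv bot∈) hz0)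
   go : Tri (Z < j) (Z ≡ j) (j < Z) → ∃[ x ] HInt P (x , j)
   go (tri≈ _ e _) = ι (fst z0) , subst (λ y → HInt P (ι (fst z0) , y)) e hz0
   go (tri< lt _ _) = up lt (recip (snd top - Z) (diff> (<-trans lt (subst (j <_) (sym top≡) h2))))
   go (tri> _ _ gt) = down gt (recip (Z - snd bot) (diff> (<-trans (subst (_< j) (sym bot≡) h1) gt)))

  NotInt : Point → Set
  NotInt q = ∃[ a ] ∃[ b ] ((a , b) ∈ edges P × orient a b q ≤ 0#)

  ¬both : ∀ {q} → HInt P q → NotInt q → ⊥
  ¬both h (_ , _ , m , l) = <-irrefl refl (<-≤-trans (left< h m) l)

  -- The edge that fails to have (r, j) strictly on its left has the interior point (x, j) there,
  -- with x < r, so it is directed upwards. Moved parallel to pass through (r, j), it still has P on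
  -- its left.
  right-line : ∀ {x r j} → HInt P (x , j) → NotInt (r , j) → x < r → ∃[ t ] (∀ {q} → HIn P q → fst q ≤ r + t * (snd q - j))
  right-line {x} {r} {j} hx (a , b , m , h) x<r = go (recip dy dy>0) where
   dy = snd b - snd a
   dx = fst b - fst a
   dy>0 : 0# < dy
   dy>0 = 0<-cancel (diff> x<r) (subst (0# <_) (sym (id114 (fst a) (snd a) (fst b) (snd b) x r j)) (diff> (≤-<-trans h (left< hx m))))
   go : ∃[ ρ ] (0# < ρ × dy * ρ ≡ 1#) → ∃[ t ] (∀ {q} → HIn P q → fst q ≤ r + t * (snd q - j))
   go (ρ , ρ>0 , e) = dx * ρ , λ {q} hq → ≤-by (<⇒≤ ρ>0 ⊠ diff≥ (≤-trans h (left hq m)))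
    (trans (id115 dx ρ r j (fst q) (snd q)) (trans (cong (λ z → dx * ρ * (snd q - j) - z * (fst q - r)) (sym e)) (id116 (fst a) (snd a) dx dy ρ r j (fst q) (snd q))))

  left-line : ∀ {x r j} → HInt P (x , j) → NotInt (r , j) → r < x → ∃[ t ] (∀ {q} → HIn P q → r + t * (snd q - j) ≤ fst q)
  left-line {x} {r} {j} hx (a , b , m , h) r<x = go (recip dy' dy'>0) where
   dy = snd b - snd a
   dx = fst b - fst a
   dy' = - dy
   dy'>0 : 0# < dy'
   dy'>0 = 0<-cancel (diff> r<x) (subst (0# <_) (sym (id117 (fst a) (snd a) (fst b) (snd b) x r j)) (diff> (≤-<-trans h (left< hx m))))
   go : ∃[ ρ ] (0# < ρ × dy' * ρ ≡ 1#) → ∃[ t ] (∀ {q} → HIn P q → r + t * (snd q - j) ≤ fst q)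
   go (ρ , ρ>0 , e) = (- dx) * ρ , λ {q} hq → ≤-by (<⇒≤ ρ>0 ⊠ diff≥ (≤-trans h (left hq m)))
    (trans (id118 dx ρ r j (fst q) (snd q)) (trans (cong (λ z → z * (fst q - r) - (- dx) * ρ * (snd q - j)) (sym e)) (id119 (fst a) (snd a) dx dy ρ r j (fst q) (snd q))))

  no-long-run : ∀ s j → ¬ (∀ {m} → m N.≤ i → HInt P (lat (s Z.+ + m , j)))
  no-long-run s j f = NP.<-irrefl refl (NP.≤-trans (run-count s j (suc i) (λ lt → f (NP.≤-pred lt))) (cnt≤i j))

  sucnat : ∀ m n → m Z.- + n ≡ Z.suc (m Z.- + suc n) Z.+ + 0
  sucnat m n = e m (+ n) where
   e : ∀ m n → m Z.- n ≡ (+ 1 Z.+ (m Z.- (+ 1 Z.+ n))) Z.+ + 0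
   e = ℤS.solve-∀

  right-of : ∀ {j x} m0 → HInt P (x , ι j) → x < ι m0 + 1# → ∀ nl nr → NotInt (lat (Z.suc (m0 Z.- + nl) Z.+ + nr , j)) →
   (∀ {m} → m N.< nl → HInt P (lat (m0 Z.- + m , j))) → (∀ {m} → m N.< nr → HInt P (lat (Z.suc (m0 Z.- + nl) Z.+ + m , j))) → ¬ (ι (Z.suc (m0 Z.- + nl) Z.+ + nr) ≤ x)
  right-of {j} {x} m0 hx hi zero zero notr fl fr r≤x = <-irrefl refl (≤-<-trans r≤x (subst (x <_) (trans (sym (ι-suc m0)) (cong ι (e m0))) hi)) where
   e : ∀ m → + 1 Z.+ m ≡ (+ 1 Z.+ (m Z.- + 0)) Z.+ + 0
   e = ℤS.solve-∀
  right-of {j} {x} m0 hx hi (suc n) zero notr fl fr r≤x = ¬both (subst (λ z → HInt P (lat (z , j))) (sucnat m0 n) (fl (NP.n<1+n n))) notr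
  right-of {j} {x} m0 hx hi nl (suc n) notr fl fr r≤x = ¬both (HInt-betweenˡ P (ι (Z.suc (m0 Z.- + nl) Z.+ + suc n)) hx (HInt⇒HIn (fr {0} (N.s≤s N.z≤n))) r≤x
   (ι-< (Z.suc (m0 Z.- + nl) Z.+ + 0) (Z.suc (m0 Z.- + nl) Z.+ + suc n) (ZP.+-monoʳ-< (Z.suc (m0 Z.- + nl)) (Z.+<+ (N.s≤s N.z≤n))))) notr

  module Run (j : ℤ) (x : ℚ) (hx : HInt P (x , ι j)) (m0 : ℤ) (lo : ι m0 ≤ x) (hi : x < ι m0 + 1#)
        (nl : ℕ) (notl : NotInt (lat (m0 Z.- + nl , j))) (fl : ∀ {m} → m N.< nl → HInt P (lat (m0 Z.- + m , j)))
        (nr : ℕ) (notr : NotInt (lat (Z.suc (m0 Z.- + nl) Z.+ + nr , j))) (fr : ∀ {m} → m N.< nr → HInt P (lat (Z.suc (m0 Z.- + nl) Z.+ + m , j))) where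
   l r : ℤ
   l = m0 Z.- + nl
   r = Z.suc l Z.+ + nr
   l≤x : ι l ≤ x
   l≤x = ≤-trans (ι-≤ l m0 (ZP.i-j≤i m0 (+ nl))) lo
   l<x : ι l < x
   l<x = go (QP.<-cmp (ι l) x) where
    go : Tri (ι l < x) (ι l ≡ x) (x < ι l) → ι l < x
    go (tri< h _ _) = h
    go (tri≈ _ e _) = ⊥-elim (¬both hx (subst (λ z → NotInt (z , ι j)) e notl))
    go (tri> _ _ h) = ⊥-elim (<-irrefl refl (<-≤-trans h l≤x))
   ιr : ι r ≡ ι l + 1# + ν nr
   ιr = trans (ι-+ (Z.suc l) (+ nr)) (cong (_+ ν nr) (ι-suc l))
   weq : ι r - ι l ≡ ν nr + 1#
   weq = trans (cong (_- ι l) ιr) (id120 (ι l) (ν nr))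
   x<r : x < ι r
   x<r = ≰⇒> (right-of {j} {x} m0 hx hi nl nr notr fl fr)
   rl = right-line hx notr x<r
   ll = left-line hx notl l<x
   btw : ∀ m → l Z.< m → m Z.< r → HInt P (lat (m , j))
   btw m h1 h2 = go Z.∣ m Z.- Z.suc l ∣ (ZP.0≤i⇒+∣i∣≡i (ZP.i≤j⇒0≤j-i (ZP.i<j⇒suc[i]≤j h1))) where
    cc : ∀ a m → a Z.+ (m Z.- a) ≡ m
    cc = ℤS.solve-∀
    go : ∀ n → + n ≡ m Z.- Z.suc l → HInt P (lat (m , j))
    go n e = subst (λ z → HInt P (lat (z , j))) eqm (fr {n} (ZP.drop‿+<+ (+-cancelˡ-<ℤ (Z.suc l) (subst (Z._< r) (sym eqm) h2)))) where
     eqm : Z.suc l Z.+ + n ≡ m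
     eqm = trans (cong (λ z → Z.suc l Z.+ z) e) (cc (Z.suc l) m)
   result : LevelData P j (cnt j)
   result = record
    { l = l ; r = r ; s = fst ll ; t = fst rl ; lines = record { on-left = snd ll ; on-right = snd rl }
    ; l<r = ZP.<-≤-trans (i<suc l) (ZP.i≤i+j (Z.suc l) (+ nr))
    ; width = ≤-trans (≤-reflexive weq) (QP.+-monoˡ-≤ 1# (ν-≤ nr (cnt j) (run-count (Z.suc l) j nr fr)))
    ; between = btw }

  -- From the floor of an interior abscissa the search goes left and then right. Both searches stop
  -- within i steps, since i + 1 consecutive interior points would exceed the total.
  level-data : ∀ j → B < ι j → ι j < T → LevelData P j (cnt j)
  level-data j h1 h2 = fromInterior (interior-on-level h1 h2) where
   Left : ℤ → ℕ → Set
   Left m0 n = HInt P (lat (m0 Z.- + n , j))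
   Right : ℤ → ℕ → ℕ → Set
   Right m0 nl n = HInt P (lat (Z.suc (m0 Z.- + nl) Z.+ + n , j))
   NotLeft : ℤ → ℕ → Set
   NotLeft m0 n = NotInt (lat (m0 Z.- + n , j))
   NotRight : ℤ → ℕ → ℕ → Set
   NotRight m0 nl n = NotInt (lat (Z.suc (m0 Z.- + nl) Z.+ + n , j))
   eq : ∀ m0 m → m N.≤ i → m0 Z.- + (i ∸ m) ≡ m0 Z.- + i Z.+ + m
   eq m0 m le = trans (cong (λ z → m0 Z.- z) (sym (trans (ZP.m-n≡m⊖n i m) (ZP.⊖-≥ le)))) (l m0 (+ i) (+ m)) where
    l : ∀ a b c → a Z.- (b Z.- c) ≡ a Z.- b Z.+ c
    l = ℤS.solve-∀
   fromRight : ∀ x (hx : HInt P (x , ι j)) m0 → ι m0 ≤ x → x < ι m0 + 1# → ∀ nl → NotLeft m0 nl → (∀ {m} → m N.< nl → Left m0 m) →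
    (∃[ n ] (n N.≤ i × NotRight m0 nl n × (∀ {m} → m N.< n → Right m0 nl m))) ⊎ (∀ {n} → n N.≤ i → Right m0 nl n) → LevelData P j (cnt j)
   fromRight x hx m0 lo hi nl notl fl (inj₂ f) = ⊥-elim (no-long-run (Z.suc (m0 Z.- + nl)) j f)
   fromRight x hx m0 lo hi nl notl fl (inj₁ (nr , _ , notr , fr)) = Run.result j x hx m0 lo hi nl notl fl nr notr fr
   fromLeft : ∀ x (hx : HInt P (x , ι j)) m0 → ι m0 ≤ x → x < ι m0 + 1# →
    (∃[ n ] (n N.≤ i × NotLeft m0 n × (∀ {m} → m N.< n → Left m0 m))) ⊎ (∀ {n} → n N.≤ i → Left m0 n) → LevelData P j (cnt j)
   fromLeft x hx m0 lo hi (inj₂ f) = ⊥-elim (no-long-run (m0 Z.- + i) j (λ {m} le → subst (λ z → HInt P (lat (z , j))) (eq m0 m le) (f (NP.m∸n≤m i m))))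
   fromLeft x hx m0 lo hi (inj₁ (nl , _ , notl , fl)) = fromRight x hx m0 lo hi nl notl fl
    (search-first {Right m0 nl} {NotRight m0 nl} (λ n → HInt? P (lat (Z.suc (m0 Z.- + nl) Z.+ + n , j))) i)
   fromFloor : ∀ x (hx : HInt P (x , ι j)) → ∃[ m ] (ι m ≤ x × x < ι m + 1#) → LevelData P j (cnt j)
   fromFloor x hx (m0 , lo , hi) = fromLeft x hx m0 lo hi (search-first {Left m0} {NotLeft m0} (λ n → HInt? P (lat (m0 Z.- + n , j))) i)
   fromInterior : ∃[ x ] HInt P (x , ι j) → LevelData P j (cnt j)
   fromInterior (x , hx) = fromFloor x hx (floorℚ x)

  -- A horizontal section of length greater than 1 at an interior level contains an interior lattice point.
  long-section : ∀ j → B < ι j → ι j < T → ∀ {u v} → HIn P (u , ι j) → HIn P (v , ι j) → u + 1# < v → 1 N.≤ cnt j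
  long-section j h1 h2 {u} {v} hu hv lt = go (interior-on-level h1 h2) (floorℚ u) where
   go : ∃[ x ] HInt P (x , ι j) → ∃[ m ] (ι m ≤ u × u < ι m + 1#) → 1 N.≤ cnt j
   go (x , hx) (m , lo , hi) = run-count (Z.suc m) j 1 λ { (N.s≤s N.z≤n) → subst (λ z → HInt P (lat (z , j))) (sym (ZP.+-identityʳ (Z.suc m))) (pick (≤-total x (ι (Z.suc m)))) } where
    u<m : u < ι (Z.suc m)
    u<m = subst (u <_) (sym (ι-suc m)) hi
    m<v : ι (Z.suc m) < v
    m<v = ≤-<-trans (subst (_≤ u + 1#) (sym (ι-suc m)) (QP.+-monoˡ-≤ 1# lo)) lt
    pick : x ≤ ι (Z.suc m) ⊎ ι (Z.suc m) ≤ x → HInt P (ι (Z.suc m) , ι j)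
    pick (inj₁ le) = HInt-betweenʳ P (ι (Z.suc m)) hx hv le m<v
    pick (inj₂ ge) = HInt-betweenˡ P (ι (Z.suc m)) hx hu ge u<m

  module _ (w : Wide k P) (1≤k : 1 N.≤ k) where
   private module W = Wide w
   K = ν k

   K>0 : 0# < K
   K>0 = <-≤-trans (<-lit 0# 1#) (ν-≤ 1 k 1≤k)

   section : ∀ j → B < ι j → ι j < T → ∀ {t1 t2} s → HIn P (t1 , t2) → 0# ≤ s → 0# ≤ 1# - s → (1# - s) * W.p2 + s * t2 ≡ ι j → 1# < (1# - s) * W.ℓ → 1 N.≤ cnt j
   section j h1 h2 {t1} {t2} s ht hs hs' e len = long-section j h1 h2
     (subst (λ y → HIn P ((1# - s) * W.p1 + s * t1 , y)) e (HIn-convex P (1# - s) s hs' hs (complement s) W.start ht))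
     (subst (λ y → HIn P ((1# - s) * (W.p1 + W.ℓ) + s * t1 , y)) e (HIn-convex P (1# - s) s hs' hs (complement s) W.end ht))
     (<-by (diff> len) (id121 s W.p1 W.ℓ t1))

   integral-gap : ∀ {x y} → IsIntegral x → IsIntegral y → x < y → x + 1# ≤ y
   integral-gap (a , refl) (b , refl) h = ι-discrete a b h

   integral-level : ∀ j → IsIntegral (K * ι j)
   integral-level j = + k Z.* j , sym (ι-* (+ k) j)

   integral-next : ∀ j → IsIntegral (K * (ι j + 1#))
   integral-next j = + k Z.* Z.suc j , trans (cong (K *_) (sym (ι-suc j))) (sym (ι-* (+ k) (Z.suc j)))

   integral-T : IsIntegral (K * T)
   integral-T = subst (λ z → IsIntegral (K * z)) top≡ (snd (integral top∈))

   integral-B : IsIntegral (K * B)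
   integral-B = subst (λ z → IsIntegral (K * z)) bot≡ (snd (integral bot∈))

   scaled< : ∀ {x y} → x < y → K * x < K * y
   scaled< {x} {y} h = <-by (K>0 ⊠< diff> h) (id122 K x y)

   -- The triangle over the chord with its tip at height T meets level j in length ℓ (T - j)/(T -
   -- p2). As k T is an integer and T > j + 1, the numerator factor T - j is at least 1 + 1/k, while
   -- T - p2 is less than (1 + 1/k) ℓ. So the section is longer than 1.
   nonempty-above : ∀ j → B < ι j → W.p2 ≤ ι j → ι j + 1# < T → 1 N.≤ cnt j
   nonempty-above j h1 h2 h3 = go (recip (T - W.p2) (diff> (≤-<-trans h2 j<T))) where
    J = ι j
    j<T : J < T
    j<T = <-trans (<-by (<-lit 0# 1#) (id123 J)) h3
    go : ∃[ r ] (0# < r × (T - W.p2) * r ≡ 1#) → 1 N.≤ cnt j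
    go (r , r>0 , e) = section j h1 j<T {fst top} {T} ((ι j - W.p2) * r) (subst (λ y → HIn P (fst top , y)) top≡ (vertex-HIn cv top∈))
     (diff≥ h2 ⊠ <⇒≤ r>0) (subst (0# ≤_) (sym 1-s) (diff≥ (<⇒≤ j<T) ⊠ <⇒≤ r>0)) lev (subst (λ z → 1# < z * W.ℓ) (sym 1-s) len) where
     1-s : 1# - (J - W.p2) * r ≡ (T - J) * r
     1-s = trans (cong (_- (J - W.p2) * r) (sym e)) (id124 T W.p2 J r)
     lev : (1# - (J - W.p2) * r) * W.p2 + (J - W.p2) * r * T ≡ J
     lev = trans (cong (λ z → z * W.p2 + (J - W.p2) * r * T) 1-s) (trans (id125 T W.p2 J r) (trans (cong (_* J) e) (QP.*-identityˡ J)))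
     gap : K * (J + 1#) + 1# ≤ K * T
     gap = integral-gap (integral-next j) integral-T (scaled< h3)
     up : K * (T - W.p2) < (K + 1#) * W.ℓ
     up = subst (λ z → K * (z - W.p2) < (K + 1#) * W.ℓ) top≡ (W.above top∈)
     len : 1# < (T - J) * r * W.ℓ
     len = <-by (0<-cancel K>0 (subst (0# <_) (sym (trans (cong (λ z → K * ((T - J) * r * W.ℓ - z)) (sym e)) (id126 K T J W.p2 r W.ℓ))) (r>0 ⊠< (diff> up ⊞< (diff≥ gap ⊠ <⇒≤ W.ℓ>0))))) refl

   nonempty-below : ∀ j → ι j < T → ι j ≤ W.p2 → B < ι j - 1# → 1 N.≤ cnt j
   nonempty-below j h1 h2 h3 = go (recip (W.p2 - B) (diff> (<-≤-trans B<j h2))) where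
    J = ι j
    B<j : B < J
    B<j = <-trans h3 (<-by (<-lit 0# 1#) (id127 J))
    go : ∃[ r ] (0# < r × (W.p2 - B) * r ≡ 1#) → 1 N.≤ cnt j
    go (r , r>0 , e) = section j B<j h1 {fst bot} {B} ((W.p2 - ι j) * r) (subst (λ y → HIn P (fst bot , y)) bot≡ (vertex-HIn cv bot∈))
     (diff≥ h2 ⊠ <⇒≤ r>0) (subst (0# ≤_) (sym 1-s) (diff≥ (<⇒≤ B<j) ⊠ <⇒≤ r>0)) lev (subst (λ z → 1# < z * W.ℓ) (sym 1-s) len) where
     1-s : 1# - (W.p2 - J) * r ≡ (J - B) * r
     1-s = trans (cong (_- (W.p2 - J) * r) (sym e)) (id128 B W.p2 J r)
     lev : (1# - (W.p2 - J) * r) * W.p2 + (W.p2 - J) * r * B ≡ J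
     lev = trans (cong (λ z → z * W.p2 + (W.p2 - J) * r * B) 1-s) (trans (id129 B W.p2 J r) (trans (cong (_* J) e) (QP.*-identityˡ J)))
     gap : K * B + 1# ≤ K * (J - 1#)
     gap = integral-gap integral-B (+ k Z.* (j Z.- + 1) , trans (cong (K *_) (sym (ι-- j (+ 1)))) (sym (ι-* (+ k) (j Z.- + 1)))) (scaled< h3)
     dn : K * (W.p2 - B) < (K + 1#) * W.ℓ
     dn = subst (λ z → K * (W.p2 - z) < (K + 1#) * W.ℓ) bot≡ (W.below bot∈)
     len : 1# < (J - B) * r * W.ℓ
     len = <-by (0<-cancel K>0 (subst (0# <_) (sym (trans (cong (λ z → K * ((J - B) * r * W.ℓ - z)) (sym e)) (id130 K B J W.p2 r W.ℓ))) (r>0 ⊠< (diff> dn ⊞< (diff≥ gap ⊠ <⇒≤ W.ℓ>0))))) refl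

   nonempty : ∀ j → B < ι j - 1# → ι j + 1# < T → 1 N.≤ cnt j
   nonempty j h1 h2 = go (≤-total W.p2 (ι j)) where
    go : W.p2 ≤ ι j ⊎ ι j ≤ W.p2 → 1 N.≤ cnt j
    go (inj₁ le) = nonempty-above j (<-trans h1 (<-by (<-lit 0# 1#) (id127 (ι j)))) le h2
    go (inj₂ ge) = nonempty-below j (<-trans (<-by (<-lit 0# 1#) (id123 (ι j))) h2) ge h1

 -- Numerical estimates for the parts beyond the extreme levels.

 c¾ c⁷⁄₄ c¹¹⁄₈ c²⁷⁄₈ c¹³⁄₄ c³⁄₂ : ℚ
 c¾ = + 3 / 4
 c⁷⁄₄ = + 7 / 4
 c¹¹⁄₈ = + 11 / 8
 c²⁷⁄₈ = + 27 / 8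
 c¹³⁄₄ = + 13 / 4
 c³⁄₂ = + 3 / 2

 -- Areas (doubled) of the two ways to cover the part of the polygon beyond the line half a unit below
 -- the last interior level: α, β bound the widths on the last two interior levels, s, s1 the outward
 -- slopes of the width there, and τ is the height of the polygon above the last interior level.
 own split : ℚ → ℚ → ℚ → ℚ → ℚ → ℚ
 own α s β s1 τ = (τ + ½) * (ν 2 * α + s * (τ - ½))
 split α s β s1 τ = ν 4 * α * τ + (½ - τ) * (ν 2 * β + s1 * (c³⁄₂ - τ))

 0≤½ : 0# ≤ ½
 0≤½ = ≤-lit 0# ½

 0≤¾ : 0# ≤ c¾
 0≤¾ = ≤-lit 0# c¾

 own-neg : ∀ α s β s1 τ → 0# ≤ α → s ≤ 0# → ½ ≤ τ → τ ≤ 1# → own α s β s1 τ ≤ ν 3 * α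
 own-neg α s β s1 τ hα hs h1 h2 = ≤-by (((≤-lit 0# (ν 2) ⊠ hα) ⊠ diff≥ h2) ⊞ (diff≥ hs ⊠ ((≤-trans 0≤½ h1 ⊞ 0≤½) ⊠ diff≥ h1))) (id131 α s τ)

 own-pos : ∀ α s β s1 τ → 0# ≤ α → 0# ≤ s → ½ ≤ τ → τ ≤ 1# → own α s β s1 τ ≤ ν 3 * α + c¾ * s
 own-pos α s β s1 τ hα hs h1 h2 = ≤-by (((≤-lit 0# (ν 2) ⊠ hα) ⊠ diff≥ h2) ⊞ (hs ⊠ (diff≥ h2 ⊠ (≤-lit 0# 1# ⊞ ≤-trans 0≤½ h1)))) (id132 α s τ)

 own-bound : ∀ α s β s1 τ E → 0# ≤ α → ½ ≤ τ → τ ≤ 1# → ν 3 * α ≤ E → ν 3 * α + c¾ * s ≤ E → own α s β s1 τ ≤ E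
 own-bound α s β s1 τ E hα h1 h2 e1 e2 = [ (λ h → ≤-trans (own-neg α s β s1 τ hα h h1 h2) e1) , (λ h → ≤-trans (own-pos α s β s1 τ hα h h1 h2) e2) ]′ (≤-total s 0#)

 -- The unit-width case, sharpened by μ ≤ 1 when the width decreases outwards at rate at least μ.
 own-unit : ∀ s β s1 τ μ → 0# ≤ μ → μ ≤ 1# → s ≤ - μ → ½ ≤ τ → τ ≤ 1# → own 1# s β s1 τ ≤ ν 3 - c¾ * μ
 own-unit s β s1 τ μ h0 h1 h2 h3 h4 = ≤-by ((diff≥ h4 ⊠ ((≤-lit 0# (ν 2) ⊠ diff≥ h1) ⊞ (h0 ⊠ diff≥ h4))) ⊞ (diff≥ h2 ⊠ (diff≥ h3 ⊠ (≤-trans 0≤½ h3 ⊞ 0≤½)))) (id133 s τ μ)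

 -- For s1 ≥ 0 the area is at most the mean, with weights 2 τ and 1 - 2 τ, of its values 2 α at τ =
 -- 1/2 and β + (3/4) s1 at τ = 0; for s1 ≤ 0 the latter value is replaced by β.
 split-bound : ∀ α s β s1 τ E → 0# ≤ τ → τ ≤ ½ → ν 2 * α ≤ E → β ≤ E → β + c¾ * s1 ≤ E → split α s β s1 τ ≤ E
 split-bound α s β s1 τ E h0 h1 e1 e2 e3 = [ neg , pos ]′ (≤-total s1 0#) where
  mix : ∀ b → b ≤ E → 0# ≤ ν 2 * τ * (E - ν 2 * α) + ν 2 * (½ - τ) * (E - b)
  mix b h = ((≤-lit 0# (ν 2) ⊠ h0) ⊠ diff≥ e1) ⊞ ((≤-lit 0# (ν 2) ⊠ diff≥ h1) ⊠ diff≥ h)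
  neg : s1 ≤ 0# → split α s β s1 τ ≤ E
  neg h = ≤-by (mix β e2 ⊞ (diff≥ h1 ⊠ ((≤-lit 0# 1# ⊞ diff≥ h1) ⊠ diff≥ h))) (id134 α β s1 τ E)
  pos : 0# ≤ s1 → split α s β s1 τ ≤ E
  pos h = ≤-by (mix (β + c¾ * s1) e3 ⊞ (diff≥ h1 ⊠ (h ⊠ h0))) (id135 α β s1 τ E)

 -- One end of a polygon with at least four interior levels.
 end-wide : ∀ α s β s1 τ → 1# ≤ α → ν 2 ≤ β → ν 3 * s ≤ α → ν 2 * s1 ≤ β → 0# ≤ τ → τ ≤ 1# →
  (½ ≤ τ → own α s β s1 τ ≤ ν 3 * β + ν 5 * α - + 31 / 4) × (τ ≤ ½ → split α s β s1 τ ≤ ν 3 * β + ν 5 * α - + 31 / 4)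
 end-wide α s β s1 τ hα hβ hs hs1 h0 h1 =
   (λ h → own-bound α s β s1 τ E (≤-trans (≤-lit 0# 1#) hα) h h1 (≤-by (((≤-lit 0# (ν 3) ⊠ b) ⊞ (≤-lit 0# (ν 2) ⊠ a)) ⊞ ≤-lit 0# (+ 1 / 4)) (id136 α β))
     (≤-by (((≤-lit 0# (ν 3) ⊠ b) ⊞ (≤-lit 0# c⁷⁄₄ ⊠ a)) ⊞ (≤-lit 0# (+ 1 / 4) ⊠ diff≥ hs)) (id137 α s β)))
  , (λ h → split-bound α s β s1 τ E h0 h (≤-by (((≤-lit 0# (ν 3) ⊠ b) ⊞ (≤-lit 0# (ν 3) ⊠ a)) ⊞ ≤-lit 0# (+ 5 / 4)) (id138 α β))
     (≤-by (((≤-lit 0# (ν 2) ⊠ b) ⊞ (≤-lit 0# (ν 5) ⊠ a)) ⊞ ≤-lit 0# (+ 5 / 4)) (id139 α β))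
     (≤-by ((((≤-lit 0# (+ 13 / 8) ⊠ b) ⊞ (≤-lit 0# (ν 5) ⊠ a)) ⊞ (≤-lit 0# (+ 3 / 8) ⊠ diff≥ hs1)) ⊞ ≤-lit 0# (+ 1 / 2)) (id140 α β s1))) where
  E = ν 3 * β + ν 5 * α - + 31 / 4
  a : 0# ≤ α - 1#
  a = diff≥ hα
  b : 0# ≤ β - ν 2
  b = diff≥ hβ

 -- Three interior levels with widths α, β, α' and at least two interior points: the two ends together.
 module Three (α s β σ τ α' s' τ' : ℚ) (hα : 1# ≤ α) (hα' : 1# ≤ α') (hβ : ν 2 ≤ β) (many : ν 5 ≤ β + α + α')
        (hs : ν 2 * s ≤ α) (hs' : ν 2 * s' ≤ α') (hσ : σ * (1# + τ') ≤ β) (hσ' : - σ * (1# + τ) ≤ β)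
        (τ0 : 0# ≤ τ) (τ1 : τ ≤ 1#) (τ0' : 0# ≤ τ') (τ1' : τ' ≤ 1#) where
  Ends : ℚ → ℚ → Set
  Ends E E' = E + E' ≤ ν 3 * β + ν 5 * α + ν 5 * α' - + 21 / 2

  OwnOwn OwnSplit SplitOwn SplitSplit : Set
  OwnOwn = Ends (own α s β σ τ) (own α' s' β (- σ) τ')
  OwnSplit = Ends (own α s β σ τ) (split α' s' β (- σ) τ')
  SplitOwn = Ends (split α s β σ τ) (own α' s' β (- σ) τ')
  SplitSplit = Ends (split α s β σ τ) (split α' s' β (- σ) τ')

  a : 0# ≤ α - 1#
  a = diff≥ hα
  a' : 0# ≤ α' - 1#
  a' = diff≥ hα'
  b : 0# ≤ β - ν 2
  b = diff≥ hβ
  n : 0# ≤ β + α + α' - ν 5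
  n = diff≥ many

  own-E : ∀ α s β s1 τ → 1# ≤ α → ν 2 * s ≤ α → ½ ≤ τ → τ ≤ 1# → own α s β s1 τ ≤ c²⁷⁄₈ * α
  own-E α s β s1 τ hα hs h h1 = own-bound α s β s1 τ (c²⁷⁄₈ * α) α≥0 h h1 (≤-by (≤-lit 0# (+ 3 / 8) ⊠ α≥0) (id141 α)) (≤-by (≤-lit 0# (+ 3 / 8) ⊠ diff≥ hs) (id142 α s)) where
   α≥0 : 0# ≤ α
   α≥0 = ≤-trans (≤-lit 0# 1#) hα

  own-own : ½ ≤ τ → ½ ≤ τ' → OwnOwn
  own-own h h' = ≤-trans (QP.+-mono-≤ (own-E α s β σ τ hα hs h τ1) (own-E α' s' β (- σ) τ' hα' hs' h' τ1'))
   (≤-by (((≤-lit 0# (+ 13 / 8) ⊠ n) ⊞ (≤-lit 0# (+ 11 / 8) ⊠ b)) ⊞ ≤-lit 0# (+ 3 / 8)) (id143 α β α'))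

  -- the cap with width bound β and outward slope s1 next to an end of height at least ½
  two-thirds : ∀ s1 τ → ½ ≤ τ → s1 * (1# + τ) ≤ β → ν 3 * s1 ≤ ν 2 * β
  two-thirds s1 τ h1 h2 = [ (λ h → ≤-by (((≤-lit 0# (ν 2) ⊠ b) ⊞ ≤-lit 0# (ν 4)) ⊞ (≤-lit 0# (ν 3) ⊠ diff≥ h)) (id144 s1 β)) , (λ h → ≤-by ((≤-lit 0# (ν 2) ⊠ diff≥ h2) ⊞ (≤-lit 0# (ν 2) ⊠ (h ⊠ diff≥ h1))) (id145 s1 τ β)) ]′ (≤-total s1 0#)

  mixed : ∀ α s s1 τ α' s' s1' τ' → 1# ≤ α → 1# ≤ α' → 0# ≤ β + α + α' - ν 5 → ν 2 * s ≤ α → ½ ≤ τ → τ ≤ 1# → 0# ≤ τ' → τ' ≤ ½ → s1' * (1# + τ) ≤ β →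
   own α s β s1 τ + split α' s' β s1' τ' ≤ ν 3 * β + ν 5 * α + ν 5 * α' - + 21 / 2
  mixed α s s1 τ α' s' s1' τ' hα hα' n hs h1 h2 h3 h4 hs1' = ≤-trans (QP.+-mono-≤ (own-E α s β s1 τ hα hs h1 h2) (split-bound α' s' β s1' τ' E h3 h4
    (≤-by ((((≤-lit 0# (+ 13 / 8) ⊠ n) ⊞ (≤-lit 0# (+ 11 / 8) ⊠ b)) ⊞ (≤-lit 0# (+ 11 / 8) ⊠ diff≥ hα')) ⊞ ≤-lit 0# (+ 7 / 4)) (id146 α β α'))
    (≤-by ((((≤-lit 0# (+ 13 / 8) ⊠ n) ⊞ (≤-lit 0# (+ 3 / 8) ⊠ b)) ⊞ (≤-lit 0# (+ 27 / 8) ⊠ diff≥ hα')) ⊞ ≤-lit 0# (+ 7 / 4)) (id147 α β α'))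
    (≤-by (((((≤-lit 0# (+ 3 / 2) ⊠ n) ⊞ (≤-lit 0# (+ 7 / 2) ⊠ diff≥ hα')) ⊞ (≤-lit 0# (+ 1 / 8) ⊠ diff≥ hα)) ⊞ (≤-lit 0# (+ 1 / 4) ⊠ diff≥ (two-thirds s1' τ h1 hs1'))) ⊞ ≤-lit 0# (+ 5 / 8)) (id148 α β α' s1'))))
    (≤-reflexive (id149 α β α')) where
   E = ν 3 * β + + 13 / 8 * α + ν 5 * α' - + 21 / 2

  own-split : ½ ≤ τ → τ' ≤ ½ → OwnSplit
  own-split h h' = mixed α s σ τ α' s' (- σ) τ' hα hα' n hs h τ1 τ0' h' hσ'

  swap-sum : ∀ α α' → β + α + α' - ν 5 ≡ β + α' + α - ν 5
  swap-sum α α' = id150 α α' β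

  swap-E : ∀ α α' → ν 3 * β + ν 5 * α + ν 5 * α' - + 21 / 2 ≡ ν 3 * β + ν 5 * α' + ν 5 * α - + 21 / 2
  swap-E α α' = id151 α α' β

  split-own : τ ≤ ½ → ½ ≤ τ' → SplitOwn
  split-own h h' = subst₂ _≤_ (QP.+-comm (own α' s' β (- σ) τ') (split α s β σ τ)) (swap-E α' α)
   (mixed α' s' (- σ) τ' α s σ τ hα' hα (subst (0# ≤_) (swap-sum α α') n) hs' h' τ1' τ0 h hσ)

  -- The outward slopes of the middle level at the two ends are opposite, so one of them is
  -- nonpositive. That end costs at most the larger of β and 2 α', and the other end fits into what
  -- remains in either case.
  double : ∀ α s s1 τ α' s' s1' τ' → 1# ≤ α → 1# ≤ α' → 0# ≤ β + α + α' - ν 5 → 0# ≤ τ → τ ≤ ½ → 0# ≤ τ' → τ' ≤ ½ → s1 ≤ β → s1' ≤ 0# →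
   split α s β s1 τ + split α' s' β s1' τ' ≤ ν 3 * β + ν 5 * α + ν 5 * α' - + 21 / 2
  double α s s1 τ α' s' s1' τ' hα hα' n h1 h2 h3 h4 hs1 hs1' = [ thin , thick ]′ (≤-total (ν 2 * α') β) where
   e1 : 0# ≤ α - 1#
   e1 = diff≥ hα
   e2 : 0# ≤ α' - 1#
   e2 = diff≥ hα'
   steep : ∀ {E} → β ≤ E → β + c¾ * s1' ≤ E
   steep h = ≤-trans (≤-by (0≤¾ ⊠ diff≥ hs1') (id152 β s1')) h
   thin : ν 2 * α' ≤ β → split α s β s1 τ + split α' s' β s1' τ' ≤ ν 3 * β + ν 5 * α + ν 5 * α' - + 21 / 2
   thin h = ≤-trans (QP.+-mono-≤ (split-bound α s β s1 τ E h1 h2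
     (≤-by ((((≤-lit 0# (ν 2) ⊠ n) ⊞ e1) ⊞ (≤-lit 0# (ν 3) ⊠ e2)) ⊞ ≤-lit 0# (+ 7 / 2)) (id153 α β α'))
     (≤-by (((≤-lit 0# (ν 1) ⊠ n) ⊞ ((≤-lit 0# (ν 4) ⊠ e1) ⊞ (≤-lit 0# (ν 4) ⊠ e2))) ⊞ ≤-lit 0# (+ 5 / 2)) (id154 α β α'))
     (≤-by ((((≤-lit 0# (ν 5) ⊠ e1) ⊞ (≤-lit 0# (ν 5) ⊠ e2)) ⊞ (≤-lit 0# (+ 1 / 4) ⊠ b)) ⊞ (0≤¾ ⊠ diff≥ hs1)) (id155 α β α' s1)))
    (split-bound α' s' β s1' τ' β h3 h4 h ≤-refl (steep ≤-refl))) (≤-reflexive (id156 α β α')) where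
    E = ν 2 * β + ν 5 * α + ν 5 * α' - + 21 / 2
   thick : β ≤ ν 2 * α' → split α s β s1 τ + split α' s' β s1' τ' ≤ ν 3 * β + ν 5 * α + ν 5 * α' - + 21 / 2
   thick h = ≤-trans (QP.+-mono-≤ (split-bound α s β s1 τ E h1 h2
     (≤-by ((≤-lit 0# (ν 3) ⊠ n) ⊞ ≤-lit 0# (+ 9 / 2)) (id157 α β α'))
     (≤-by (((≤-lit 0# (ν 2) ⊠ n) ⊞ ((≤-lit 0# (ν 3) ⊠ e1) ⊞ e2)) ⊞ ≤-lit 0# (+ 7 / 2)) (id158 α β α'))
     (≤-by ((((≤-lit 0# (+ 5 / 4) ⊠ n) ⊞ ((≤-lit 0# (+ 15 / 4) ⊠ e1) ⊞ (≤-lit 0# (+ 7 / 4) ⊠ e2))) ⊞ (0≤¾ ⊠ diff≥ hs1)) ⊞ ≤-lit 0# (+ 5 / 4)) (id159 α β α' s1)))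
    (split-bound α' s' β s1' τ' (ν 2 * α') h3 h4 ≤-refl h (steep h))) (≤-reflexive (id160 α β α')) where
    E = ν 3 * β + ν 5 * α + ν 3 * α' - + 21 / 2

  slope≤ : ∀ s τ → 0# ≤ τ → 0# ≤ s → s * (1# + τ) ≤ β → s ≤ β
  slope≤ s τ h1 h2 h3 = ≤-trans (≤-by (h2 ⊠ h1) (id161 s τ)) h3

  split-split : τ ≤ ½ → τ' ≤ ½ → SplitSplit
  split-split h h' = [ neg , pos ]′ (≤-total σ 0#) where
   pos : 0# ≤ σ → SplitSplit
   pos σ≥0 = double α s σ τ α' s' (- σ) τ' hα hα' n τ0 h τ0' h' (slope≤ σ τ' τ0' σ≥0 hσ) (QP.neg-antimono-≤ σ≥0)
   neg : σ ≤ 0# → SplitSplit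
   neg σ≤0 = subst₂ _≤_ (QP.+-comm (split α' s' β (- σ) τ') (split α s β σ τ)) (swap-E α' α)
    (double α' s' (- σ) τ' α s σ τ hα' hα (subst (0# ≤_) (swap-sum α α') n) τ0' h' τ0 h (slope≤ (- σ) τ τ0 (QP.neg-antimono-≤ σ≤0) hσ') σ≤0)

 -- Three interior levels with a single interior point, on the middle one: the widths are 1, 2, 1.
 unit-end : ∀ s s1 τ → ½ ≤ τ → τ ≤ 1# →
  (ν 2 * (1# - s) + own 1# s (ν 2) s1 τ ≤ + 25 / 4) ⊎ (ν 4 + own 1# s (ν 2) s1 τ ≤ + 25 / 4)
 unit-end s s1 τ h1 h2 = [ neg , pos ]′ (≤-total s 0#) where
  M = own 1# s (ν 2) s1 τ
  pos : 0# ≤ s → (ν 2 * (1# - s) + M ≤ + 25 / 4) ⊎ (ν 4 + M ≤ + 25 / 4)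
  pos h = inj₁ (≤-trans (QP.+-monoʳ-≤ (ν 2 * (1# - s)) (own-pos 1# s (ν 2) s1 τ (≤-lit 0# 1#) h h1 h2)) (≤-by ((≤-lit 0# (+ 5 / 4) ⊠ h) ⊞ ≤-lit 0# (+ 5 / 4)) (id162 s)))
  neg : s ≤ 0# → (ν 2 * (1# - s) + M ≤ + 25 / 4) ⊎ (ν 4 + M ≤ + 25 / 4)
  neg h = [ (λ g → inj₁ (≤-trans (QP.+-monoʳ-≤ (ν 2 * (1# - s)) (own-unit s (ν 2) s1 τ (- s) (QP.neg-antimono-≤ h) g (≤-reflexive (sym (neg-neg s))) h1 h2)) (≤-by (≤-lit 0# (+ 5 / 4) ⊠ diff≥ g) (id163 s))))
      , (λ g → inj₂ (QP.+-monoʳ-≤ (ν 4) (own-unit s (ν 2) s1 τ 1# (≤-lit 0# 1#) ≤-refl (subst (_≤ - 1#) (neg-neg s) (QP.neg-antimono-≤ g)) h1 h2))) ]′ (≤-total (- s) 1#)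

 unit-end⁻ : ∀ s s1 τ → s ≤ 0# → ½ ≤ τ → τ ≤ 1# → own 1# s (ν 2) s1 τ ≤ ν 3
 unit-end⁻ s s1 τ h h1 h2 = own-neg 1# s (ν 2) s1 τ (≤-lit 0# 1#) h h1 h2

 unit-end⁺ : ∀ s s1 τ → 0# ≤ s → ½ ≤ τ → τ ≤ 1# → ν 2 * (1# - s) + own 1# s (ν 2) s1 τ ≤ ν 5
 unit-end⁺ s s1 τ h h1 h2 = ≤-trans (QP.+-monoʳ-≤ (ν 2 * (1# - s)) (own-pos 1# s (ν 2) s1 τ (≤-lit 0# 1#) h h1 h2)) (≤-by (≤-lit 0# (+ 5 / 4) ⊠ h) (id164 s))

 unit-end-max : ∀ s s1 τ → ν 2 * s ≤ 1# → ½ ≤ τ → τ ≤ 1# → own 1# s (ν 2) s1 τ ≤ c²⁷⁄₈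
 unit-end-max s s1 τ hs h1 h2 = own-bound 1# s (ν 2) s1 τ c²⁷⁄₈ (≤-lit 0# 1#) h1 h2 (≤-lit (ν 3 * 1#) c²⁷⁄₈) (≤-by (≤-lit 0# (+ 3 / 8) ⊠ diff≥ hs) (id165 s))

 unit-split : ∀ s s1 τ E → 0# ≤ τ → τ ≤ ½ → ν 2 ≤ E → ν 2 + c¾ * s1 ≤ E → split 1# s (ν 2) s1 τ ≤ E
 unit-split s s1 τ E h1 h2 e1 e2 = split-bound 1# s (ν 2) s1 τ E h1 h2 e1 e1 e2

 unit-slope : ∀ s1 τ c d → 0# ≤ c → 0# < d → c ≤ τ → s1 * (1# + τ) ≤ ν 2 → (1# + c) * d ≡ ν 2 → s1 ≤ d
 unit-slope s1 τ c d hc hd h1 h2 e = [ (λ h → ≤-trans h (<⇒≤ hd)) , (λ h → ≤-by (0≤-cancel {1# + c} (<-≤-trans (<-lit 0# 1#) (≤-by hc (id166 c))) (subst (0# ≤_) (trans (cong (λ z → (z - s1 * (1# + τ)) + s1 * (τ - c)) (sym e)) (id167 c d s1 τ)) (diff≥ h2 ⊞ (h ⊠ diff≥ h1)))) refl) ]′ (≤-total s1 0#)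

 -- Two interior levels.
 two-tall : ∀ α β s' τ τ' → 1# ≤ α → ν 2 ≤ β → 0# ≤ τ → τ ≤ 1# → 0# ≤ τ' → τ' ≤ 1# → 1# ≤ τ + τ' → s' * (1# + τ) ≤ β →
  ν 4 * α * τ + (1# + τ' - τ) * (ν 2 * β + s' * (τ + τ' - 1#)) ≤ ν 5 * (α + β - 1#) - ½
 two-tall α β s' τ τ' hα hβ h0 h1 h0' h1' h2 hs = ≤-by (0≤-cancel {1# + τ} (<-≤-trans (<-lit 0# 1#) (≤-by h0 (id166 τ))) (subst (0# ≤_) (sym (id170 α β s' τ τ'))
   (((((T1 ⊞ T2) ⊞ T3) ⊞ T4) ⊞ (≤-lit 0# (ν 2) ⊠ sq)) ⊞ ≤-lit 0# (+ 23 / 32)))) refl where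
  β≥0 : 0# ≤ β
  β≥0 = ≤-trans (≤-lit 0# (ν 2)) hβ
  p : 0# ≤ 1# + τ' - τ
  p = subst (0# ≤_) (id168 τ τ') (diff≥ h1 ⊞ h0')
  T1 = (p ⊠ diff≥ h2) ⊠ diff≥ hs
  T2 = (β≥0 ⊠ diff≥ h1') ⊠ ((≤-lit 0# (ν 3) ⊞ (≤-lit 0# (ν 2) ⊠ h0)) ⊞ h0')
  T3 = (diff≥ hα ⊠ (≤-lit 0# 1# ⊞ h0)) ⊠ (≤-lit 0# 1# ⊞ (≤-lit 0# (ν 4) ⊠ diff≥ h1))
  T4 = diff≥ hβ ⊠ ((≤-lit 0# 1# ⊞ h0) ⊞ (≤-lit 0# (ν 3) ⊠ (h0 ⊠ h0)))
  -- In (1 + τ) times the gap, the terms left after T1 to T4 form a quadratic in τ; completing the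
  -- square at 5/8 writes it as 2 (τ - 5/8)² + 23/32.
  sq : 0# ≤ (τ - + 5 / 8) * (τ - + 5 / 8)
  sq = [ (λ h → subst (0# ≤_) (id169 τ) (diff≥ h ⊠ diff≥ h)) , (λ h → diff≥ h ⊠ diff≥ h) ]′ (≤-total τ (+ 5 / 8))

 -- Low ends: one end has height τ and the other 1 - z, with τ ≤ z. The quantity `D` is affine in z,
 -- so it is nonnegative between z = κ and z = 1 - κ because its end values `D0` and `D1` are. The
 -- term α (K - 2) (z - κ) subtracted in `D` absorbs the square (z - τ)² that remains after using
 -- the slope condition (`quad`).
 module TwoLow (K κ α β s τ z : ℚ) (Kκ : K * κ ≡ 1#) (K≥4 : ν 4 ≤ K) (κ>0 : 0# < κ) (hα : 1# ≤ α) (hβ : ν 2 ≤ β) (αβ : α ≤ β)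
        (κτ : κ ≤ τ) (τz : τ ≤ z) (κz : κ ≤ 1# - z) (hs : 0# ≤ α + s * τ) where
  V = (K + 1#) * (α + β - 1#) - ½

  κ≤¼ : 0# ≤ 1# - ν 4 * κ
  κ≤¼ = subst (0# ≤_) (trans (id171 K κ) (cong (_- ν 4 * κ) Kκ)) (diff≥ K≥4 ⊠ <⇒≤ κ>0)
  τ>0 : 0# < τ
  τ>0 = <-≤-trans κ>0 κτ
  β≥0 : 0# ≤ β
  β≥0 = ≤-trans (≤-lit 0# (ν 2)) hβ
  α≥0 : 0# ≤ α
  α≥0 = ≤-trans (≤-lit 0# 1#) hα

  D0 : 0# ≤ V - ν 4 * β + ν 4 * (β - α) * κ
  D0 = subst (0# ≤_) (id172 K κ α β) (((((diff≥ K≥4 ⊠ ((diff≥ hα ⊞ diff≥ hβ) ⊞ ≤-lit 0# (ν 2))) ⊞ (≤-lit 0# (ν 5) ⊠ diff≥ hα)) ⊞ diff≥ hβ) ⊞ ≤-lit 0# (+ 3 / 2)) ⊞ ((≤-lit 0# (ν 4) ⊠ diff≥ αβ) ⊠ <⇒≤ κ>0))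

  D1 : 0# ≤ V - ν 4 * β * κ - α * K
  D1 = subst (0# ≤_) (id173 K κ α β) ((((diff≥ hα ⊞ (diff≥ K≥4 ⊠ (diff≥ hβ ⊞ ≤-lit 0# 1#))) ⊞ (β≥0 ⊠ κ≤¼)) ⊞ (≤-lit 0# (ν 4) ⊠ diff≥ hβ)) ⊞ ≤-lit 0# (+ 7 / 2))

  κ≤z : 0# ≤ z - κ
  κ≤z = diff≥ (≤-trans κτ τz)

  z≤1-κ : 0# ≤ 1# - κ - z
  z≤1-κ = subst (0# ≤_) (id174 κ z) (diff≥ κz)

  D : ℚ
  D = V - ν 4 * β * (1# - z) - ν 4 * α * z - α * (K - ν 2) * (z - κ)

  D≥0 : 0# ≤ D
  D≥0 = 0≤-cancel {1# - ν 2 * κ} pos (subst (0# ≤_) (sym eq) ((z≤1-κ ⊠ D0) ⊞ (κ≤z ⊠ D1))) where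
   pos : 0# < 1# - ν 2 * κ
   pos = subst (0# <_) (id175 κ) ((κ>0 ⊞< <⇒≤ κ>0) ⊞< κ≤¼)
   R = (1# - κ - z) * (V - ν 4 * β + ν 4 * (β - α) * κ) + (z - κ) * (V - ν 4 * β * κ - α * K)
   eq : (1# - ν 2 * κ) * D ≡ R
   eq = trans (id176 V K κ α β z) (trans (cong (λ w → R + (w - 1#) * (ν 2 * α * (z - κ))) Kκ) (id10 R (ν 2 * α * (z - κ))))

  quad : 0# ≤ τ * (K - ν 2) * (z - κ) - (z - τ) * (z - τ)
  quad = subst (0# ≤_) (sym eq) ((κ≤z ⊠ ((K-1 ⊠ diff≥ κτ) ⊞ z≤1-κ)) ⊞ (diff≥ τz ⊠ diff≥ κτ)) where
   K-1 : 0# ≤ K - 1#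
   K-1 = subst (0# ≤_) (id177 K) (diff≥ K≥4 ⊞ ≤-lit 0# (ν 3))
   R = (z - κ) * ((K - 1#) * (τ - κ) + (1# - κ - z)) + (z - τ) * (τ - κ)
   eq : τ * (K - ν 2) * (z - κ) - (z - τ) * (z - τ) ≡ R
   eq = trans (id178 K κ τ z) (trans (cong (λ w → R + (w - 1#) * (z - κ)) Kκ) (id10 R (z - κ)))

  two-low : ν 4 * β * (1# - z) + (z + τ) * (ν 2 * α + s * (τ - z)) ≤ (K + 1#) * (α + β - 1#) - ½
  two-low = ≤-by (0≤-cancel {τ} τ>0 (subst (0# ≤_) (sym (id179 V α β s τ z κ K)) ((((<⇒≤ τ>0 ⊞ κz') ⊠ diff≥ τz) ⊠ hs) ⊞ ((<⇒≤ τ>0 ⊠ D≥0) ⊞ (α≥0 ⊠ quad))))) refl where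
   κz' : 0# ≤ z
   κz' = ≤-trans (<⇒≤ τ>0) τz

 -- The right-hand side as a polynomial in each range of b.

 bmaxℚ : ∀ k i → ν (bmax k i) ≡ (ν k + 1#) * (ν i + 1#) + ν 3
 bmaxℚ k i = trans (ν-+ (suc k N.* suc i) 3) (cong (_+ ν 3) (trans (ν-* (suc k) (suc i)) (cong₂ _*_ (trans (ν-suc k) (QP.+-comm 1# (ν k))) (trans (ν-suc i) (QP.+-comm 1# (ν i))))))

 ν-∸ : ∀ a b → b N.≤ a → ν (a ∸ b) ≡ ν a - ν b
 ν-∸ a b h = trans (add-sub (ν (a ∸ b)) (ν b)) (cong (_- ν b) (trans (sym (ν-+ (a ∸ b) b)) (cong ν (NP.m∸n+n≡m h))))

 correction-high : ∀ k i b → bmax k i N.≤ suc (suc b) → correction k i (suc b) ≡ bmax k i ∸ suc b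
 correction-high k i b h with bmax k i N.≤ᵇ suc (suc b) | NP.≤⇒≤ᵇ h
 ... | true | _ = refl

 correction-low : ∀ k i b → suc (suc b) N.< bmax k i → correction k i (suc b) ≡ 2 N.+ k N.* ((bmax k i ∸ suc b) ∸ 2)
 correction-low k i b h with bmax k i N.≤ᵇ suc (suc b) | NP.≤ᵇ⇒≤ (bmax k i) (suc (suc b))
 ... | false | _ = refl
 ... | true | f = ⊥-elim (NP.<-irrefl refl (NP.≤-trans h (f tt)))

 module RHS (k i : ℕ) where
  K = ν k
  I = ν i + 1#

  suc-ν : ∀ n → ν (suc n) ≡ ν n + 1#
  suc-ν n = trans (ν-suc n) (QP.+-comm 1# (ν n))

  leading : ν (k N.* (suc k N.* suc k) N.* suc i) ≡ K * ((K + 1#) * (K + 1#)) * I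
  leading = trans (ν-* (k N.* (suc k N.* suc k)) (suc i)) (cong₂ _*_ (trans (ν-* k (suc k N.* suc k)) (cong (K *_) (trans (ν-* (suc k) (suc k)) (cong₂ _*_ (suc-ν k) (suc-ν k))))) (suc-ν i))

  2≤bmax : 2 N.≤ bmax k i
  2≤bmax = NP.≤-trans (N.s≤s (N.s≤s N.z≤n)) (NP.m≤n+m 3 (suc k N.* suc i))

  rhs-zero : rhs k i 0 ≡ K * K * (K + 1#) * I - K - ν 3
  rhs-zero = trans (cong₂ _-_ leading (trans (ν-+ 3 (k N.* (bmax k i ∸ 2))) (cong (λ z → ν 3 + z) (trans (ν-* k (bmax k i ∸ 2)) (cong (K *_) (trans (ν-∸ (bmax k i) 2 2≤bmax) (cong (_- ν 2) (bmaxℚ k i)))))))) (id180 K I)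

  rhs-mid : ∀ b → 1 N.≤ b → suc b N.< bmax k i → rhs k i b ≡ K * K * (K + 1#) * I + K * ν b - K - ν 2
  rhs-mid (suc b) _ h = trans (cong₂ _-_ leading (trans (cong ν (correction-low k i b h)) (trans (ν-+ 2 (k N.* ((bmax k i ∸ suc b) ∸ 2))) (cong (λ z → ν 2 + z) (trans (ν-* k ((bmax k i ∸ suc b) ∸ 2)) (cong (K *_)
    (trans (ν-∸ (bmax k i ∸ suc b) 2 le2) (cong (_- ν 2) (trans (ν-∸ (bmax k i) (suc b) le₁) (cong (_- ν (suc b)) (bmaxℚ k i))))))))))) (id181 K I (ν (suc b))) where
   le₁ : suc b N.≤ bmax k i
   le₁ = NP.<⇒≤ (NP.<-trans (NP.n<1+n (suc b)) h)
   le2 : 2 N.≤ bmax k i ∸ suc b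
   le2 = subst (N._≤ bmax k i ∸ suc b) (NP.m+n∸n≡m 2 (suc b)) (NP.∸-monoˡ-≤ (suc b) h)

  rhs-high : ∀ b → 1 N.≤ b → bmax k i N.≤ suc b → b N.≤ bmax k i → rhs k i b ≡ K * ((K + 1#) * (K + 1#)) * I - ((K + 1#) * I + ν 3 - ν b)
  rhs-high (suc b) _ h h' = cong₂ _-_ leading (trans (cong ν (correction-high k i b h)) (trans (ν-∸ (bmax k i) (suc b) h') (cong (_- ν (suc b)) (bmaxℚ k i))))

  data Range (b : ℕ) : Set where
   none : b ≡ 0 → Range b
   mid : 1 N.≤ b → suc b N.< bmax k i → Range b
   high : 1 N.≤ b → bmax k i N.≤ suc b → Range b

  range : ∀ b → Range b
  range zero = none refl
  range (suc b) with bmax k i NP.≤? suc (suc b)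
  ... | yes h = high (N.s≤s N.z≤n) h
  ... | no ¬h = mid (N.s≤s N.z≤n) (NP.≰⇒> ¬h)

  bmax-bound : ∀ b → bmax k i N.≤ suc b → (K + 1#) * I + ν 2 ≤ ν b
  bmax-bound b h = ≤-by (diff≥ (ν-≤ (bmax k i) (suc b) h)) (trans (id182 (ν b) ((K + 1#) * I)) (sym (cong₂ _-_ (suc-ν b) (bmaxℚ k i))))

  -- A strict bound against the value at b = 0 then settles all b at once.
  rhs-min : 4 N.≤ k → ∀ b → b N.≤ bmax k i → rhs k i 0 ≤ rhs k i b
  rhs-min 4≤k b hb = go (range b) where
   K≥4 : ν 4 ≤ K
   K≥4 = ν-≤ 4 k 4≤k
   K≥0 : 0# ≤ K
   K≥0 = ν-0≤ k
   I≥0 : 0# ≤ I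
   I≥0 = ν-0≤ i ⊞ ≤-lit 0# 1#
   go : Range b → rhs k i 0 ≤ rhs k i b
   go (none refl) = ≤-refl
   go (mid h1 h2) = ≤-by ((K≥0 ⊠ ν-0≤ b) ⊞ ≤-lit 0# 1#) (trans (cong₂ _-_ (rhs-mid b h1 h2) rhs-zero) (id183 K I (ν b)))
   go (high h1 h2) = ≤-by ((((K≥0 ⊠ (K≥0 ⊞ ≤-lit 0# 1#)) ⊠ I≥0) ⊞ K≥0) ⊞ (diff≥ (bmax-bound b h2) ⊞ ≤-lit 0# (ν 2))) (trans (cong₂ _-_ (rhs-high b h1 h2 hb) rhs-zero) (id184 K I (ν b)))

  -- Every polygon that is not one of the thin ones satisfies the bound strictly, with room to spare.
  coarse : ∀ {b P} → 4 N.≤ k → b N.≤ bmax k i → ∀ S → S ≤ I → area2 P ≤ (K + 1#) * S - ½ → Concl k i b P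
  coarse {b} {P} 4≤k hb S hS hA = hb , <⇒≤ strict , λ e → ⊥-elim (<-irrefl e strict) where
   K≥4 : ν 4 ≤ K
   K≥4 = ν-≤ 4 k 4≤k
   K≥0 : 0# ≤ K
   K≥0 = ν-0≤ k
   -- Scaled by k², the term 1/2 gains k²/2, which exceeds the k + 3 subtracted in `rhs k i 0` by 1
   -- + (k - 4)(k/2 + 1). This is positive for k ≥ 4.
   strict : ν (k N.* k) * area2 P < rhs k i b
   strict = <-≤-trans (subst₂ _<_ (cong (_* area2 P) (sym (ν-* k k))) (sym rhs-zero)
    (<-by ((<-lit 0# 1# ⊞< (diff≥ K≥4 ⊠ ((≤-lit 0# ½ ⊠ K≥0) ⊞ ≤-lit 0# 1#))) ⊞< (((K≥0 ⊠ K≥0) ⊠ diff≥ hA) ⊞ (((K≥0 ⊠ K≥0) ⊠ (K≥0 ⊞ ≤-lit 0# 1#)) ⊠ diff≥ hS))) (id185 K I S (area2 P)))) (rhs-min 4≤k b hb)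

 -- Affine width bounds and the count of boundary lattice points.

 -- The width of P at height y is at most (c + 1) + σ (y - j). Only two consequences are kept: the
 -- area bound for each strip, and nonnegativity at every point of P, which limits the slope σ.
 record Width (P : List Point) (j : ℚ) (c : ℕ) : Set where
  field
   σ : ℚ
   bound : ∀ u v → AreaBound P u v ((v - u) * (ν 2 * (ν c + 1#) + σ * ((u - j) + (v - j))))
   nonneg : ∀ {x y} → HIn P (x , y) → 0# ≤ (ν c + 1#) + σ * (y - j)

 level-width : ∀ {P j c} → LevelData P j c → Width P (ι j) c
 level-width {P} {j} {c} D = record { σ = t - s ; bound = λ u v → weaken (≤-reflexive (id187 (ι l) α t s u v (ι j))) (slab wide u v)
   ; nonneg = λ {x} {y} h → subst (0# ≤_) (id188 (ι l) α t s x y (ι j)) (diff≥ (Lines.on-right wide h) ⊞ diff≥ (Lines.on-left wide h)) } where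
  open LevelData D
  α = ν c + 1#
  -- The right line is shifted outwards so that the distance of the lines on level `j` becomes
  -- exactly c + 1.
  wide : Lines P (ι j) (ι l) s (ι l + α) t
  wide = record { on-left = Lines.on-left lines ; on-right = λ {q} h → ≤-trans (Lines.on-right lines h) (≤-by (diff≥ width) (id186 (ι l) (ι r) α t (snd q - ι j))) }

 α≥1 : ∀ c → 1# ≤ ν c + 1#
 α≥1 c = ≤-by (ν-0≤ c) (id189 (ν c))

 β≥2 : ∀ c → 1 N.≤ c → ν 2 ≤ ν c + 1#
 β≥2 c h = ≤-by (diff≥ (ν-≤ 1 c h)) (id190 (ν c))

 slope-from : ∀ s c d α → 0# ≤ α → 0# ≤ c → c ≤ d → s * d ≤ α → c * s ≤ α
 slope-from s c d α hα hc cd h = [ (λ g → ≤-by (hα ⊞ (hc ⊠ diff≥ g)) (id191 s c α)) , (λ g → ≤-by (diff≥ h ⊞ (g ⊠ diff≥ cd)) (id192 s c d α)) ]′ (≤-total s 0#)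

 countRange-in : ∀ a n z zs → a Z.≤ snd z → snd z Z.< a Z.+ + n → suc (countRange a n zs) N.≤ countRange a n (z ∷ zs)
 countRange-in a zero z zs h1 h2 = ⊥-elim (ZP.<-irrefl refl (ZP.≤-<-trans h1 (subst (snd z Z.<_) (ZP.+-identityʳ a) h2)))
 countRange-in a (suc n) z zs h1 h2 = go (snd z ZP.≟ a) where
  e : ∀ a n → a Z.+ (+ 1 Z.+ n) ≡ (+ 1 Z.+ a) Z.+ n
  e = ℤS.solve-∀
  mono : ∀ a n → countRange a n zs N.≤ countRange a n (z ∷ zs)
  mono a zero = N.z≤n
  mono a (suc n) = NP.+-mono-≤ (pick (snd z ZP.≟ a)) (mono (Z.suc a) n) where
   pick : Dec (snd z ≡ a) → count a zs N.≤ count a (z ∷ zs)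
   pick (yes e) = NP.≤-trans (NP.n≤1+n _) (NP.≤-reflexive (sym (count-cons-≡ a z zs e)))
   pick (no ne) = NP.≤-reflexive (sym (count-cons-≢ a z zs ne))
  go : Dec (snd z ≡ a) → suc (countRange a (suc n) zs) N.≤ countRange a (suc n) (z ∷ zs)
  go (yes eq) = NP.+-mono-≤ (NP.≤-reflexive (sym (count-cons-≡ a z zs eq))) (mono (Z.suc a) n)
  go (no ne) = subst (N._≤ countRange a (suc n) (z ∷ zs)) (NP.+-suc (count a zs) (countRange (Z.suc a) n zs))
   (NP.+-mono-≤ (NP.≤-reflexive (sym (count-cons-≢ a z zs ne))) (countRange-in (Z.suc a) n z zs (ZP.i<j⇒suc[i]≤j (ZP.≤∧≢⇒< h1 (λ e → ne (sym e)))) (subst (snd z Z.<_) (e a (+ n)) h2)))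

 length≤countRange : ∀ a n zs → (∀ {z} → z ∈ zs → a Z.≤ snd z × snd z Z.< a Z.+ + n) → length zs N.≤ countRange a n zs
 length≤countRange a n [] h = N.z≤n
 length≤countRange a n (z ∷ zs) h = NP.≤-trans (N.s≤s (length≤countRange a n zs (λ m → h (there m)))) (countRange-in a n z zs (fst (h ∈0)) (snd (h ∈0)))

 countRange-last : ∀ a n zs → countRange a (suc n) zs ≡ countRange a n zs N.+ count (a Z.+ + n) zs
 countRange-last a zero zs = trans (NP.+-identityʳ _) (cong (λ z → count z zs) (sym (ZP.+-identityʳ a)))
 countRange-last a (suc n) zs = trans (cong (count a zs N.+_) (trans (countRange-last (Z.suc a) n zs) (cong (λ z → countRange (Z.suc a) n zs N.+ count z zs) (e a (+ n))))) (sym (NP.+-assoc (count a zs) (countRange (Z.suc a) n zs) (count (a Z.+ + suc n) zs))) where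
  e : ∀ a n → (+ 1 Z.+ a) Z.+ n ≡ a Z.+ (+ 1 Z.+ n)
  e = ℤS.solve-∀

 countRange-≤ : ∀ a n c zs → (∀ m → m N.< n → count (a Z.+ + m) zs N.≤ c) → countRange a n zs N.≤ n N.* c
 countRange-≤ a zero c zs h = N.z≤n
 countRange-≤ a (suc n) c zs h = NP.+-mono-≤ (subst (λ z → count z zs N.≤ c) (ZP.+-identityʳ a) (h 0 (N.s≤s N.z≤n)))
  (countRange-≤ (Z.suc a) n c zs (λ m lt → subst (λ z → count z zs N.≤ c) (e a (+ m)) (h (suc m) (N.s≤s lt)))) where
  e : ∀ a n → a Z.+ (+ 1 Z.+ n) ≡ (+ 1 Z.+ a) Z.+ n
  e = ℤS.solve-∀

 countRange-≥ : ∀ a n zs → (∀ m → m N.< n → 1 N.≤ count (a Z.+ + m) zs) → n N.≤ countRange a n zs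
 countRange-≥ a zero zs h = N.z≤n
 countRange-≥ a (suc n) zs h = NP.+-mono-≤ (subst (λ z → 1 N.≤ count z zs) (ZP.+-identityʳ a) (h 0 (N.s≤s N.z≤n)))
  (countRange-≥ (Z.suc a) n zs (λ m lt → subst (λ z → 1 N.≤ count z zs) (e a (+ m)) (h (suc m) (N.s≤s lt)))) where
  e : ∀ a n → a Z.+ (+ 1 Z.+ n) ≡ (+ 1 Z.+ a) Z.+ n
  e = ℤS.solve-∀

 filter-unique : ∀ j {zs : List (ℤ × ℤ)} → Unique zs → Unique (filter (λ z → snd z ZP.≟ j) zs)
 filter-unique j = UP.filter⁺ (λ z → snd z ZP.≟ j)

 -- Distinct lattice points on one level whose abscissae lie in [A , A'].
 count-interval : ∀ j zs A A' → Unique zs → (∀ {x} → (x , j) ∈ zs → A ≤ ι x × ι x ≤ A') → count j zs ≡ 0 ⊎ ν (count j zs) ≤ A' - A + 1#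
 count-interval j zs A A' un h = go (filter (λ z → snd z ZP.≟ j) zs) refl where
  ms : List (ℤ × ℤ)
  ms = filter (λ z → snd z ZP.≟ j) zs
  lo = strictly-below A
  hi = floorℚ A'
  a = fst lo
  f = fst hi
  sound : ∀ {z} → z ∈ ms → A ≤ ι (fst z) × ι (fst z) ≤ A' × snd z ≡ j
  sound {x , y} m = fst hh , snd hh , e where
   e : y ≡ j
   e = snd (∈P.∈-filter⁻ (λ z → snd z ZP.≟ j) {xs = zs} m)
   hh : A ≤ ι x × ι x ≤ A'
   hh = h (subst (λ w → (x , w) ∈ zs) e (fst (∈P.∈-filter⁻ (λ z → snd z ZP.≟ j) {xs = zs} m)))
  a<x : ∀ {z} → z ∈ ms → a Z.< fst z
  a<x {z} m = ι-<⁻ a (fst z) (<-≤-trans (fst (snd lo)) (fst (sound m)))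
  x≤f : ∀ {z} → z ∈ ms → fst z Z.≤ f
  x≤f {z} m = ZP.≤-trans (ZP.i<j⇒i≤pred[j] (ι-<⁻ (fst z) (Z.suc f) (≤-<-trans (fst (snd (sound m))) (subst (A' <_) (sym (ι-suc f)) (snd (snd hi)))))) (ZP.≤-reflexive (ZP.pred-suc f))
  cc : ∀ a m → a Z.+ (m Z.- a) ≡ m
  cc = ℤS.solve-∀
  consecutive-∈ : ∀ s j n m → m N.< n → (s Z.+ + m , j) ∈ consecutive s j n
  consecutive-∈ s j (suc n) zero lt = here (cong (_, j) (ZP.+-identityʳ s))
  consecutive-∈ s j (suc n) (suc m) (N.s≤s lt) = there (subst (λ w → (w , j) ∈ consecutive (Z.suc s) j n) (e s (+ m)) (consecutive-∈ (Z.suc s) j n m lt)) where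
   e : ∀ a n → (+ 1 Z.+ a) Z.+ n ≡ a Z.+ (+ 1 Z.+ n)
   e = ℤS.solve-∀
  covered : ∀ n → + n ≡ f Z.- a → ∀ {z} → z ∈ ms → z ∈ consecutive (Z.suc a) j n
  covered n en {x , y} m = subst₂ (λ u v → (u , v) ∈ consecutive (Z.suc a) j n) eqx (sym (snd (snd (sound m)))) (consecutive-∈ (Z.suc a) j n d lt) where
   d = Z.∣ x Z.- Z.suc a ∣
   ed : + d ≡ x Z.- Z.suc a
   ed = ZP.0≤i⇒+∣i∣≡i (ZP.i≤j⇒0≤j-i (ZP.i<j⇒suc[i]≤j (a<x m)))
   eqx : Z.suc a Z.+ + d ≡ x
   eqx = trans (cong (λ w → Z.suc a Z.+ w) ed) (cc (Z.suc a) x)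
   e1 : ∀ a n → (+ 1 Z.+ a) Z.+ n ≡ + 1 Z.+ (a Z.+ n)
   e1 = ℤS.solve-∀
   lt : d N.< n
   lt = ZP.drop‿+<+ (+-cancelˡ-<ℤ (Z.suc a) (subst₂ Z._<_ (sym eqx) (sym (trans (cong (λ w → Z.suc a Z.+ w) en) (trans (e1 a (f Z.- a)) (cong Z.suc (cc a f))))) (ZP.≤-<-trans (x≤f m) (i<suc f))))
  go : ∀ ws → ws ≡ ms → length ms ≡ 0 ⊎ ν (length ms) ≤ A' - A + 1#
  go [] e = inj₁ (cong length (sym e))
  go (w ∷ ws) e = inj₂ (≤-trans (ν-≤ (length ms) n (subst (length ms N.≤_) (consecutive-length (Z.suc a) j n) (unique-⊆-length (filter-unique j un) (covered n en))))
    (≤-trans (≤-reflexive (trans (cong ι en) (ι-- f a))) (≤-by (diff≥ (fst (snd hi)) ⊞ diff≥ (snd (snd lo))) (id193 (ι f) (ι a) A A')))) where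
   w∈ : w ∈ ms
   w∈ = subst (w ∈_) e ∈0
   n = Z.∣ f Z.- a ∣
   en : + n ≡ f Z.- a
   en = ZP.0≤i⇒+∣i∣≡i (ZP.i≤j⇒0≤j-i (ZP.<⇒≤ (ZP.<-≤-trans (a<x w∈) (x≤f w∈))))

 count-two : ∀ j zs (l r : ℤ) → Unique zs → (∀ {x} → (x , j) ∈ zs → x ≡ l ⊎ x ≡ r) → count j zs N.≤ 2
 count-two j zs l r un h = unique-⊆-length {ys = (l , j) ∷ (r , j) ∷ []} (filter-unique j un) sub where
  sub : ∀ {z} → z ∈ filter (λ z → snd z ZP.≟ j) zs → z ∈ (l , j) ∷ (r , j) ∷ []
  sub {x , y} m = place (h (subst (λ w → (x , w) ∈ zs) e (fst (∈P.∈-filter⁻ (λ z → snd z ZP.≟ j) {xs = zs} m)))) where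
   e : y ≡ j
   e = snd (∈P.∈-filter⁻ (λ z → snd z ZP.≟ j) {xs = zs} m)
   place : x ≡ l ⊎ x ≡ r → (x , y) ∈ (l , j) ∷ (r , j) ∷ []
   place (inj₁ ex) = here (cong₂ _,_ ex e)
   place (inj₂ ex) = there (here (cong₂ _,_ ex e))

 trivial-slab : ∀ {P c d} → d ≡ c → AreaBound P c d 0#
 trivial-slab {P} {c} e = record { Φ = λ _ → 0# ; Ψ = λ _ → 0#
  ; upper = λ p q _ _ h1 h2 h3 → ≤-reflexive (flat p q h1 h2 (subst (snd q ≤_) e h3))
  ; lower = λ p q _ _ h1 h2 h3 → ≤-reflexive (sym (flat p q h1 h2 (subst (snd q ≤_) e h3)))
  ; total = ≤-refl } where
  flat : ∀ p q → c ≤ snd p → snd p ≤ snd q → snd q ≤ c → trap p q ≡ 0#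
  flat p q h1 h2 h3 = trans (cong (λ z → (fst p + fst q) * (z - snd p)) (≤-antisym (≤-trans h3 h1) h2)) (id194 (fst p + fst q) (snd p))

 module Ends {P : List Point} {B T : ℚ} where

  top-own : ∀ {j c} (W : Width P j c) β s1 → AreaBound P (j - ½) T (own (ν c + 1#) (Width.σ W) β s1 (T - j))
  top-own {j} {c} W β s1 = weaken (≤-reflexive (id195 T j (ν c + 1#) σ)) (bound (j - ½) T) where
   open Width W

  bot-own : ∀ {j c} (W : Width P j c) β s1 → AreaBound P B (j + ½) (own (ν c + 1#) (- Width.σ W) β s1 (j - B))
  bot-own {j} {c} W β s1 = weaken (≤-reflexive (id196 B j (ν c + 1#) σ)) (bound B (j + ½)) where
   open Width W

  -- The cut is made at the mirror image of T in level j, so the upper strip is symmetric about j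
  -- and the slope there cancels; the rest is charged to level j - 1.
  top-split : ∀ {j c c1} (W : Width P j c) (W1 : Width P (j - 1#) c1) → j ≤ T → T - j ≤ ½ → AreaBound P (j - ½) T (split (ν c + 1#) (Width.σ W) (ν c1 + 1#) (Width.σ W1) (T - j))
  top-split {j} {c} {c1} W W1 h1 h2 = weaken (≤-reflexive (id199 T j (ν c + 1#) (Width.σ W) (ν c1 + 1#) (Width.σ W1)))
    (glue (≤-by (diff≥ h2) (id197 T j)) (≤-by (diff≥ h1 ⊞ diff≥ h1) (id198 T j)) (Width.bound W1 (j - ½) (j - (T - j))) (Width.bound W (j - (T - j)) T))

  bot-split : ∀ {j c c1} (W : Width P j c) (W1 : Width P (j + 1#) c1) → B ≤ j → j - B ≤ ½ → AreaBound P B (j + ½) (split (ν c + 1#) (- Width.σ W) (ν c1 + 1#) (- Width.σ W1) (j - B))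
  bot-split {j} {c} {c1} W W1 h1 h2 = weaken (≤-reflexive (id202 B j (ν c + 1#) (Width.σ W) (ν c1 + 1#) (Width.σ W1)))
    (glue (≤-by (diff≥ h1 ⊞ diff≥ h1) (id201 B j)) (≤-by (diff≥ h2) (id200 B j)) (Width.bound W B (j + (j - B))) (Width.bound W1 (j + (j - B)) (j + ½)))

 -- The integer levels strictly between B and T are Jb, ..., Jb + n. The heights of the polygon
 -- beyond the extreme ones are τ above and τ' below, each in the interval from 1/k to 1.
 module Assembly {k i b : ℕ} {P : List Point} (pr : Prob k i b P) (w : Wide k P) (4≤k : 4 N.≤ k) {B T : ℚ} (L : Levels P B T)
         (z0 : ℤ × ℤ) (hz0 : HInt P (lat z0)) (Jb : ℤ) (n : ℕ)
         (hB1 : B < ι Jb) (hB2 : ι Jb ≤ B + 1#) (hT1 : ι (Jb Z.+ + n) < T) (hT2 : T ≤ ι (Jb Z.+ + n) + 1#) where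
  open Prob pr
  open Levels L
  open LevelAnalysis pr L z0 hz0 public hiding (K; K>0)
  open RHS k i public using (K; I; suc-ν; coarse)

  1≤k : 1 N.≤ k
  1≤k = NP.≤-trans (N.s≤s N.z≤n) 4≤k

  Jt : ℤ
  Jt = Jb Z.+ + n

  jb jt τ τ' : ℚ
  jb = ι Jb
  jt = ι Jt
  τ = T - jt
  τ' = jb - B

  jt≡ : jt ≡ jb + ν n
  jt≡ = ι-+ Jb (+ n)

  τ>0 : 0# < τ
  τ>0 = diff> hT1

  τ'>0 : 0# < τ'
  τ'>0 = diff> hB1

  τ≤1 : τ ≤ 1#
  τ≤1 = ≤-by (diff≥ hT2) (id203 T jt)

  τ'≤1 : τ' ≤ 1#
  τ'≤1 = ≤-by (diff≥ hB2) (id204 B jb)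

  -- `K * T` and `K * jt` are distinct integers.
  Kτ≥1 : 1# ≤ K * τ
  Kτ≥1 = ≤-by (diff≥ (integral-gap w 1≤k (integral-level w 1≤k Jt) (integral-T w 1≤k) (scaled< w 1≤k hT1))) (id205 K T jt)

  Kτ'≥1 : 1# ≤ K * τ'
  Kτ'≥1 = ≤-by (diff≥ (integral-gap w 1≤k (integral-B w 1≤k) (integral-level w 1≤k Jb) (scaled< w 1≤k hB1))) (id206 K B jb)

  inside : ∀ m → m N.≤ n → B < ι (Jb Z.+ + m) × ι (Jb Z.+ + m) < T
  inside m le = <-≤-trans hB1 (ι-≤ Jb (Jb Z.+ + m) (ZP.i≤i+j Jb (+ m))) , ≤-<-trans (ι-≤ (Jb Z.+ + m) Jt (ZP.+-monoʳ-≤ Jb (Z.+≤+ le))) hT1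

  ldata : ∀ m → m N.≤ n → LevelData P (Jb Z.+ + m) (cnt (Jb Z.+ + m))
  ldata m le = level-data (Jb Z.+ + m) (fst (inside m le)) (snd (inside m le))

  bot-HIn : HIn P (fst bot , B)
  bot-HIn = subst (λ y → HIn P (fst bot , y)) bot≡ (vertex-HIn cv bot∈)

  top-HIn : HIn P (fst top , T)
  top-HIn = subst (λ y → HIn P (fst top , y)) top≡ (vertex-HIn cv top∈)

  Dt : LevelData P Jt (cnt Jt)
  Dt = ldata n NP.≤-refl

  Db : LevelData P Jb (cnt Jb)
  Db = level-data Jb hB1 (subst (_< T) (cong ι (ZP.+-identityʳ Jb)) (snd (inside 0 N.z≤n)))

  Wt : Width P jt (cnt Jt)
  Wt = level-width Dt

  Wb : Width P jb (cnt Jb)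
  Wb = level-width Db

  α α' σt σb : ℚ
  α = ν (cnt Jt) + 1#
  α' = ν (cnt Jb) + 1#
  σt = Width.σ Wt
  σb = Width.σ Wb

  -- The affine width of the top level is nonnegative at the lowest vertex, n + τ' below it. So the
  -- polygon cannot widen upwards faster than this.
  slope-t : σt * (ν n + τ') ≤ α
  slope-t = ≤-by (Width.nonneg Wt bot-HIn) (trans (id207 α σt (ν n) jb B) (cong (λ z → α + σt * (B - z)) (sym jt≡)))

  slope-b : - σb * (ν n + τ) ≤ α'
  slope-b = ≤-by (Width.nonneg Wb top-HIn) (trans (cong (λ z → α' - - σb * (ν n + (T - z))) jt≡) (id208 α' σb (ν n) jb T))

  bs : List (ℤ × ℤ)
  bs = fst bds

  bs-unique : Unique bs
  bs-unique = fst (snd bds)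

  bs-HIn : ∀ {z} → z ∈ bs → HIn P (lat z)
  bs-HIn {z} m = fst (fst (snd (snd (snd bds)) z) m)

  bs-¬HInt : ∀ {z} → z ∈ bs → ¬ HInt P (lat z)
  bs-¬HInt {z} m = snd (fst (snd (snd (snd bds)) z) m)

  -- Lattice points strictly between `l` and `r` are interior and those beyond are outside, which
  -- leaves the two ends.
  level-count : ∀ m → m N.≤ n → count (Jb Z.+ + m) bs N.≤ 2
  level-count m le = count-two (Jb Z.+ + m) bs l r bs-unique ends where
   open LevelData (ldata m le)
   J = Jb Z.+ + m
   ends : ∀ {x} → (x , J) ∈ bs → x ≡ l ⊎ x ≡ r
   ends {x} x∈ = go (ZP.<-cmp l x) (ZP.<-cmp x r) where
    l≤x : l Z.≤ x
    l≤x = ι-≤⁻ l x (subst (_≤ ι x) (id209 (ι l) s (ι J)) (Lines.on-left lines (bs-HIn x∈)))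
    x≤r : x Z.≤ r
    x≤r = ι-≤⁻ x r (subst (ι x ≤_) (id209 (ι r) t (ι J)) (Lines.on-right lines (bs-HIn x∈)))
    go : Tri (l Z.< x) (l ≡ x) (x Z.< l) → Tri (x Z.< r) (x ≡ r) (r Z.< x) → x ≡ l ⊎ x ≡ r
    go (tri≈ _ e _) _ = inj₁ (sym e)
    go (tri> _ _ h) _ = ⊥-elim (ZP.<-irrefl refl (ZP.<-≤-trans h l≤x))
    go (tri< _ _ _) (tri≈ _ e _) = inj₂ e
    go (tri< _ _ _) (tri> _ _ h) = ⊥-elim (ZP.<-irrefl refl (ZP.<-≤-trans h x≤r))
    go (tri< h1 _ _) (tri< h2 _ _) = ⊥-elim (bs-¬HInt x∈ (between x h1 h2))

  nt nb : ℕ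
  nt = count (Z.suc Jt) bs
  nb = count (Z.pred Jb) bs

  -- Boundary points one level above Jt lie between the two bounding lines of level Jt, whose
  -- distance has grown there to at most α + σt.
  top-count : nt ≡ 0 ⊎ ν nt ≤ α + σt + 1#
  top-count = [ inj₁ , (λ h → inj₂ (≤-trans h (≤-by (diff≥ width) (id211 α (ι r) (ι l) t s)))) ]′
    (count-interval (Z.suc Jt) bs (ι l + s) (ι r + t) bs-unique (λ {x} m → subst (_≤ ι x) (at (ι l) s) (Lines.on-left lines (bs-HIn m)) , subst (ι x ≤_) (at (ι r) t) (Lines.on-right lines (bs-HIn m)))) where
   open LevelData Dt
   at : ∀ l s → l + s * (ι (Z.suc Jt) - jt) ≡ l + s
   at l s = trans (cong (λ z → l + s * (z - jt)) (ι-suc Jt)) (id210 l s jt)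

  ι-pred : ∀ a → ι (Z.pred a) ≡ ι a - 1#
  ι-pred a = trans (ι-+ (Z.- + 1) a) (QP.+-comm (ι (Z.- + 1)) (ι a))

  bot-count : nb ≡ 0 ⊎ ν nb ≤ α' - σb + 1#
  bot-count = [ inj₁ , (λ h → inj₂ (≤-trans h (≤-by (diff≥ width) (id213 α' (ι r) (ι l) t s)))) ]′
    (count-interval (Z.pred Jb) bs (ι l - s) (ι r - t) bs-unique (λ {x} m → subst (_≤ ι x) (at (ι l) s) (Lines.on-left lines (bs-HIn m)) , subst (ι x ≤_) (at (ι r) t) (Lines.on-right lines (bs-HIn m)))) where
   open LevelData Db
   at : ∀ l s → l + s * (ι (Z.pred Jb) - jb) ≡ l - s
   at l s = trans (cong (λ z → l + s * (z - jb)) (ι-pred Jb)) (id212 l s jb)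

  b-count : b N.≤ nb N.+ (suc n N.* 2 N.+ nt)
  b-count = subst (N._≤ nb N.+ (suc n N.* 2 N.+ nt)) (fst (snd (snd bds))) (NP.≤-trans (length≤countRange (Z.pred Jb) (suc (suc (suc n))) bs in-range) (NP.+-monoʳ-≤ nb rest)) where
   sp : Z.suc (Z.pred Jb) ≡ Jb
   sp = ZP.suc-pred Jb
   rest : countRange (Z.suc (Z.pred Jb)) (suc (suc n)) bs N.≤ suc n N.* 2 N.+ nt
   rest = subst (λ a → countRange a (suc (suc n)) bs N.≤ suc n N.* 2 N.+ nt) (sym sp) (subst (N._≤ suc n N.* 2 N.+ nt) (sym (countRange-last Jb (suc n) bs))
    (NP.+-mono-≤ (countRange-≤ Jb (suc n) 2 bs (λ m lt → level-count m (NP.≤-pred lt))) (NP.≤-reflexive (cong (λ z → count z bs) (e Jb (+ n)))))) where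
    e : ∀ a n → a Z.+ (+ 1 Z.+ n) ≡ + 1 Z.+ (a Z.+ n)
    e = ℤS.solve-∀
   in-range : ∀ {z} → z ∈ bs → Z.pred Jb Z.≤ snd z × snd z Z.< Z.pred Jb Z.+ + suc (suc (suc n))
   in-range {x , y} m = ι-≤⁻ (Z.pred Jb) y (≤-trans (≤-reflexive (ι-pred Jb)) (≤-trans (≤-by (diff≥ hB2) (id214 jb B)) (fst lv)))
     , subst (y Z.<_) (e Jb (+ n)) (ZP.≤-<-trans (ι-≤⁻ y (Z.suc Jt) (≤-trans (snd lv) (subst (T ≤_) (sym (ι-suc Jt)) hT2))) (i<suc (Z.suc Jt))) where
    lv : B ≤ ι y × ι y ≤ T
    lv = HIn-levels cv L (bs-HIn m)
    e : ∀ a n → + 1 Z.+ (+ 1 Z.+ (a Z.+ n)) ≡ (Z.- + 1 Z.+ a) Z.+ (+ 1 Z.+ (+ 1 Z.+ (+ 1 Z.+ n)))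
    e = ℤS.solve-∀

  b-countℚ : ν b ≤ ν nb + (ν 2 * (ν n + 1#) + ν nt)
  b-countℚ = ≤-trans (ν-≤ b (nb N.+ (suc n N.* 2 N.+ nt)) b-count) (≤-reflexive (trans (ν-+ nb (suc n N.* 2 N.+ nt)) (cong (λ z → ν nb + z) (trans (ν-+ (suc n N.* 2) nt) (cong (_+ ν nt) (trans (ν-* (suc n) 2) (trans (cong (_* ν 2) (suc-ν n)) (QP.*-comm (ν n + 1#) (ν 2)))))))))

  K≥4 : ν 4 ≤ K
  K≥4 = ν-≤ 4 k 4≤k

 countRange-mono : ∀ a n z zs → countRange a n zs N.≤ countRange a n (z ∷ zs)
 countRange-mono a zero z zs = N.z≤n
 countRange-mono a (suc n) z zs = NP.+-mono-≤ (pick (snd z ZP.≟ a)) (countRange-mono (Z.suc a) n z zs) where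
  pick : Dec (snd z ≡ a) → count a zs N.≤ count a (z ∷ zs)
  pick (yes e) = NP.≤-trans (NP.n≤1+n _) (NP.≤-reflexive (sym (count-cons-≡ a z zs e)))
  pick (no ne) = NP.≤-reflexive (sym (count-cons-≢ a z zs ne))

 countRange-member : ∀ a n {z} {zs} → z ∈ zs → a Z.≤ snd z → snd z Z.< a Z.+ + n → 1 N.≤ countRange a n zs
 countRange-member a n {z} {_ ∷ zs} ∈0 h1 h2 = NP.≤-trans (N.s≤s N.z≤n) (countRange-in a n z zs h1 h2)
 countRange-member a n {z} {y ∷ zs} (there m) h1 h2 = NP.≤-trans (countRange-member a n m h1 h2) (countRange-mono a n y zs)

 -- At least two interior levels: common estimates.

 module AtLeastTwo {k i b : ℕ} {P : List Point} (pr : Prob k i b P) (w : Wide k P) (4≤k : 4 N.≤ k) {B T : ℚ} (L : Levels P B T)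
          (z0 : ℤ × ℤ) (hz0 : HInt P (lat z0)) (Jb : ℤ) (n' : ℕ)
          (hB1 : B < ι Jb) (hB2 : ι Jb ≤ B + 1#) (hT1 : ι (Jb Z.+ + suc n') < T) (hT2 : T ≤ ι (Jb Z.+ + suc n') + 1#) where
  open Prob pr using (cv; ints; bds)
  open Assembly pr w 4≤k L z0 hz0 Jb (suc n') hB1 hB2 hT1 hT2
  open Ends {P} {B} {T}

  m : ℕ
  m = countRange (Z.suc Jb) n' zs

  sJb : ∀ a → Z.suc Jb Z.+ + a ≡ Jb Z.+ + suc a
  sJb a = e Jb (+ a) where
   e : ∀ a n → (+ 1 Z.+ a) Z.+ n ≡ a Z.+ (+ 1 Z.+ n)
   e = ℤS.solve-∀

  all-levels : countRange Jb (suc (suc n')) zs ≡ cnt Jb N.+ (m N.+ cnt Jt)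
  all-levels = cong (cnt Jb N.+_) (trans (countRange-last (Z.suc Jb) n' zs) (cong (λ z → m N.+ count z zs) (sJb n')))

  total≤ : cnt Jb N.+ (m N.+ cnt Jt) N.≤ i
  total≤ = subst₂ N._≤_ all-levels (fst (snd (snd ints))) (countRange≤ Jb (suc (suc n')) zs)

  total≥1 : 1 N.≤ cnt Jb N.+ (m N.+ cnt Jt)
  total≥1 = subst (1 N.≤_) all-levels (countRange-member Jb (suc (suc n')) (snd (snd (snd (snd ints)) z0) hz0) lo hi) where
   lv : B < ι (snd z0) × ι (snd z0) < T
   lv = HInt-levels cv L hz0
   lo : Jb Z.≤ snd z0
   lo = ZP.≤-trans (ZP.≤-reflexive (sym (ZP.suc-pred Jb))) (ZP.i<j⇒suc[i]≤j (ι-<⁻ (Z.pred Jb) (snd z0) (≤-<-trans (≤-trans (≤-reflexive (ι-pred Jb)) (≤-by (diff≥ hB2) (id214 jb B))) (fst lv))))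
   hi : snd z0 Z.< Jb Z.+ + suc (suc n')
   hi = ι-<⁻ (snd z0) (Jb Z.+ + suc (suc n')) (<-≤-trans (<-≤-trans (snd lv) hT2) (≤-reflexive (trans (sym (ι-suc Jt)) (cong ι (e Jb (+ suc n')))))) where
    e : ∀ a n → + 1 Z.+ (a Z.+ n) ≡ a Z.+ (+ 1 Z.+ n)
    e = ℤS.solve-∀

  μ ν' : ℚ
  μ = ν m
  ν' = ν n'

  -- One more than the number of interior lattice points on these levels, as α and α' each contain
  -- an extra 1.
  S : ℚ
  S = α + α' + μ - 1#

  totalℚ : ν (cnt Jb N.+ (m N.+ cnt Jt)) ≡ ν (cnt Jb) + (μ + ν (cnt Jt))
  totalℚ = trans (ν-+ (cnt Jb) (m N.+ cnt Jt)) (cong (λ z → ν (cnt Jb) + z) (ν-+ m (cnt Jt)))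

  S≤I : S ≤ I
  S≤I = ≤-by (diff≥ (ν-≤ (cnt Jb N.+ (m N.+ cnt Jt)) i total≤)) (trans (id215 (ν i) (ν (cnt Jt)) (ν (cnt Jb)) μ) (cong (λ z → ν i - z) (sym totalℚ)))

  S≥2 : ν 2 ≤ S
  S≥2 = ≤-by (diff≥ (ν-≤ 1 (cnt Jb N.+ (m N.+ cnt Jt)) total≥1)) (trans (id216 (ν (cnt Jt)) (ν (cnt Jb)) μ) (cong (_- 1#) (sym totalℚ)))

  mid-nonempty : ∀ a → a N.< n' → 1 N.≤ cnt (Z.suc Jb Z.+ + a)
  mid-nonempty a lt = nonempty w 1≤k (Z.suc Jb Z.+ + a) (<-≤-trans hB1 (≤-trans (ι-≤ Jb (Jb Z.+ + a) (ZP.i≤i+j Jb (+ a))) (≤-reflexive (sym lower))))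
    (≤-<-trans (≤-trans (≤-reflexive (trans (sym (ι-suc (Z.suc Jb Z.+ + a))) (cong ι (e2 Jb (+ a))))) (ι-≤ (Jb Z.+ + suc (suc a)) Jt (ZP.+-monoʳ-≤ Jb (Z.+≤+ (N.s≤s lt))))) hT1) where
   e2 : ∀ a n → + 1 Z.+ ((+ 1 Z.+ a) Z.+ n) ≡ a Z.+ (+ 1 Z.+ (+ 1 Z.+ n))
   e2 = ℤS.solve-∀
   e1 : ∀ a n → (+ 1 Z.+ a) Z.+ n ≡ + 1 Z.+ (a Z.+ n)
   e1 = ℤS.solve-∀
   lower : ι (Z.suc Jb Z.+ + a) - 1# ≡ ι (Jb Z.+ + a)
   lower = trans (cong (_- 1#) (trans (cong ι (e1 Jb (+ a))) (ι-suc (Jb Z.+ + a)))) (id189 (ι (Jb Z.+ + a)))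

  n'≤m : n' N.≤ m
  n'≤m = countRange-≥ (Z.suc Jb) n' zs mid-nonempty

  α≥0 : 0# ≤ α
  α≥0 = ≤-trans (≤-lit 0# 1#) (α≥1 (cnt Jt))

  α'≥0 : 0# ≤ α'
  α'≥0 = ≤-trans (≤-lit 0# 1#) (α≥1 (cnt Jb))

  nn : ν (suc n') ≡ ν' + 1#
  nn = suc-ν n'

  ν'≥0 : 0# ≤ ν'
  ν'≥0 = ν-0≤ n'

  slope-tν : σt * (ν' + 1# + τ') ≤ α
  slope-tν = subst (λ z → σt * (z + τ') ≤ α) nn slope-t

  slope-bν : - σb * (ν' + 1# + τ) ≤ α'
  slope-bν = subst (λ z → - σb * (z + τ) ≤ α') nn slope-b

  steep-t : ∀ c → 0# ≤ c → c ≤ ν' + 1# → c * σt ≤ α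
  steep-t c h0 h = slope-from σt c (ν' + 1# + τ') α α≥0 h0 (≤-trans h (≤-by (<⇒≤ τ'>0) (cancelJ (ν' + 1#) τ'))) slope-tν

  steep-b : ∀ c → 0# ≤ c → c ≤ ν' + 1# → c * - σb ≤ α'
  steep-b c h0 h = slope-from (- σb) c (ν' + 1# + τ) α' α'≥0 h0 (≤-trans h (≤-by (<⇒≤ τ>0) (cancelJ (ν' + 1#) τ))) slope-bν

  -- The slopes are at most the widths, so the outermost rows hold at most 2 α + 1 and 2 α' + 1
  -- points. Each interior level holds at most two, and each middle level has an interior point. For
  -- k ≥ 4 the total stays below `bmax k i`.
  b≤bmax : b N.≤ bmax k i
  b≤bmax = ν-≤⁻ b (bmax k i) (≤-trans b-countℚ (subst (λ z → ν nb + (ν 2 * (ν (suc n') + 1#) + ν nt) ≤ z) (sym (bmaxℚ k i)) (≤-by cert (trans (cong (λ z → (K + 1#) * I + ν 3 - (ν nb + (ν 2 * (z + 1#) + ν nt))) nn) (id219 K I α α' μ ν' (ν nt) (ν nb)))))) where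
   one≤ : 1# ≤ ν' + 1#
   one≤ = α≥1 n'
   ht : ν nt ≤ ν 2 * α + 1#
   ht = [ (λ e → subst (_≤ ν 2 * α + 1#) (cong ν (sym e)) ((≤-lit 0# (ν 2) ⊠ α≥0) ⊞ ≤-lit 0# 1#)) , (λ h → ≤-trans h (≤-by (diff≥ (steep-t 1# (≤-lit 0# 1#) one≤)) (id217 α σt))) ]′ top-count
   hb : ν nb ≤ ν 2 * α' + 1#
   hb = [ (λ e → subst (_≤ ν 2 * α' + 1#) (cong ν (sym e)) ((≤-lit 0# (ν 2) ⊠ α'≥0) ⊞ ≤-lit 0# 1#)) , (λ h → ≤-trans h (≤-by (diff≥ (steep-b 1# (≤-lit 0# 1#) one≤)) (id218 α' σb))) ]′ bot-count
   I≥0 : 0# ≤ I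
   I≥0 = ≤-trans (≤-trans (≤-lit 0# (ν 2)) S≥2) S≤I
   cert = ((((diff≥ K≥4 ⊠ I≥0) ⊞ (≤-lit 0# (ν 5) ⊠ diff≥ S≤I)) ⊞ ((≤-lit 0# (ν 3) ⊠ diff≥ S≥2) ⊞ ≤-lit 0# (ν 1))) ⊞ (≤-lit 0# (ν 2) ⊠ diff≥ (ν-≤ n' m n'≤m))) ⊞ (diff≥ ht ⊞ diff≥ hb)

  -- This is how k ≥ 4 enters the estimates that do not mention k: they are proved with 5 in place
  -- of `K + 1`.
  five≤ : ν 5 * S - ½ ≤ (K + 1#) * S - ½
  five≤ = ≤-by (diff≥ K≥4 ⊠ ≤-trans (≤-lit 0# (ν 2)) S≥2) (id220 K S)

  conclude : area2 P ≤ (K + 1#) * S - ½ → Concl k i b P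
  conclude h = coarse {b} {P} 4≤k b≤bmax S S≤I h

  jt≡' : jt ≡ jb + 1# + ν'
  jt≡' = trans jt≡ (trans (cong (λ z → jb + z) nn) (id221 jb ν'))

  mid-width : ∀ a → a N.< n' → Width P (ι (Z.suc Jb Z.+ + a)) (cnt (Z.suc Jb Z.+ + a))
  mid-width a lt = subst (λ z → Width P (ι z) (cnt z)) (sym (sJb a)) (level-width (ldata (suc a) (N.s≤s (NP.<⇒≤ lt))))

  -- A middle level is charged the unit strip centred at it, where the slope cancels.
  unit-slab : ∀ {j c} → Width P j c → AreaBound P (j - ½) (j + ½) (ν 2 * (ν c + 1#))
  unit-slab {j} {c} W = weaken (≤-reflexive (id222 j (ν c + 1#) (Width.σ W))) (Width.bound W (j - ½) (j + ½))

  mids : ∀ a q → (∀ d → d N.< q → Width P (ι (a Z.+ + d)) (cnt (a Z.+ + d))) → AreaBound P (ι a - ½) (ι a - ½ + ν q) (ν 2 * (ν (countRange a q zs) + ν q))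
  mids a zero f = trivial-slab (QP.+-identityʳ (ι a - ½))
  mids a (suc q) f = subst₂ (λ u v → AreaBound P (ι a - ½) u v) end-eq tot-eq
    (glue (≤-by (≤-lit 0# 1#) (id223 (ι a))) (≤-by (ν-0≤ q) (cancelJ (ι a + ½) (ν q)))
     (unit-slab (subst (λ z → Width P (ι z) (cnt z)) (ZP.+-identityʳ a) (f 0 (N.s≤s N.z≤n))))
     (subst₂ (λ u v → AreaBound P u v (ν 2 * (ν (countRange (Z.suc a) q zs) + ν q))) start-eq (cong (_+ ν q) start-eq)
      (mids (Z.suc a) q (λ d lt → subst (λ z → Width P (ι z) (cnt z)) (e a (+ d)) (f (suc d) (N.s≤s lt)))))) where
   e : ∀ a n → a Z.+ (+ 1 Z.+ n) ≡ (+ 1 Z.+ a) Z.+ n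
   e = ℤS.solve-∀
   start-eq : ι (Z.suc a) - ½ ≡ ι a + ½
   start-eq = trans (cong (_- ½) (ι-suc a)) (id224 (ι a))
   end-eq : ι a + ½ + ν q ≡ ι a - ½ + ν (suc q)
   end-eq = trans (id225 (ι a) (ν q)) (cong (λ z → ι a - ½ + z) (sym (suc-ν q)))
   tot-eq : ν 2 * (ν (cnt a) + 1#) + ν 2 * (ν (countRange (Z.suc a) q zs) + ν q) ≡ ν 2 * (ν (countRange a (suc q) zs) + ν (suc q))
   tot-eq = trans (id226 (ν (cnt a)) (ν (countRange (Z.suc a) q zs)) (ν q)) (cong₂ (λ u v → ν 2 * (u + v)) (sym (ν-+ (cnt a) (countRange (Z.suc a) q zs))) (sym (suc-ν q)))

  mid-block : AreaBound P (jb + ½) (jt - ½) (ν 2 * (μ + ν'))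
  mid-block = subst₂ (λ u v → AreaBound P u v (ν 2 * (μ + ν'))) start-eq (trans (cong (_+ ν') start-eq) (trans (id227 jb ν') (cong (_- ½) (sym jt≡')))) (mids (Z.suc Jb) n' mid-width) where
   start-eq : ι (Z.suc Jb) - ½ ≡ jb + ½
   start-eq = trans (cong (_- ½) (ι-suc Jb)) (id224 jb)

  B≤c1 : B ≤ jb + ½
  B≤c1 = ≤-by (<⇒≤ τ'>0 ⊞ 0≤½) (id228 jb B)

  c1≤c2 : jb + ½ ≤ jt - ½
  c1≤c2 = ≤-by ν'≥0 (trans (cong (λ z → z - ½ - (jb + ½)) jt≡') (id229 jb ν'))

  c2≤T : jt - ½ ≤ T
  c2≤T = ≤-by (<⇒≤ τ>0 ⊞ 0≤½) (id230 jt T)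

  assemble : ∀ {M1 M2 M3} → AreaBound P B (jb + ½) M1 → AreaBound P (jb + ½) (jt - ½) M2 → AreaBound P (jt - ½) T M3 → area2 P ≤ (M1 + M2) + M3
  assemble A1 A2 A3 = area≤ cv L (glue (≤-trans B≤c1 c1≤c2) c2≤T (glue B≤c1 c1≤c2 A1 A2) A3)

 ordered-halves : ∀ τ → (½ ≤ τ) ⊎ (τ ≤ ½)
 ordered-halves τ = ≤-total ½ τ

 -- Four or more interior levels.

 module ManyLevels {k i b : ℕ} {P : List Point} (pr : Prob k i b P) (w : Wide k P) (4≤k : 4 N.≤ k) {B T : ℚ} (L : Levels P B T)
          (z0 : ℤ × ℤ) (hz0 : HInt P (lat z0)) (Jb : ℤ) (n″ : ℕ) (hB1 : B < ι Jb) (hB2 : ι Jb ≤ B + 1#)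
          (hT1 : ι (Jb Z.+ + suc (suc (suc n″))) < T) (hT2 : T ≤ ι (Jb Z.+ + suc (suc (suc n″))) + 1#) where
  open AtLeastTwo pr w 4≤k L z0 hz0 Jb (suc (suc n″)) hB1 hB2 hT1 hT2
  open Assembly pr w 4≤k L z0 hz0 Jb (suc (suc (suc n″))) hB1 hB2 hT1 hT2
  open Ends {P} {B} {T}

  Jf Jl : ℤ
  Jf = Z.suc Jb
  Jl = Z.suc Jb Z.+ + suc n″

  g' g r : ℕ
  g' = cnt Jf
  g = cnt Jl
  r = countRange (Z.suc Jf) n″ zs

  m≡ : m ≡ g' N.+ (r N.+ g)
  m≡ = cong (g' N.+_) (trans (countRange-last (Z.suc Jf) n″ zs) (cong (λ z → r N.+ cnt z) (e Jb (+ n″)))) where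
   e : ∀ a n → (+ 1 Z.+ (+ 1 Z.+ a)) Z.+ n ≡ (+ 1 Z.+ a) Z.+ (+ 1 Z.+ n)
   e = ℤS.solve-∀

  Wf : Width P (jb + 1#) g'
  Wf = subst (λ z → Width P z g') (ι-suc Jb) (subst (λ z → Width P (ι z) (cnt z)) (ZP.+-identityʳ Jf) (mid-width 0 (N.s≤s N.z≤n)))

  Wl : Width P (jt - 1#) g
  Wl = subst (λ z → Width P z g) eq (mid-width (suc n″) NP.≤-refl) where
   e : ∀ a n → (+ 1 Z.+ a) Z.+ n ≡ (a Z.+ (+ 1 Z.+ n))
   e = ℤS.solve-∀
   e' : ∀ a n → a Z.+ (+ 1 Z.+ n) ≡ + 1 Z.+ (a Z.+ n)
   e' = ℤS.solve-∀
   eq : ι Jl ≡ jt - 1#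
   eq = trans (id231 (ι Jl)) (cong (_- 1#) (trans (sym (ι-suc Jl)) (cong ι (trans (cong Z.suc (e Jb (+ suc n″))) (sym (e' Jb (+ suc (suc n″))))))))

  β β' σ1 σ1' : ℚ
  β = ν g + 1#
  β' = ν g' + 1#
  σ1 = Width.σ Wl
  σ1' = - Width.σ Wf

  g≥1 : 1 N.≤ g
  g≥1 = mid-nonempty (suc n″) NP.≤-refl

  g'≥1 : 1 N.≤ g'
  g'≥1 = subst (λ z → 1 N.≤ cnt z) (ZP.+-identityʳ Jf) (mid-nonempty 0 (N.s≤s N.z≤n))

  r≥ : n″ N.≤ r
  r≥ = countRange-≥ (Z.suc Jf) n″ zs (λ a lt → subst (λ z → 1 N.≤ cnt z) (e Jb (+ a)) (mid-nonempty (suc a) (N.s≤s (NP.m≤n⇒m≤1+n lt)))) where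
   e : ∀ a n → (+ 1 Z.+ a) Z.+ (+ 1 Z.+ n) ≡ (+ 1 Z.+ (+ 1 Z.+ a)) Z.+ n
   e = ℤS.solve-∀

  ν″ : ℚ
  ν″ = ν n″

  ν'≡ : ν' ≡ ν″ + 1# + 1#
  ν'≡ = trans (suc-ν (suc n″)) (cong (_+ 1#) (suc-ν n″))

  three≤ : ν 3 ≤ ν' + 1#
  three≤ = ≤-by (ν-0≤ n″) (trans (cong (λ z → z + 1# - ν 3) ν'≡) (id232 ν″))

  inner-slope : ∀ σ β d → 0# ≤ β → ν 2 ≤ d → σ * d ≤ β → ν 2 * σ ≤ β
  inner-slope σ β d h0 h1 h2 = slope-from σ (ν 2) d β h0 (≤-lit 0# (ν 2)) h1 h2

  s1-t : ν 2 * σ1 ≤ β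
  s1-t = inner-slope σ1 β (ν″ + ν 2 + τ') (≤-trans (≤-lit 0# 1#) (α≥1 g)) (≤-by (ν-0≤ n″ ⊞ <⇒≤ τ'>0) (id233 ν″ τ')) (≤-by (Width.nonneg Wl bot-HIn) (trans (id234 β σ1 ν″ jb B) (cong (λ z → β + σ1 * (B - (z - 1#))) (sym (trans jt≡' (cong (λ z → jb + 1# + z) ν'≡))))))

  s1-b : ν 2 * σ1' ≤ β'
  s1-b = inner-slope σ1' β' (ν″ + ν 2 + τ) (≤-trans (≤-lit 0# 1#) (α≥1 g')) (≤-by (ν-0≤ n″ ⊞ <⇒≤ τ>0) (id233 ν″ τ)) (≤-by (Width.nonneg Wf top-HIn) (trans (cong (λ z → β' - σ1' * (ν″ + ν 2 + (T - z))) (trans jt≡' (cong (λ z → jb + 1# + z) ν'≡))) (id235 β' (Width.σ Wf) ν″ jb T)))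

  -- The coefficient 3 of the neighbouring middle level complements the 2 from its own unit strip,
  -- for a total of 5. The constants 31/4 leave a slack that is nonnegative because each further
  -- middle level has an interior point.
  Et Eb : ℚ
  Et = ν 3 * β + ν 5 * α - + 31 / 4
  Eb = ν 3 * β' + ν 5 * α' - + 31 / 4

  top-part : AreaBound P (jt - ½) T Et
  top-part = [ (λ h → weaken (fst E h) (top-own Wt β σ1)) , (λ h → weaken (snd E h) (top-split Wt Wl (<⇒≤ hT1) h)) ]′ (ordered-halves τ) where
   E = end-wide α σt β σ1 τ (α≥1 (cnt Jt)) (β≥2 g g≥1) (steep-t (ν 3) (≤-lit 0# (ν 3)) three≤) s1-t (<⇒≤ τ>0) τ≤1

  bot-part : AreaBound P B (jb + ½) Eb
  bot-part = [ (λ h → weaken (fst E h) (bot-own Wb β' σ1')) , (λ h → weaken (snd E h) (bot-split Wb Wf (<⇒≤ hB1) h)) ]′ (ordered-halves τ') where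
   E = end-wide α' (- σb) β' σ1' τ' (α≥1 (cnt Jb)) (β≥2 g' g'≥1) (steep-b (ν 3) (≤-lit 0# (ν 3)) three≤) s1-b (<⇒≤ τ'>0) τ'≤1

  result : Concl k i b P
  result = conclude (≤-trans (≤-trans (assemble bot-part mid-block top-part) (≤-by (ν-0≤ n″ ⊞ (≤-lit 0# (ν 3) ⊠ diff≥ (ν-≤ n″ r r≥))) eq)) five≤) where
   μ≡ : μ ≡ ν g' + (ν r + ν g)
   μ≡ = trans (cong ν m≡) (trans (ν-+ g' (r N.+ g)) (cong (λ z → ν g' + z) (ν-+ r g)))
   eq : (ν 5 * S - ½) - ((Eb + ν 2 * (μ + ν')) + Et) ≡ ν″ + ν 3 * (ν r - ν″)
   eq = trans (cong₂ (λ u v → (ν 5 * (α + α' + u - 1#) - ½) - ((Eb + ν 2 * (u + v)) + Et)) μ≡ ν'≡) (id236 α α' (ν g) (ν g') (ν r) ν″)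

 -- Three interior levels.

 module ThreeLevels {k i b : ℕ} {P : List Point} (pr : Prob k i b P) (w : Wide k P) (4≤k : 4 N.≤ k) {B T : ℚ} (L : Levels P B T)
           (z0 : ℤ × ℤ) (hz0 : HInt P (lat z0)) (Jb : ℤ) (hB1 : B < ι Jb) (hB2 : ι Jb ≤ B + 1#)
           (hT1 : ι (Jb Z.+ + 2) < T) (hT2 : T ≤ ι (Jb Z.+ + 2) + 1#) where
  open AtLeastTwo pr w 4≤k L z0 hz0 Jb 1 hB1 hB2 hT1 hT2
  open Assembly pr w 4≤k L z0 hz0 Jb 2 hB1 hB2 hT1 hT2
  open Ends {P} {B} {T}

  Jm : ℤ
  Jm = Z.suc Jb

  c : ℕ
  c = cnt Jm

  c≥1 : 1 N.≤ c
  c≥1 = subst (λ z → 1 N.≤ cnt z) (ZP.+-identityʳ Jm) (mid-nonempty 0 (N.s≤s N.z≤n))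

  jt≡2 : jt ≡ jb + 1# + 1#
  jt≡2 = jt≡'

  mid≡ : jb + 1# ≡ jt - 1#
  mid≡ = trans (id237 jb) (cong (_- 1#) (sym jt≡2))

  Wm : Width P (jb + 1#) c
  Wm = subst (λ z → Width P z c) (ι-suc Jb) (subst (λ z → Width P (ι z) (cnt z)) (ZP.+-identityʳ Jm) (mid-width 0 (N.s≤s N.z≤n)))

  -- The same argument for the three widths given by arbitrary bounds on the numbers of points.
  module Bounds {ct cm cb : ℕ} (Wt : Width P jt ct) (Wm : Width P (jb + 1#) cm) (Wb : Width P jb cb) where
   αt αb β σ st sb : ℚ
   αt = ν ct + 1#
   αb = ν cb + 1#
   β = ν cm + 1#
   σ = Width.σ Wm
   st = Width.σ Wt
   sb = - Width.σ Wb

   -- The level is renamed with its slope kept visible, since the same σ must appear, with opposite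
   -- signs, in the estimates of the two ends.
   Wm' : Σ (Width P (jt - 1#) cm) (λ W → Width.σ W ≡ σ)
   Wm' = go mid≡ where
    go : ∀ {j} → jb + 1# ≡ j → Σ (Width P j cm) (λ W → Width.σ W ≡ σ)
    go refl = Wm , refl

   hst : st * (ν 2 + τ') ≤ αt
   hst = ≤-by (Width.nonneg Wt bot-HIn) (trans (id238 αt st jb B) (cong (λ z → αt + st * (B - z)) (sym jt≡2)))

   hsb : sb * (ν 2 + τ) ≤ αb
   hsb = ≤-by (Width.nonneg Wb top-HIn) (trans (cong (λ z → αb - sb * (ν 2 + (T - z))) jt≡2) (id239 αb (Width.σ Wb) jb T))

   two≤ : ∀ t → 0# ≤ t → ν 2 ≤ ν 2 + t
   two≤ t h = ≤-by h (id240 t)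

   half-t : ν 2 * st ≤ αt
   half-t = slope-from st (ν 2) (ν 2 + τ') αt (≤-trans (≤-lit 0# 1#) (α≥1 ct)) (≤-lit 0# (ν 2)) (two≤ τ' (<⇒≤ τ'>0)) hst

   half-b : ν 2 * sb ≤ αb
   half-b = slope-from sb (ν 2) (ν 2 + τ) αb (≤-trans (≤-lit 0# 1#) (α≥1 cb)) (≤-lit 0# (ν 2)) (two≤ τ (<⇒≤ τ>0)) hsb

   hσ : σ * (1# + τ') ≤ β
   hσ = ≤-by (Width.nonneg Wm bot-HIn) (id241 β σ jb B)

   hσ' : - σ * (1# + τ) ≤ β
   hσ' = ≤-by (Width.nonneg Wm top-HIn) (trans (cong (λ z → β - - σ * (1# + (T - z))) jt≡2) (id242 β σ jb T))

   mid-own : AreaBound P (jb + ½) (jt - ½) (ν 2 * β)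
   mid-own = subst₂ (λ u v → AreaBound P u v (ν 2 * β)) (id224 jb) (trans (id243 jb) (cong (_- ½) (sym jt≡2))) (unit-slab Wm)

   -- The middle strip may instead be charged to the top level, extrapolated downwards. For widths
   -- 1, 2, 1 this is no worse than `mid-own` as long as `st` is at least -1.
   mid-top : AreaBound P (jb + ½) (jt - ½) (ν 2 * (αt - st))
   mid-top = weaken (≤-reflexive (trans (cong (λ z → (z - ½ - (jb + ½)) * (ν 2 * αt + st * ((jb + ½ - z) + (z - ½ - z)))) jt≡2) (id244 jb αt st))) (Width.bound Wt (jb + ½) (jt - ½))

   mid-bot : AreaBound P (jb + ½) (jt - ½) (ν 2 * (αb - sb))
   mid-bot = weaken (≤-reflexive (trans (cong (λ z → (z - ½ - (jb + ½)) * (ν 2 * αb + Width.σ Wb * ((jb + ½ - jb) + (z - ½ - jb)))) jt≡2) (id245 jb αb (Width.σ Wb)))) (Width.bound Wb (jb + ½) (jt - ½))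

   t-own : AreaBound P (jt - ½) T (own αt st β σ τ)
   t-own = top-own Wt β σ

   b-own : AreaBound P B (jb + ½) (own αb sb β (- σ) τ')
   b-own = bot-own Wb β (- σ)

   t-split : τ ≤ ½ → AreaBound P (jt - ½) T (split αt st β σ τ)
   t-split h = subst (λ z → AreaBound P (jt - ½) T (split αt st β z τ)) (snd Wm') (top-split Wt (fst Wm') (<⇒≤ hT1) h)

   b-split : τ' ≤ ½ → AreaBound P B (jb + ½) (split αb sb β (- σ) τ')
   b-split h = bot-split Wb Wm (<⇒≤ hB1) h

   sum-up : ∀ {M1 M2 M3} V → AreaBound P B (jb + ½) M1 → AreaBound P (jb + ½) (jt - ½) M2 → AreaBound P (jt - ½) T M3 → (M3 + M1) + M2 ≤ V → area2 P ≤ V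
   sum-up {M1} {M2} {M3} V A1 A2 A3 h = ≤-trans (assemble A1 A2 A3) (subst (_≤ V) (id246 M1 M2 M3) h)

   many : 1 N.≤ cm → ν 5 ≤ β + αt + αb → area2 P ≤ (ν 3 * β + ν 5 * αt + ν 5 * αb - + 21 / 2) + ν 2 * β
   many hc h5 = go (ordered-halves τ) (ordered-halves τ') where
    open Three αt st β σ τ αb sb τ' (α≥1 ct) (α≥1 cb) (β≥2 cm hc) h5 half-t half-b hσ hσ' (<⇒≤ τ>0) τ≤1 (<⇒≤ τ'>0) τ'≤1
    V = (ν 3 * β + ν 5 * αt + ν 5 * αb - + 21 / 2) + ν 2 * β
    go : (½ ≤ τ) ⊎ (τ ≤ ½) → (½ ≤ τ') ⊎ (τ' ≤ ½) → area2 P ≤ V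
    go (inj₁ x) (inj₁ y) = sum-up V b-own mid-own t-own (QP.+-monoˡ-≤ (ν 2 * β) (own-own x y))
    go (inj₁ x) (inj₂ y) = sum-up V (b-split y) mid-own t-own (QP.+-monoˡ-≤ (ν 2 * β) (own-split x y))
    go (inj₂ x) (inj₁ y) = sum-up V b-own mid-own (t-split x) (QP.+-monoˡ-≤ (ν 2 * β) (split-own x y))
    go (inj₂ x) (inj₂ y) = sum-up V (b-split y) mid-own (t-split x) (QP.+-monoˡ-≤ (ν 2 * β) (split-split x y))

  module Single (Wt : Width P jt 0) (Wm : Width P (jb + 1#) 1) (Wb : Width P jb 0) where
   open Bounds Wt Wm Wb

   -- The value of 5 S - 1/2 at S = 2.
   V : ℚ
   V = + 19 / 2

   slope1 : σ ≤ ν 2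
   slope1 = unit-slope σ τ' 0# (ν 2) ≤-refl (<-lit 0# (ν 2)) (<⇒≤ τ'>0) hσ refl

   slope1' : - σ ≤ ν 2
   slope1' = unit-slope (- σ) τ 0# (ν 2) ≤-refl (<-lit 0# (ν 2)) (<⇒≤ τ>0) hσ' refl

   cap : ∀ s1 d E → s1 ≤ d → ν 2 + c¾ * d ≤ E → ν 2 + c¾ * s1 ≤ E
   cap s1 d E h h' = ≤-trans (≤-by (0≤¾ ⊠ diff≥ h) (id247 s1 d)) h'

   Mt Mb St Sb : ℚ
   Mt = own 1# st (ν 2) σ τ
   Mb = own 1# sb (ν 2) (- σ) τ'
   St = split 1# st (ν 2) σ τ
   Sb = split 1# sb (ν 2) (- σ) τ'

   regroup : ∀ a b c x y → c + a ≤ x → b ≤ y → x + y ≤ V → (a + b) + c ≤ V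
   regroup a b c x y h1 h2 h3 = ≤-trans (subst (_≤ x + y) (id246 a b c) (QP.+-mono-≤ h1 h2)) h3

   regroup' : ∀ a b c x y → c + b ≤ x → a ≤ y → x + y ≤ V → (a + b) + c ≤ V
   regroup' a b c x y h1 h2 h3 = ≤-trans (subst (_≤ x + y) (id248 a b c) (QP.+-mono-≤ h1 h2)) h3

   own-own : ½ ≤ τ → ½ ≤ τ' → area2 P ≤ V
   own-own x y = [ neg (unit-end st σ τ x τ≤1) , pos ]′ (≤-total sb 0#) where
    neg : (ν 2 * (1# - st) + own 1# st (ν 2) σ τ ≤ + 25 / 4) ⊎ (ν 4 + own 1# st (ν 2) σ τ ≤ + 25 / 4) → sb ≤ 0# → area2 P ≤ V
    neg (inj₁ h) s = sum-up V b-own mid-top t-own (regroup Mt Mb (ν 2 * (1# - st)) (+ 25 / 4) (ν 3) h (unit-end⁻ sb (- σ) τ' s y τ'≤1) (≤-lit (+ 25 / 4 + ν 3) V))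
    neg (inj₂ h) s = sum-up V b-own mid-own t-own (regroup Mt Mb (ν 4) (+ 25 / 4) (ν 3) h (unit-end⁻ sb (- σ) τ' s y τ'≤1) (≤-lit (+ 25 / 4 + ν 3) V))
    pos : 0# ≤ sb → area2 P ≤ V
    pos s = sum-up V b-own mid-bot t-own (regroup' Mt Mb (ν 2 * (1# - sb)) (ν 5) c²⁷⁄₈ (unit-end⁺ sb (- σ) τ' s y τ'≤1) (unit-end-max st σ τ half-t x τ≤1) (≤-lit (ν 5 + c²⁷⁄₈) V))

   own-split : ½ ≤ τ → τ' ≤ ½ → area2 P ≤ V
   own-split x y = go (unit-end st σ τ x τ≤1) where
    small : split 1# sb (ν 2) (- σ) τ' ≤ ν 3
    small = unit-split sb (- σ) τ' (ν 3) (<⇒≤ τ'>0) y (≤-lit (ν 2) (ν 3)) (cap (- σ) (+ 4 / 3) (ν 3) (unit-slope (- σ) τ ½ (+ 4 / 3) 0≤½ (<-lit 0# (+ 4 / 3)) x hσ' refl) (≤-lit (ν 2 + c¾ * (+ 4 / 3)) (ν 3)))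
    go : (ν 2 * (1# - st) + own 1# st (ν 2) σ τ ≤ + 25 / 4) ⊎ (ν 4 + own 1# st (ν 2) σ τ ≤ + 25 / 4) → area2 P ≤ V
    go (inj₁ h) = sum-up V (b-split y) mid-top t-own (regroup Mt Sb (ν 2 * (1# - st)) (+ 25 / 4) (ν 3) h small (≤-lit (+ 25 / 4 + ν 3) V))
    go (inj₂ h) = sum-up V (b-split y) mid-own t-own (regroup Mt Sb (ν 4) (+ 25 / 4) (ν 3) h small (≤-lit (+ 25 / 4 + ν 3) V))

   split-own : τ ≤ ½ → ½ ≤ τ' → area2 P ≤ V
   split-own x y = go (unit-end sb (- σ) τ' y τ'≤1) where
    small : split 1# st (ν 2) σ τ ≤ ν 3
    small = unit-split st σ τ (ν 3) (<⇒≤ τ>0) x (≤-lit (ν 2) (ν 3)) (cap σ (+ 4 / 3) (ν 3) (unit-slope σ τ' ½ (+ 4 / 3) 0≤½ (<-lit 0# (+ 4 / 3)) y hσ refl) (≤-lit (ν 2 + c¾ * (+ 4 / 3)) (ν 3)))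
    go : (ν 2 * (1# - sb) + own 1# sb (ν 2) (- σ) τ' ≤ + 25 / 4) ⊎ (ν 4 + own 1# sb (ν 2) (- σ) τ' ≤ + 25 / 4) → area2 P ≤ V
    go (inj₁ h) = sum-up V b-own mid-bot (t-split x) (regroup' St Mb (ν 2 * (1# - sb)) (+ 25 / 4) (ν 3) h small (≤-lit (+ 25 / 4 + ν 3) V))
    go (inj₂ h) = sum-up V b-own mid-own (t-split x) (regroup' St Mb (ν 4) (+ 25 / 4) (ν 3) h small (≤-lit (+ 25 / 4 + ν 3) V))

   split-split : τ ≤ ½ → τ' ≤ ½ → area2 P ≤ V
   split-split x y = [ neg , pos ]′ (≤-total σ 0#) where
    flat : ∀ s1 → s1 ≤ 0# → ν 2 + c¾ * s1 ≤ ν 2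
    flat s1 h = cap s1 0# (ν 2) h (≤-lit (ν 2 + c¾ * 0#) (ν 2))
    wide-t : split 1# st (ν 2) σ τ ≤ + 7 / 2
    wide-t = unit-split st σ τ (+ 7 / 2) (<⇒≤ τ>0) x (≤-lit (ν 2) (+ 7 / 2)) (cap σ (ν 2) (+ 7 / 2) slope1 (≤-lit (ν 2 + c¾ * ν 2) (+ 7 / 2)))
    wide-b : split 1# sb (ν 2) (- σ) τ' ≤ + 7 / 2
    wide-b = unit-split sb (- σ) τ' (+ 7 / 2) (<⇒≤ τ'>0) y (≤-lit (ν 2) (+ 7 / 2)) (cap (- σ) (ν 2) (+ 7 / 2) slope1' (≤-lit (ν 2 + c¾ * ν 2) (+ 7 / 2)))
    neg : σ ≤ 0# → area2 P ≤ V
    neg h = sum-up V (b-split y) mid-own (t-split x) (≤-trans (QP.+-monoˡ-≤ (ν 4) (QP.+-mono-≤ (unit-split st σ τ (ν 2) (<⇒≤ τ>0) x ≤-refl (flat σ h)) wide-b)) (≤-lit (ν 2 + (+ 7 / 2) + ν 4) V))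
    pos : 0# ≤ σ → area2 P ≤ V
    pos h = sum-up V (b-split y) mid-own (t-split x) (≤-trans (QP.+-monoˡ-≤ (ν 4) (QP.+-mono-≤ wide-t (unit-split sb (- σ) τ' (ν 2) (<⇒≤ τ'>0) y ≤-refl (flat (- σ) (QP.neg-antimono-≤ h))))) (≤-lit ((+ 7 / 2) + ν 2 + ν 4) V))

   single : area2 P ≤ V
   single = go (ordered-halves τ) (ordered-halves τ') where
    go : (½ ≤ τ) ⊎ (τ ≤ ½) → (½ ≤ τ') ⊎ (τ' ≤ ½) → area2 P ≤ V
    go (inj₁ x) (inj₁ y) = own-own x y
    go (inj₁ x) (inj₂ y) = own-split x y
    go (inj₂ x) (inj₁ y) = split-own x y
    go (inj₂ x) (inj₂ y) = split-split x y

  result : Concl k i b P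
  result = conclude (≤-trans (go (2 NP.≤? cnt Jt N.+ cnt Jb N.+ c)) five≤) where
   μ≡ : μ ≡ ν c
   μ≡ = cong ν (NP.+-identityʳ c)
   zero-of : ∀ a b c → 1 N.≤ c → ¬ (2 N.≤ a N.+ b N.+ c) → a ≡ 0 × b ≡ 0 × c ≡ 1
   zero-of zero zero (suc zero) _ _ = refl , refl , refl
   zero-of zero zero (suc (suc c)) _ h = ⊥-elim (h (N.s≤s (N.s≤s N.z≤n)))
   zero-of zero (suc b) (suc c) _ h = ⊥-elim (h (N.s≤s (subst (1 N.≤_) (sym (NP.+-suc b c)) (N.s≤s N.z≤n))))
   zero-of (suc a) b (suc c) _ h = ⊥-elim (h (N.s≤s (subst (1 N.≤_) (sym (NP.+-suc (a N.+ b) c)) (N.s≤s N.z≤n))))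
   few : cnt Jt ≡ 0 × cnt Jb ≡ 0 × c ≡ 1 → area2 P ≤ ν 5 * S - ½
   few (e1 , e2 , e3) = ≤-trans (Single.single (subst (Width P jt) e1 Wt) (subst (Width P (jb + 1#)) e3 Wm) (subst (Width P jb) e2 Wb))
    (≤-by (≤-lit 0# (ν 5) ⊠ diff≥ S≥2) (id249 S))
   go : Dec (2 N.≤ cnt Jt N.+ cnt Jb N.+ c) → area2 P ≤ ν 5 * S - ½
   go (no h) = few (zero-of (cnt Jt) (cnt Jb) c c≥1 h)
   go (yes h) = ≤-trans (Bounds.many Wt Wm Wb c≥1 five) (≤-reflexive (trans (id250 α α' (ν c)) (cong (λ z → ν 5 * (α + α' + z - 1#) - ½) (sym μ≡)))) where
    five : ν 5 ≤ (ν c + 1#) + α + α'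
    five = ≤-by (diff≥ (ν-≤ 2 (cnt Jt N.+ cnt Jb N.+ c) h)) (trans (id251 (ν (cnt Jt)) (ν (cnt Jb)) (ν c)) (cong (_- ν 2) (sym (trans (ν-+ (cnt Jt N.+ cnt Jb) c) (cong (_+ ν c) (ν-+ (cnt Jt) (cnt Jb)))))))

 -- Two interior levels.

 module TwoLevels {k i b : ℕ} {P : List Point} (pr : Prob k i b P) (w : Wide k P) (4≤k : 4 N.≤ k) {B T : ℚ} (L : Levels P B T)
          (z0 : ℤ × ℤ) (hz0 : HInt P (lat z0)) (Jb : ℤ) (hB1 : B < ι Jb) (hB2 : ι Jb ≤ B + 1#)
          (hT1 : ι (Jb Z.+ + 1) < T) (hT2 : T ≤ ι (Jb Z.+ + 1) + 1#) where
  open Prob pr using (cv)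
  open AtLeastTwo pr w 4≤k L z0 hz0 Jb 0 hB1 hB2 hT1 hT2
  open Assembly pr w 4≤k L z0 hz0 Jb 1 hB1 hB2 hT1 hT2

  jt≡1 : jt ≡ jb + 1#
  jt≡1 = jt≡

  κ : ℚ
  κ = inv k

  Kκ : K * κ ≡ 1#
  Kκ = inv-* k 1≤k

  κ>0 : 0# < κ
  κ>0 = 0<-cancel (<-≤-trans (<-lit 0# (ν 4)) K≥4) (subst (0# <_) (sym Kκ) (<-lit 0# 1#))

  κ≤ : ∀ t → 1# ≤ K * t → κ ≤ t
  κ≤ t h = ≤-by (<⇒≤ κ>0 ⊠ diff≥ h) (trans (id252 κ t) (trans (cong (λ z → z * t - κ) (sym Kκ)) (id253 K κ t)))

  -- The cut lies τ' above the lower level, so the lower strip is symmetric about that level and its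
  -- slope cancels; all the rest is charged to the upper level. `high-cut` is the same with the
  -- levels exchanged.
  low-cut : area2 P ≤ ν 4 * α' * τ' + (1# + τ - τ') * (ν 2 * α + σt * (τ' + τ - 1#))
  low-cut = ≤-trans (area≤ cv L (glue (≤-by (<⇒≤ τ'>0 ⊞ <⇒≤ τ'>0) (id254 jb B)) (≤-by (<⇒≤ τ>0 ⊞ diff≥ τ'≤1) (trans (id255 jb B T) (cong (λ z → (T - z) + (1# - (jb - B))) (sym jt≡1))))
    (Width.bound Wb B (jb + τ')) (Width.bound Wt (jb + τ') T))) (≤-reflexive (trans (cong (λ z → (jb + (jb - B) - B) * (ν 2 * α' + σb * ((B - jb) + (jb + (jb - B) - jb))) + (T - (jb + (jb - B))) * (ν 2 * α + σt * ((jb + (jb - B) - z) + (T - z)))) jt≡1)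
     (trans (id256 jb B T α' α σb σt) (cong (λ z → ν 4 * α' * (jb - B) + (1# + (T - z) - (jb - B)) * (ν 2 * α + σt * ((jb - B) + (T - z) - 1#))) (sym jt≡1)))))

  high-cut : area2 P ≤ ν 4 * α * τ + (1# + τ' - τ) * (ν 2 * α' + - σb * (τ + τ' - 1#))
  high-cut = ≤-trans (area≤ cv L (glue (≤-by (<⇒≤ τ'>0 ⊞ diff≥ τ≤1) (trans (cong (λ z → z - (T - jt) - B) jt≡1) (id258 jb B (T - jt)))) (≤-by (<⇒≤ τ>0 ⊞ <⇒≤ τ>0) (id257 jt T))
    (Width.bound Wb B (jt - τ)) (Width.bound Wt (jt - τ) T))) (≤-reflexive (trans (cong (λ z → ((z - (T - z)) - B) * (ν 2 * α' + σb * ((B - jb) + (z - (T - z) - jb))) + (T - (z - (T - z))) * (ν 2 * α + σt * ((z - (T - z) - z) + (T - z)))) jt≡1)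
     (trans (id259 jb B T α' α σb σt) (cong (λ z → ν 4 * α * (T - z) + (1# + (jb - B) - (T - z)) * (ν 2 * α' + - σb * ((T - z) + (jb - B) - 1#))) (sym jt≡1)))))

  S≡ : S ≡ α + α' - 1#
  S≡ = id260 α α'

  S≡' : S ≡ α' + α - 1#
  S≡' = trans S≡ (cong (_- 1#) (QP.+-comm α α'))

  bigger : ∀ a b → a N.≤ b → 1 N.≤ b N.+ (0 N.+ a) → 1 N.≤ b
  bigger zero (suc b) _ _ = N.s≤s N.z≤n
  bigger (suc a) (suc b) _ _ = N.s≤s N.z≤n

  slope-t1 : σt * (1# + τ') ≤ α
  slope-t1 = slope-t

  slope-b1 : - σb * (1# + τ) ≤ α'
  slope-b1 = slope-b

  finish : ∀ V → V ≡ (K + 1#) * S - ½ → area2 P ≤ V → area2 P ≤ (K + 1#) * S - ½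
  finish V e h = subst (area2 P ≤_) e h

  sum-sym : ∀ {x} → x ≤ τ + τ' → x ≤ τ' + τ
  sum-sym {x} h = subst (x ≤_) (QP.+-comm τ τ') h

  -- If the ends are tall, τ + τ' ≥ 1, the level with fewer points gets the strip symmetric about
  -- it. If they are low, the level with more points gets the symmetric strip and the thinner level
  -- covers the rest.
  thin-top : cnt Jt N.≤ cnt Jb → area2 P ≤ (K + 1#) * S - ½
  thin-top h = [ (λ g → ≤-trans (≤-trans high-cut (two-tall α α' (- σb) τ τ' (α≥1 (cnt Jt)) β2 (<⇒≤ τ>0) τ≤1 (<⇒≤ τ'>0) τ'≤1 g slope-b1)) (subst (λ z → ν 5 * z - ½ ≤ (K + 1#) * S - ½) S≡ five≤))
         , (λ g → finish ((K + 1#) * (α + α' - 1#) - ½) (cong (λ z → (K + 1#) * z - ½) (sym S≡)) (≤-trans low-cut (≤-trans (≤-reflexive (id262 α α' σt τ τ')) (low g)))) ]′ (≤-total 1# (τ + τ')) where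
   β2 : ν 2 ≤ α'
   β2 = β≥2 (cnt Jb) (bigger (cnt Jt) (cnt Jb) h total≥1)
   low : τ + τ' ≤ 1# → ν 4 * α' * (1# - (1# - τ')) + ((1# - τ') + τ) * (ν 2 * α + σt * (τ - (1# - τ'))) ≤ (K + 1#) * (α + α' - 1#) - ½
   low g = TwoLow.two-low K κ α α' σt τ (1# - τ') Kκ K≥4 κ>0 (α≥1 (cnt Jt)) β2 (QP.+-monoˡ-≤ 1# (ν-≤ (cnt Jt) (cnt Jb) h)) (κ≤ τ Kτ≥1)
    (≤-by (diff≥ g) (sym (id263 τ τ'))) (subst (κ ≤_) (sym (id261 τ')) (κ≤ τ' Kτ'≥1)) (Width.nonneg Wt top-HIn)

  thin-bot : cnt Jb N.≤ cnt Jt → area2 P ≤ (K + 1#) * S - ½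
  thin-bot h = [ (λ g → ≤-trans (≤-trans low-cut (two-tall α' α σt τ' τ (α≥1 (cnt Jb)) β2 (<⇒≤ τ'>0) τ'≤1 (<⇒≤ τ>0) τ≤1 (sum-sym g) slope-t1)) (subst (λ z → ν 5 * z - ½ ≤ (K + 1#) * S - ½) S≡' five≤))
         , (λ g → finish ((K + 1#) * (α' + α - 1#) - ½) (cong (λ z → (K + 1#) * z - ½) (sym S≡')) (≤-trans high-cut (≤-trans (≤-reflexive (id264 α α' σb τ τ')) (low g)))) ]′ (≤-total 1# (τ + τ')) where
   β2 : ν 2 ≤ α
   β2 = β≥2 (cnt Jt) (bigger (cnt Jb) (cnt Jt) h (subst (1 N.≤_) (NP.+-comm (cnt Jb) (cnt Jt)) total≥1))
   low : τ + τ' ≤ 1# → ν 4 * α * (1# - (1# - τ)) + ((1# - τ) + τ') * (ν 2 * α' + - σb * (τ' - (1# - τ))) ≤ (K + 1#) * (α' + α - 1#) - ½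
   low g = TwoLow.two-low K κ α' α (- σb) τ' (1# - τ) Kκ K≥4 κ>0 (α≥1 (cnt Jb)) β2 (QP.+-monoˡ-≤ 1# (ν-≤ (cnt Jb) (cnt Jt) h)) (κ≤ τ' Kτ'≥1)
    (≤-by (diff≥ g) (sym (id265 τ τ'))) (subst (κ ≤_) (sym (id261 τ)) (κ≤ τ Kτ≥1)) (subst (0# ≤_) (id266 α' σb jb B) (Width.nonneg Wb bot-HIn))

  result : Concl k i b P
  result = conclude ([ thin-top , thin-bot ]′ (NP.≤-total (cnt Jt) (cnt Jb)))

 -- One interior level: reduction to thin polygons.

 -- Here M bounds twice the area by a single trapezoid with end heights τ ≤ τ' ≤ 1. The heights are
 -- multiples of 1/k, so `steep` handles τ ≥ 2/k and `short` handles τ = 1/k with τ' < 1; only τ =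
 -- 1/k, τ' = 1 escapes.
 module OneSlab (K κ α σ τ τ' : ℚ) (Kκ : K * κ ≡ 1#) (K≥4 : ν 4 ≤ K) (hα : 1# ≤ α) (τ>0 : 0# < τ) (τ≤τ' : τ ≤ τ') (τ'≤1 : τ' ≤ 1#) (hσ : 0# ≤ α + σ * τ) where
  M V : ℚ
  M = (τ + τ') * (ν 2 * α + σ * (τ - τ'))
  V = (K + 1#) * α - ½

  α≥0 : 0# ≤ α
  α≥0 = ≤-trans (≤-lit 0# 1#) hα

  τ'≥0 : 0# ≤ τ'
  τ'≥0 = ≤-trans (<⇒≤ τ>0) τ≤τ'

  κ>0 : 0# < κ
  κ>0 = 0<-cancel (<-≤-trans (<-lit 0# (ν 4)) K≥4) (subst (0# <_) (sym Kκ) (<-lit 0# 1#))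

  κ≤¼ : 0# ≤ 1# - ν 4 * κ
  κ≤¼ = subst (0# ≤_) (trans (id171 K κ) (cong (_- ν 4 * κ) Kκ)) (diff≥ K≥4 ⊠ <⇒≤ κ>0)

  steep : ν 2 ≤ K * τ → M ≤ V
  steep h = ≤-by (0≤-cancel {τ} τ>0 (subst (0# ≤_) (sym eq) (((((<⇒≤ τ>0 ⊞ τ'≥0) ⊠ diff≥ τ≤τ') ⊠ hσ) ⊞ (α≥0 ⊠ (diff≥ τ'≤1 ⊠ ((≤-lit 0# 1# ⊞ τ'≥0) ⊞ (≤-lit 0# (ν 2) ⊠ <⇒≤ τ>0)))))
    ⊞ ((α≥0 ⊠ (((<⇒≤ κ>0 ⊠ diff≥ h) ⊠ diff≥ (≤-trans τ≤τ' τ'≤1)) ⊞ (diff≥ h ⊠ ½-κ))) ⊞ (<⇒≤ τ>0 ⊠ rest))))) refl where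
   ½-κ : 0# ≤ ½ - κ
   ½-κ = subst (0# ≤_) (id267 κ) ((0≤½ ⊠ κ≤¼) ⊞ <⇒≤ κ>0)
   rest : 0# ≤ (½ * K - 1# - ν 2 * κ) * α - ½
   rest = subst (0# ≤_) (id268 K κ α) (((0≤½ ⊠ diff≥ K≥4) ⊠ α≥0) ⊞ (((0≤½ ⊠ κ≤¼) ⊠ α≥0) ⊞ (0≤½ ⊠ diff≥ hα)))
   R = (((τ + τ') * (τ' - τ)) * (α + σ * τ) + α * ((1# - τ') * (1# + τ' + ν 2 * τ))) + (α * ((κ * (K * τ - ν 2)) * (1# - τ) + (K * τ - ν 2) * (½ - κ)) + τ * ((½ * K - 1# - ν 2 * κ) * α - ½))
   eq : τ * (V - M) ≡ R
   eq = trans (id269 K κ α σ τ τ') (trans (cong (λ z → R + (z - 1#) * (α * τ * τ)) Kκ) (id10 R (α * τ * τ)))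

  short : K * τ ≡ 1# → τ + τ' ≤ 1# → M ≤ V
  short h g = ≤-by (0≤-cancel {τ} τ>0 (subst (0# ≤_) (sym eq) (((((<⇒≤ τ>0 ⊞ τ'≥0) ⊠ diff≥ τ≤τ') ⊠ hσ) ⊞ (α≥0 ⊠ (diff≥ g ⊠ ((≤-lit 0# 1# ⊞ <⇒≤ τ>0) ⊞ τ'≥0)))) ⊞ (<⇒≤ τ>0 ⊠ (diff≥ hα ⊞ 0≤½))))) refl where
   R = (((τ + τ') * (τ' - τ)) * (α + σ * τ) + α * ((1# - (τ + τ')) * (1# + τ + τ'))) + τ * ((α - 1#) + ½)
   eq : τ * (V - M) ≡ R
   eq = trans (id270 K α σ τ τ') (trans (cong (λ z → R + (z - 1#) * α) h) (id10 R α))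

 -- All interior lattice points on one line, the polygon reaching one unit to one side of it and 1/k to the other.
 record Thin (k i : ℕ) (P : List Point) : Set where
  field
   J l : ℤ
   lower : ∀ {v} → v ∈ P → ι J - 1# ≤ snd v
   upper : ∀ {v} → v ∈ P → snd v ≤ ι J + inv k
   top bot : Point
   top∈ : top ∈ P
   bot∈ : bot ∈ P
   top≡ : snd top ≡ ι J + inv k
   bot≡ : snd bot ≡ ι J - 1#
   row : ∀ m → l Z.< m → m Z.< l Z.+ + suc i → HInt P (lat (m , J))
   left-end : ¬ HInt P (lat (l , J))
   right-end : ¬ HInt P (lat (l Z.+ + suc i , J))

 1-or-≥2 : ∀ {x} → IsIntegral x → 1# ≤ x → x ≡ 1# ⊎ ν 2 ≤ x
 1-or-≥2 {x} (z , e) h = go (QP.<-cmp 1# x) where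
  go : Tri (1# < x) (1# ≡ x) (x < 1#) → x ≡ 1# ⊎ ν 2 ≤ x
  go (tri< lt _ _) = inj₂ (subst (ν 2 ≤_) (sym e) (ι-discrete (+ 1) z (subst (1# <_) e lt)))
  go (tri≈ _ eq _) = inj₁ (sym eq)
  go (tri> _ _ gt) = ⊥-elim (<-irrefl refl (<-≤-trans gt h))

 integral-sub : ∀ {x y} → IsIntegral x → IsIntegral y → IsIntegral (x - y)
 integral-sub (z , e) (w , f) = z Z.- w , trans (cong₂ _-_ e f) (sym (ι-- z w))

 module OneLevel {k i b : ℕ} {P : List Point} (pr : Prob k i b P) (w : Wide k P) (4≤k : 4 N.≤ k) (1≤i : 1 N.≤ i) {B T : ℚ} (L : Levels P B T)
         (z0 : ℤ × ℤ) (hz0 : HInt P (lat z0)) (J : ℤ) (hB1 : B < ι J) (hB2 : ι J ≤ B + 1#)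
         (hT1 : ι (J Z.+ + 0) < T) (hT2 : T ≤ ι (J Z.+ + 0) + 1#)
         (thin-goal : ∀ {P'} → Prob k i b P' → b N.≤ bmax k i → Thin k i P' → Concl k i b P') where
  open Prob pr
  open Assembly pr w 4≤k L z0 hz0 J 0 hB1 hB2 hT1 hT2
  open Levels L
  open LevelData Db

  jt≡j : jt ≡ jb
  jt≡j = trans jt≡ (QP.+-identityʳ jb)

  κ : ℚ
  κ = inv k

  Kκ : K * κ ≡ 1#
  Kκ = inv-* k 1≤k

  α≤I : α' ≤ I
  α≤I = QP.+-monoˡ-≤ 1# (ν-≤ (cnt J) i (cnt≤i J))

  area-one : area2 P ≤ (τ + τ') * (ν 2 * α' + σb * (τ - τ'))
  area-one = ≤-trans (area≤ cv L (Width.bound Wb B T)) (≤-reflexive (trans (id271 T B jb α' σb) (cong (λ z → (T - z + (jb - B)) * (ν 2 * α' + σb * (T - z - (jb - B)))) (sym jt≡j))))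

  σ-top : 0# ≤ α' + σb * τ
  σ-top = subst (λ z → 0# ≤ α' + σb * (T - z)) (sym jt≡j) (Width.nonneg Wb top-HIn)

  σ-bot : 0# ≤ α' + - σb * τ'
  σ-bot = subst (0# ≤_) (id272 α' σb B jb) (Width.nonneg Wb bot-HIn)

  nt1 : ℕ
  nt1 = count (Z.suc J) bs

  nt≡ : nt ≡ nt1
  nt≡ = cong (λ z → count (Z.suc z) bs) (ZP.+-identityʳ J)

  top-count1 : nt1 ≡ 0 ⊎ ν nt1 ≤ α' + σb + 1#
  top-count1 = [ inj₁ , (λ h → inj₂ (≤-trans h (≤-by (diff≥ width) (id211 α' (ι r) (ι l) t s)))) ]′
    (count-interval (Z.suc J) bs (ι l + s) (ι r + t) bs-unique (λ {x} m → subst (_≤ ι x) (at (ι l) s) (Lines.on-left lines (bs-HIn m)) , subst (ι x ≤_) (at (ι r) t) (Lines.on-right lines (bs-HIn m)))) where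
   at : ∀ l s → l + s * (ι (Z.suc J) - jb) ≡ l + s
   at l s = trans (cong (λ z → l + s * (z - jb)) (ι-suc J)) (id210 l s jb)

  α'≥1 : 1# ≤ α'
  α'≥1 = α≥1 (cnt J)

  α'≥0 : 0# ≤ α'
  α'≥0 = ≤-trans (≤-lit 0# 1#) α'≥1

  K≥0 : 0# ≤ K
  K≥0 = ≤-trans (≤-lit 0# (ν 4)) K≥4

  K≥1 : 1# ≤ K
  K≥1 = ≤-trans (≤-lit 1# (ν 4)) K≥4

  slope-K : ∀ s t → 0# ≤ t → 1# ≤ K * t → 0# ≤ α' + - s * t → s ≤ K * α'
  slope-K s t t≥0 h1 h2 = [ (λ h → ≤-trans h (K≥0 ⊠ α'≥0)) , (λ h → ≤-by ((K≥0 ⊠ h2) ⊞ (h ⊠ diff≥ h1)) (id273 K α' s t)) ]′ (≤-total s 0#)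

  σ≤ : σb ≤ K * α'
  σ≤ = slope-K σb τ' (<⇒≤ τ'>0) Kτ'≥1 σ-bot

  σ≥ : - σb ≤ K * α'
  σ≥ = slope-K (- σb) τ (<⇒≤ τ>0) Kτ≥1 (subst (λ z → 0# ≤ α' + z * τ) (sym (neg-neg σb)) σ-top)

  -- The level itself has at most two boundary points. The opposite end has height at least 1/k, so
  -- the slope is at most K α' in either direction, and one outer row holds at most (K + 1) α' + 1
  -- points. If both outer rows are occupied, the slopes cancel in the sum of their counts.
  b≤bmax : b N.≤ bmax k i
  b≤bmax = ν-≤⁻ b (bmax k i) (≤-trans b-countℚ (subst (λ z → ν nb + (ν 2 * (ν 0 + 1#) + ν nt) ≤ z) (sym (bmaxℚ k i)) (subst (λ z → ν nb + (ν 2 * (ν 0 + 1#) + ν z) ≤ (K + 1#) * I + ν 3) (sym nt≡) (go top-count1 bot-count)))) where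
   I≥α = diff≥ α≤I
   K+1≥0 = K≥0 ⊞ ≤-lit 0# 1#
   I≥0 : 0# ≤ I
   I≥0 = ≤-trans α'≥0 α≤I
   X : ℕ → ℕ → ℚ
   X p q = ν p + (ν 2 * (ν 0 + 1#) + ν q)
   go : nt1 ≡ 0 ⊎ ν nt1 ≤ α' + σb + 1# → nb ≡ 0 ⊎ ν nb ≤ α' - σb + 1# → X nb nt1 ≤ (K + 1#) * I + ν 3
   go (inj₁ e) (inj₁ e') = subst₂ (λ p q → X p q ≤ (K + 1#) * I + ν 3) (sym e') (sym e) (≤-by ((K+1≥0 ⊠ I≥0) ⊞ ≤-lit 0# 1#) (id274 ((K + 1#) * I)))
   go (inj₂ h) (inj₁ e') = subst (λ p → X p nt1 ≤ (K + 1#) * I + ν 3) (sym e') (≤-by (((K+1≥0 ⊠ I≥α) ⊞ diff≥ σ≤) ⊞ diff≥ h) (id275 K I α' σb (ν nt1)))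
   go (inj₁ e) (inj₂ h) = subst (λ p → X nb p ≤ (K + 1#) * I + ν 3) (sym e) (≤-by (((K+1≥0 ⊠ I≥α) ⊞ diff≥ σ≥) ⊞ diff≥ h) (id276 K I α' σb (ν nb)))
   go (inj₂ h) (inj₂ h') = ≤-by ((((K+1≥0 ⊠ I≥α) ⊞ (diff≥ K≥4 ⊠ α'≥0)) ⊞ ((≤-lit 0# (ν 3) ⊠ diff≥ α'≥1) ⊞ ≤-lit 0# (ν 2))) ⊞ (diff≥ h ⊞ diff≥ h')) (id277 K I α' σb (ν nt1) (ν nb))

  coarse1 : ∀ M → area2 P ≤ M → M ≤ (K + 1#) * α' - ½ → Concl k i b P
  coarse1 M h h' = coarse {b} {P} 4≤k b≤bmax α' α≤I (≤-trans h h')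

  l≤ : ∀ {x} → HIn P (x , jb) → ι l ≤ x
  l≤ {x} h = subst (_≤ x) (id209 (ι l) s jb) (Lines.on-left lines h)

  ≤r : ∀ {x} → HIn P (x , jb) → x ≤ ι r
  ≤r {x} h = subst (x ≤_) (id209 (ι r) t jb) (Lines.on-right lines h)

  wiggle : ∀ x → HInt P (x , jb) → ∃[ ε ] (0# < ε × HIn P (x - ε , jb) × HIn P (x + ε , jb))
  wiggle x h = ε , ε>0 , at (- ε) (box (- ε) 0# ≤-refl (≤-trans nε≤0 (<⇒≤ ε>0)) nε≤0 (<⇒≤ ε>0)) , at ε (box ε 0# (≤-trans nε≤0 (<⇒≤ ε>0)) ≤-refl nε≤0 (<⇒≤ ε>0)) where
   int : Interior P (x , jb)
   int = HInt⇒Interior cv h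
   ε = fst int
   ε>0 : 0# < ε
   ε>0 = fst (snd int)
   nε≤0 : - ε ≤ 0#
   nε≤0 = QP.neg-antimono-≤ (<⇒≤ ε>0)
   box = Interior⇒box int cv
   at : ∀ δ → HIn P (x + δ , jb + 0#) → HIn P (x + δ , jb)
   at δ = subst (λ y → HIn P (x + δ , y)) (QP.+-identityʳ jb)

  l< : ∀ x → HInt P (x , jb) → ι l < x
  l< x h = go (wiggle x h) where
   go : ∃[ ε ] (0# < ε × HIn P (x - ε , jb) × HIn P (x + ε , jb)) → ι l < x
   go (ε , ε>0 , h1 , _) = <-by (diff≥ (l≤ h1) ⊞≤< ε>0) (id278 x (ι l) ε)

  <r : ∀ x → HInt P (x , jb) → x < ι r
  <r x h = go (wiggle x h) where
   go : ∃[ ε ] (0# < ε × HIn P (x - ε , jb) × HIn P (x + ε , jb)) → x < ι r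
   go (ε , ε>0 , _ , h2) = <-by (diff≥ (≤r h2) ⊞≤< ε>0) (id279 x (ι r) ε)

  zs-HInt : ∀ {z} → z ∈ zs → HInt P (lat z)
  zs-HInt {z} m = fst (snd (snd (snd ints)) z) m

  row-J : ∀ {z} → z ∈ zs → J Z.≤ snd z × snd z Z.< J Z.+ + 1
  row-J {x , y} m = y≥ , subst (y Z.<_) (ZP.+-comm (+ 1) J) (ι-<⁻ y (Z.suc J) (<-≤-trans (<-≤-trans (snd lv) hT2) (≤-reflexive (trans (cong (_+ 1#) jt≡j) (sym (ι-suc J)))))) where
   lv : B < ι y × ι y < T
   lv = HInt-levels cv L (zs-HInt m)
   y≥ : J Z.≤ y
   y≥ = ZP.≤-trans (ZP.≤-reflexive (sym (ZP.suc-pred J))) (ZP.i<j⇒suc[i]≤j (ι-<⁻ (Z.pred J) y (≤-<-trans (≤-trans (≤-reflexive (ι-pred J)) (≤-by (diff≥ hB2) (id214 jb B))) (fst lv))))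

  i≤cnt : i N.≤ cnt J
  i≤cnt = subst (N._≤ cnt J) (fst (snd (snd ints))) (NP.≤-trans (length≤countRange J 1 zs row-J) (NP.≤-reflexive (NP.+-identityʳ (cnt J))))

  -- The i interior points all lie on this level strictly between `l` and `r`, so r - l is at least
  -- i + 1; the width bound gives the other inequality.
  exact : r ≡ l Z.+ + suc i
  exact = ι-inj r (l Z.+ + suc i) (≤-antisym (≤-by (diff≥ (≤-trans width α≤I)) (trans (cong (_- ι r) l+) (id280 (ι l) (ι r) (ν i)))) (≤-by (diff≥ lower) (trans (cong (λ z → ι r - z) l+) (id281 (ι l) (ι r) (ν i))))) where
   l+ : ι (l Z.+ + suc i) ≡ ι l + (1# + ν i)
   l+ = trans (ι-+ l (+ suc i)) (cong (λ z → ι l + z) (ν-suc i))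
   gap : ∀ {x} → (x , J) ∈ zs → ι l + 1# ≤ ι x × ι x ≤ ι r - 1#
   gap {x} m = ι-discrete l x (l< (ι x) (zs-HInt m)) , ≤-by (diff≥ (ι-discrete x r (<r (ι x) (zs-HInt m)))) (id282 (ι x) (ι r))
   lower : ν i ≤ (ι r - 1#) - (ι l + 1#) + 1#
   lower = [ (λ e → ⊥-elim (NP.<⇒≢ (NP.≤-trans 1≤i i≤cnt) (sym e))) , ≤-trans (ν-≤ i (cnt J) i≤cnt) ]′
    (count-interval J zs (ι l + 1#) (ι r - 1#) (fst (snd ints)) gap)

  row : ∀ m → l Z.< m → m Z.< l Z.+ + suc i → HInt P (lat (m , J))
  row m h1 h2 = between m h1 (subst (m Z.<_) (sym exact) h2)

  left-end : ¬ HInt P (lat (l , J))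
  left-end h = <-irrefl refl (l< (ι l) h)

  right-end : ¬ HInt P (lat (l Z.+ + suc i , J))
  right-end h = <-irrefl refl (subst (λ z → ι (l Z.+ + suc i) < ι z) exact (<r (ι (l Z.+ + suc i)) h))

  τ-unit : ∀ x → K * x ≡ 1# → x ≡ κ
  τ-unit x h = trans (id283 x) (trans (cong (_* x) (sym (trans (QP.*-comm κ K) Kκ))) (trans (QP.*-assoc κ K x) (trans (cong (κ *_) h) (QP.*-identityʳ κ))))

  thin : τ ≡ κ → τ' ≡ 1# → Thin k i P
  thin h h' = record
   { J = J ; l = l ; lower = λ m → subst (_≤ _) B≡ (≥bot m) ; upper = λ m → subst (_ ≤_) T≡ (≤top m)
   ; top = top ; bot = bot ; top∈ = top∈ ; bot∈ = bot∈ ; top≡ = trans top≡ T≡ ; bot≡ = trans bot≡ B≡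
   ; row = row ; left-end = left-end ; right-end = right-end } where
   T≡ : T ≡ jb + κ
   T≡ = trans (id70 T jt) (cong₂ _+_ jt≡j h)
   B≡ : B ≡ jb - 1#
   B≡ = trans (id284 B jb) (cong (λ z → jb - z) h')

  -- The half turn has determinant 1 and exchanges the two ends.
  module Ng = Transform (Z.- + 1) (+ 0) (+ 0) (Z.- + 1) (+ 0) (+ 0) refl

  N-x : ∀ p → fst (Ng.U p) ≡ - fst p
  N-x (x , y) = id285 x y

  N-y : ∀ p → snd (Ng.U p) ≡ - snd p
  N-y (x , y) = id286 x y

  N-lat : ∀ m j → Ng.U (lat (m , j)) ≡ lat (Z.- m , Z.- j)
  N-lat m j = cong₂ _,_ (trans (N-x (lat (m , j))) (sym (ι-neg m))) (trans (N-y (lat (m , j))) (sym (ι-neg j)))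

  thin⁻ : τ' ≡ κ → τ ≡ 1# → Thin k i (map Ng.U P)
  thin⁻ h h' = record
   { J = Z.- J ; l = l' ; lower = lo ; upper = hi
   ; top = Ng.U bot ; bot = Ng.U top ; top∈ = ∈P.∈-map⁺ Ng.U bot∈ ; bot∈ = ∈P.∈-map⁺ Ng.U top∈
   ; top≡ = trans (N-y bot) (trans (cong -_ bot≡) B≡) ; bot≡ = trans (N-y top) (trans (cong -_ top≡) T≡)
   ; row = row' ; left-end = λ hh → right-end (pull (l Z.+ + suc i) hh)
   ; right-end = λ hh → left-end (pull l (subst (λ z → HInt (map Ng.U P) (lat (z , Z.- J))) (i2 l (+ suc i)) hh)) } where
   l' = Z.- (l Z.+ + suc i)
   T≡ : - T ≡ ι (Z.- J) - 1#
   T≡ = trans (id287 T jt) (cong₂ _-_ (trans (cong -_ jt≡j) (sym (ι-neg J))) h')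
   B≡ : - B ≡ ι (Z.- J) + κ
   B≡ = trans (id288 B jb) (cong₂ _+_ (sym (ι-neg J)) h)
   lo : ∀ {v} → v ∈ map Ng.U P → ι (Z.- J) - 1# ≤ snd v
   lo {v} m = go (∈P.∈-map⁻ Ng.U m) where
    go : ∃[ p ] (p ∈ P × v ≡ Ng.U p) → ι (Z.- J) - 1# ≤ snd v
    go (p , p∈ , e) = subst₂ _≤_ T≡ (sym (trans (cong snd e) (N-y p))) (QP.neg-antimono-≤ (≤top p∈))
   hi : ∀ {v} → v ∈ map Ng.U P → snd v ≤ ι (Z.- J) + κ
   hi {v} m = go (∈P.∈-map⁻ Ng.U m) where
    go : ∃[ p ] (p ∈ P × v ≡ Ng.U p) → snd v ≤ ι (Z.- J) + κ
    go (p , p∈ , e) = subst₂ _≤_ (sym (trans (cong snd e) (N-y p))) B≡ (QP.neg-antimono-≤ (≥bot p∈))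
   pull : ∀ m → HInt (map Ng.U P) (lat (Z.- m , Z.- J)) → HInt P (lat (m , J))
   pull m hh = Ng.HInt⁻ {P} {lat (m , J)} (subst (HInt (map Ng.U P)) (sym (N-lat m J)) hh)
   i1 : ∀ m → Z.- (Z.- m) ≡ m
   i1 = ℤS.solve-∀
   i2 : ∀ l s → Z.- (l Z.+ s) Z.+ s ≡ Z.- l
   i2 = ℤS.solve-∀
   row' : ∀ m → l' Z.< m → m Z.< l' Z.+ + suc i → HInt (map Ng.U P) (lat (m , Z.- J))
   row' m h1 h2 = subst (λ z → HInt (map Ng.U P) (lat (z , Z.- J))) (i1 m) (subst (HInt (map Ng.U P)) (N-lat (Z.- m) J)
    (Ng.HInt⁺ {P} {lat (Z.- m , J)} (row (Z.- m) (subst (Z._< Z.- m) (i1 l) (ZP.neg-mono-< (subst (m Z.<_) (i2 l (+ suc i)) h2)))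
     (subst (Z.- m Z.<_) (i1 (l Z.+ + suc i)) (ZP.neg-mono-< h1)))))

  Kτ-integral : IsIntegral (K * τ)
  Kτ-integral = subst IsIntegral (id289 K T jt) (integral-sub (integral-T w 1≤k) (integral-level w 1≤k Jt))

  Kτ'-integral : IsIntegral (K * τ')
  Kτ'-integral = subst IsIntegral (id289 K jb B) (integral-sub (integral-level w 1≤k J) (integral-B w 1≤k))

  K>0 : 0# < K
  K>0 = <-≤-trans (<-lit 0# (ν 4)) K≥4

  -- A multiple of 1/k below 1 is at most 1 - 1/k, and x equals 1/k.
  gap-unit : ∀ x y → K * x ≡ 1# → IsIntegral (K * y) → y < 1# → x + y ≤ 1#
  gap-unit x y h int lt = ≤-by (0≤-cancel {K} K>0 (subst (0# ≤_) (trans (cong (λ z → K * 1# - (K * y + z)) (sym h)) (id290 K x y)) (diff≥ (integral-gap w 1≤k int (+ k , QP.*-identityʳ K) (scaled< w 1≤k lt))))) refl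

  result : Concl k i b P
  result = [ A , A' ]′ (≤-total τ τ') where
   A : τ ≤ τ' → Concl k i b P
   A h = [ unit , (λ h2 → coarse1 S.M area-one (S.steep h2)) ]′ (1-or-≥2 Kτ-integral Kτ≥1) where
    module S = OneSlab K κ α' σb τ τ' Kκ K≥4 α'≥1 τ>0 h τ'≤1 σ-top
    unit : K * τ ≡ 1# → Concl k i b P
    unit u = go (QP.<-cmp τ' 1#) where
     go : Tri (τ' < 1#) (τ' ≡ 1#) (1# < τ') → Concl k i b P
     go (tri< lt _ _) = coarse1 S.M area-one (S.short u (gap-unit τ τ' u Kτ'-integral lt))
     go (tri≈ _ e _) = thin-goal pr b≤bmax (thin (τ-unit τ u) e)
     go (tri> _ _ gt) = ⊥-elim (<-irrefl refl (<-≤-trans gt τ'≤1))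
   A' : τ' ≤ τ → Concl k i b P
   A' h = [ unit , (λ h2 → coarse1 S.M area' (S.steep h2)) ]′ (1-or-≥2 Kτ'-integral Kτ'≥1) where
    module S = OneSlab K κ α' (- σb) τ' τ Kκ K≥4 α'≥1 τ'>0 h τ≤1 σ-bot
    area' : area2 P ≤ S.M
    area' = subst (area2 P ≤_) (id291 τ τ' α' σb) area-one
    unit : K * τ' ≡ 1# → Concl k i b P
    unit u = go (QP.<-cmp τ 1#) where
     go : Tri (τ < 1#) (τ ≡ 1#) (1# < τ) → Concl k i b P
     go (tri< lt _ _) = coarse1 S.M area' (S.short u (gap-unit τ' τ u Kτ-integral lt))
     go (tri≈ _ id291 _) = Ng.Concl⁻ {k} {i} {b} {P} cv (thin-goal (Ng.Prob⁺ pr) b≤bmax (thin⁻ (τ-unit τ' u) id291))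
     go (tri> _ _ gt) = ⊥-elim (<-irrefl refl (<-≤-trans gt τ≤1))

 -- Coordinates for thin polygons.

 level-min : ∀ (f : Point → ℚ) (h : ℚ) P {v0} → v0 ∈ P → snd v0 ≡ h → ∃[ m ] (m ∈ P × snd m ≡ h × (∀ {v} → v ∈ P → snd v ≡ h → f m ≤ f v))
 level-min f h (p ∷ P) {v0} v0∈ e0 = go (snd p ≟ h) (rest P) where
  Min : List Point → Set
  Min Q = ∃[ m ] (m ∈ Q × snd m ≡ h × (∀ {v} → v ∈ Q → snd v ≡ h → f m ≤ f v))
  None : List Point → Set
  None Q = ∀ {v} → v ∈ Q → snd v ≢ h
  add : ∀ p Q → Dec (snd p ≡ h) → Min Q ⊎ None Q → Min (p ∷ Q) ⊎ None (p ∷ Q)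
  add p Q (yes e) (inj₁ (m , m∈ , em , lo)) = inj₁ (pick (≤-total (f p) (f m))) where
   pick : f p ≤ f m ⊎ f m ≤ f p → Min (p ∷ Q)
   pick (inj₁ l) = p , here refl , e , λ { (here q) _ → ≤-reflexive (cong f (sym q)) ; (there n) q → ≤-trans l (lo n q) }
   pick (inj₂ l) = m , there m∈ , em , λ { (here q) _ → ≤-trans l (≤-reflexive (cong f (sym q))) ; (there n) q → lo n q }
  add p Q (yes e) (inj₂ no') = inj₁ (p , here refl , e , λ { (here q) _ → ≤-reflexive (cong f (sym q)) ; (there n) q → ⊥-elim (no' n q) })
  add p Q (no ¬e) (inj₁ (m , m∈ , em , lo)) = inj₁ (m , there m∈ , em , λ { (here q) q' → ⊥-elim (¬e (trans (cong snd (sym q)) q')) ; (there n) q → lo n q })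
  add p Q (no ¬e) (inj₂ no') = inj₂ λ { (here q) q' → ¬e (trans (cong snd (sym q)) q') ; (there n) q → no' n q }
  rest : ∀ Q → Min Q ⊎ None Q
  rest [] = inj₂ λ ()
  rest (p ∷ Q) = add p Q (snd p ≟ h) (rest Q)
  go : Dec (snd p ≡ h) → Min P ⊎ None P → Min (p ∷ P)
  go d r = [ id , (λ no' → ⊥-elim (no' v0∈ e0)) ]′ (add p P d r)

 -- A thin polygon moved so that its row of interior points starts at (1, 0), the point (0, 0) being
 -- the non-interior one before it, and so that the leftmost vertex on the top line is (0, 1/k).
 record Fine (k i : ℕ) (P : List Point) : Set where
  field
   lower : ∀ {v} → v ∈ P → - 1# ≤ snd v
   upper : ∀ {v} → v ∈ P → snd v ≤ inv k
   apex : (0# , inv k) ∈ P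
   apex-left : ∀ {v} → v ∈ P → snd v ≡ inv k → 0# ≤ fst v
   bot : Point
   bot∈ : bot ∈ P
   bot≡ : snd bot ≡ - 1#
   centre : HInt P (1# , 0#)
   left-end : ¬ HInt P (0# , 0#)
   right-end : ¬ HInt P (ν (suc i) , 0#)

 module Normalise {k i b : ℕ} {P : List Point} (pr : Prob k i b P) (1≤k : 1 N.≤ k) (1≤i : 1 N.≤ i) (th : Thin k i P)
          (m : Point) (m∈ : m ∈ P) (m≡ : snd m ≡ ι (Thin.J th) + inv k)
          (m-min : ∀ {v} → v ∈ P → snd v ≡ ι (Thin.J th) + inv k → fst m ≤ fst v)
          (z : ℤ) (ez : ν k * fst m ≡ ι z) where
  open Prob pr
  open Thin th renaming (lower to lower0; upper to upper0; bot to bot0; bot∈ to bot0∈; bot≡ to bot0≡; left-end to left0; right-end to right0)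

  -- The shear moves a point at height 1/k above the row by a/k. This must equal the abscissa of `m`
  -- minus `l`, and `a` is an integer because k times that abscissa is one.
  a : ℤ
  a = z Z.- + k Z.* l

  shear-det : ∀ a → + 1 Z.* + 1 Z.- (Z.- a) Z.* + 0 ≡ + 1
  shear-det = ℤS.solve-∀

  open Transform (+ 1) (Z.- a) (+ 0) (+ 1) (a Z.* J Z.- l) (Z.- J) (shear-det a)

  U-y : ∀ p → snd (U p) ≡ snd p - ι J
  U-y (x , y) = trans (cong (λ j → 0# * x + 1# * y + j) (ι-neg J)) (id292 x y (ι J))

  U-x : ∀ p → fst (U p) ≡ fst p - ι a * (snd p - ι J) - ι l
  U-x (x , y) = trans (cong₂ (λ A c → 1# * x + A * y + c) (ι-neg a) (trans (ι-- (a Z.* J) l) (cong (_- ι l) (ι-* a J)))) (id293 x y (ι a) (ι J) (ι l))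

  κ K : ℚ
  κ = inv k
  K = ν k

  aκ : ι a * κ ≡ fst m - ι l
  aκ = trans (cong (_* κ) (trans (ι-- z (+ k Z.* l)) (cong₂ _-_ (sym ez) (ι-* (+ k) l)))) (trans (id294 K κ (fst m) (ι l)) (trans (cong (_* (fst m - ι l)) (inv-* k 1≤k)) (QP.*-identityˡ _)))

  top-x : ∀ p → snd p ≡ ι J + κ → fst (U p) ≡ fst p - fst m
  top-x p e = trans (U-x p) (trans (cong (λ y → fst p - ι a * y - ι l) (trans (cong (_- ι J) e) (cancelJ (ι J) κ))) (trans (cong (λ w → fst p - w - ι l) aκ) (id295 (fst p) (fst m) (ι l))))

  U-m : U m ≡ (0# , κ)
  U-m = cong₂ _,_ (trans (top-x m m≡) (QP.+-inverseʳ (fst m))) (trans (U-y m) (trans (cong (_- ι J) m≡) (cancelJ (ι J) κ)))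

  U-lat : ∀ n → U (lat (l Z.+ n , J)) ≡ lat (n , + 0)
  U-lat n = trans (sym (lat-U (l Z.+ n , J))) (cong lat (cong₂ _,_ (e1 a J l n) (e2 J l n))) where
   e1 : ∀ a j l n → + 1 Z.* (l Z.+ n) Z.+ Z.- a Z.* j Z.+ (a Z.* j Z.- l) ≡ n
   e1 = ℤS.solve-∀
   e2 : ∀ j l n → + 0 Z.* (l Z.+ n) Z.+ + 1 Z.* j Z.+ Z.- j ≡ + 0
   e2 = ℤS.solve-∀

  pull : ∀ n → HInt (map U P) (lat (n , + 0)) → HInt P (lat (l Z.+ n , J))
  pull n h = HInt⁻ {P} {lat (l Z.+ n , J)} (subst (HInt (map U P)) (sym (U-lat n)) h)

  over : ∀ {Q : Point → Set} → (∀ {v} → v ∈ P → Q (U v)) → ∀ {v} → v ∈ map U P → Q v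
  over {Q} f {v} n = go (∈P.∈-map⁻ U n) where
   go : ∃[ p ] (p ∈ P × v ≡ U p) → Q v
   go (p , p∈ , e) = subst Q (sym e) (f p∈)

  fine : Fine k i (map U P)
  fine = record
   { lower = over {λ v → - 1# ≤ snd v} (λ {v} n → subst (- 1# ≤_) (sym (U-y v)) (≤-by (diff≥ (lower0 n)) (id296 (snd v) (ι J))))
   ; upper = over {λ v → snd v ≤ κ} (λ {v} n → subst (_≤ κ) (sym (U-y v)) (≤-by (diff≥ (upper0 n)) (id297 (snd v) (ι J) κ)))
   ; apex = subst (_∈ map U P) U-m (∈P.∈-map⁺ U m∈)
   ; apex-left = over {λ v → snd v ≡ κ → 0# ≤ fst v} (λ {v} n e → al v n (trans (id70 (snd v) (ι J)) (cong (λ y → ι J + y) (trans (sym (U-y v)) e))))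
   ; bot = U bot0 ; bot∈ = ∈P.∈-map⁺ U bot0∈ ; bot≡ = trans (U-y bot0) (trans (cong (_- ι J) bot0≡) (id298 (ι J)))
   ; centre = subst (HInt (map U P)) (U-lat (+ 1)) (HInt⁺ {P} {lat (l Z.+ + 1 , J)} (row (l Z.+ + 1) (lt l) (ZP.+-monoʳ-< l (Z.+<+ (N.s≤s 1≤i)))))
   ; left-end = λ h → left0 (subst (λ w → HInt P (lat (w , J))) (ZP.+-identityʳ l) (pull (+ 0) h))
   ; right-end = λ h → right0 (pull (+ suc i) h) } where
   lt : ∀ l → l Z.< l Z.+ + 1
   lt l = subst (l Z.<_) (ZP.+-comm (+ 1) l) (i<suc l)
   al : ∀ v → v ∈ P → snd v ≡ ι J + κ → 0# ≤ fst (U v)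
   al v n e = subst (0# ≤_) (sym (top-x v e)) (diff≥ (m-min n e))

  result : (∀ {P'} → Prob k i b P' → Fine k i P' → Concl k i b P') → Concl k i b P
  result f = Concl⁻ {k} {i} {b} {P} cv (f (Prob⁺ pr) fine)

 normalise : ∀ {k i b P} → Prob k i b P → 1 N.≤ k → 1 N.≤ i → Thin k i P → (∀ {P'} → Prob k i b P' → Fine k i P' → Concl k i b P') → Concl k i b P
 normalise {k} {i} {b} {P} pr 1≤k 1≤i th f = go (level-min fst (ι (Thin.J th) + inv k) P (Thin.top∈ th) (Thin.top≡ th)) where
  go : ∃[ m ] (m ∈ P × snd m ≡ ι (Thin.J th) + inv k × (∀ {v} → v ∈ P → snd v ≡ ι (Thin.J th) + inv k → fst m ≤ fst v)) → Concl k i b P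
  go (m , m∈ , m≡ , m-min) = Normalise.result pr 1≤k 1≤i th m m∈ m≡ m-min (fst int) (snd int) f where
   int = fst (Prob.integral pr m∈)

 -- One side of a thin polygon.

 integral-step : ∀ {x y} → IsIntegral x → IsIntegral y → x < y → x + 1# ≤ y
 integral-step (a , e) (b , f) h = subst₂ (λ p q → p + 1# ≤ q) (sym e) (sym f) (ι-discrete a b (subst₂ _<_ e f h))

 affine-mix : ∀ α β γ s t p q → s + t ≡ 1# → affine α β γ ((s · p) ⊕ (t · q)) ≡ s * affine α β γ p + t * affine α β γ q
 affine-mix α β γ s t (x , y) (x' , y') e = trans (id299 α β γ s t x y x' y') (trans (cong (λ id10 → R + (1# - id10) * γ) e) (id10 R γ)) where
  R = s * (α * x + β * y + γ) + t * (α * x' + β * y' + γ)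

 module Scale (k : ℕ) (4≤k : 4 N.≤ k) where
  K κ : ℚ
  K = ν k
  κ = inv k

  1≤k : 1 N.≤ k
  1≤k = NP.≤-trans (N.s≤s N.z≤n) 4≤k

  Kκ : K * κ ≡ 1#
  Kκ = inv-* k 1≤k

  K≥4 : ν 4 ≤ K
  K≥4 = ν-≤ 4 k 4≤k

  K>0 : 0# < K
  K>0 = <-≤-trans (<-lit 0# (ν 4)) K≥4

  K≥0 : 0# ≤ K
  K≥0 = <⇒≤ K>0

  κ>0 : 0# < κ
  κ>0 = 0<-cancel K>0 (subst (0# <_) (sym Kκ) (<-lit 0# 1#))

  κ≥0 : 0# ≤ κ
  κ≥0 = <⇒≤ κ>0

  κ≤¼ : 0# ≤ 1# - ν 4 * κ
  κ≤¼ = subst (0# ≤_) (trans (id171 K κ) (cong (_- ν 4 * κ) Kκ)) (diff≥ K≥4 ⊠ κ≥0)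

  κ<1 : 0# < 1# - κ
  κ<1 = subst (0# <_) (id300 κ) (κ≤¼ ⊞≤< (<-lit 0# (ν 3) ⊠< κ>0))

  -- A ring identity whose two sides differ by a multiple of K κ - 1.
  by-Kκ : ∀ {a r} c → a ≡ r + (K * κ - 1#) * c → a ≡ r
  by-Kκ {a} {r} c e = trans e (trans (cong (λ id10 → r + (id10 - 1#) * c) Kκ) (id10 r c))

  scale-≤ : ∀ {x y} → K * x ≤ K * y → x ≤ y
  scale-≤ {x} {y} h = ≤-by (0≤-cancel {K} K>0 (subst (0# ≤_) (id122 K x y) (diff≥ h))) refl

  -- Elements of (1/k)Z.
  Grid : ℚ → Set
  Grid x = IsIntegral (K * x)

  grid-step : ∀ {x y} → Grid x → Grid y → x < y → x + κ ≤ y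
  grid-step {x} {y} gx gy h = scale-≤ (subst (_≤ K * y) (trans (cong (λ z → K * x + z) (sym Kκ)) (sym (QP.*-distribˡ-+ K x κ))) (integral-step gx gy (QP.*-monoʳ-<-pos K {{ℚ.positive K>0}} h)))

  grid-0 : Grid 0#
  grid-0 = + 0 , QP.*-zeroʳ K

  grid-κ : Grid κ
  grid-κ = + 1 , Kκ

  grid-+ : ∀ {x y} → Grid x → Grid y → Grid (x + y)
  grid-+ {x} {y} (a , e) (b , f) = a Z.+ b , trans (QP.*-distribˡ-+ K x y) (trans (cong₂ _+_ e f) (sym (ι-+ a b)))

  grid-- : ∀ {x y} → Grid x → Grid y → Grid (x - y)
  grid-- {x} {y} gx gy = subst IsIntegral (id289 K x y) (integral-sub gx gy)

  grid-ι : ∀ z → Grid (ι z)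
  grid-ι z = + k Z.* z , sym (ι-* (+ k) z)

  u : Point → ℚ
  u p = κ - snd p

  -- Both sides are treated at once in the coordinates u, the depth below the top line, and ξ, the
  -- horizontal distance from a reference line. The value e of ξ belongs to the bottom corner on
  -- this side.
  module Side {P : List Point} (cv : ConvexCCW P) (u-grid : ∀ {v} → v ∈ P → Grid (u v)) (u≥0 : ∀ {v} → v ∈ P → 0# ≤ u v) (u≤ : ∀ {v} → v ∈ P → u v ≤ 1# + κ)
        (α β γ : ℚ) (nonneg : ∀ {v} → v ∈ P → 0# ≤ affine α β γ v)
        (vl : Point) (vl∈ : vl ∈ P) (vl-bottom : u vl ≡ 1# + κ) (vl-min : ∀ {v} → v ∈ P → u v ≡ 1# + κ → affine α β γ vl ≤ affine α β γ v) where
   ξ : Point → ℚ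
   ξ = affine α β γ

   e : ℚ
   e = ξ vl

   -- Depths are multiples of κ, so no vertex lies strictly between depth 1 and the bottom line at
   -- depth 1 + κ, or strictly between depths 0 and κ.
   data Height (v : Point) : Set where
    bottom : u v ≡ 1# + κ → Height v
    level : u v ≡ 1# → Height v
    between : κ ≤ u v → u v ≤ 1# - κ → Height v
    top : u v ≡ 0# → Height v

   height : ∀ {v} → v ∈ P → Height v
   height {v} m = go (QP.<-cmp (u v) (1# + κ)) (QP.<-cmp (u v) 1#) (QP.<-cmp 0# (u v)) where
    l1 : ∀ u → 1# + κ - (u + κ) ≡ 1# - u
    l1 u = id302 u κ
    go : Tri (u v < 1# + κ) (u v ≡ 1# + κ) (1# + κ < u v) → Tri (u v < 1#) (u v ≡ 1#) (1# < u v) → Tri (0# < u v) (0# ≡ u v) (u v < 0#) → Height v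
    go (tri≈ _ h _) _ _ = bottom h
    go (tri> _ _ h) _ _ = ⊥-elim (<-irrefl refl (<-≤-trans h (u≤ m)))
    go (tri< _ _ _) (tri≈ _ h _) _ = level h
    go (tri< h _ _) (tri> _ _ h') _ = ⊥-elim (<-irrefl refl (<-≤-trans h' (≤-by (diff≥ (grid-step (u-grid m) (grid-+ (grid-ι (+ 1)) grid-κ) h)) (sym (l1 (u v))))))
    go (tri< _ _ _) (tri< _ _ _) (tri≈ _ h _) = top (sym h)
    go (tri< _ _ _) (tri< _ _ _) (tri> _ _ h) = ⊥-elim (<-irrefl refl (≤-<-trans (u≥0 m) h))
    go (tri< _ _ _) (tri< h _ _) (tri< h' _ _) = between (subst (_≤ u v) (QP.+-identityˡ κ) (grid-step grid-0 (u-grid m) h')) (≤-by (diff≥ (grid-step (u-grid m) (grid-ι (+ 1)) h)) (id303 (u v) κ))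

   -- The lines through the apex with slope ρ and through the bottom vertex vl and the point at height 1 - k⁻¹ below the axis with ξ = a.
   record Bound (ρ a : ℚ) : Set where
    field
     upper : ∀ {v} → v ∈ P → ρ * u v ≤ ξ v
     lower : ∀ {v} → v ∈ P → a + K * (e - a) * (u v - 1#) ≤ ξ v

   at-bottom : ∀ a {v} → v ∈ P → u v ≡ 1# + κ → a + K * (e - a) * (u v - 1#) ≤ ξ v
   at-bottom a {v} m h = subst (_≤ ξ v) (sym (trans (cong (λ z → a + K * (e - a) * (z - 1#)) h) (by-Kκ (e - a) (id304 K κ a e)))) (vl-min m h)

   -- The second line joins the point of the first at depth 1 to the bottom corner. It is at least
   -- as steep as the first line, so at depths up to 1 it demands no more, and below depth 1 only
   -- bottom vertices remain.
   bound : ∀ ρ → (∀ {v} → v ∈ P → ρ * u v ≤ ξ v) → Bound ρ ρ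
   bound ρ h = record { upper = h ; lower = λ m → go m (height m) } where
    slope : 0# ≤ K * (e - ρ) - ρ
    slope = subst (0# ≤_) (trans (cong (λ z → K * (e - ρ * z)) vl-bottom) (by-Kκ (- ρ) (id305 K κ ρ e))) (K≥0 ⊠ diff≥ (h vl∈))
    inner : ∀ {v} → v ∈ P → u v ≤ 1# → ρ + K * (e - ρ) * (u v - 1#) ≤ ξ v
    inner {v} m g = ≤-by (diff≥ (h m) ⊞ (diff≥ g ⊠ slope)) (id306 K e ρ (u v) (ξ v))
    go : ∀ {v} → v ∈ P → Height v → ρ + K * (e - ρ) * (u v - 1#) ≤ ξ v
    go m (bottom g) = at-bottom ρ m g
    go m (level g) = inner m (≤-reflexive g)
    go {v} m (between _ g) = inner m (≤-trans g (≤-by κ≥0 (id261 κ)))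
    go m (top g) = inner m (≤-trans (≤-reflexive g) (≤-lit 0# 1#))

   bound0 : Bound 0# 0#
   bound0 = bound 0# λ {v} m → subst (_≤ ξ v) (sym (QP.*-zeroˡ (u v))) (nonneg m)

   module Kinds (ξ-grid : ∀ {v} → v ∈ P → Grid (ξ v)) (o : Point) (o∈ : o ∈ P) (o-top : u o ≡ 0#) (ξo : ξ o ≡ 0#)
          (pt : ℚ → ℚ → Point) (pt-coords : ∀ p → p ≡ pt (ξ p) (u p)) where

    segment : ∀ {v} h → v ∈ P → ξ v ≡ 0# → 0# ≤ h → h ≤ u v → 0# < u v → HIn P (pt 0# h)
    segment {v} h m z h≥0 h≤ uv>0 = go (recip (u v) uv>0) where
     go : ∃[ r ] (0# < r × u v * r ≡ 1#) → HIn P (pt 0# h)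
     go (r , r>0 , ur) = subst (HIn P) eq (HIn-convex P s t (diff≥ h≤ ⊠ <⇒≤ r>0) (h≥0 ⊠ <⇒≤ r>0) st (vertex-HIn cv o∈) (vertex-HIn cv m)) where
      s = (u v - h) * r
      t = h * r
      p : Point
      p = (s · o) ⊕ (t · v)
      st : s + t ≡ 1#
      st = trans (id307 (u v) h r) ur
      ξp : ξ p ≡ 0#
      ξp = trans (affine-mix α β γ s t o v st) (trans (cong₂ (λ x y → s * x + t * y) ξo z) (id308 s t))
      as-affine : ∀ q → u q ≡ affine 0# (- 1#) κ q
      as-affine (x , y) = id309 x y κ
      up : u p ≡ h
      up = trans (as-affine p) (trans (affine-mix 0# (- 1#) κ s t o v st) (trans (cong₂ (λ x y → s * x + t * y) (trans (sym (as-affine o)) o-top) (sym (as-affine v))) (trans (id310 s h r (u v)) (trans (cong (h *_) ur) (QP.*-identityʳ h)))))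
      eq : p ≡ pt 0# h
      eq = trans (pt-coords p) (cong₂ pt ξp up)

    away : ∀ {v} h → 0# < h → ¬ HIn P (pt 0# h) → v ∈ P → h ≤ u v → κ ≤ ξ v
    away {v} h h>0 n m h≤ = go (QP.<-cmp 0# (ξ v)) where
     go : Tri (0# < ξ v) (0# ≡ ξ v) (ξ v < 0#) → κ ≤ ξ v
     go (tri< g _ _) = subst (_≤ ξ v) (QP.+-identityˡ κ) (grid-step grid-0 (ξ-grid m) g)
     go (tri≈ _ g _) = ⊥-elim (n (segment h m (sym g) (<⇒≤ h>0) h≤ (<-≤-trans h>0 h≤)))
     go (tri> _ _ g) = ⊥-elim (<-irrefl refl (≤-<-trans (nonneg m) g))

    Touch : Set
    Touch = HIn P (pt 0# κ)

    κ≤1+κ : κ ≤ 1# + κ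
    κ≤1+κ = ≤-by (≤-lit 0# 1#) (id311 κ)

    κ≤1 : κ ≤ 1#
    κ≤1 = ≤-by (κ≤¼ ⊞ (≤-lit 0# (ν 3) ⊠ κ≥0)) (id312 κ)

    1≤1+κ : 1# ≤ 1# + κ
    1≤1+κ = ≤-by κ≥0 (id313 κ)

    -- At depth κ the reference line passes through the lattice point at the end of the row. A
    -- touching side contains this point; a side that does not has its bottom corner either exactly
    -- one grid step or at least two grid steps away.
    data Kind : Set where
     touching : Touch → Kind
     sharp : ¬ Touch → e ≡ κ → Kind
     gap : ¬ Touch → ν 2 * κ ≤ e → Kind

    kind : Kind
    kind = go (HIn? P (pt 0# κ)) where
     go : HIn P (pt 0# κ) ⊎ ¬ HIn P (pt 0# κ) → Kind
     go (inj₁ h) = touching h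
     go (inj₂ n) = go' (QP.<-cmp κ e) where
      go' : Tri (κ < e) (κ ≡ e) (e < κ) → Kind
      go' (tri< h _ _) = gap n (subst (_≤ e) (id314 κ) (grid-step grid-κ (ξ-grid vl∈) h))
      go' (tri≈ _ h _) = sharp n (sym h)
      go' (tri> _ _ h) = ⊥-elim (<-irrefl refl (<-≤-trans h (away κ κ>0 n vl∈ (subst (κ ≤_) (sym vl-bottom) κ≤1+κ))))

    -- Since ρ (1 + κ) = κ, this is the line from the apex to the sharp corner; all vertices at
    -- depth κ or more have ξ ≥ κ ≥ ρ u.
    bound-sharp : ¬ Touch → e ≡ κ → ∀ ρ → (K + 1#) * ρ ≡ 1# → Bound ρ ρ
    bound-sharp n ee ρ hρ = bound ρ λ m → go m (height m) where
     ρ>0 : 0# < ρ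
     ρ>0 = 0<-cancel {K + 1#} (K>0 ⊞< ≤-lit 0# 1#) (subst (0# <_) (sym hρ) (<-lit 0# 1#))
     ρκ : ρ * (1# + κ) ≡ κ
     ρκ = trans (by-Kκ (- ρ) (id315 K κ ρ)) (trans (cong (_* κ) hρ) (QP.*-identityˡ κ))
     inner : ∀ {v} → v ∈ P → κ ≤ u v → ρ * u v ≤ ξ v
     inner {v} m h = ≤-trans (subst (ρ * u v ≤_) ρκ (QP.*-monoˡ-≤-nonNeg ρ {{ℚ.nonNegative (<⇒≤ ρ>0)}} (u≤ m))) (away κ κ>0 n m h)
     go : ∀ {v} → v ∈ P → Height v → ρ * u v ≤ ξ v
     go m (bottom h) = inner m (subst (κ ≤_) (sym h) κ≤1+κ)
     go m (level h) = inner m (subst (κ ≤_) (sym h) κ≤1)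
     go m (between h _) = inner m h
     go {v} m (top h) = ≤-trans (≤-reflexive (trans (cong (ρ *_) h) (QP.*-zeroʳ ρ))) (nonneg m)

    -- Vertices down to depth 1 satisfy κ u ≤ κ ≤ ξ, and those on the bottom line have ξ ≥ 2 κ ≥ κ
    -- (1 + κ).
    bound-gap : ¬ Touch → ν 2 * κ ≤ e → Bound κ κ
    bound-gap n ee = bound κ λ m → go m (height m) where
     inner : ∀ {v} → v ∈ P → κ ≤ u v → u v ≤ 1# → κ * u v ≤ ξ v
     inner {v} m h h' = ≤-by (diff≥ (away κ κ>0 n m h) ⊞ (κ≥0 ⊠ diff≥ h')) (id316 κ (u v) (ξ v))
     go : ∀ {v} → v ∈ P → Height v → κ * u v ≤ ξ v
     go {v} m (bottom h) = ≤-by ((diff≥ (≤-trans ee (vl-min m h))) ⊞ (κ≥0 ⊠ diff≥ κ≤1)) (trans (cong (λ z → ξ v - κ * z) h) (id317 κ (ξ v)))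
     go m (level h) = inner m (subst (κ ≤_) (sym h) κ≤1) (≤-reflexive h)
     go m (between h h') = inner m h (≤-trans h' (≤-by κ≥0 (id261 κ)))
     go {v} m (top h) = ≤-trans (≤-reflexive (trans (cong (κ *_) h) (QP.*-zeroʳ κ))) (nonneg m)

    ¼ : ℚ
    ¼ = + 1 / 4

    steep : ∀ {x} → x ≤ 1# - κ → 0# ≤ K * (1# - x) - 1#
    steep {x} h = subst (0# ≤_) (by-Kκ (- 1#) (id318 K κ x)) (K≥0 ⊠ diff≥ h)

    at-one : ∀ a {x z} → x ≡ 1# → a ≤ z → a + K * (e - a) * (x - 1#) ≤ z
    at-one a {x} {z} h g = subst (_≤ z) (sym (trans (cong (λ x → a + K * (e - a) * (x - 1#)) h) (id319 K a e))) g

    -- If the corner at depth 1 is missing, all vertices from depth 1 on have ξ ≥ κ, and the bound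
    -- at depth 1 can be raised by κ/4. The raise makes the area estimate strict, so equality forces
    -- the corner to belong to P.
    tight-touching : HIn P (pt 0# 1#) ⊎ Bound 0# (¼ * κ)
    tight-touching = [ inj₁ , (λ n → inj₂ (improve n)) ]′ (HIn? P (pt 0# 1#)) where
     improve : ¬ HIn P (pt 0# 1#) → Bound 0# (¼ * κ)
     improve n = record { upper = Bound.upper bound0 ; lower = λ m → go m (height m) } where
      a = ¼ * κ
      far : ∀ {v} → v ∈ P → 1# ≤ u v → κ ≤ ξ v
      far = away 1# (<-lit 0# 1#) n
      κ≤e : 0# ≤ e - κ
      κ≤e = diff≥ (far vl∈ (subst (1# ≤_) (sym vl-bottom) 1≤1+κ))
      inner : ∀ {v} → v ∈ P → u v ≤ 1# - κ → a + K * (e - a) * (u v - 1#) ≤ ξ v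
      inner {v} m h = ≤-by ((nonneg m ⊞ ((κ≤e ⊞ (≤-lit 0# (+ 3 / 4) ⊠ κ≥0)) ⊠ steep h)) ⊞ (κ≤e ⊞ (0≤½ ⊠ κ≥0))) (id320 K κ e (u v) (ξ v))
      go : ∀ {v} → v ∈ P → Height v → a + K * (e - a) * (u v - 1#) ≤ ξ v
      go m (bottom h) = at-bottom a m h
      go {v} m (level h) = at-one a h (≤-trans (≤-by (≤-lit 0# (+ 3 / 4) ⊠ κ≥0) (id321 κ)) (far m (≤-reflexive (sym h))))
      go m (between _ h) = inner m h
      go m (top h) = inner m (≤-trans (≤-reflexive h) (≤-by (κ≤¼ ⊞ (≤-lit 0# (ν 3) ⊠ κ≥0)) (id322 κ)))

    -- The analogue for a gap: without the corner at ξ = κ, vertices at depth 1 have ξ ≥ 2 κ, and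
    -- the bound κ at depth 1 can be raised by κ/4.
    tight-gap : ¬ Touch → ν 2 * κ ≤ e → HIn P (pt κ 1#) ⊎ Bound κ (+ 5 / 4 * κ)
    tight-gap nt ee = [ inj₁ , (λ n → inj₂ (improve n)) ]′ (HIn? P (pt κ 1#)) where
     improve : ¬ HIn P (pt κ 1#) → Bound κ (+ 5 / 4 * κ)
     improve n = record { upper = Bound.upper (bound-gap nt ee) ; lower = λ m → go m (height m) } where
      a = + 5 / 4 * κ
      e≥ : 0# ≤ e - ν 2 * κ
      e≥ = diff≥ ee
      far : ∀ {v} → v ∈ P → u v ≡ 1# → κ + κ ≤ ξ v
      far {v} m h = pick (QP.<-cmp κ (ξ v)) where
       pick : Tri (κ < ξ v) (κ ≡ ξ v) (ξ v < κ) → κ + κ ≤ ξ v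
       pick (tri< g _ _) = grid-step grid-κ (ξ-grid m) g
       pick (tri≈ _ g _) = ⊥-elim (n (subst (HIn P) (trans (pt-coords v) (cong₂ pt (sym g) h)) (vertex-HIn cv m)))
       pick (tri> _ _ g) = ⊥-elim (<-irrefl refl (<-≤-trans g (away κ κ>0 nt m (subst (κ ≤_) (sym h) κ≤1))))
      go : ∀ {v} → v ∈ P → Height v → a + K * (e - a) * (u v - 1#) ≤ ξ v
      go m (bottom h) = at-bottom a m h
      go {v} m (level h) = at-one a h (≤-trans (≤-by (≤-lit 0# (+ 3 / 4) ⊠ κ≥0) (id323 κ)) (far m h))
      go {v} m (between h h') = ≤-by ((diff≥ (away κ κ>0 nt m h) ⊞ ((e≥ ⊞ (≤-lit 0# (+ 3 / 4) ⊠ κ≥0)) ⊠ steep h')) ⊞ (e≥ ⊞ (0≤½ ⊠ κ≥0))) (id324 K κ e (u v) (ξ v))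
      go {v} m (top h) = ≤-by ((nonneg m ⊞ (K≥0 ⊠ e≥)) ⊞ ((≤-lit 0# (+ 5 / 16) ⊠ κ≤¼) ⊞ ≤-lit 0# (+ 7 / 16)))
        (trans (cong (λ z → ξ v - (a + K * (e - a) * (z - 1#))) h) (by-Kκ (+ 3 / 4) (id325 K κ e (ξ v))))

 -- The area of a thin polygon in terms of its two sides.

 module FineFrame {k i b : ℕ} {P : List Point} (pr : Prob k i b P) (4≤k : 4 N.≤ k) (1≤i : 1 N.≤ i) (F : Fine k i P) where
  open Prob pr
  open Fine F
  open Scale k 4≤k

  I : ℚ
  I = ν i + 1#

  I-suc : ν (suc i) ≡ I
  I-suc = trans (ν-suc i) (QP.+-comm 1# (ν i))

  I≥2 : ν 2 ≤ I
  I≥2 = QP.+-monoˡ-≤ 1# (ν-≤ 1 i 1≤i)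

  Lv : Levels P (- 1#) κ
  Lv = record { bot = bot ; top = (0# , κ) ; bot∈ = bot∈ ; top∈ = apex ; bot≡ = bot≡ ; top≡ = refl ; ≥bot = lower ; ≤top = upper }

  z0 : ∃[ z ] HInt P (lat z)
  z0 = interior-lattice-point pr 1≤i

  open LevelAnalysis pr Lv (fst z0) (snd z0) using (NotInt; left-line; right-line)

  not-int : ∀ {p} → ¬ HInt P p → NotInt p
  not-int {p} n = [ (λ h → ⊥-elim (n h)) , id ]′ (HInt? P p)

  u-grid : ∀ {v} → v ∈ P → Grid (u v)
  u-grid m = grid-- grid-κ (snd (integral m))

  u≥0 : ∀ {v} → v ∈ P → 0# ≤ u v
  u≥0 m = diff≥ (upper m)

  u≤ : ∀ {v} → v ∈ P → u v ≤ 1# + κ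
  u≤ {v} m = ≤-by (diff≥ (lower m)) (id326 κ (snd v))

  top-or-low : ∀ {v} → v ∈ P → snd v ≡ κ ⊎ snd v ≤ 0#
  top-or-low {v} m = go (QP.<-cmp 0# (snd v)) where
   go : Tri (0# < snd v) (0# ≡ snd v) (snd v < 0#) → snd v ≡ κ ⊎ snd v ≤ 0#
   go (tri< h _ _) = inj₁ (≤-antisym (upper m) (subst (_≤ snd v) (QP.+-identityˡ κ) (grid-step grid-0 (snd (integral m)) h)))
   go (tri≈ _ h _) = inj₂ (≤-reflexive (sym h))
   go (tri> _ _ h) = inj₂ (<⇒≤ h)

  -- The bounding line through (0, 0) has nonpositive slope parameter s because (0, κ) belongs to P,
  -- so it gives x ≥ s y ≥ 0 at heights y ≤ 0. All other vertices are on the top line, where (0, κ)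
  -- is leftmost.
  left-nonneg0 : ∀ {v} → v ∈ P → 0# ≤ fst v
  left-nonneg0 {v} m = go (left-line centre (not-int left-end) (<-lit 0# 1#)) (top-or-low m) where
   go : ∃[ s ] (∀ {q} → HIn P q → 0# + s * (snd q - 0#) ≤ fst q) → snd v ≡ κ ⊎ snd v ≤ 0# → 0# ≤ fst v
   go _ (inj₁ e) = apex-left m e
   go (s , h) (inj₂ y≤0) = subst (0# ≤_) (id328 s (fst v) (snd v)) (diff≥ (h (vertex-HIn cv m)) ⊞ (-s≥0 ⊠ diff≥ y≤0)) where
    -s≥0 : 0# ≤ - s
    -s≥0 = 0≤-cancel {κ} κ>0 (subst (0# ≤_) (id327 s κ) (diff≥ (h (vertex-HIn cv apex))))

  rightmost-top : ∃[ m ] (m ∈ P × snd m ≡ κ × (∀ {v} → v ∈ P → snd v ≡ κ → - fst m ≤ - fst v))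
  rightmost-top = level-min (λ p → - fst p) κ P apex refl

  leftmost-bottom : ∃[ m ] (m ∈ P × snd m ≡ - 1# × (∀ {v} → v ∈ P → snd v ≡ - 1# → fst m ≤ fst v))
  leftmost-bottom = level-min fst (- 1#) P bot∈ bot≡

  rightmost-bottom : ∃[ m ] (m ∈ P × snd m ≡ - 1# × (∀ {v} → v ∈ P → snd v ≡ - 1# → - fst m ≤ - fst v))
  rightmost-bottom = level-min (λ p → - fst p) (- 1#) P bot∈ bot≡

  q : ℚ
  q = fst (fst rightmost-top)

  vl vr : Point
  vl = fst leftmost-bottom
  vr = fst rightmost-bottom

  vl∈ : vl ∈ P
  vl∈ = fst (snd leftmost-bottom)

  vr∈ : vr ∈ P
  vr∈ = fst (snd rightmost-bottom)

  vl-y : snd vl ≡ - 1#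
  vl-y = fst (snd (snd leftmost-bottom))

  vr-y : snd vr ≡ - 1#
  vr-y = fst (snd (snd rightmost-bottom))

  xl xr w D : ℚ
  xl = fst vl
  xr = fst vr
  w = xr - xl
  D = K * (I - q)

  neg-≤ : ∀ {x y} → - x ≤ - y → y ≤ x
  neg-≤ {x} {y} h = ≤-by (diff≥ h) (id329 x y)

  q∈ : (q , κ) ∈ P
  q∈ = subst (λ y → (q , y) ∈ P) (fst (snd (snd rightmost-top))) (fst (snd rightmost-top))

  q≥0 : 0# ≤ q
  q≥0 = apex-left q∈ refl

  bottom-y : ∀ {p} → u p ≡ 1# + κ → snd p ≡ - 1#
  bottom-y {p} h = trans (y-back κ (snd p)) (trans (cong (λ z → κ - z) h) (id330 κ))

  bottom-u : ∀ {p} → snd p ≡ - 1# → u p ≡ 1# + κ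
  bottom-u h = trans (cong (λ z → κ - z) h) (id331 κ)

  bottom-range : ∀ {v} → v ∈ P → snd v ≡ - 1# → xl ≤ fst v × fst v ≤ xr
  bottom-range m h = snd (snd (snd leftmost-bottom)) m h , neg-≤ (snd (snd (snd rightmost-bottom)) m h)

  xl≤xr : xl ≤ xr
  xl≤xr = snd (bottom-range vl∈ vl-y)

  L-x : ∀ p → affine 1# 0# 0# p ≡ fst p
  L-x (x , y) = id332 x y

  -- The right-hand coordinate vanishes on the line from (q , κ) through (i + 1 , 0).
  R-x : ∀ p → affine (- 1#) (- D) (q + D * κ) p ≡ q + D * u p - fst p
  R-x (x , y) = id333 x y q D κ

  -- As on the left: since (q, κ) belongs to P, the bounding line through (i + 1, 0) is, below that
  -- point, nowhere to the right of the reference line.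
  right-nonneg0 : ∀ {v} → v ∈ P → fst v ≤ q + D * u v
  right-nonneg0 {v} m = go (right-line centre (not-int (λ h → right-end (subst (λ x → HInt P (x , 0#)) (sym I-suc) h))) (<-≤-trans (<-lit 1# (ν 2)) I≥2)) (top-or-low m) where
   go : ∃[ t ] (∀ {p} → HIn P p → fst p ≤ I + t * (snd p - 0#)) → snd v ≡ κ ⊎ snd v ≤ 0# → fst v ≤ q + D * u v
   go _ (inj₁ e) = ≤-trans (neg-≤ (snd (snd (snd rightmost-top)) m e)) (≤-reflexive (trans (id334 q D κ) (cong (λ y → q + D * (κ - y)) (sym e))))
   go (t , h) (inj₂ y≤0) = ≤-by (diff≥ (h (vertex-HIn cv m)) ⊞ (slope ⊠ diff≥ y≤0)) (by-Kκ (I - q) (id336 K κ I q t (fst v) (snd v))) where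
    slope : 0# ≤ t + K * (I - q)
    slope = subst (0# ≤_) (by-Kκ t (id335 K κ I q t)) (K≥0 ⊠ diff≥ (h (vertex-HIn cv q∈)))

  module L = Side cv u-grid u≥0 u≤ 1# 0# 0# (λ {v} m → subst (0# ≤_) (sym (L-x v)) (left-nonneg0 m)) vl vl∈ (bottom-u {vl} vl-y)
   (λ {v} m h → subst₂ _≤_ (sym (L-x vl)) (sym (L-x v)) (fst (bottom-range m (bottom-y {v} h))))

  module R = Side cv u-grid u≥0 u≤ (- 1#) (- D) (q + D * κ) (λ {v} m → subst (0# ≤_) (sym (R-x v)) (diff≥ (right-nonneg0 m))) vr vr∈ (bottom-u {vr} vr-y)
   (λ {v} m h → subst₂ _≤_ (sym (R-x vr)) (sym (R-x v)) (≤-by (diff≥ (snd (bottom-range m (bottom-y {v} h)))) (trans (cong₂ (λ a b → q + D * a - fst v - (q + D * b - xr)) h (bottom-u {vr} vr-y)) (cancel-right q D κ (fst v) xr))))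

  eL : L.e ≡ xl
  eL = L-x vl

  eR : R.e ≡ q + D * (1# + κ) - xr
  eR = trans (R-x vr) (cong (λ z → q + D * z - xr) (bottom-u {vr} vr-y))

  -- P is cut at depth 1: the upper strip is bounded by the lines of slopes ρ and μ, the lower one
  -- by the lines through the bottom corners.
  area-bound : ∀ {ρ a μ a'} → L.Bound ρ a → R.Bound μ a' → area2 P ≤ κ * (w + q + D - a - a') + (ν 2 * q + D - ρ - μ)
  area-bound {ρ} {a} {μ} {a'} BL BR = area≤ cv Lv (Glue.glue {P} -1≤ ≤κ bottom-slab top-slab) where
   module BL = L.Bound BL
   module BR = R.Bound BR
   j = κ - 1#
   -1≤ : - 1# ≤ j
   -1≤ = ≤-by κ≥0 (id337 κ)
   ≤κ : j ≤ κ
   ≤κ = ≤-by (≤-lit 0# 1#) (id127 κ)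
   top-lines : Lines P κ 0# (- ρ) q (- (D - μ))
   top-lines = record
    { on-left = λ {p} h → ≤-by (HIn-affine cv 1# ρ (- (ρ * κ)) (λ {v} m → subst (0# ≤_) (trans (cong (_- ρ * u v) (L-x v)) (id338 (fst v) (snd v) ρ κ)) (diff≥ (BL.upper m))) h) (id339 (fst p) (snd p) ρ κ)
    ; on-right = λ {p} h → ≤-by (HIn-affine cv (- 1#) (μ - D) (q + (D - μ) * κ) (λ {v} m → subst (0# ≤_) (trans (cong (_- μ * u v) (R-x v)) (id340 (fst v) (snd v) q D μ κ)) (diff≥ (BR.upper m))) h) (id341 (fst p) (snd p) q D μ κ) }
   S V : ℚ
   S = K * (xl - a)
   V = K * (q + D * (1# + κ) - xr - a')
   bottom-lines : Lines P j a (- S) (q + D - a') (V - D)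
   bottom-lines = record
    { on-left = λ {p} h → ≤-by (HIn-affine cv 1# S (- (a + S * (κ - 1#))) (λ {v} m → subst (0# ≤_) (trans (cong₂ (λ x e → x - (a + K * (e - a) * (u v - 1#))) (L-x v) eL) (id342 (fst v) (snd v) a S κ)) (diff≥ (BL.lower m))) h) (id343 (fst p) (snd p) a S κ)
    ; on-right = λ {p} h → ≤-by (HIn-affine cv (- 1#) (V - D) (q + D * κ - a' - V * (κ - 1#)) (λ {v} m → subst (0# ≤_) (trans (cong₂ (λ x e → x - (a' + K * (e - a') * (u v - 1#))) (R-x v) eR) (id344 (fst v) (snd v) q D V a' κ)) (diff≥ (BR.lower m))) h) (id345 (fst p) (snd p) q D V a' κ) }
   top-slab : AreaBound P j κ (ν 2 * q + D - ρ - μ)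
   top-slab = weaken (≤-reflexive (id346 κ q D ρ μ)) (slab top-lines j κ)
   bottom-slab : AreaBound P (- 1#) j (κ * (w + q + D - a - a'))
   bottom-slab = weaken (≤-reflexive (by-Kκ c (id347 K κ q D a a' xl xr))) (slab bottom-lines (- 1#) j) where
    c = - (κ * ((q + D * (1# + κ) - xr - a') + (xl - a)))

  -- In this scale a side with `Bound ρ a` lowers the estimate by K a + K² ρ, independently of the
  -- other side.
  scaled-area : ∀ {ρ a μ a'} → L.Bound ρ a → R.Bound μ a' → ν (k N.* k) * area2 P ≤ K * (w + q + D - a - a') + K * K * (ν 2 * q + D - ρ - μ)
  scaled-area {ρ} {a} {μ} {a'} BL BR = subst₂ _≤_ (cong (_* area2 P) (sym (ν-* k k))) (by-Kκ (K * X) (id348 K κ X Y)) (QP.*-monoˡ-≤-nonNeg (K * K) {{ℚ.nonNegative (K≥0 ⊠ K≥0)}} (area-bound BL BR)) where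
   X = w + q + D - a - a'
   Y = ν 2 * q + D - ρ - μ

 -- Convexity and areas of the candidate polygons.

 -- Lists of vertices with apex (0 , κ), corners at height κ - 1 and bottom edge from (p , -1) to (q , -1).
 pent quad1 : ℚ → ℚ → ℚ → ℚ → List Point
 pent κ p q X = (0# , κ) ∷ (0# , κ - 1#) ∷ (p , - 1#) ∷ (q , - 1#) ∷ (X , κ - 1#) ∷ []
 quad1 κ p q X = (0# , κ) ∷ (p , - 1#) ∷ (q , - 1#) ∷ (X , κ - 1#) ∷ []

 quad2 tri : ℚ → ℚ → ℚ → List Point
 quad2 κ p q = (0# , κ) ∷ (0# , κ - 1#) ∷ (p , - 1#) ∷ (q , - 1#) ∷ []
 tri κ p q = (0# , κ) ∷ (p , - 1#) ∷ (q , - 1#) ∷ []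

 x-distinct : ∀ {x y x' y' : ℚ} → x < x' → (x , y) ≢ (x' , y')
 x-distinct h e = <-irrefl (cong fst e) h

 y-distinct : ∀ {x y x' y' : ℚ} → y' < y → (x , y) ≢ (x' , y')
 y-distinct h e = <-irrefl (cong snd (sym e)) h

 module ShapeGeometry (κ : ℚ) (κ>0 : 0# < κ) where

  κ≥0 : 0# ≤ κ
  κ≥0 = <⇒≤ κ>0

  1+κ>0 : 0# < 1# + κ
  1+κ>0 = <-lit 0# 1# ⊞< κ≥0

  upper-left : ∀ x y → orient (0# , κ) (0# , κ - 1#) (x , y) ≡ x
  upper-left x y = id349 κ x y

  lower-left : ∀ p x y → orient (0# , κ - 1#) (p , - 1#) (x , y) ≡ κ * x - p * (κ - y - 1#)
  lower-left p x y = id350 κ p x y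

  full-left : ∀ p x y → orient (0# , κ) (p , - 1#) (x , y) ≡ (1# + κ) * x - p * (κ - y)
  full-left p x y = id351 κ p x y

  bottom-edge : ∀ p q x y → orient (p , - 1#) (q , - 1#) (x , y) ≡ (q - p) * (y + 1#)
  bottom-edge p q x y = id352 p q x y

  lower-right : ∀ q X x y → orient (q , - 1#) (X , κ - 1#) (x , y) ≡ κ * (X * (κ - y) - x) - (X * (1# + κ) - q) * (κ - y - 1#)
  lower-right q X x y = id353 κ q X x y

  upper-right : ∀ X x y → orient (X , κ - 1#) (0# , κ) (x , y) ≡ X * (κ - y) - x
  upper-right X x y = id354 κ X x y

  full-right : ∀ q x y → orient (q , - 1#) (0# , κ) (x , y) ≡ q * (κ - y) - (1# + κ) * x
  full-right q x y = id355 κ q x y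

  y01 : κ - 1# < κ
  y01 = <-by (<-lit 0# 1#) (id127 κ)

  y12 : - 1# < κ - 1#
  y12 = <-by κ>0 (id337 κ)

  y02 : - 1# < κ
  y02 = <-trans y12 y01

  pos : ∀ {a c} → 0# < c → a ≡ c → 0# < a
  pos h e = subst (0# <_) (sym e) h

  nn : ∀ {a c} → 0# ≤ c → a ≡ c → 0# ≤ a
  nn h e = subst (0# ≤_) (sym e) h

  module _ (p q : ℚ) (p<q : 0# < q - p) where

   p<q' : p < q
   p<q' = <-by p<q refl

   be0 : 0# < orient (p , - 1#) (q , - 1#) (0# , κ)
   be0 = pos (p<q ⊠< (κ>0 ⊞< ≤-lit 0# 1#)) (bottom-edge p q 0# κ)

   be1 : ∀ x → 0# < orient (p , - 1#) (q , - 1#) (x , κ - 1#)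
   be1 x = pos (p<q ⊠< κ>0) (trans (bottom-edge p q x (κ - 1#)) (id356 κ p q))

   fl : 0# < orient (0# , κ) (p , - 1#) (q , - 1#)
   fl = pos (1+κ>0 ⊠< p<q) (trans (full-left p q (- 1#)) (id357 κ p q))

   fr : 0# < orient (q , - 1#) (0# , κ) (p , - 1#)
   fr = pos (1+κ>0 ⊠< p<q) (trans (full-right q p (- 1#)) (id358 κ p q))

   tri-convex : ConvexCCW (tri κ p q)
   tri-convex = N.s≤s (N.s≤s (N.s≤s N.z≤n))
    , ((y-distinct y02 All.∷ y-distinct y02 All.∷ All.[]) AP.∷ (x-distinct p<q' All.∷ All.[]) AP.∷ All.[] AP.∷ AP.[]) , go where
    go : (e : Point × Point) → e ∈ edges (tri κ p q) → (v : Point) → v ∈ tri κ p q → v ≢ fst e → v ≢ snd e → 0# < cross (snd e ⊖ fst e) (v ⊖ fst e)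
    go _ ∈0 _ ∈0 n _ = ⊥-elim (n refl)
    go _ ∈0 _ ∈1 _ n = ⊥-elim (n refl)
    go _ ∈0 _ ∈2 _ _ = fl
    go _ ∈1 _ ∈0 _ _ = be0
    go _ ∈1 _ ∈1 n _ = ⊥-elim (n refl)
    go _ ∈1 _ ∈2 _ n = ⊥-elim (n refl)
    go _ ∈2 _ ∈0 _ n = ⊥-elim (n refl)
    go _ ∈2 _ ∈1 _ _ = fr
    go _ ∈2 _ ∈2 n _ = ⊥-elim (n refl)

   module _ (p>0 : 0# < p) where

    q>0 : 0# < q
    q>0 = <-trans p>0 p<q'

    ul : ∀ x y → 0# < x → 0# < orient (0# , κ) (0# , κ - 1#) (x , y)
    ul x y h = pos h (upper-left x y)

    ll0 : 0# < orient (0# , κ - 1#) (p , - 1#) (0# , κ)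
    ll0 = pos p>0 (trans (lower-left p 0# κ) (id359 κ p))

    ll3 : 0# < orient (0# , κ - 1#) (p , - 1#) (q , - 1#)
    ll3 = pos (κ>0 ⊠< p<q) (trans (lower-left p q (- 1#)) (id360 κ p q))

    quad2-convex : ConvexCCW (quad2 κ p q)
    quad2-convex = N.s≤s (N.s≤s (N.s≤s N.z≤n))
     , ((y-distinct y01 All.∷ y-distinct y02 All.∷ y-distinct y02 All.∷ All.[]) AP.∷ (y-distinct y12 All.∷ y-distinct y12 All.∷ All.[]) AP.∷ (x-distinct p<q' All.∷ All.[]) AP.∷ All.[] AP.∷ AP.[]) , go where
     fr1 : 0# < orient (q , - 1#) (0# , κ) (0# , κ - 1#)
     fr1 = pos q>0 (trans (full-right q 0# (κ - 1#)) (id361 κ q))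
     go : (e : Point × Point) → e ∈ edges (quad2 κ p q) → (v : Point) → v ∈ quad2 κ p q → v ≢ fst e → v ≢ snd e → 0# < cross (snd e ⊖ fst e) (v ⊖ fst e)
     go _ ∈0 _ ∈0 n _ = ⊥-elim (n refl)
     go _ ∈0 _ ∈1 _ n = ⊥-elim (n refl)
     go _ ∈0 _ ∈2 _ _ = ul p (- 1#) p>0
     go _ ∈0 _ ∈3 _ _ = ul q (- 1#) q>0
     go _ ∈1 _ ∈0 _ _ = ll0
     go _ ∈1 _ ∈1 n _ = ⊥-elim (n refl)
     go _ ∈1 _ ∈2 _ n = ⊥-elim (n refl)
     go _ ∈1 _ ∈3 _ _ = ll3
     go _ ∈2 _ ∈0 _ _ = be0
     go _ ∈2 _ ∈1 _ _ = be1 0#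
     go _ ∈2 _ ∈2 n _ = ⊥-elim (n refl)
     go _ ∈2 _ ∈3 _ n = ⊥-elim (n refl)
     go _ ∈3 _ ∈0 _ n = ⊥-elim (n refl)
     go _ ∈3 _ ∈1 _ _ = fr1
     go _ ∈3 _ ∈2 _ _ = fr
     go _ ∈3 _ ∈3 n _ = ⊥-elim (n refl)

   module _ (X : ℚ) (q<X : 0# < X * (1# + κ) - q) where

    lr0 : 0# < orient (q , - 1#) (X , κ - 1#) (0# , κ)
    lr0 = pos q<X (trans (lower-right q X 0# κ) (id362 κ q X))

    lr2 : 0# < orient (q , - 1#) (X , κ - 1#) (p , - 1#)
    lr2 = pos (κ>0 ⊠< p<q) (trans (lower-right q X p (- 1#)) (id363 κ p q X))

    p<X : 0# < X * (1# + κ) - p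
    p<X = pos (q<X ⊞< <⇒≤ p<q) (id364 κ p q X)

    ur : ∀ z → 0# < X * (1# + κ) - z → 0# < orient (X , κ - 1#) (0# , κ) (z , - 1#)
    ur z h = pos h (trans (upper-right X z (- 1#)) (id365 κ X z))

    quad1-convex : ConvexCCW (quad1 κ p q X)
    quad1-convex = N.s≤s (N.s≤s (N.s≤s N.z≤n))
     , ((y-distinct y02 All.∷ y-distinct y02 All.∷ y-distinct y01 All.∷ All.[]) AP.∷ (x-distinct p<q' All.∷ (λ e → y-distinct y12 (sym e)) All.∷ All.[]) AP.∷ ((λ e → y-distinct y12 (sym e)) All.∷ All.[]) AP.∷ All.[] AP.∷ AP.[]) , go where
     fl3 : 0# < orient (0# , κ) (p , - 1#) (X , κ - 1#)
     fl3 = pos p<X (trans (full-left p X (κ - 1#)) (id366 κ p X))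
     go : (e : Point × Point) → e ∈ edges (quad1 κ p q X) → (v : Point) → v ∈ quad1 κ p q X → v ≢ fst e → v ≢ snd e → 0# < cross (snd e ⊖ fst e) (v ⊖ fst e)
     go _ ∈0 _ ∈0 n _ = ⊥-elim (n refl)
     go _ ∈0 _ ∈1 _ n = ⊥-elim (n refl)
     go _ ∈0 _ ∈2 _ _ = fl
     go _ ∈0 _ ∈3 _ _ = fl3
     go _ ∈1 _ ∈0 _ _ = be0
     go _ ∈1 _ ∈1 n _ = ⊥-elim (n refl)
     go _ ∈1 _ ∈2 _ n = ⊥-elim (n refl)
     go _ ∈1 _ ∈3 _ _ = be1 X
     go _ ∈2 _ ∈0 _ _ = lr0
     go _ ∈2 _ ∈1 _ _ = lr2
     go _ ∈2 _ ∈2 n _ = ⊥-elim (n refl)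
     go _ ∈2 _ ∈3 _ n = ⊥-elim (n refl)
     go _ ∈3 _ ∈0 _ n = ⊥-elim (n refl)
     go _ ∈3 _ ∈1 _ _ = ur p p<X
     go _ ∈3 _ ∈2 _ _ = ur q q<X
     go _ ∈3 _ ∈3 n _ = ⊥-elim (n refl)

    pent-convex : 0# < p → 0# < X → ConvexCCW (pent κ p q X)
    pent-convex p>0 X>0 = N.s≤s (N.s≤s (N.s≤s N.z≤n))
     , ((y-distinct y01 All.∷ y-distinct y02 All.∷ y-distinct y02 All.∷ y-distinct y01 All.∷ All.[]) AP.∷ (y-distinct y12 All.∷ y-distinct y12 All.∷ x-distinct X>0 All.∷ All.[]) AP.∷ (x-distinct p<q' All.∷ (λ e → y-distinct y12 (sym e)) All.∷ All.[]) AP.∷ ((λ e → y-distinct y12 (sym e)) All.∷ All.[]) AP.∷ All.[] AP.∷ AP.[]) , go where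
     ll4 : 0# < orient (0# , κ - 1#) (p , - 1#) (X , κ - 1#)
     ll4 = pos (κ>0 ⊠< X>0) (trans (lower-left p X (κ - 1#)) (id367 κ p X))
     lr1 : 0# < orient (q , - 1#) (X , κ - 1#) (0# , κ - 1#)
     lr1 = pos (κ>0 ⊠< X>0) (trans (lower-right q X 0# (κ - 1#)) (id368 κ q X))
     ur1 : 0# < orient (X , κ - 1#) (0# , κ) (0# , κ - 1#)
     ur1 = pos X>0 (trans (upper-right X 0# (κ - 1#)) (id369 κ X))
     go : (e : Point × Point) → e ∈ edges (pent κ p q X) → (v : Point) → v ∈ pent κ p q X → v ≢ fst e → v ≢ snd e → 0# < cross (snd e ⊖ fst e) (v ⊖ fst e)
     go _ ∈0 _ ∈0 n _ = ⊥-elim (n refl)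
     go _ ∈0 _ ∈1 _ n = ⊥-elim (n refl)
     go _ ∈0 _ ∈2 _ _ = ul p>0 p (- 1#) p>0
     go _ ∈0 _ ∈3 _ _ = ul p>0 q (- 1#) (q>0 p>0)
     go _ ∈0 _ ∈4 _ _ = ul p>0 X (κ - 1#) X>0
     go _ ∈1 _ ∈0 _ _ = ll0 p>0
     go _ ∈1 _ ∈1 n _ = ⊥-elim (n refl)
     go _ ∈1 _ ∈2 _ n = ⊥-elim (n refl)
     go _ ∈1 _ ∈3 _ _ = ll3 p>0
     go _ ∈1 _ ∈4 _ _ = ll4
     go _ ∈2 _ ∈0 _ _ = be0
     go _ ∈2 _ ∈1 _ _ = be1 0#
     go _ ∈2 _ ∈2 n _ = ⊥-elim (n refl)
     go _ ∈2 _ ∈3 _ n = ⊥-elim (n refl)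
     go _ ∈2 _ ∈4 _ _ = be1 X
     go _ ∈3 _ ∈0 _ _ = lr0
     go _ ∈3 _ ∈1 _ _ = lr1
     go _ ∈3 _ ∈2 _ _ = lr2
     go _ ∈3 _ ∈3 n _ = ⊥-elim (n refl)
     go _ ∈3 _ ∈4 _ n = ⊥-elim (n refl)
     go _ ∈4 _ ∈0 _ n = ⊥-elim (n refl)
     go _ ∈4 _ ∈1 _ _ = ur1
     go _ ∈4 _ ∈2 _ _ = ur p p<X
     go _ ∈4 _ ∈3 _ _ = ur q q<X
     go _ ∈4 _ ∈4 n _ = ⊥-elim (n refl)

  pent-area : ∀ p q X → area2 (pent κ p q X) ≡ X + κ * (X + q - p)
  pent-area p q X = id370 κ p q X

  quad1-area : ∀ p q X → area2 (quad1 κ p q X) ≡ X + κ * (X + q - p) - p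
  quad1-area p q X = id371 κ p q X

  quad2-area : ∀ p q → area2 (quad2 κ p q) ≡ q + κ * (q - p)
  quad2-area p q = id372 κ p q

  tri-area : ∀ p q → area2 (tri κ p q) ≡ (1# + κ) * (q - p)
  tri-area p q = id373 κ p q

 -- Extreme points and invariants of equivalence.

 affine-aff : ∀ α β γ A B C D e f p → affine α β γ (aff A B C D e f p) ≡ affine (α * A + β * C) (α * B + β * D) (α * e + β * f + γ) p
 affine-aff α β γ A B C D e f (x , y) = id374 α β γ A B C D e f x y

 orient-pull : ∀ A B C D e f a b → ∃[ α ] ∃[ β ] ∃[ γ ] (∀ p → orient a b (aff A B C D e f p) ≡ affine α β γ p)
 orient-pull A B C D e f a b = α * A + β * C , α * B + β * D , α * e + β * f + γ , λ p → trans (orient-as-affine a b (aff A B C D e f p))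
  (affine-aff α β γ A B C D e f p) where
  α = - (snd b - snd a)
  β = fst b - fst a
  γ = fst a * (snd b - snd a) - snd a * (fst b - fst a)

 aff-HIn : ∀ {P S} A B C D e f → ConvexCCW P → (∀ {v} → v ∈ P → HIn S (aff A B C D e f v)) → ∀ {q} → HIn P q → HIn S (aff A B C D e f q)
 aff-HIn {P} {S} A B C D e f cv h {q} hq = hin λ {a} {b} m → go a b m (orient-pull A B C D e f a b) where
  go : ∀ a b → (a , b) ∈ edges S → ∃[ α ] ∃[ β ] ∃[ γ ] (∀ p → orient a b (aff A B C D e f p) ≡ affine α β γ p) → 0# ≤ orient a b (aff A B C D e f q)
  go a b m (α , β , γ , eq) = subst (0# ≤_) (sym (eq q)) (HIn-affine cv α β γ (λ {v} n → subst (0# ≤_) (eq v) (left (h n) m)) hq)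

 positive-gap : ∀ (f : Point → ℚ) L → (∀ {s} → s ∈ L → 0# < f s) → ∃[ ε ] (0# < ε × (∀ {s} → s ∈ L → ε ≤ f s))
 positive-gap f [] h = 1# , <-lit 0# 1# , λ ()
 positive-gap f (x ∷ L) h = go (positive-gap f L (λ m → h (there m))) where
  go : ∃[ ε ] (0# < ε × (∀ {s} → s ∈ L → ε ≤ f s)) → ∃[ ε ] (0# < ε × (∀ {s} → s ∈ x ∷ L → ε ≤ f s))
  go (ε , ε>0 , lo) = pick (≤-total ε (f x)) where
   pick : ε ≤ f x ⊎ f x ≤ ε → ∃[ ε ] (0# < ε × (∀ {s} → s ∈ x ∷ L → ε ≤ f s))
   pick (inj₁ g) = ε , ε>0 , λ { ∈0 → g ; (there m) → lo m }
   pick (inj₂ g) = f x , h ∈0 , λ { ∈0 → ≤-refl ; (there m) → ≤-trans g (lo m) }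

 zero-or-positive : ∀ (f : Point → ℚ) L → (∀ {s} → s ∈ L → 0# ≤ f s) → (∃[ s ] (s ∈ L × f s ≡ 0#)) ⊎ (∀ {s} → s ∈ L → 0# < f s)
 zero-or-positive f [] h = inj₂ λ ()
 zero-or-positive f (x ∷ L) h = go (QP.<-cmp 0# (f x)) (zero-or-positive f L (λ m → h (there m))) where
  go : Tri (0# < f x) (0# ≡ f x) (f x < 0#) → (∃[ s ] (s ∈ L × f s ≡ 0#)) ⊎ (∀ {s} → s ∈ L → 0# < f s) → (∃[ s ] (s ∈ x ∷ L × f s ≡ 0#)) ⊎ (∀ {s} → s ∈ x ∷ L → 0# < f s)
  go (tri≈ _ e _) _ = inj₁ (x , here refl , sym e)
  go (tri> _ _ g) _ = ⊥-elim (<-irrefl refl (≤-<-trans (h ∈0) g))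
  go (tri< _ _ _) (inj₁ (s , m , e)) = inj₁ (s , there m , e)
  go (tri< g _ _) (inj₂ all) = inj₂ λ { ∈0 → g ; (there m) → all m }

 -- If the function were positive on the whole finite list, it would be at least some ε > 0 there
 -- and hence on the hull.
 InConv-attained : ∀ α β γ L {q} → (∀ {s} → s ∈ L → 0# ≤ affine α β γ s) → InConv L q → affine α β γ q ≡ 0# → ∃[ s ] (s ∈ L × affine α β γ s ≡ 0#)
 InConv-attained α β γ L {q} h iq e = go (zero-or-positive (affine α β γ) L h) where
  shift : ∀ ε p → affine α β γ p - ε ≡ affine α β (γ - ε) p
  shift ε (x , y) = id375 α β γ ε x y
  go : (∃[ s ] (s ∈ L × affine α β γ s ≡ 0#)) ⊎ (∀ {s} → s ∈ L → 0# < affine α β γ s) → ∃[ s ] (s ∈ L × affine α β γ s ≡ 0#)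
  go (inj₁ r) = r
  go (inj₂ all) = absurd (positive-gap (affine α β γ) L all) where
   absurd : ∃[ ε ] (0# < ε × (∀ {s} → s ∈ L → ε ≤ affine α β γ s)) → ∃[ s ] (s ∈ L × affine α β γ s ≡ 0#)
   absurd (ε , ε>0 , lo) = absurd-by (InConv-affine α β (γ - ε) L (λ {s} m → subst (0# ≤_) (shift ε s) (diff≥ (lo m))) iq) ε>0
    (trans (cong (_+ ε) (trans (sym (shift ε q)) (cong (_- ε) e))) (id376 ε))

 edge-distinct : ∀ {P} → ConvexCCW P → ∀ {a b} → (a , b) ∈ edges P → a ≢ b
 edge-distinct {P} cv {a} {b} m e = go (edge-nondegenerate cv m) where
  go : ∃[ v ] (v ∈ P × 0# < orient a b v) → ⊥
  go (v , _ , h) = <-irrefl refl (subst (0# <_) (trans (cong (λ z → orient a z v) (sym e)) (orient-degenerate a v)) h)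

 corner : ∀ {P} → ConvexCCW P → ∀ {a v c} → (a , v) ∈ edges P → (v , c) ∈ edges P → 0# < orient a v c
 corner {P} cv {a} {v} {c} m n = strictly-left cv m (edge-snd P n) (λ e → no-2-cycle cv m (subst (λ z → (v , z) ∈ edges P) e n)) (λ e → edge-distinct cv n (sym e))

 -- If the successor of `a` were some `c` other than `b`, then `b` would be strictly left of the
 -- edge from `a` to `c` while `c` is not right of the line from `a` to `b`; these two orientations
 -- are opposite numbers.
 supporting : ∀ {P} → ConvexCCW P → ∀ {a b} → a ∈ P → b ∈ P → a ≢ b → (∀ {v} → v ∈ P → 0# ≤ orient a b v) → (a , b) ∈ edges P
 supporting {P} cv {a} {b} a∈ b∈ ne h = go (edge-out P a∈) where
  go : ∃[ c ] ((a , c) ∈ edges P) → (a , b) ∈ edges P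
  go (c , m) = decide (b ≟ₚ c) where
   decide : Dec (b ≡ c) → (a , b) ∈ edges P
   decide (yes e) = subst (λ z → (a , z) ∈ edges P) (sym e) m
   decide (no n) = absurd-by (h (edge-snd P m)) (strictly-left cv m b∈ (λ e → ne (sym e)) n) (trans (cong (λ z → orient a b c + z) (orient-swap a b c)) (QP.+-inverseʳ (orient a b c)))

 successor-unique : ∀ {P} → ConvexCCW P → ∀ {a b c} → (a , b) ∈ edges P → (a , c) ∈ edges P → b ≡ c
 successor-unique {P} cv {a} {b} {c} m n = go (b ≟ₚ c) where
  go : Dec (b ≡ c) → b ≡ c
  go (yes e) = e
  go (no ne) = absurd-by (<⇒≤ (strictly-left cv m (edge-snd P n) (λ e → edge-distinct cv n (sym e)) (λ e → ne (sym e)))) (strictly-left cv n (edge-snd P m) (λ e → edge-distinct cv m (sym e)) ne)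
   (trans (cong (λ z → orient a b c + z) (orient-swap a b c)) (QP.+-inverseʳ (orient a b c)))

 predecessor-unique : ∀ {P} → ConvexCCW P → ∀ {a b c} → (a , c) ∈ edges P → (b , c) ∈ edges P → a ≡ b
 predecessor-unique {P} cv {a} {b} {c} m n = go (a ≟ₚ b) where
  go : Dec (a ≡ b) → a ≡ b
  go (yes e) = e
  go (no ne) = absurd-by (<⇒≤ (strictly-left cv m (edge-fst P n) (λ e → ne (sym e)) (edge-distinct cv n))) (strictly-left cv n (edge-fst P m) ne (edge-distinct cv m))
   (trans (cong₂ _+_ (orient-rotate a c b) (trans (orient-rotate b c a) (orient-swap c b a))) (QP.+-inverseʳ (orient c b a)))

 -- v is the only zero of orient a v + orient v c on P, so a convex combination equal to v must use v itself.
 extreme : ∀ {Q} → ConvexCCW Q → ∀ {v} → v ∈ Q → ∀ L A B C D e f → (∀ {x} → x ∈ L → HIn Q (aff A B C D e f x)) → ∀ {x0} → InConv L x0 → aff A B C D e f x0 ≡ v → ∃[ x ] (x ∈ L × aff A B C D e f x ≡ v)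
 extreme {Q} cv {v} v∈ L A B C D e f into {x0} ix0 ev = start (edge-in Q v∈) (edge-out Q v∈) where
  φ : Point → Point
  φ = aff A B C D e f
  start : ∃[ a ] ((a , v) ∈ edges Q) → ∃[ c ] ((v , c) ∈ edges Q) → ∃[ x ] (x ∈ L × φ x ≡ v)
  start (a , m) (c , n) = pulled (orient-pull A B C D e f a v) (orient-pull A B C D e f v c) where
   pulled : ∃[ α ] ∃[ β ] ∃[ γ ] (∀ p → orient a v (φ p) ≡ affine α β γ p) → ∃[ α ] ∃[ β ] ∃[ γ ] (∀ p → orient v c (φ p) ≡ affine α β γ p) → ∃[ x ] (x ∈ L × φ x ≡ v)
   pulled (α , β , γ , h) (α' , β' , γ' , h') = finish (InConv-attained (α + α') (β + β') (γ + γ') L (λ {s} s∈ → subst (0# ≤_) (add s) (left (into s∈) m ⊞ left (into s∈) n)) ix0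
     (trans (sym (add x0)) (trans (cong (λ z → orient a v z + orient v c z) ev) (trans (cong₂ _+_ (orient-right a v) (orient-left v c)) (QP.+-identityˡ 0#))))) where
    add : ∀ s → orient a v (φ s) + orient v c (φ s) ≡ affine (α + α') (β + β') (γ + γ') s
    add (x , y) = trans (cong₂ _+_ (h (x , y)) (h' (x , y))) (id377 α β γ α' β' γ' x y)
    finish : ∃[ s ] (s ∈ L × affine (α + α') (β + β') (γ + γ') s ≡ 0#) → ∃[ x ] (x ∈ L × φ x ≡ v)
    finish (s , s∈ , z) = s , s∈ , cong₂ _,_ (coord (fst (φ s)) (fst v) (fst a) (fst c) (cong fst bary)) (coord (snd (φ s)) (snd v) (snd a) (snd c) (cong snd bary)) where
     p1 = orient a v (φ s)
     p2 = orient v c (φ s)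
     sum0 : p1 + p2 ≡ 0#
     sum0 = trans (add s) z
     z1 : p1 ≡ 0#
     z1 = ≤-antisym (≤-by (left (into s∈) n) (trans (cong (_- p1) (sym sum0)) (cancelJ p1 p2))) (left (into s∈) m)
     z2 : p2 ≡ 0#
     z2 = trans (sym (QP.+-identityˡ p2)) (trans (cong (_+ p2) (sym z1)) sum0)
     Δ = orient a v c
     mid : - orient a c (φ s) ≡ Δ
     mid = trans (id378 (orient a c (φ s))) (trans (cong₂ (λ x y → x + y - orient a c (φ s)) (sym z2) (sym z1)) (orient-split a v c (φ s)))
     bary : ((0# · a) ⊕ ((Δ · v) ⊕ (0# · c))) ≡ Δ · φ s
     bary = trans (sym (cong₂ (λ x y → (x · a) ⊕ (((- orient a c (φ s)) · v) ⊕ (y · c))) z2 z1) ⟫ cong (λ w → (0# · a) ⊕ ((w · v) ⊕ (0# · c))) mid) (orient-bary a v c (φ s)) where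
      _⟫_ : ∀ {x y z : Point} → x ≡ y → x ≡ z → z ≡ y
      _⟫_ p q = trans (sym q) p
     coord : ∀ x y a' c' → 0# * a' + (Δ * y + 0# * c') ≡ Δ * x → x ≡ y
     coord x y a' c' h'' = trans (id60 x y) (trans (cong (_+ y) (≡0-cancel {Δ} {x - y} (corner cv m n) (trans (id379 Δ x y a' c') (trans (cong (_- (0# * a' + (Δ * y + 0# * c'))) (sym h'')) (QP.+-inverseʳ (0# * a' + (Δ * y + 0# * c'))))))) (QP.+-identityˡ y))

 crossSum-↭ : ∀ {es fs} → es ↭ fs → crossSum es ≡ crossSum fs
 crossSum-↭ Perm.refl = refl
 crossSum-↭ (Perm.prep x p) = cong (λ z → cross (fst x) (snd x) + z) (crossSum-↭ p)
 crossSum-↭ (Perm.swap {xs} {ys} x y p) = trans (id380 (cross (fst x) (snd x)) (cross (fst y) (snd y)) (crossSum xs)) (cong (λ z → cross (fst y) (snd y) + (cross (fst x) (snd x) + z)) (crossSum-↭ p))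
 crossSum-↭ (Perm.trans p q) = trans (crossSum-↭ p) (crossSum-↭ q)

 flip : Point × Point → Point × Point
 flip (a , b) = (b , a)

 crossSum-flip : ∀ es → crossSum (map flip es) ≡ - crossSum es
 crossSum-flip [] = refl
 crossSum-flip (((a , b) , (c , d)) ∷ es) = trans (cong (λ z → c * b - d * a + z) (crossSum-flip es)) (id381 a b c d (crossSum es))

 edges-unique : ∀ P → Unique P → Unique (edges P)
 edges-unique [] _ = AP.[]
 edges-unique (p ∷ ps) un = subst Unique (sym (edges≡pathE p ps)) (go p ps p un) where
  go : ∀ p xs q → Unique (p ∷ xs) → Unique (pathE p xs q)
  go p [] q _ = All.[] AP.∷ AP.[]
  go p (x ∷ xs) q (h AP.∷ un) = All.tabulate (λ {e} m eq → All.lookup h (pathE-fst x xs q m) (cong fst eq)) AP.∷ go x xs q un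

 same-crossSum : ∀ {es fs} → Unique es → Unique fs → (∀ {e} → e ∈ es → e ∈ fs) → (∀ {e} → e ∈ fs → e ∈ es) → crossSum es ≡ crossSum fs
 same-crossSum u v f g = crossSum-↭ (∼bag⇒↭ (unique∧set⇒bag u v (mk⇔ f g)))

 -- The equivalence is given on hulls only. Extremality makes it a bijection of vertices, and
 -- supporting lines make it a bijection of edges, with directions reversed when the determinant σ
 -- is -1.
 module SameHull {P S : List Point} (cvP : ConvexCCW P) (cvS : ConvexCCW S) (a b c d : ℤ) (t : ℤ × ℤ)
         (to : ∀ q → HIn P q → ∃[ q' ] (HIn S q' × q ≡ applyAff a b c d t q'))
         (from : ∀ q' → HIn S q' → HIn P (applyAff a b c d t q'))
         (σ : ℚ) (σσ : σ * σ ≡ 1#) (det : ι a * ι d - ι b * ι c ≡ σ) where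
  A B C D e f : ℚ
  A = ι a
  B = ι b
  C = ι c
  D = ι d
  e = ι (fst t)
  f = ι (snd t)

  U V : Point → Point
  U = applyAff a b c d t
  -- The inverse of `U`, with σ serving as its own reciprocal.
  V = aff (σ * D) (- (σ * B)) (- (σ * C)) (σ * A) (- (σ * (D * e - B * f))) (- (σ * (A * f - C * e)))

  VU : ∀ p → V (U p) ≡ p
  VU (x , y) = cong₂ _,_ (trans (id382 σ A B C D e f x y) (one x)) (trans (id383 σ A B C D e f x y) (one y)) where
   one : ∀ x → σ * (A * D - B * C) * x ≡ x
   one x = trans (cong (λ z → σ * z * x) det) (trans (cong (_* x) σσ) (QP.*-identityˡ x))

  U-inj : ∀ {p q} → U p ≡ U q → p ≡ q
  U-inj {p} {q} h = trans (sym (VU p)) (trans (cong V h) (VU q))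

  pre : ∀ {v} → v ∈ P → ∃[ s ] (s ∈ S × U s ≡ v)
  pre {v} m = go (to v (vertex-HIn cvP m)) where
   go : ∃[ q' ] (HIn S q' × v ≡ U q') → ∃[ s ] (s ∈ S × U s ≡ v)
   go (q' , h , eq) = extreme cvP m S A B C D e f (λ {x} n → from x (vertex-HIn cvS n)) (HIn⇒InConv cvS h) (sym eq)

  V-into : ∀ {v} → v ∈ P → HIn S (V v)
  V-into {v} m = go (pre m) where
   go : ∃[ s ] (s ∈ S × U s ≡ v) → HIn S (V v)
   go (s , n , eq) = subst (HIn S) (trans (sym (VU s)) (cong V eq)) (vertex-HIn cvS n)

  image : ∀ {s} → s ∈ S → U s ∈ P
  image {s} m = go (extreme cvS m P (σ * D) (- (σ * B)) (- (σ * C)) (σ * A) (- (σ * (D * e - B * f))) (- (σ * (A * f - C * e))) V-into (HIn⇒InConv cvP (from s (vertex-HIn cvS m))) (VU s)) where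
   go : ∃[ x ] (x ∈ P × V x ≡ s) → U s ∈ P
   go (x , n , eq) = back (pre n) where
    back : ∃[ s' ] (s' ∈ S × U s' ≡ x) → U s ∈ P
    back (s' , n' , eq') = subst (_∈ P) (trans (sym eq') (cong U (trans (sym (VU s')) (trans (cong V eq') eq)))) n

  orient-U : ∀ p q r → orient (U p) (U q) (U r) ≡ σ * orient p q r
  orient-U p q r = trans (orient-aff A B C D e f p q r) (cong (_* orient p q r) det)

  same-length : length P ≡ length S
  same-length = NP.≤-antisym (subst (length P N.≤_) (LP.length-map U S) (unique-⊆-length (fst (snd cvP)) (λ {v} m → fwd v (pre m))))
    (subst (N._≤ length P) (LP.length-map U S) (unique-⊆-length (UP.map⁺ U-inj (fst (snd cvS))) (λ {v} m → bwd v (∈P.∈-map⁻ U m)))) where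
   fwd : ∀ v → ∃[ s ] (s ∈ S × U s ≡ v) → v ∈ map U S
   fwd v (s , n , eq) = subst (_∈ map U S) eq (∈P.∈-map⁺ U n)
   bwd : ∀ v → ∃[ s ] (s ∈ S × v ≡ U s) → v ∈ P
   bwd v (s , n , eq) = subst (_∈ P) (sym eq) (image n)

  edge-image : ∀ {x y} → x ∈ S → y ∈ S → x ≢ y → (∀ {s} → s ∈ S → 0# ≤ σ * orient x y s) → (U x , U y) ∈ edges P
  edge-image {x} {y} x∈ y∈ ne h = supporting cvP (image x∈) (image y∈) (λ eq → ne (U-inj eq)) λ {v} m → go v (pre m) where
   go : ∀ v → ∃[ s ] (s ∈ S × U s ≡ v) → 0# ≤ orient (U x) (U y) v
   go v (s , n , eq) = subst (0# ≤_) (trans (sym (orient-U x y s)) (cong (orient (U x) (U y)) eq)) (h n)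

  area-map : area2 (map U S) ≡ σ * area2 S
  area-map = trans (area2-aff A B C D e f S) (cong (_* area2 S) det)

  Turn : List Point → ℚ → Set
  Turn Q r = ∃[ x ] ∃[ v ] ∃[ y ] ((x , v) ∈ edges Q × (v , y) ∈ edges Q × orient x v y ≡ r)

  module Direct (σ≡1 : σ ≡ 1#) where

   edge⁺ : ∀ {x y} → (x , y) ∈ edges S → (U x , U y) ∈ edges P
   edge⁺ {x} {y} m = edge-image (edge-fst S m) (edge-snd S m) (edge-distinct cvS m)
    (λ {s} n → subst (0# ≤_) (trans (sym (QP.*-identityˡ (orient x y s))) (cong (_* orient x y s) (sym σ≡1))) (left (vertex-HIn cvS n) m))

   same-area : area2 P ≡ area2 S
   same-area = trans (same-crossSum (edges-unique P (fst (snd cvP))) (edges-unique (map U S) (UP.map⁺ U-inj (fst (snd cvS)))) (λ {e} m → fwd (fst e) (snd e) m (pre (edge-fst P m))) (λ {e} m → bwd (fst e) (snd e) (edges-map⁻ U S m)))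
     (trans area-map (trans (cong (_* area2 S) σ≡1) (QP.*-identityˡ (area2 S)))) where
    fwd : ∀ x y → (x , y) ∈ edges P → ∃[ s ] (s ∈ S × U s ≡ x) → (x , y) ∈ edges (map U S)
    fwd x y m (s , n , eq) = go (edge-out S n) where
     go : ∃[ w ] ((s , w) ∈ edges S) → (x , y) ∈ edges (map U S)
     go (w , n') = subst₂ (λ p q → (p , q) ∈ edges (map U S)) eq (successor-unique cvP (subst (λ p → (p , U w) ∈ edges P) eq (edge⁺ n')) m) (edges-map⁺ U S n')
    bwd : ∀ x y → ∃[ p ] ∃[ q ] ((p , q) ∈ edges S × x ≡ U p × y ≡ U q) → (x , y) ∈ edges P
    bwd x y (p , q , m , e1 , e2) = subst₂ (λ p q → (p , q) ∈ edges P) (sym e1) (sym e2) (edge⁺ m)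

   turn : ∀ {r} → Turn S r → Turn P r
   turn (x , v , y , m , n , eq) = U x , U v , U y , edge⁺ m , edge⁺ n , trans (orient-U x v y) (trans (cong (_* orient x v y) σ≡1) (trans (QP.*-identityˡ _) eq))

  module Reversed (σ≡-1 : σ ≡ - 1#) where

   orient-flip : ∀ x y s → orient y x s ≡ - orient x y s
   orient-flip x y s = trans (orient-rotate y x s) (orient-swap x y s)

   edge⁻ : ∀ {x y} → (x , y) ∈ edges S → (U y , U x) ∈ edges P
   edge⁻ {x} {y} m = edge-image (edge-snd S m) (edge-fst S m) (λ eq → edge-distinct cvS m (sym eq))
    (λ {s} n → subst (0# ≤_) (trans (neg-one (orient x y s)) (cong₂ _*_ (sym σ≡-1) (sym (orient-flip x y s)))) (left (vertex-HIn cvS n) m))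

   flip-inj : ∀ {x y} → flip x ≡ flip y → x ≡ y
   flip-inj h = cong₂ _,_ (cong snd h) (cong fst h)

   same-area : area2 P ≡ area2 S
   same-area = trans (same-crossSum (edges-unique P (fst (snd cvP))) (UP.map⁺ flip-inj (edges-unique (map U S) (UP.map⁺ U-inj (fst (snd cvS))))) (λ {e} m → fwd (fst e) (snd e) m (pre (edge-fst P m))) (λ {e} m → bwd (fst e) (snd e) (∈P.∈-map⁻ flip m)))
     (trans (crossSum-flip (edges (map U S))) (trans (cong -_ (trans area-map (cong (_* area2 S) σ≡-1))) (id384 (area2 S)))) where
    fwd : ∀ x y → (x , y) ∈ edges P → ∃[ s ] (s ∈ S × U s ≡ x) → (x , y) ∈ map flip (edges (map U S))
    fwd x y m (s , n , eq) = go (edge-in S n) where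
     go : ∃[ w ] ((w , s) ∈ edges S) → (x , y) ∈ map flip (edges (map U S))
     go (w , n') = subst₂ (λ p q → (p , q) ∈ map flip (edges (map U S))) eq (successor-unique cvP (subst (λ p → (p , U w) ∈ edges P) eq (edge⁻ n')) m) (∈P.∈-map⁺ flip (edges-map⁺ U S n'))
    bwd : ∀ x y → ∃[ e ] (e ∈ edges (map U S) × (x , y) ≡ flip e) → (x , y) ∈ edges P
    bwd x y ((p , q) , m , eq) = subst (_∈ edges P) (sym eq) (go (edges-map⁻ U S m)) where
     go : ∃[ p' ] ∃[ q' ] ((p' , q') ∈ edges S × p ≡ U p' × q ≡ U q') → (q , p) ∈ edges P
     go (p' , q' , m' , e1 , e2) = subst₂ (λ p q → (q , p) ∈ edges P) (sym e1) (sym e2) (edge⁻ m')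

   turn : ∀ {r} → Turn S r → Turn P r
   turn (x , v , y , m , n , eq) = U y , U v , U x , edge⁻ n , edge⁻ m , trans (orient-U y v x) (trans (cong₂ _*_ σ≡-1 (trans (orient-rotate y v x) (trans (orient-rotate v x y) (orient-swap x v y)))) (trans (sym (neg-one (orient x v y))) eq))

 -- The field `turns` compares the corner triangles spanned by three consecutive vertices, through
 -- twice their areas.
 record Congruent (P S : List Point) : Set where
  field
   same-area : area2 P ≡ area2 S
   same-length : length P ≡ length S
   turns : ∀ {x v y} → (x , v) ∈ edges S → (v , y) ∈ edges S → ∃[ x' ] ∃[ v' ] ∃[ y' ] ((x' , v') ∈ edges P × (v' , y') ∈ edges P × orient x' v' y' ≡ orient x v y)

 equivalent⇒congruent : ∀ {P S} → ConvexCCW P → ConvexCCW S → Equivalent P S → Congruent P S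
 equivalent⇒congruent {P} {S} cvP cvS (a , b , c , d , t , dt , h) = [ pos , neg ]′ dt where
  to : ∀ q → HIn P q → ∃[ q' ] (HIn S q' × q ≡ applyAff a b c d t q')
  to q hq = go (fst (h q) (HIn⇒InConv cvP hq)) where
   go : ∃[ q' ] (InConv S q' × q ≡ applyAff a b c d t q') → ∃[ q' ] (HIn S q' × q ≡ applyAff a b c d t q')
   go (q' , i , e) = q' , InConv⇒HIn cvS i , e
  from : ∀ q' → HIn S q' → HIn P (applyAff a b c d t q')
  from q' hq = InConv⇒HIn cvP (snd (h (applyAff a b c d t q')) (q' , HIn⇒InConv cvS hq , refl))
  pos : a Z.* d Z.- b Z.* c ≡ + 1 → Congruent P S
  pos e = record { same-area = M.Direct.same-area refl ; same-length = M.same-length ; turns = λ m n → M.Direct.turn refl (_ , _ , _ , m , n , refl) } where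
   module M = SameHull cvP cvS a b c d t to from 1# refl (trans (sym (det2 a d b c)) (cong ι e))
  neg : a Z.* d Z.- b Z.* c ≡ -[1+ 0 ] → Congruent P S
  neg e = record { same-area = M.Reversed.same-area refl ; same-length = M.same-length ; turns = λ m n → M.Reversed.turn refl (_ , _ , _ , m , n , refl) } where
   module M = SameHull cvP cvS a b c d t to from (- 1#) refl (trans (sym (det2 a d b c)) (cong ι e))

 -- An involution carrying the vertices of each polygon into the other polygon.
 equivalent-by-involution : ∀ {P S} → ConvexCCW P → ConvexCCW S → ∀ a b c d t → (a Z.* d Z.- b Z.* c ≡ + 1 ⊎ a Z.* d Z.- b Z.* c ≡ -[1+ 0 ]) → (∀ p → applyAff a b c d t (applyAff a b c d t p) ≡ p)
  → (∀ {v} → v ∈ P → HIn S (applyAff a b c d t v)) → (∀ {s} → s ∈ S → HIn P (applyAff a b c d t s)) → Equivalent P S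
 equivalent-by-involution {P} {S} cvP cvS a b c d t dt inv f g = a , b , c , d , t , dt , λ q →
   (λ i → U q , HIn⇒InConv cvS (aff-HIn A B C D e1 e2 cvP f (InConv⇒HIn cvP i)) , sym (inv q))
  , (λ { (q' , i , e) → subst (InConv P) (sym e) (HIn⇒InConv cvP (aff-HIn A B C D e1 e2 cvS g (InConv⇒HIn cvS i))) }) where
  U = applyAff a b c d t
  A = ι a
  B = ι b
  C = ι c
  D = ι d
  e1 = ι (fst t)
  e2 = ι (snd t)

 -- Each vertex has a unique predecessor, so there are five corner triangles; the two at the bottom
 -- corners have the same area, which leaves four values.
 pent-turns : ∀ κ p q X → ConvexCCW (pent κ p q X) → ∀ {x v y} → (x , v) ∈ edges (pent κ p q X) → (v , y) ∈ edges (pent κ p q X) →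
  (orient x v y ≡ p ⊎ orient x v y ≡ κ * (q - p)) ⊎ (orient x v y ≡ X * (1# + κ) - q ⊎ orient x v y ≡ X)
 pent-turns κ p q X cv {x} m ∈0 = inj₂ (inj₂ (trans (cong (λ z → orient z (0# , κ) (0# , κ - 1#)) (predecessor-unique cv m ∈4)) (id385 κ X)))
 pent-turns κ p q X cv m ∈1 = inj₁ (inj₁ (trans (cong (λ z → orient z (0# , κ - 1#) (p , - 1#)) (predecessor-unique cv m ∈0)) (id386 κ p)))
 pent-turns κ p q X cv m ∈2 = inj₁ (inj₂ (trans (cong (λ z → orient z (p , - 1#) (q , - 1#)) (predecessor-unique cv m ∈1)) (id387 κ p q)))
 pent-turns κ p q X cv m ∈3 = inj₁ (inj₂ (trans (cong (λ z → orient z (q , - 1#) (X , κ - 1#)) (predecessor-unique cv m ∈2)) (id388 κ p q X)))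
 pent-turns κ p q X cv m ∈4 = inj₂ (inj₁ (trans (cong (λ z → orient z (X , κ - 1#) (0# , κ)) (predecessor-unique cv m ∈3)) (id389 κ q X)))

 -- Areas of the listed polygons and their pairwise non-equivalence.

 near : ∀ m c d → d N.≤ c → c N.≤ m → d N.+ (m ∸ c) N.≤ m
 near m c d h h' = NP.≤-trans (NP.+-monoˡ-≤ (m ∸ c) h) (NP.≤-reflexive (trans (NP.+-comm c (m ∸ c)) (NP.m∸n+n≡m h')))

 ∸-≢ : ∀ m c → 1 N.≤ c → c N.≤ m → m ∸ c ≢ m
 ∸-≢ m c h h' e = NP.<-irrefl e (near m c 1 h h')

 module ShapeFacts (k i : ℕ) (4≤k : 4 N.≤ k) where
  open Scale k 4≤k public
  open RHS k i hiding (K) public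
  open ShapeGeometry κ κ>0 hiding (κ≥0)

  N : ℚ
  N = (K + 1#) * I

  ν-X : ν (k N.* suc i) ≡ K * I
  ν-X = trans (ν-* k (suc i)) (cong (K *_) (suc-ν i))

  ν-N : ν (suc k N.* suc i) ≡ N
  ν-N = trans (ν-* (suc k) (suc i)) (cong₂ _*_ (suc-ν k) (suc-ν i))

  ν-bmax∸ : ∀ c → c N.≤ bmax k i → ν (bmax k i ∸ c) ≡ N + ν 3 - ν c
  ν-bmax∸ c h = trans (ν-∸ (bmax k i) c h) (cong (_- ν c) (bmaxℚ k i))

  I≥1 : 0# ≤ I - 1#
  I≥1 = subst (0# ≤_) (id231 (ν i)) (ν-0≤ i)

  N≥5 : 0# ≤ N - ν 5
  N≥5 = subst (0# ≤_) (id390 K I) (((K≥0 ⊞ ≤-lit 0# 1#) ⊠ I≥1) ⊞ diff≥ K≥4)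

  N>0 : 0# < N
  N>0 = subst (0# <_) (id391 N) (N≥5 ⊞≤< <-lit 0# (ν 5))

  8≤bmax : 8 N.≤ bmax k i
  8≤bmax = NP.+-monoˡ-≤ 3 (NP.≤-trans (N.s≤s 4≤k) (NP.m≤m*n (suc k) (suc i)))

  ≤bmax : ∀ {c} {w : True (c NP.≤? 8)} → c N.≤ bmax k i
  ≤bmax {c} {w} = NP.≤-trans (toWitness w) 8≤bmax

  2κ<1 : 0# < 1# - ν 2 * κ
  2κ<1 = subst (0# <_) (id392 κ) (κ≤¼ ⊞≤< (<-lit 0# (ν 2) ⊠< κ>0))

  at-least : ∀ b c → c N.≤ b → 0# ≤ ν b - ν c
  at-least b c h = diff≥ (ν-≤ c b h)

  1a-bound : ∀ b → b N.≤ bmax k i ∸ 3 → 0# ≤ N - ν b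
  1a-bound b h = subst (λ z → 0# ≤ z - ν b) (trans (ν-bmax∸ 3 ≤bmax) (id393 N)) (diff≥ (ν-≤ b (bmax k i ∸ 3) h))

  2a-bound : ∀ b x → b N.≤ bmax k i ∸ 2 → x N.< (bmax k i ∸ b) ℕDM./ 2 → 0# ≤ N + 1# - ν b - ν 2 * ν x
  2a-bound b x hb hx = subst (0# ≤_) (trans (cong₂ _-_ (ν-bmax∸ b b≤) (trans (ν-* (suc x) 2) (cong (_* ν 2) (suc-ν x)))) (id394 N (ν b) (ν x)))
    (diff≥ (ν-≤ (suc x N.* 2) (bmax k i ∸ b) (NP.≤-trans (NP.*-monoˡ-≤ 2 hx) (ℕDM.m/n*n≤m (bmax k i ∸ b) 2)))) where
   b≤ : b N.≤ bmax k i
   b≤ = NP.≤-trans hb (NP.m∸n≤m (bmax k i) 2)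

  shape-convex : ∀ s → Admissible k i s → ConvexCCW (shape k i s)
  shape-convex s0a _ = tri-convex κ (ν (suc k N.* suc i) - κ) (subst (0# <_) (trans (id395 N κ) (cong (λ z → z - κ - κ) (sym ν-N))) (N≥5 ⊞≤< (<-lit 0# (ν 4) ⊞< <⇒≤ 2κ<1)))
  shape-convex s0b _ = quad1-convex κ (1# - κ) (subst (0# <_) (id396 κ) 2κ<1) (ν (k N.* suc i) - κ)
    (subst (0# <_) (trans (sym (by-Kκ I (id397 K κ I))) (cong (λ z → (z - κ) * (1# + κ) - (1# - κ)) (sym ν-X))) (N≥5 ⊞≤< (<-lit 0# (ν 3) ⊞< (κ≤1 ⊠ (≤-lit 0# 1# ⊞ κ≥0))))) where
   κ≤1 : 0# ≤ 1# - κ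
   κ≤1 = <⇒≤ κ<1
  shape-convex (s1a b) (h1 , h2) = quad1-convex κ (ν b - κ) (subst (0# <_) (id398 κ (ν b)) (at-least b 1 h1 ⊞≤< 2κ<1)) (ν (k N.* suc i))
    (subst (0# <_) (trans (sym (by-Kκ I (id399 K κ I (ν b)))) (cong (λ z → z * (1# + κ) - (ν b - κ)) (sym ν-X))) (1a-bound b h2 ⊞≤< κ>0))
  shape-convex (s2a b x) (h1 , h2 , h3) = pent-convex (ν x + κ) (ν (x N.+ b) - 1# - κ)
    (subst (0# <_) (trans (id400 κ (ν b) (ν x)) (cong (λ z → z - 1# - κ - (ν x + κ)) (sym (ν-+ x b)))) (at-least b 2 h1 ⊞≤< 2κ<1)) (ν (k N.* suc i))
    (subst (0# <_) (trans (sym (by-Kκ I (id401 K κ I (ν b) (ν x)))) (cong₂ (λ z w → z * (1# + κ) - (w - 1# - κ)) (sym ν-X) (sym (ν-+ x b)))) ((2a-bound b x h2 h3 ⊞ ν-0≤ x) ⊞≤< κ>0))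
    (ν-0≤ x ⊞≤< κ>0) (ν-< 0 (k N.* suc i) (NP.≤-trans 1≤k (NP.m≤m*n k (suc i))))
  shape-convex s2b _ = quad2-convex κ (ν (suc k N.* suc i)) (subst (0# <_) (trans (id402 N κ) (cong (_- κ) (sym ν-N))) (N≥5 ⊞≤< (<-lit 0# (ν 4) ⊞< <⇒≤ κ<1))) κ>0
  shape-convex s2c _ = tri-convex 0# (ν (suc k N.* suc i)) (subst (0# <_) (trans (id403 N) (cong (_- 0#) (sym ν-N))) N>0)

  bOf≤bmax : ∀ s → Admissible k i s → bOf k i s N.≤ bmax k i
  bOf≤bmax s0a _ = NP.m∸n≤m (bmax k i) 4
  bOf≤bmax s0b _ = N.z≤n
  bOf≤bmax (s1a b) (_ , h) = NP.≤-trans h (NP.m∸n≤m (bmax k i) 3)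
  bOf≤bmax (s2a b x) (_ , h , _) = NP.≤-trans h (NP.m∸n≤m (bmax k i) 2)
  bOf≤bmax s2b _ = NP.m∸n≤m (bmax k i) 1
  bOf≤bmax s2c _ = NP.≤-refl

  K² : ℚ
  K² = ν (k N.* k)

  shape-area : ∀ s → Admissible k i s → K² * area2 (shape k i s) ≡ rhs k i (bOf k i s)
  shape-area s0a _ = trans (cong₂ _*_ (ν-* k k) (trans (tri-area κ (ν (suc k N.* suc i) - κ)) (cong (λ z → (1# + κ) * (z - κ - κ)) ν-N)))
    (trans (by-Kκ (K * (K + 1#) * I - ν 2 * K * κ - ν 2 - ν 2 * K) (id404 K κ I)) (sym (trans (rhs-mid (bmax k i ∸ 4) 1≤b 2+b≤) (cong (λ z → K * K * (K + 1#) * I + K * z - K - ν 2) (ν-bmax∸ 4 ≤bmax))))) where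
   1≤b : 1 N.≤ bmax k i ∸ 4
   1≤b = NP.≤-trans (N.s≤s N.z≤n) (NP.∸-monoˡ-≤ 4 8≤bmax)
   2+b≤ : 2 N.+ (bmax k i ∸ 4) N.≤ bmax k i
   2+b≤ = near (bmax k i) 4 2 (N.s≤s (N.s≤s N.z≤n)) ≤bmax
  shape-area s0b _ = trans (cong₂ _*_ (ν-* k k) (trans (quad1-area κ (1# - κ) (ν (k N.* suc i) - κ)) (cong (λ z → (z - κ) + κ * ((z - κ) + (1# - κ) - κ) - κ) ν-X)))
    (trans (by-Kκ (K * K * I - K - ν 3 * K * κ - ν 3) (id405 K κ I)) (sym rhs-zero))
  shape-area (s1a b) (h1 , h2) = trans (cong₂ _*_ (ν-* k k) (trans (quad1-area κ (ν b - κ) (ν (k N.* suc i))) (cong (λ z → z + κ * (z + (ν b - κ) - κ) - κ) ν-X)))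
    (trans (by-Kκ (K * K * I + K * ν b - K - ν 2 * K * κ - ν 2) (id406 K κ I (ν b))) (sym (rhs-mid b h1 (NP.≤-trans (NP.+-monoʳ-≤ 2 h2) (near (bmax k i) 3 2 (N.s≤s (N.s≤s N.z≤n)) ≤bmax)))))
  shape-area (s2a b x) (h1 , h2 , h3) = trans (cong₂ _*_ (ν-* k k) (trans (pent-area (ν x + κ) (ν (x N.+ b) - 1# - κ) (ν (k N.* suc i))) (cong₂ (λ z w → z + κ * (z + (w - 1# - κ) - (ν x + κ))) ν-X (ν-+ x b))))
    (trans (by-Kκ (K * K * I + K * ν b - K - ν 2 * K * κ - ν 2) (id407 K κ I (ν b) (ν x))) (sym (rhs-mid b (NP.≤-trans (N.s≤s N.z≤n) h1) (NP.≤-trans (NP.+-monoʳ-≤ 2 h2) (near (bmax k i) 2 2 NP.≤-refl ≤bmax)))))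
  shape-area s2b _ = trans (cong₂ _*_ (ν-* k k) (trans (quad2-area κ (ν (suc k N.* suc i))) (cong (λ z → z + κ * (z - κ)) ν-N)))
    (trans (by-Kκ (K * (K + 1#) * I - K * κ - 1#) (id408 K κ I)) (sym (trans (rhs-high (bmax k i ∸ 1) (NP.≤-trans (N.s≤s N.z≤n) (NP.∸-monoˡ-≤ 1 8≤bmax)) (NP.≤-reflexive (trans (sym (NP.m∸n+n≡m {bmax k i} {1} ≤bmax)) (NP.+-comm (bmax k i ∸ 1) 1))) (NP.m∸n≤m (bmax k i) 1)) (cong (λ z → K * ((K + 1#) * (K + 1#)) * I - ((K + 1#) * I + ν 3 - z)) (ν-bmax∸ 1 ≤bmax)))))
  shape-area s2c _ = trans (cong₂ _*_ (ν-* k k) (trans (tri-area 0# (ν (suc k N.* suc i))) (cong (λ z → (1# + κ) * (z - 0#)) ν-N)))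
    (trans (by-Kκ (K * (K + 1#) * I) (id409 K κ I)) (sym (trans (rhs-high (bmax k i) ≤bmax (NP.n≤1+n (bmax k i)) NP.≤-refl) (cong (λ z → K * ((K + 1#) * (K + 1#)) * I - ((K + 1#) * I + ν 3 - z)) (bmaxℚ k i)))))

  rhs-< : ∀ b b' → b N.< b' → b' N.≤ bmax k i → rhs k i b < rhs k i b'
  rhs-< b b' lt le = go (range b) (range b') where
   d : 0# < ν b' - ν b
   d = diff> (ν-< b b' lt)
   go : Range b → Range b' → rhs k i b < rhs k i b'
   go _ (none e) = ⊥-elim (NP.n≮0 (subst (b N.<_) e lt))
   go (none refl) (mid h h') = subst₂ _<_ (sym rhs-zero) (sym (rhs-mid b' h h')) (<-by ((K≥0 ⊠ ν-0≤ b') ⊞≤< <-lit 0# 1#) (id410 K I (ν b')))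
   go (none refl) (high h h') = subst₂ _<_ (sym rhs-zero) (sym (rhs-high b' h h' le)) (<-by (((K≥0 ⊠ <⇒≤ N>0) ⊞ K≥0) ⊞≤< (<-lit 0# (ν 2) ⊞< diff≥ (bmax-bound b' h'))) (id411 K I (ν b')))
   go (mid h1 h1') (mid h h') = subst₂ _<_ (sym (rhs-mid b h1 h1')) (sym (rhs-mid b' h h')) (<-by (K>0 ⊠< d) (id412 K I (ν b) (ν b')))
   go (mid h1 h1') (high h h') = subst₂ _<_ (sym (rhs-mid b h1 h1')) (sym (rhs-high b' h h' le)) (<-by ((K≥0 ⊠ low) ⊞≤< (<-lit 0# 1# ⊞< diff≥ (bmax-bound b' h'))) (id414 K I (ν b) (ν b'))) where
    low : 0# ≤ N + 1# - ν b
    low = subst (0# ≤_) (trans (cong₂ _-_ (bmaxℚ k i) (ν-+ 2 b)) (id413 N (ν b))) (diff≥ (ν-≤ (suc (suc b)) (bmax k i) h1'))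
   go (high h1 h1') (high h h') = subst₂ _<_ (sym (rhs-high b h1 h1' (NP.≤-trans (NP.<⇒≤ lt) le))) (sym (rhs-high b' h h' le)) (<-by d (id415 K I (ν b) (ν b')))
   go (high _ h1') (mid _ h') = ⊥-elim (NP.<-irrefl refl (NP.<-≤-trans h' (NP.≤-trans h1' (N.s≤s (NP.<⇒≤ lt)))))

  -- The right-hand side increases with b, so the area of a listed polygon reveals its number of
  -- boundary points.
  rhs-injective : ∀ b b' → b N.≤ bmax k i → b' N.≤ bmax k i → rhs k i b ≡ rhs k i b' → b ≡ b'
  rhs-injective b b' h h' e = go (NP.<-cmp b b') where
   go : Tri (b N.< b') (b ≡ b') (b' N.< b) → b ≡ b'
   go (tri< lt _ _) = ⊥-elim (<-irrefl e (rhs-< b b' lt h'))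
   go (tri≈ _ eq _) = eq
   go (tri> _ _ gt) = ⊥-elim (<-irrefl (sym e) (rhs-< b' b gt h))

  no-fraction : ∀ z → 0# < ι z → 0# < 1# - ι z → ⊥
  no-fraction z h h' = ZP.<-irrefl refl (ZP.<-≤-trans (ι-<⁻ z (+ 1) (<-by h' refl)) (ZP.i<j⇒suc[i]≤j (ι-<⁻ (+ 0) z h)))

  -- The corner of value x' + κ in the second pentagon must occur in the first. If it is the value x
  -- + κ, then x = x'. If it is the corner at X, then x + x' = bmax - b - 2, and since both indices
  -- are at most half of this they agree. The two other values would make 2 κ or κ an integer.
  2a-distinct : ∀ b x x' → Admissible k i (s2a b x) → Admissible k i (s2a b x') → Congruent (shape k i (s2a b x)) (shape k i (s2a b x')) → x ≡ x'
  2a-distinct b x x' ad@(h1 , h2 , h3) (_ , h2' , h3') c = start (Congruent.turns c ∈0 ∈1) where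
   X = ν (k N.* suc i)
   p = ν x + κ
   q = ν (x N.+ b) - 1# - κ
   r : ℚ
   r = orient (0# , κ) (0# , κ - 1#) (ν x' + κ , - 1#)
   r≡ : r ≡ ν x' + κ
   r≡ = upper-left (ν x' + κ) (- 1#)
   drop : ∀ {y z} → y + κ ≡ z + κ → y ≡ z
   drop {y} {z} e = trans (add-sub y κ) (trans (cong (_- κ) e) (sym (add-sub z κ)))
   finish : (r ≡ p ⊎ r ≡ κ * (q - p)) ⊎ (r ≡ X * (1# + κ) - q ⊎ r ≡ X) → x ≡ x'
   finish (inj₁ (inj₁ e)) = ν-inj x x' (sym (drop (trans (sym r≡) e)))
   finish (inj₁ (inj₂ e)) = ⊥-elim (no-fraction (+ b Z.- + 2 Z.- + k Z.* + x') (subst (0# <_) (sym eq) (<-lit 0# (ν 2) ⊠< κ>0)) (subst (λ z → 0# < 1# - z) (sym eq) 2κ<1)) where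
    eq : ι (+ b Z.- + 2 Z.- + k Z.* + x') ≡ ν 2 * κ
    eq = trans (ι-- (+ b Z.- + 2) (+ k Z.* + x')) (trans (cong₂ _-_ (ι-- (+ b) (+ 2)) (ι-* (+ k) (+ x')))
     (trans (by-Kκ (ν 2 * κ + ν 2 - ν b) (id417 K κ (ν b) (ν x'))) (trans (cong (λ z → ν 2 * κ + K * z) diff) (id418 K κ)))) where
     diff : κ * (ν b - 1# - ν 2 * κ) - (ν x' + κ) ≡ 0#
     diff = trans (cong (_- (ν x' + κ)) (trans (trans (id416 κ (ν b) (ν x)) (cong (λ z → κ * (z - 1# - κ - (ν x + κ))) (sym (ν-+ x b)))) (trans (sym e) r≡))) (QP.+-inverseʳ (ν x' + κ))
   finish (inj₂ (inj₁ e)) = NP.≤-antisym (ν-≤⁻ x x' (≤-by (subst (λ z → 0# ≤ z - ν 2 * ν x) total (2a-bound b x h2 h3)) (id419 (ν x) (ν x')))) (ν-≤⁻ x' x (≤-by (subst (λ z → 0# ≤ z - ν 2 * ν x') (trans total (QP.+-comm (ν x) (ν x'))) (2a-bound b x' h2' h3')) (id419 (ν x') (ν x)))) where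
    total : N + 1# - ν b ≡ ν x + ν x'
    total = trans (id420 N (ν b) (ν x) κ) (trans (cong (λ z → ν x + (z - κ)) (trans (sym val) (trans (sym e) r≡))) (id422 (ν x) (ν x') κ)) where
     val : X * (1# + κ) - q ≡ N + 1# - ν b - ν x + κ
     val = trans (cong₂ (λ z w → z * (1# + κ) - (w - 1# - κ)) ν-X (ν-+ x b)) (by-Kκ I (id421 K κ I (ν b) (ν x)))
   finish (inj₂ (inj₂ e)) = ⊥-elim (no-fraction (+ (k N.* suc i) Z.- + x') (subst (0# <_) (sym eq) κ>0) (subst (λ z → 0# < 1# - z) (sym eq) κ<1)) where
    eq : ι (+ (k N.* suc i) Z.- + x') ≡ κ
    eq = trans (ι-- (+ (k N.* suc i)) (+ x')) (trans (cong (_- ν x') (trans (sym e) r≡)) (cancelJ (ν x') κ))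
   start : ∃[ y1 ] ∃[ v1 ] ∃[ y2 ] ((y1 , v1) ∈ edges (shape k i (s2a b x)) × (v1 , y2) ∈ edges (shape k i (s2a b x)) × orient y1 v1 y2 ≡ r) → x ≡ x'
   start (y1 , v1 , y2 , m , n , eq) = finish (subst (λ z → (z ≡ p ⊎ z ≡ κ * (q - p)) ⊎ (z ≡ X * (1# + κ) - q ⊎ z ≡ X)) eq (pent-turns κ p q X (shape-convex (s2a b x) ad) m n))

  equivalent⇒rhs : ∀ {P} → ConvexCCW P → ∀ s → Admissible k i s → Equivalent P (shape k i s) → K² * area2 P ≡ rhs k i (bOf k i s)
  equivalent⇒rhs cv s ad eq = trans (cong (K² *_) (Congruent.same-area (equivalent⇒congruent cv (shape-convex s ad) eq))) (shape-area s ad)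

  -- Equal areas give equal b. Together with the number of vertices this separates all shapes except
  -- pentagons with the same b, which `2a-distinct` handles.
  non-equivalent : ∀ s t → Admissible k i s → Admissible k i t → s ≢ t → ¬ Equivalent (shape k i s) (shape k i t)
  non-equivalent s t as at ne eq = go s t as at ne c same-b (Congruent.same-length c) where
   c : Congruent (shape k i s) (shape k i t)
   c = equivalent⇒congruent (shape-convex s as) (shape-convex t at) eq
   same-b : bOf k i s ≡ bOf k i t
   same-b = rhs-injective (bOf k i s) (bOf k i t) (bOf≤bmax s as) (bOf≤bmax t at) (trans (sym (shape-area s as)) (trans (cong (K² *_) (Congruent.same-area c)) (shape-area t at)))
   mid-low : ∀ b → b N.≤ bmax k i ∸ 3 → b ≢ bmax k i ∸ 1
   mid-low b h e = NP.<-irrefl refl (NP.<-≤-trans (NP.∸-monoʳ-< {bmax k i} {3} {1} (N.s≤s (N.s≤s N.z≤n)) (≤bmax {3})) (subst (N._≤ bmax k i ∸ 3) e h))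
   go : ∀ s t → Admissible k i s → Admissible k i t → s ≢ t → Congruent (shape k i s) (shape k i t) → bOf k i s ≡ bOf k i t → length (shape k i s) ≡ length (shape k i t) → ⊥
   go s0a s0a _ _ ne _ _ _ = ne refl
   go s0a s2c _ _ _ _ e _ = ∸-≢ (bmax k i) 4 (N.s≤s N.z≤n) ≤bmax e
   go s2c s0a _ _ _ _ e _ = ∸-≢ (bmax k i) 4 (N.s≤s N.z≤n) ≤bmax (sym e)
   go s2c s2c _ _ ne _ _ _ = ne refl
   go s0b s0b _ _ ne _ _ _ = ne refl
   go s0b (s1a b) _ (h , _) _ _ e _ = NP.<⇒≢ h e
   go s0b s2b _ _ _ _ e _ = NP.<⇒≢ (NP.≤-trans (N.s≤s N.z≤n) (NP.∸-monoˡ-≤ 1 8≤bmax)) e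
   go (s1a b) s0b (h , _) _ _ _ e _ = NP.<⇒≢ h (sym e)
   go (s1a b) (s1a b') _ _ ne _ e _ = ne (cong s1a e)
   go (s1a b) s2b (_ , h) _ _ _ e _ = mid-low b h e
   go s2b s0b _ _ _ _ e _ = NP.<⇒≢ (NP.≤-trans (N.s≤s N.z≤n) (NP.∸-monoˡ-≤ 1 8≤bmax)) (sym e)
   go s2b (s1a b) _ (_ , h) _ _ e _ = mid-low b h (sym e)
   go s2b s2b _ _ ne _ _ _ = ne refl
   go (s2a b x) (s2a b' x') ad ad' ne c refl _ = ne (cong (s2a b) (2a-distinct b x x' ad ad' c))
   go s0a s0b _ _ _ _ _ ()
   go s0a (s1a _) _ _ _ _ _ ()
   go s0a (s2a _ _) _ _ _ _ _ ()
   go s0a s2b _ _ _ _ _ ()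
   go s0b s0a _ _ _ _ _ ()
   go s0b (s2a _ _) _ _ _ _ _ ()
   go s0b s2c _ _ _ _ _ ()
   go (s1a _) s0a _ _ _ _ _ ()
   go (s1a _) (s2a _ _) _ _ _ _ _ ()
   go (s1a _) s2c _ _ _ _ _ ()
   go (s2a _ _) s0a _ _ _ _ _ ()
   go (s2a _ _) s0b _ _ _ _ _ ()
   go (s2a _ _) (s1a _) _ _ _ _ _ ()
   go (s2a _ _) s2b _ _ _ _ _ ()
   go (s2a _ _) s2c _ _ _ _ _ ()
   go s2b s0a _ _ _ _ _ ()
   go s2b (s2a _ _) _ _ _ _ _ ()
   go s2b s2c _ _ _ _ _ ()
   go s2c s0b _ _ _ _ _ ()
   go s2c (s1a _) _ _ _ _ _ ()
   go s2c (s2a _ _) _ _ _ _ _ ()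
   go s2c s2b _ _ _ _ _ ()

 -- Recognising the listed polygons by mutual inclusion of vertices.

 module ShapeMembership (κ : ℚ) (κ>0 : 0# < κ) where
  open ShapeGeometry κ κ>0

  pent-HIn : ∀ {p q X x y} → 0# ≤ x → p * (κ - y - 1#) ≤ κ * x → p ≤ q → - 1# ≤ y → (X * (1# + κ) - q) * (κ - y - 1#) ≤ κ * (X * (κ - y) - x) → x ≤ X * (κ - y) → HIn (pent κ p q X) (x , y)
  pent-HIn {p} {q} {X} {x} {y} h1 h2 h3 h3' h4 h₅ = hin go where
   go : ∀ {a b} → (a , b) ∈ edges (pent κ p q X) → 0# ≤ orient a b (x , y)
   go ∈0 = nn h1 (upper-left x y)
   go ∈1 = nn (diff≥ h2) (lower-left p x y)
   go ∈2 = nn (diff≥ h3 ⊠ diff≥ h3') (bottom-edge p q x y)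
   go ∈3 = nn (diff≥ h4) (lower-right q X x y)
   go ∈4 = nn (diff≥ h₅) (upper-right X x y)

  quad1-HIn : ∀ {p q X x y} → p * (κ - y) ≤ (1# + κ) * x → p ≤ q → - 1# ≤ y → (X * (1# + κ) - q) * (κ - y - 1#) ≤ κ * (X * (κ - y) - x) → x ≤ X * (κ - y) → HIn (quad1 κ p q X) (x , y)
  quad1-HIn {p} {q} {X} {x} {y} h1 h3 h3' h4 h₅ = hin go where
   go : ∀ {a b} → (a , b) ∈ edges (quad1 κ p q X) → 0# ≤ orient a b (x , y)
   go ∈0 = nn (diff≥ h1) (full-left p x y)
   go ∈1 = nn (diff≥ h3 ⊠ diff≥ h3') (bottom-edge p q x y)
   go ∈2 = nn (diff≥ h4) (lower-right q X x y)
   go ∈3 = nn (diff≥ h₅) (upper-right X x y)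

  quad2-HIn : ∀ {p q x y} → 0# ≤ x → p * (κ - y - 1#) ≤ κ * x → p ≤ q → - 1# ≤ y → (1# + κ) * x ≤ q * (κ - y) → HIn (quad2 κ p q) (x , y)
  quad2-HIn {p} {q} {x} {y} h1 h2 h3 h3' h4 = hin go where
   go : ∀ {a b} → (a , b) ∈ edges (quad2 κ p q) → 0# ≤ orient a b (x , y)
   go ∈0 = nn h1 (upper-left x y)
   go ∈1 = nn (diff≥ h2) (lower-left p x y)
   go ∈2 = nn (diff≥ h3 ⊠ diff≥ h3') (bottom-edge p q x y)
   go ∈3 = nn (diff≥ h4) (full-right q x y)

  tri-HIn : ∀ {p q x y} → p * (κ - y) ≤ (1# + κ) * x → p ≤ q → - 1# ≤ y → (1# + κ) * x ≤ q * (κ - y) → HIn (tri κ p q) (x , y)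
  tri-HIn {p} {q} {x} {y} h1 h3 h3' h4 = hin go where
   go : ∀ {a b} → (a , b) ∈ edges (tri κ p q) → 0# ≤ orient a b (x , y)
   go ∈0 = nn (diff≥ h1) (full-left p x y)
   go ∈1 = nn (diff≥ h3 ⊠ diff≥ h3') (bottom-edge p q x y)
   go ∈2 = nn (diff≥ h4) (full-right q x y)

 -- P seen through an involution U with first coordinate η (the identity, or the reflection exchanging the two sides).
 module Placement (k i : ℕ) (4≤k : 4 N.≤ k) {P : List Point} (cv : ConvexCCW P) (above : ∀ {v} → v ∈ P → - 1# ≤ snd v)
          (a b c d : ℤ) (t : ℤ × ℤ) (dt : a Z.* d Z.- b Z.* c ≡ + 1 ⊎ a Z.* d Z.- b Z.* c ≡ -[1+ 0 ])
          (invol : ∀ p → applyAff a b c d t (applyAff a b c d t p) ≡ p) (η : Point → ℚ) (U-η : ∀ p → applyAff a b c d t p ≡ (η p , snd p))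
          (e e' : ℚ) where
  open ShapeFacts k i 4≤k
  open ShapeMembership κ κ>0

  U : Point → Point
  U = applyAff a b c d t

  η' : Point → ℚ
  η' v = K * I * u v - η v

  NearBound FarBound : ℚ → ℚ → Set
  NearBound ρ a = ∀ {v} → v ∈ P → ρ * u v ≤ η v × a + K * (e - a) * (u v - 1#) ≤ η v
  FarBound ρ a = ∀ {v} → v ∈ P → ρ * u v ≤ η' v × a + K * (e' - a) * (u v - 1#) ≤ η' v

  scaled-lower : ∀ a e {x z} → a + K * (e - a) * x ≤ z → (e - a) * x ≤ κ * z - κ * a
  scaled-lower a e {x} {z} h = ≤-by (κ≥0 ⊠ diff≥ h) (sym (by-Kκ (- ((e - a) * x)) (id423 K κ a e x z)))

  place : ∀ s → Admissible k i s → (∀ {v} → v ∈ P → HIn (shape k i s) (η v , snd v)) → All (λ q → HIn P (U q)) (shape k i s) → Equivalent P (shape k i s)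
  place s ad f g = equivalent-by-involution cv (shape-convex s ad) a b c d t dt invol (λ {v} m → subst (HIn (shape k i s)) (sym (U-η v)) (f m)) (λ m → All.lookup g m)

  X q : ℚ
  X = ν (k N.* suc i)
  -- On the bottom line the two reference lines are K I (1 + κ) = N apart, so this is the abscissa
  -- of the far bottom corner measured from the near side.
  q = N - e'

  far-corner : X * (1# + κ) - q ≡ e'
  far-corner = trans (cong (λ z → z * (1# + κ) - q) ν-X) (by-Kκ I (id424 K κ I e'))

  far-lower : FarBound 0# 0# → ∀ {v} → v ∈ P → (X * (1# + κ) - q) * (u v - 1#) ≤ κ * (X * u v - η v)
  far-lower B {v} m = subst₂ _≤_ (cong (_* (u v - 1#)) (trans (QP.+-identityʳ e') (sym far-corner))) (trans (id425 κ (η' v)) (cong (λ z → κ * (z * u v - η v)) (sym ν-X))) (scaled-lower 0# e' (snd (B m)))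

  far-upper : FarBound 0# 0# → ∀ {v} → v ∈ P → η v ≤ X * u v
  far-upper B {v} m = ≤-by (diff≥ (fst (B m))) (trans (cong (λ z → z * u v - η v) ν-X) (id426 (K * I * u v - η v) (u v)))

  near-nonneg : NearBound 0# 0# → ∀ {v} → v ∈ P → 0# ≤ η v
  near-nonneg B {v} m = subst (_≤ η v) (QP.*-zeroˡ (u v)) (fst (B m))

  near-lower : NearBound 0# 0# → ∀ {v} → v ∈ P → e * (u v - 1#) ≤ κ * η v
  near-lower B {v} m = subst₂ _≤_ (cong (_* (u v - 1#)) (QP.+-identityʳ e)) (id425 κ (η v)) (scaled-lower 0# e (snd (B m)))

  sharp-scale : ∀ ρ → (K + 1#) * ρ ≡ 1# → ∀ {x z} → ρ * x ≤ z → κ * x ≤ (1# + κ) * z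
  sharp-scale ρ hρ {x} {z} h = ≤-by (((≤-lit 0# 1# ⊞ κ≥0) ⊠ diff≥ h)) (trans (cong (λ y → (1# + κ) * z - y * x) (sym ρκ)) (id427 κ ρ x z)) where
   ρκ : ρ * (1# + κ) ≡ κ
   ρκ = trans (by-Kκ (- ρ) (id315 K κ ρ)) (trans (cong (_* κ) hρ) (QP.*-identityˡ κ))

  far-full : ∀ c → (∀ {v} → v ∈ P → c * u v ≤ (1# + κ) * η' v) → ∀ {v} → v ∈ P → (1# + κ) * η v ≤ (N - c) * u v
  far-full c h {v} m = ≤-by (diff≥ (h m)) (sym (by-Kκ (I * u v) (id428 K κ I c (u v) (η v))))

  at-point : ∀ {p q y} → p ≡ q → HIn P (U (q , y)) → HIn P (U (p , y))
  at-point {p} {q} {y} h = subst (λ z → HIn P (U (z , y))) (sym h)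

  module _ (apex∈ : HIn P (U (0# , κ))) (near∈ : HIn P (U (e , - 1#))) (far∈ : HIn P (U (q , - 1#))) (e≤q : e ≤ q) where

   as-2a : NearBound 0# 0# → FarBound 0# 0# → HIn P (U (0# , κ - 1#)) → HIn P (U (K * I , κ - 1#)) → ∀ b x → Admissible k i (s2a b x) → ν x + κ ≡ e → ν (x N.+ b) - 1# - κ ≡ q → Equivalent P (shape k i (s2a b x))
   as-2a B B' h h' b x ad ep eq = place (s2a b x) ad (λ {v} m → subst₂ (λ p q → HIn (pent κ p q X) (η v , snd v)) (sym ep) (sym eq) (pent-HIn (near-nonneg B m) (near-lower B m) e≤q (above m) (far-lower B' m) (far-upper B' m)))
    (apex∈ All.∷ h All.∷ at-point ep near∈ All.∷ at-point eq far∈ All.∷ at-point ν-X h' All.∷ All.[])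

   as-1a : ∀ ρ → (K + 1#) * ρ ≡ 1# → NearBound ρ ρ → FarBound 0# 0# → HIn P (U (K * I , κ - 1#)) → ∀ b → Admissible k i (s1a b) → κ ≡ e → ν b - κ ≡ q → Equivalent P (shape k i (s1a b))
   as-1a ρ hρ B B' h' b ad ep eq = place (s1a b) ad (λ {v} m → subst (λ q → HIn (quad1 κ κ q X) (η v , snd v)) (sym eq) (quad1-HIn (sharp-scale ρ hρ (fst (B m))) (subst (_≤ q) (sym ep) e≤q) (above m) (far-lower B' m) (far-upper B' m)))
    (apex∈ All.∷ at-point ep near∈ All.∷ at-point eq far∈ All.∷ at-point ν-X h' All.∷ All.[])

   as-0a : ∀ ρ → (K + 1#) * ρ ≡ 1# → NearBound ρ ρ → FarBound ρ ρ → κ ≡ e → κ ≡ e' → Equivalent P (shape k i s0a)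
   as-0a ρ hρ B B' ep ep' = place s0a ≤bmax (λ {v} m → subst (λ q → HIn (tri κ κ q) (η v , snd v)) (sym eq) (tri-HIn (sharp-scale ρ hρ (fst (B m))) (subst (_≤ q) (sym ep) e≤q) (above m) (subst (λ c → (1# + κ) * η v ≤ (N - c) * u v) ep' (far-full κ (λ n → sharp-scale ρ hρ (fst (B' n))) m))))
    (apex∈ All.∷ at-point ep near∈ All.∷ at-point eq far∈ All.∷ All.[]) where
    eq : ν (suc k N.* suc i) - κ ≡ q
    eq = cong₂ _-_ ν-N ep'

   as-0b : ∀ ρ → (K + 1#) * ρ ≡ 1# → NearBound ρ ρ → FarBound κ κ → HIn P (U (K * I - κ , κ - 1#)) → κ ≡ e → 1# - κ ≡ q → Equivalent P (shape k i s0b)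
   as-0b ρ hρ B B' h' ep eq = place s0b tt (λ {v} m → subst (λ q → HIn (quad1 κ κ q (X - κ)) (η v , snd v)) (sym eq) (quad1-HIn (sharp-scale ρ hρ (fst (B m))) (subst (_≤ q) (sym ep) e≤q) (above m) (lower m) (upper m)))
    (apex∈ All.∷ at-point ep near∈ All.∷ at-point eq far∈ All.∷ at-point (cong (_- κ) ν-X) h' All.∷ All.[]) where
    upper : ∀ {v} → v ∈ P → η v ≤ (X - κ) * u v
    upper {v} m = ≤-by (diff≥ (fst (B' m))) (trans (cong (λ z → (z - κ) * u v - η v) ν-X) (id429 K κ I (u v) (η v)))
    lower : ∀ {v} → v ∈ P → ((X - κ) * (1# + κ) - q) * (u v - 1#) ≤ κ * ((X - κ) * u v - η v)
    lower {v} m = ≤-by (diff≥ (scaled-lower κ e' (snd (B' m)))) (trans (cong (λ z → κ * ((z - κ) * u v - η v) - ((z - κ) * (1# + κ) - q) * (u v - 1#)) ν-X) (by-Kκ (- (I * (u v - 1#))) (id430 K κ I e' (u v) (η v))))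

   far-full0 : FarBound 0# 0# → 0# ≡ e' → ∀ {v} → v ∈ P → (1# + κ) * η v ≤ q * u v
   far-full0 B' ep' {v} m = subst (λ c → (1# + κ) * η v ≤ (N - c) * u v) ep' (far-full 0# (λ {w} n → ≤-by ((≤-lit 0# 1# ⊞ κ≥0) ⊠ diff≥ (fst (B' n))) (id431 κ (u w) (η' w))) m)

   q-full : 0# ≡ e' → ν (suc k N.* suc i) ≡ q
   q-full ep' = trans ν-N (trans (id403 N) (cong (λ z → N - z) ep'))

   as-2b : NearBound 0# 0# → FarBound 0# 0# → HIn P (U (0# , κ - 1#)) → κ ≡ e → 0# ≡ e' → Equivalent P (shape k i s2b)
   as-2b B B' h ep ep' = place s2b tt (λ {v} m → subst₂ (λ p q → HIn (quad2 κ p q) (η v , snd v)) (sym ep) (sym (q-full ep')) (quad2-HIn (near-nonneg B m) (near-lower B m) e≤q (above m) (far-full0 B' ep' m)))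
    (apex∈ All.∷ h All.∷ at-point ep near∈ All.∷ at-point (q-full ep') far∈ All.∷ All.[])

   as-2c : NearBound 0# 0# → FarBound 0# 0# → 0# ≡ e → 0# ≡ e' → Equivalent P (shape k i s2c)
   as-2c B B' ep ep' = place s2c tt (λ {v} m → subst (λ q → HIn (tri κ 0# q) (η v , snd v)) (sym (q-full ep')) (tri-HIn (≤-by ((≤-lit 0# 1# ⊞ κ≥0) ⊠ near-nonneg B m) (id432 κ (u v) (η v))) (subst (_≤ q) (sym ep) e≤q) (above m) (far-full0 B' ep' m)))
    (apex∈ All.∷ at-point ep near∈ All.∷ at-point (q-full ep') far∈ All.∷ All.[])

 HIn-row : ∀ {P x x' y} m → HIn P (x , y) → HIn P (x' , y) → x ≤ m → m ≤ x' → HIn P (m , y)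
 HIn-row {P} {x} {x'} {y} m h h' l r = go (QP.<-cmp x x') where
  go : Tri (x < x') (x ≡ x') (x' < x) → HIn P (m , y)
  go (tri≈ _ e _) = subst (λ z → HIn P (z , y)) (≤-antisym l (subst (m ≤_) (sym e) r)) h
  go (tri> _ _ g) = ⊥-elim (<-irrefl refl (<-≤-trans g (≤-trans l r)))
  go (tri< g _ _) = mix (recip (x' - x) (diff> g)) where
   mix : ∃[ ρ ] (0# < ρ × (x' - x) * ρ ≡ 1#) → HIn P (m , y)
   mix (ρ , ρ>0 , e) = subst (HIn P) (cong₂ _,_ (trans (id433 x x' m ρ) (trans (cong (_* m) e) (QP.*-identityˡ m))) (trans (id434 x x' m ρ y) (trans (cong (_* y) e) (QP.*-identityˡ y))))
     (HIn-convex P ((x' - m) * ρ) ((m - x) * ρ) (diff≥ r ⊠ <⇒≤ ρ>0) (diff≥ l ⊠ <⇒≤ ρ>0) (trans (id42 x x' m ρ) e) h h')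

 -- The bottom edge, and polygons with a top edge.

 module FineCases {k i b : ℕ} {P : List Point} (pr : Prob k i b P) (4≤k : 4 N.≤ k) (1≤i : 1 N.≤ i) (b≤bmax : b N.≤ bmax k i) (F : Fine k i P) where
  open Prob pr public
  open ShapeFacts k i 4≤k public
  open FineFrame pr 4≤k 1≤i F hiding (I) public

  A Y : ℚ
  A = K² * area2 P
  Y = K * K * (K + 1#) * I

  strictly : A < rhs k i b → Concl k i b P
  strictly h = b≤bmax , <⇒≤ h , λ e → ⊥-elim (<-irrefl e h)

  below : ∃[ z ] (ι z < xl × xl ≤ ι z + 1#)
  below = strictly-below xl

  floor : ∃[ f ] (ι f ≤ xr × xr < ι f + 1#)
  floor = floorℚ xr

  z f : ℤ
  z = fst below
  f = fst floor

  z≤f : z Z.≤ f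
  z≤f = ZP.≤-trans (ZP.i<j⇒i≤pred[j] (ι-<⁻ z (Z.suc f) (subst (ι z <_) (sym (ι-suc f)) (<-trans (<-≤-trans (fst (snd below)) xl≤xr) (snd (snd floor)))))) (ZP.≤-reflexive (ZP.pred-suc f))

  -- The number of lattice points on the bottom edge, which are the integers from z + 1 to f.
  n : ℕ
  n = Z.∣ f Z.- z ∣

  n≡ : + n ≡ f Z.- z
  n≡ = ZP.0≤i⇒+∣i∣≡i (ZP.i≤j⇒0≤j-i z≤f)

  νn : ν n ≡ ι f - ι z
  νn = trans (cong ι n≡) (ι-- f z)

  xl-grid : Grid xl
  xl-grid = fst (integral vl∈)

  xr-grid : Grid xr
  xr-grid = fst (integral vr∈)

  xl≥ : ι z + κ ≤ xl
  xl≥ = grid-step (grid-ι z) xl-grid (fst (snd below))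

  xr≤ : xr + κ ≤ ι f + 1#
  xr≤ = grid-step xr-grid (grid-+ (grid-ι f) (grid-ι (+ 1))) (snd (snd floor))

  w-room : ν n + 1# - ν 2 * κ - w ≡ (ι f + 1# - (xr + κ)) + (xl - (ι z + κ))
  w-room = trans (cong (λ m → m + 1# - ν 2 * κ - w) νn) (id435 (ι f) (ι z) xl xr κ)

  -- Both bottom corners are multiples of κ strictly inside the interval from z to f + 1, so at
  -- least κ is missing at each end.
  w≤ : 0# ≤ ν n + 1# - ν 2 * κ - w
  w≤ = subst (0# ≤_) (sym w-room) (diff≥ xr≤ ⊞ diff≥ xl≥)

  on-bottom : ∀ m → xl ≤ m → m ≤ xr → HIn P (m , - 1#)
  on-bottom m = HIn-row m (subst (λ y → HIn P (xl , y)) vl-y (vertex-HIn cv vl∈)) (subst (λ y → HIn P (xr , y)) vr-y (vertex-HIn cv vr∈))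

  bottom-¬HInt : ∀ x → ¬ HInt P (x , - 1#)
  bottom-¬HInt x h = <-irrefl refl (fst (HInt-levels cv Lv h))

  bottom-point : ∀ m → m N.< n → HIn P (lat (Z.suc z Z.+ + m , -[1+ 0 ]))
  bottom-point m h = on-bottom (ι (Z.suc z Z.+ + m)) lo hi where
   eq : ι (Z.suc z Z.+ + m) ≡ ι z + 1# + ν m
   eq = trans (ι-+ (Z.suc z) (+ m)) (cong (_+ ν m) (ι-suc z))
   lo : xl ≤ ι (Z.suc z Z.+ + m)
   lo = ≤-trans (snd (snd below)) (subst (ι z + 1# ≤_) (sym eq) (≤-by (ν-0≤ m) (id436 (ι z) (ν m))))
   hi : ι (Z.suc z Z.+ + m) ≤ xr
   hi = ≤-trans (≤-by (diff≥ (ν-≤ (suc m) n h)) (trans (cong (λ y → ι f - y) eq) (trans (id437 (ι f) (ι z) (ν m)) (sym (cong₂ _-_ νn (ν-suc m)))))) (fst (snd floor))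

  boundary-count : ∀ ts → Unique ts → (∀ {t} → t ∈ ts → snd t ≡ + 0 × HIn P (lat t) × ¬ HInt P (lat t)) → length ts N.+ n N.≤ b
  boundary-count ts un h = subst₂ N._≤_ (trans (LP.length-++ ts) (cong (length ts N.+_) (consecutive-length (Z.suc z) -[1+ 0 ] n))) (fst (snd (snd bds)))
    (unique-⊆-length (UP.++⁺ un (consecutive-unique (Z.suc z) -[1+ 0 ] n) disjoint) (λ {t} m → snd (snd (snd (snd bds)) t) ([ (λ m' → snd (h m')) , (λ m' → bottom t (consecutive-bound (Z.suc z) -[1+ 0 ] n m')) ]′ (∈P.∈-++⁻ ts m)))) where
   bottom : ∀ t → ∃[ m ] (m N.< n × t ≡ (Z.suc z Z.+ + m , -[1+ 0 ])) → HIn P (lat t) × ¬ HInt P (lat t)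
   bottom t (m , m<n , e) = subst (λ t → HIn P (lat t) × ¬ HInt P (lat t)) (sym e) (bottom-point m m<n , bottom-¬HInt (ι (Z.suc z Z.+ + m)))
   clash : ∀ {t} → snd t ≡ + 0 → ∃[ m ] (m N.< n × t ≡ (Z.suc z Z.+ + m , -[1+ 0 ])) → ⊥
   clash e (m , _ , e') = zero≢-1 (trans (sym e) (cong snd e')) where
    zero≢-1 : + 0 ≢ -[1+ 0 ]
    zero≢-1 ()
   disjoint : ∀ {t} → ¬ (t ∈ ts × t ∈ consecutive (Z.suc z) -[1+ 0 ] n)
   disjoint (m1 , m2) = clash (fst (h m1)) (consecutive-bound (Z.suc z) -[1+ 0 ] n m2)

  n≤b : n N.≤ b
  n≤b = boundary-count [] AP.[] (λ ())

  b-zero : b ≡ 0 → rhs k i b ≡ Y + K * ν b - K - ν 3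
  b-zero e = trans (cong (rhs k i) e) (trans rhs-zero (trans (id438 Y K) (cong (λ m → Y + K * ν m - K - ν 3) (sym e))))

  -- A top edge of length q tilts the right reference line. In the scaled area this gains q (K² + K)
  -- and loses K³ q, a net loss of K q (K² - K - 1). As K q ≥ 1 and K ≥ 4, the bound becomes strict
  -- in every range of b.
  second-top : 0# < q → Concl k i b P
  second-top q>0 = strictly (go (range b)) where
   H : ℚ
   H = K * (w + q + K * (I - q) - 0# - 0#) + K * K * (ν 2 * q + K * (I - q) - 0# - 0#)
   H-A : 0# ≤ H - A
   H-A = diff≥ (scaled-area L.bound0 R.bound0)
   Kq : 0# ≤ K * q - 1#
   Kq = subst (0# ≤_) (by-Kκ (- 1#) (id439 K κ q)) (K≥0 ⊠ diff≥ (grid-step grid-0 (fst (integral q∈)) q>0))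
   J : 0# ≤ K - ν 4
   J = diff≥ K≥4
   slack : 0# ≤ (H - A) + (K * (ν n + 1# - ν 2 * κ - w) + (K * (ν b - ν n) + (K * q - 1#) * ((K - ν 4) * (K - ν 4) + (ν 7 * (K - ν 4) + ν 11))))
   slack = H-A ⊞ ((K≥0 ⊠ w≤) ⊞ ((K≥0 ⊠ diff≥ (ν-≤ n b n≤b)) ⊞ (Kq ⊠ ((J ⊠ J) ⊞ ((≤-lit 0# (ν 7) ⊠ J) ⊞ ≤-lit 0# (ν 11))))))
   go : Range b → A < rhs k i b
   go (none e) = subst (A <_) (sym (b-zero e)) (<-by (slack ⊞≤< (((J ⊠ J) ⊞ (≤-lit 0# (ν 5) ⊠ J)) ⊞≤< <-lit 0# (ν 2))) (by-Kκ (ν 2) (id440 K κ I q w (ν n) (ν b) A)))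
   go (mid h h') = subst (A <_) (sym (rhs-mid b h h')) (<-by (slack ⊞≤< (((J ⊠ J) ⊞ (≤-lit 0# (ν 5) ⊠ J)) ⊞≤< <-lit 0# (ν 3))) (by-Kκ (ν 2) (id441 K κ I q w (ν n) (ν b) A)))
   go (high h h') = subst (A <_) (sym (rhs-high b h h' b≤bmax)) (<-by ((H-A ⊞ (K≥0 ⊠ room)) ⊞≤< (((Kq ⊠ ((J ⊠ (J ⊞ ≤-lit 0# (ν 8))) ⊞ ≤-lit 0# (ν 15))) ⊞ diff≥ (bmax-bound b h')) ⊞≤< ((J ⊠ (J ⊞ ≤-lit 0# (ν 8))) ⊞≤< <-lit 0# (ν 14)))) (by-Kκ (- (K * (I - q))) (id443 K κ I q w (ν b) A))) where
    room : 0# ≤ q + K * (I - q) * (1# + κ) - w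
    room = subst (0# ≤_) (trans (cong (λ y → q + D * y - xr + xl) (bottom-u {vr} vr-y)) (id442 (q + D * (1# + κ)) xr xl)) (diff≥ (right-nonneg0 vr∈) ⊞ left-nonneg0 vl∈)

 -- The reflection exchanging the sides turns the index x of a pentagon into m - 2 - x; this brings
 -- an index that is too large into the admissible range.
 half-flip : ∀ m x → 2 N.≤ m → m ℕDM./ 2 N.≤ x → m ∸ (2 N.+ x) N.< m ℕDM./ 2
 half-flip m x h le = go (m ℕDM./ 2) le (ℕDM.m≥n⇒m/n>0 h) bound where
  bound : m N.≤ 1 N.+ (m ℕDM./ 2) N.* 2
  bound = NP.≤-trans (NP.≤-reflexive (ℕDM.m≡m%n+[m/n]*n m 2)) (NP.+-monoˡ-≤ ((m ℕDM./ 2) N.* 2) (NP.≤-pred (ℕDM.m%n<n m 2)))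
  go : ∀ h → h N.≤ x → 0 N.< h → m N.≤ 1 N.+ h N.* 2 → m ∸ (2 N.+ x) N.< h
  go (suc h) le _ up = N.s≤s (NP.≤-trans (NP.∸-mono up (NP.+-monoʳ-≤ 2 le)) (NP.≤-reflexive (trans (cong (λ z → 1 N.+ z ∸ (2 N.+ suc h)) (trans (NP.*-comm (suc h) 2) (cong (suc h N.+_) (NP.+-identityʳ (suc h))))) (NP.m+n∸n≡m h (suc h)))))

 -- A single top vertex: weighing the two sides.

 module Apex {k i b : ℕ} {P : List Point} (pr : Prob k i b P) (4≤k : 4 N.≤ k) (1≤i : 1 N.≤ i) (b≤bmax : b N.≤ bmax k i) (F : Fine k i P)
       (q≡0 : FineFrame.q pr 4≤k 1≤i F ≡ 0#) where
  open FineCases pr 4≤k 1≤i b≤bmax F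
  open Fine F using (apex; lower; left-end; right-end)

  D≡ : D ≡ K * I
  D≡ = trans (cong (λ x → K * (I - x)) q≡0) (id444 K I)

  -- The number c is the amount by which a bound of the left or right side lowers the scaled area.
  LB RB : ℚ → Set
  LB c = ∃[ ρ ] ∃[ a ] (L.Bound ρ a × K * a + K * K * ρ ≡ c)
  RB c = ∃[ ρ ] ∃[ a ] (R.Bound ρ a × K * a + K * K * ρ ≡ c)

  A≤ : ∀ {c c'} → LB c → RB c' → 0# ≤ Y + K * w - (c + c') - A
  A≤ {c} {c'} (ρ , a , B , e) (ρ' , a' , B' , e') = subst (0# ≤_) (cong (_- A) (trans (cong₂ (λ x d → K * (w + x + d - a - a') + K * K * (ν 2 * x + d - ρ - ρ')) q≡0 D≡) (trans (id445 K I w a a' ρ ρ') (cong₂ (λ x y → Y + K * w - (x + y)) e e')))) (diff≥ (scaled-area B B'))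

  apex-u : κ - κ ≡ 0#
  apex-u = QP.+-inverseʳ κ

  ptL ptR : ℚ → ℚ → Point
  ptL x h = (x , κ - h)
  ptR x h = (q + D * h - x , κ - h)

  ptR-x : ∀ x h → fst (ptR x h) ≡ K * I * h - x
  ptR-x x h = trans (cong₂ (λ a d → a + d * h - x) q≡0 D≡) (id446 (K * I) h x)

  module Lk = L.Kinds (λ {v} m → subst Grid (sym (L-x v)) (fst (integral m))) (0# , κ) apex apex-u (L-x (0# , κ)) ptL
   (λ p → cong₂ _,_ (sym (L-x p)) (y-back κ (snd p)))

  R-grid : ∀ {v} → v ∈ P → Grid (R.ξ v)
  R-grid {v} m = subst Grid (sym (trans (R-x v) (cong₂ (λ a d → a + d * u v - fst v) q≡0 D≡))) (grid-- (grid-+ grid-0 (prod (u-grid m))) (fst (integral m))) where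
   prod : Grid (u v) → Grid (K * I * u v)
   prod (y , e) = + (k N.* suc i) Z.* y , trans (id447 K I (u v)) (trans (cong₂ _*_ (sym ν-X) e) (sym (ι-* (+ (k N.* suc i)) y)))

  module Rk = R.Kinds R-grid (0# , κ) apex apex-u
   (trans (R-x (0# , κ)) (trans (cong₂ (λ a h → a + D * h - 0#) q≡0 apex-u) (zero-right D))) ptR
   (λ p → cong₂ _,_ (trans (y-back (q + D * u p) (fst p)) (cong (λ z → q + D * u p - z) (sym (R-x p)))) (y-back κ (snd p)))

  touchL : Lk.Touch → HIn P (lat (+ 0 , + 0))
  touchL = subst (λ y → HIn P (0# , y)) apex-u

  touchR : Rk.Touch → HIn P (lat (+ suc i , + 0))
  touchR = subst₂ (λ x y → HIn P (x , y)) (trans (ptR-x 0# κ) (trans (by-Kκ I (id448 K κ I)) (sym (suc-ν i)))) apex-u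

  b≥2 : Lk.Touch → Rk.Touch → 2 N.+ n N.≤ b
  b≥2 t t' = boundary-count ((+ 0 , + 0) ∷ (+ suc i , + 0) ∷ []) (((λ ()) All.∷ All.[]) AP.∷ All.[] AP.∷ AP.[]) λ { ∈0 → refl , touchL t , left-end ; ∈1 → refl , touchR t' , right-end }

  b≥1ˡ : Lk.Touch → 1 N.+ n N.≤ b
  b≥1ˡ t = boundary-count ((+ 0 , + 0) ∷ []) (All.[] AP.∷ AP.[]) λ { ∈0 → refl , touchL t , left-end }

  b≥1ʳ : Rk.Touch → 1 N.+ n N.≤ b
  b≥1ʳ t = boundary-count ((+ suc i , + 0) ∷ []) (All.[] AP.∷ AP.[]) λ { ∈0 → refl , touchR t , right-end }

  room : ∀ t → t N.+ n N.≤ b → 0# ≤ ν b - (ν t + ν n)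
  room t h = subst (λ x → 0# ≤ ν b - x) (ν-+ t n) (diff≥ (ν-≤ (t N.+ n) b h))

  -- A touching or sharp side has weight K in K t + c, a side with a gap has weight K + 1.
  module Weigh (t : ℕ) (hb : t N.+ n N.≤ b) {c c' : ℚ} (lb : LB c) (rb : RB c') where

   s1 s2 s3 : ℚ
   s1 = Y + K * w - (c + c') - A
   s2 = ν n + 1# - ν 2 * κ - w
   s3 = ν b - (ν t + ν n)

   slack : 0# ≤ s1 + (K * s2 + K * s3)
   slack = A≤ lb rb ⊞ ((K≥0 ⊠ w≤) ⊞ (K≥0 ⊠ room t hb))

   none-eq : b ≡ 0 → rhs k i b - A ≡ (s1 + (K * s2 + K * s3)) + (K * ν t + (c + c') - ν 2 * K - 1#)
   none-eq e = trans (cong (_- A) (b-zero e)) (by-Kκ (ν 2) (id449 Y K κ w (ν n) (ν t) (ν b) (c + c') A))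

   mid-eq : 1 N.≤ b → suc b N.< bmax k i → rhs k i b - A ≡ (s1 + (K * s2 + K * s3)) + (K * ν t + (c + c') - ν 2 * K)
   mid-eq h h' = trans (cong (_- A) (rhs-mid b h h')) (by-Kκ (ν 2) (id450 Y K κ w (ν n) (ν t) (ν b) (c + c') A))

   none-< : b ≡ 0 → 0# < K * ν t + (c + c') - ν 2 * K - 1# → A < rhs k i b
   none-< e h = <-by (slack ⊞≤< h) (none-eq e)

   none-≤ : b ≡ 0 → 0# ≤ K * ν t + (c + c') - ν 2 * K - 1# → A ≤ rhs k i b
   none-≤ e h = ≤-by (slack ⊞ h) (none-eq e)

   mid-< : 1 N.≤ b → suc b N.< bmax k i → 0# < K * ν t + (c + c') - ν 2 * K → A < rhs k i b
   mid-< h h' g = <-by (slack ⊞≤< g) (mid-eq h h')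

   mid-≤ : 1 N.≤ b → suc b N.< bmax k i → 0# ≤ K * ν t + (c + c') - ν 2 * K → A ≤ rhs k i b
   mid-≤ h h' g = ≤-by (slack ⊞ g) (mid-eq h h')

   zero-sum : ∀ {x y} → 0# ≤ x → 0# ≤ y → x + y ≡ 0# → x ≡ 0# × y ≡ 0#
   zero-sum {x} {y} hx hy e = ≤-antisym (≤-by hy (trans (cong (_- x) (sym e)) (cancelJ x y))) hx , ≤-antisym (≤-by hx (trans (cong (_- y) (sym e)) (id451 x y))) hy

   -- In case of equality every nonnegative summand vanishes: the bottom edge is as long as its n
   -- lattice points permit, and b counts exactly these and the t counted ends of the row.
   tight : ∀ {r} → 0# ≤ r → rhs k i b - A ≡ (s1 + (K * s2 + K * s3)) + r → A ≡ rhs k i b → s2 ≡ 0# × s3 ≡ 0#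
   tight {r} hr eq e = ≡0-cancel K>0 (fst z3) , ≡0-cancel K>0 (snd z3) where
    z1 : s1 + (K * s2 + K * s3) ≡ 0#
    z1 = fst (zero-sum slack hr (trans (sym eq) (trans (cong (λ x → rhs k i b - x) e) (QP.+-inverseʳ (rhs k i b)))))
    z2 : K * s2 + K * s3 ≡ 0#
    z2 = snd (zero-sum (A≤ lb rb) ((K≥0 ⊠ w≤) ⊞ (K≥0 ⊠ room t hb)) z1)
    z3 : K * s2 ≡ 0# × K * s3 ≡ 0#
    z3 = zero-sum (K≥0 ⊠ w≤) (K≥0 ⊠ room t hb) z2

  eR' : R.e ≡ N - xr
  eR' = trans eR (trans (cong₂ (λ a d → a + d * (1# + κ) - xr) q≡0 D≡) (by-Kκ I (id452 K κ I xr)))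

  R-e≥0 : 0# ≤ N - xr
  R-e≥0 = subst (0# ≤_) (trans (sym (R-x vr)) eR') (diff≥ (right-nonneg0 vr∈))

  N-w≥0 : 0# ≤ N - w
  N-w≥0 = subst (0# ≤_) (id442 N xr xl) (R-e≥0 ⊞ left-nonneg0 vl∈)

  high-eq : ∀ {c c'} → 1 N.≤ b → bmax k i N.≤ suc b → rhs k i b - A ≡ ((Y + K * w - (c + c') - A) + (ν b - (N + ν 2))) + (K * (N - w) + (c + c') - 1#)
  high-eq {c} {c'} h h' = trans (cong (_- A) (rhs-high b h h' b≤bmax)) (id453 K I w (c + c') (ν b) A)

  high-< : ∀ {c c'} → LB c → RB c' → 1 N.≤ b → bmax k i N.≤ suc b → 0# < c + c' - 1# → A < rhs k i b
  high-< {c} {c'} lb rb h h' g = <-by ((A≤ lb rb ⊞ diff≥ (bmax-bound b h')) ⊞≤< ((K≥0 ⊠ N-w≥0) ⊞≤< g)) (trans (high-eq {c} {c'} h h') (cong (λ x → (Y + K * w - (c + c') - A) + (ν b - (N + ν 2)) + x) (QP.+-assoc (K * (N - w)) (c + c') (- 1#))))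

 -- The equality cases for touching sides.

 module ApexCases {k i b : ℕ} {P : List Point} (pr : Prob k i b P) (4≤k : 4 N.≤ k) (1≤i : 1 N.≤ i) (b≤bmax : b N.≤ bmax k i) (F : Fine k i P)
          (q≡0 : FineFrame.q pr 4≤k 1≤i F ≡ 0#) where
  open FineCases pr 4≤k 1≤i b≤bmax F
  open Apex pr 4≤k 1≤i b≤bmax F q≡0
  open Fine F using (apex; lower)

  η : Point → ℚ
  η p = K * I * u p - fst p

  id-η : ∀ p → applyAff (+ 1) (+ 0) (+ 0) (+ 1) (+ 0 , + 0) p ≡ (fst p , snd p)
  id-η (x , y) = cong₂ _,_ (id332 x y) (id454 x y)

  -- An entry of the reflection (x, y) ↦ (i + 1 - k (i+1) y - x, y), which fixes heights and
  -- exchanges the two reference lines.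
  rf-b : ℤ
  rf-b = Z.- + (k N.* suc i)

  rf-η : ∀ p → applyAff (Z.- + 1) rf-b (+ 0) (+ 1) (+ suc i , + 0) p ≡ (η p , snd p)
  rf-η (x , y) = cong₂ _,_ (trans (cong₂ (λ m s → - 1# * x + m * y + s) (trans (ι-neg (+ (k N.* suc i))) (cong -_ ν-X)) (suc-ν i)) (sym (by-Kκ I (id455 K κ I x y)))) (id454 x y)

  η-η : ∀ x y → η (η (x , y) , y) ≡ x
  η-η x y = sym (y-back (K * I * (κ - y)) x)

  rf-invol : ∀ p → applyAff (Z.- + 1) rf-b (+ 0) (+ 1) (+ suc i , + 0) (applyAff (Z.- + 1) rf-b (+ 0) (+ 1) (+ suc i , + 0) p) ≡ p
  rf-invol (x , y) = trans (cong (applyAff (Z.- + 1) rf-b (+ 0) (+ 1) (+ suc i , + 0)) (rf-η (x , y))) (trans (rf-η (η (x , y) , y)) (cong (_, y) (η-η x y)))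

  rf-det : ∀ m → (Z.- + 1) Z.* + 1 Z.- (Z.- m) Z.* + 0 ≡ Z.- + 1
  rf-det = ℤS.solve-∀

  module Id = Placement k i 4≤k cv lower (+ 1) (+ 0) (+ 0) (+ 1) (+ 0 , + 0) (inj₁ refl) (λ p → trans (cong (applyAff (+ 1) (+ 0) (+ 0) (+ 1) (+ 0 , + 0)) (id-η p)) (id-η p)) fst id-η xl (N - xr)
  module Rf = Placement k i 4≤k cv lower (Z.- + 1) rf-b (+ 0) (+ 1) (+ suc i , + 0) (inj₂ (rf-det (+ (k N.* suc i)))) rf-invol η rf-η (N - xr) xl

  R-η : ∀ v → R.ξ v ≡ η v
  R-η v = trans (R-x v) (trans (cong₂ (λ a d → a + d * u v - fst v) q≡0 D≡) (id456 (K * I * u v) (fst v)))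

  left-bound : ∀ {ρ a} → L.Bound ρ a → ∀ {v} → v ∈ P → ρ * u v ≤ fst v × a + K * (xl - a) * (u v - 1#) ≤ fst v
  left-bound {ρ} {a} B {v} m = subst (ρ * u v ≤_) (L-x v) (L.Bound.upper B m) , subst₂ (λ e x → a + K * (e - a) * (u v - 1#) ≤ x) eL (L-x v) (L.Bound.lower B m)

  right-bound : ∀ {ρ a} → R.Bound ρ a → ∀ {v} → v ∈ P → ρ * u v ≤ η v × a + K * (N - xr - a) * (u v - 1#) ≤ η v
  right-bound {ρ} {a} B {v} m = subst (ρ * u v ≤_) (R-η v) (R.Bound.upper B m) , subst₂ (λ e x → a + K * (e - a) * (u v - 1#) ≤ x) eR' (R-η v) (R.Bound.lower B m)

  left-bound' : ∀ {ρ a} → L.Bound ρ a → Rf.FarBound ρ a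
  left-bound' {ρ} {a} B {v} m = subst (λ x → ρ * u v ≤ x × a + K * (xl - a) * (u v - 1#) ≤ x) (y-back (K * I * u v) (fst v)) (left-bound B m)

  via-id : ∀ {x y} → HIn P (x , y) → HIn P (Id.U (x , y))
  via-id {x} {y} h = subst (HIn P) (sym (id-η (x , y))) h

  via-rf : ∀ {z} x y → HIn P (z , y) → η (x , y) ≡ z → HIn P (Rf.U (x , y))
  via-rf x y h e = subst (HIn P) (sym (trans (rf-η (x , y)) (cong (_, y) e))) h

  left-corner : HIn P (xl , - 1#)
  left-corner = on-bottom xl ≤-refl xl≤xr

  right-corner : HIn P (xr , - 1#)
  right-corner = on-bottom xr xl≤xr ≤-refl

  η-bottom : ∀ x → η (N - x , - 1#) ≡ x
  η-bottom x = by-Kκ I (id457 K κ I x)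

  η-low : ∀ x → η (x , κ - 1#) ≡ K * I - x
  η-low x = id458 K κ I x

  xr-back : xr ≡ N - (N - xr)
  xr-back = y-back N xr

  id-apex : HIn P (Id.U (0# , κ))
  id-apex = via-id (vertex-HIn cv apex)

  rf-apex : HIn P (Rf.U (0# , κ))
  rf-apex = via-rf 0# κ (vertex-HIn cv apex) (id459 (K * I) κ)

  id-far : HIn P (Id.U (N - (N - xr) , - 1#))
  id-far = via-id (subst (λ x → HIn P (x , - 1#)) xr-back right-corner)

  id-≤ : xl ≤ N - (N - xr)
  id-≤ = subst (xl ≤_) xr-back xl≤xr

  rf-near : HIn P (Rf.U (N - xr , - 1#))
  rf-near = via-rf (N - xr) (- 1#) right-corner (η-bottom xr)

  rf-far : HIn P (Rf.U (N - xl , - 1#))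
  rf-far = via-rf (N - xl) (- 1#) left-corner (η-bottom xl)

  rf-≤ : N - xr ≤ N - xl
  rf-≤ = ≤-by (diff≥ xl≤xr) (id460 N xl xr)

  from-ptR : ∀ {x} → HIn P (ptR x 1#) → HIn P (K * I - x , κ - 1#)
  from-ptR {x} = subst (λ z → HIn P (z , κ - 1#)) (trans (ptR-x x 1#) (cong (_- x) (QP.*-identityʳ (K * I))))

  from-ptR0 : HIn P (ptR 0# 1#) → HIn P (K * I , κ - 1#)
  from-ptR0 h = subst (λ z → HIn P (z , κ - 1#)) (id461 (K * I)) (from-ptR {0#} h)

  rf-low : ∀ {x} → HIn P (x , κ - 1#) → HIn P (Rf.U (K * I - x , κ - 1#))
  rf-low {x} h = via-rf (K * I - x) (κ - 1#) h (trans (η-low (K * I - x)) (sym (y-back (K * I) x)))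

  rf-low0 : HIn P (K * I , κ - 1#) → HIn P (Rf.U (0# , κ - 1#))
  rf-low0 h = via-rf 0# (κ - 1#) h (trans (η-low 0#) (id461 (K * I)))

  rf-lowX : HIn P (0# , κ - 1#) → HIn P (Rf.U (K * I , κ - 1#))
  rf-lowX h = via-rf (K * I) (κ - 1#) h (trans (η-low (K * I)) (QP.+-inverseʳ (K * I)))

  -- The costs K a + K² ρ of the available bounds: 0 for a touching side, K for a sharp one and K +
  -- 1 for a gap. A missing corner at depth 1 adds 1/4 in the touching and gap cases.
  cost0 : K * 0# + K * K * 0# ≡ 0#
  cost0 = id462 K

  cost0' : K * (+ 1 / 4 * κ) + K * K * 0# ≡ + 1 / 4
  cost0' = by-Kκ (+ 1 / 4) (id463 K κ)

  costS : ∀ ρ → (K + 1#) * ρ ≡ 1# → K * ρ + K * K * ρ ≡ K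
  costS ρ h = trans (id464 K ρ) (trans (cong (K *_) h) (QP.*-identityʳ K))

  costG : K * κ + K * K * κ ≡ K + 1#
  costG = by-Kκ (K + 1#) (id465 K κ)

  costG' : K * (+ 5 / 4 * κ) + K * K * κ ≡ K + + 5 / 4
  costG' = by-Kκ (K + + 5 / 4) (id466 K κ)

  lbT : LB 0#
  lbT = 0# , 0# , L.bound0 , cost0

  rbT : RB 0#
  rbT = 0# , 0# , R.bound0 , cost0

  -- ρ is the slope 1/(k + 1) of the side from the apex to a sharp bottom corner.
  ρ-data : ∃[ ρ ] (0# < ρ × (K + 1#) * ρ ≡ 1#)
  ρ-data = recip (K + 1#) (K>0 ⊞< ≤-lit 0# 1#)

  ρ : ℚ
  ρ = fst ρ-data

  hρ : (K + 1#) * ρ ≡ 1#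
  hρ = snd (snd ρ-data)

  w-def : xr ≡ w + xl
  w-def = id467 xr xl

  flush : ∀ {x y} → x - y ≡ 0# → x ≡ y
  flush {x} {y} h = trans (id467 x y) (trans (cong (_+ y) h) (QP.+-identityˡ y))

  contra : ∀ {X : Set} → A ≡ rhs k i b → A < rhs k i b → X
  contra e h = ⊥-elim (<-irrefl e h)

  n0 : ℕ
  n0 = suc k N.* suc i

  xr≤N : xr ≤ N
  xr≤N = ≤-by R-e≥0 refl

  b≤∸3 : ∀ y → y ≤ N → ν b - κ ≡ y → b N.≤ bmax k i ∸ 3
  b≤∸3 y h e = subst (b N.≤_) (sym (NP.m+n∸n≡m n0 3)) (NP.≤-pred (ν-<⁻ b (suc n0) (<-by ((diff≥ (subst (_≤ N) (sym e) h)) ⊞≤< κ<1) (trans (cong (_- ν b) (trans (ν-suc n0) (cong (λ z → 1# + z) ν-N))) (id468 N (ν b) κ)))))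

  weight2 : K * ν 2 + (0# + 0#) - ν 2 * K ≡ 0#
  weight2 = id469 K

  as-nonneg : ∀ {x} → x ≡ 0# → 0# ≤ x
  as-nonneg e = ≤-reflexive (sym e)

  -- The vanishing slacks say that the bottom edge runs from z + κ to f + 1 - κ and that b = n + 2.
  -- With both corners at depth 1 in P this is a pentagon of index z, or of the reflected index.
  module Pentagon (2+n≤b : 2 N.+ n N.≤ b) (2+b≤ : 2 N.+ b N.≤ bmax k i) (s2 : ν n + 1# - ν 2 * κ - w ≡ 0#) (s3 : ν b - (ν 2 + ν n) ≡ 0#)
          (pL : HIn P (0# , κ - 1#)) (pR : HIn P (K * I , κ - 1#)) where

   rooms : ι f + 1# - (xr + κ) ≡ 0# × xl - (ι z + κ) ≡ 0#
   rooms = Weigh.zero-sum 2 2+n≤b lbT rbT (diff≥ xr≤) (diff≥ xl≥) (trans (sym w-room) s2)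

   xl≡ : xl ≡ ι z + κ
   xl≡ = flush {xl} {ι z + κ} (snd rooms)

   xr≡ : xr ≡ ι f + 1# - κ
   xr≡ = trans (add-sub xr κ) (cong (_- κ) (sym (flush {ι f + 1#} {xr + κ} (fst rooms))))

   νb : ν b ≡ ν 2 + (ι f - ι z)
   νb = trans (flush {ν b} {ν 2 + ν n} s3) (cong (λ y → ν 2 + y) νn)

   z≥0 : + 0 Z.≤ z
   z≥0 = ZP.i<j⇒suc[i]≤j (ι-<⁻ -[1+ 0 ] z (<-by (subst (0# ≤_) xl≡ (left-nonneg0 vl∈) ⊞≤< κ<1) (id470 (ι z) κ)))

   x : ℕ
   x = Z.∣ z ∣

   νx : ν x ≡ ι z
   νx = cong ι (ZP.0≤i⇒+∣i∣≡i z≥0)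

   b̃ : ℕ
   b̃ = bmax k i ∸ b

   νb̃ : ν b̃ ≡ N + ν 3 - ν b
   νb̃ = ν-bmax∸ b b≤bmax

   f+1≤N : 0# ≤ N - (ι f + 1#)
   f+1≤N = subst (λ y → 0# ≤ y - (ι f + 1#)) ν-N (diff≥ (ι-discrete f (+ n0) (subst (ι f <_) (sym ν-N) (<-by (diff≥ (subst (_≤ N) xr≡ xr≤N) ⊞≤< κ<1) (id471 N (ι f) κ)))))

   2+x≤b̃ : 2 N.+ x N.≤ b̃
   2+x≤b̃ = ν-≤⁻ (2 N.+ x) b̃ (≤-by f+1≤N (trans (cong₂ _-_ (trans νb̃ (cong (λ y → N + ν 3 - y) νb)) (trans (ν-+ 2 x) (cong (λ y → ν 2 + y) νx))) (id472 N (ι f) (ι z))))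

   b≤∸2 : b N.≤ bmax k i ∸ 2
   b≤∸2 = NP.∸-monoˡ-≤ 2 2+b≤

   2≤b : 2 N.≤ b
   2≤b = NP.≤-trans (NP.m≤m+n 2 n) 2+n≤b

   result : Extremal k i b P
   result = go (suc x NP.≤? b̃ ℕDM./ 2) where
    go : Dec (x N.< b̃ ℕDM./ 2) → Extremal k i b P
    go (yes h) = s2a b x , (2≤b , b≤∸2 , h) , refl , Id.as-2a id-apex (via-id left-corner) id-far id-≤ (left-bound L.bound0) (right-bound R.bound0) (via-id pL) (via-id pR) b x (2≤b , b≤∸2 , h)
      (trans (cong (_+ κ) νx) (sym xl≡)) (trans (trans (cong (λ y → y - 1# - κ) (trans (ν-+ x b) (cong₂ _+_ νx νb))) (id473 (ι f) (ι z) κ)) (trans (sym xr≡) xr-back))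
    -- The index z is beyond the admissible half, so the polygon is viewed through the reflection,
    -- where the index becomes bmax - b - 2 - z.
    go (no h) = s2a b x̄ , ad , refl , Rf.as-2a rf-apex rf-near rf-far rf-≤ (right-bound R.bound0) (left-bound' L.bound0) (rf-low0 pR) (rf-lowX pL) b x̄ ad
      (trans (cong (_+ κ) νx̄) (trans (id475 N (ι f) κ) (cong (λ y → N - y) (sym xr≡)))) (trans (cong (λ y → y - 1# - κ) (trans (ν-+ x̄ b) (cong₂ _+_ νx̄ νb))) (trans (id476 N (ι f) (ι z) κ) (cong (λ y → N - y) (sym xl≡)))) where
     x̄ = b̃ ∸ (2 N.+ x)
     ad : Admissible k i (s2a b x̄)
     ad = 2≤b , b≤∸2 , half-flip b̃ x (NP.≤-trans (NP.m≤m+n 2 x) 2+x≤b̃) (NP.≮⇒≥ h)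
     νx̄ : ν x̄ ≡ N - 1# - ι f
     νx̄ = trans (ν-∸ b̃ (2 N.+ x) 2+x≤b̃) (trans (cong₂ _-_ (trans νb̃ (cong (λ y → N + ν 3 - y) νb)) (trans (ν-+ 2 x) (cong (λ y → ν 2 + y) νx))) (id474 N (ι f) (ι z)))

  b>0 : ∀ {m} → suc m N.≤ b → b ≢ 0
  b>0 h e = NP.n≮0 (subst (_ N.<_) e h)

  module TouchTouch (t : Lk.Touch) (t' : Rk.Touch) where

   2+n≤b : 2 N.+ n N.≤ b
   2+n≤b = b≥2 t t'

   N-grid : Grid N
   N-grid = subst Grid ν-N (grid-ι (+ n0))

   -- The bottom edge is all of [0 , (k+1)(i+1)].
   full : xl ≡ 0# → N - xr ≡ 0# → 1 N.≤ b → bmax k i N.≤ suc b → Concl k i b P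
   full e e' h h' = b≤bmax , ≤-by ((A≤ lbT rbT ⊞ diff≥ b≥) ⊞ (K≥0 ⊠ N-w≥0)) (trans (high-eq {0#} {0#} h h') (id477 s (ν b) N (K * (N - w))))
     , λ _ → s2c , tt , b≡ , Id.as-2c id-apex (via-id left-corner) id-far id-≤ (left-bound L.bound0) (right-bound R.bound0) (sym e) (sym e') where
    s = Y + K * w - (0# + 0#) - A
    z<0 : ι z + 1# ≤ 0#
    z<0 = ι-discrete z (+ 0) (subst (ι z <_) e (fst (snd below)))
    f≥N : N ≤ ι f
    f≥N = subst (_≤ ι f) ν-N (ι-≤ (+ n0) f (ZP.≤-trans (ZP.i<j⇒i≤pred[j] (ι-<⁻ (+ n0) (Z.suc f) (subst₂ _<_ (sym (trans ν-N (flush e'))) (sym (ι-suc f)) (snd (snd floor))))) (ZP.≤-reflexive (ZP.pred-suc f))))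
    b≥ : N + ν 3 ≤ ν b
    b≥ = ≤-by ((room 2 2+n≤b ⊞ diff≥ f≥N) ⊞ diff≥ z<0) (trans (id478 (ν b) (ν n) N) (trans (cong (λ y → (ν b - (ν 2 + ν n)) + (y - N - 1#)) νn) (id479 (ν b - (ν 2 + ν n)) (ι f) (ι z) N)))
    b≡ : bmax k i ≡ b
    b≡ = NP.≤-antisym (ν-≤⁻ (bmax k i) b (subst (_≤ ν b) (sym (bmaxℚ k i)) b≥)) b≤bmax

   -- The missing length is a positive multiple of κ, so it costs at least 1 in the scaled area,
   -- which is what b ≥ bmax - 1 allows. Equality means that exactly κ is missing, hence all of it
   -- at one end, which is the quadrilateral with b = bmax - 1 or its mirror image.
   partial : 0# < N - w → 1 N.≤ b → bmax k i N.≤ suc b → Concl k i b P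
   partial d>0 h h' = b≤bmax , ≤-by slack eq , ext where
    s r : ℚ
    s = Y + K * w - (0# + 0#) - A
    r = ν b - (N + ν 2)
    d≥κ : 0# ≤ N - w - κ
    d≥κ = diff≥ (subst (_≤ N - w) (QP.+-identityˡ κ) (grid-step grid-0 (grid-- N-grid (grid-- xr-grid xl-grid)) d>0))
    Kd : 0# ≤ K * (N - w) - 1#
    Kd = subst (0# ≤_) (by-Kκ (- 1#) (id480 K κ (N - w))) (K≥0 ⊠ d≥κ)
    r≥0 : 0# ≤ r
    r≥0 = diff≥ (bmax-bound b h')
    slack : 0# ≤ s + (r + (K * (N - w) - 1#))
    slack = A≤ lbT rbT ⊞ (r≥0 ⊞ Kd)
    eq : rhs k i b - A ≡ s + (r + (K * (N - w) - 1#))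
    eq = trans (high-eq {0#} {0#} h h') (id481 s r (K * (N - w)))
    improved : ∀ {c c'} → LB c → RB c' → 0# < c + c' → A < rhs k i b
    improved {c} {c'} lb rb pos = <-by ((A≤ lb rb ⊞ (r≥0 ⊞ Kd)) ⊞≤< pos) (trans (high-eq {c} {c'} h h') (id482 (Y + K * w - (c + c') - A) r (K * (N - w)) (c + c')))
    open Weigh 2 2+n≤b lbT rbT using (zero-sum)
    ext : A ≡ rhs k i b → Extremal k i b P
    ext e = sides (QP.<-cmp 0# xl) where
     z1 = zero-sum (A≤ lbT rbT) (r≥0 ⊞ Kd) (trans (sym eq) (trans (cong (λ x → rhs k i b - x) e) (QP.+-inverseʳ (rhs k i b))))
     z2 = zero-sum r≥0 Kd (snd z1)
     b≡ : bmax k i ∸ 1 ≡ b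
     b≡ = ν-inj (bmax k i ∸ 1) b (trans (ν-bmax∸ 1 ≤bmax) (trans (id483 N) (sym (flush (fst z2)))))
     sum≡ : (N - xr) + xl ≡ κ
     sum≡ = trans (id442 N xr xl) (flush (≡0-cancel {K} K>0 (trans (by-Kκ (- 1#) (id480 K κ (N - w))) (snd z2))))
     sides : Tri (0# < xl) (0# ≡ xl) (xl < 0#) → Extremal k i b P
     sides (tri< g _ _) = s2b , tt , b≡ , Id.as-2b id-apex (via-id left-corner) id-far id-≤ (left-bound L.bound0) (right-bound R.bound0)
       (via-id ([ id , (λ B → contra e (improved (0# , + 1 / 4 * κ , B , cost0') rbT (<-lit 0# (+ 1 / 4)))) ]′ Lk.tight-touching)) (sym (flush (snd zs))) (sym (fst zs)) where
      zs : N - xr ≡ 0# × xl - κ ≡ 0#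
      zs = zero-sum R-e≥0 (diff≥ (subst (_≤ xl) (QP.+-identityˡ κ) (grid-step grid-0 xl-grid g))) (trans (id484 (N - xr) xl κ) (trans (cong (_- κ) sum≡) (QP.+-inverseʳ κ)))
     sides (tri≈ _ g _) = s2b , tt , b≡ , Rf.as-2b rf-apex rf-near rf-far rf-≤ (right-bound R.bound0) (left-bound' L.bound0)
       (rf-low0 (from-ptR0 ([ id , (λ B → contra e (improved lbT (0# , + 1 / 4 * κ , B , cost0') (<-lit 0# (0# + + 1 / 4)))) ]′ Rk.tight-touching))) (sym (trans (trans (id485 (N - xr)) (cong (λ y → N - xr + y) g)) sum≡)) g
     sides (tri> _ _ g) = ⊥-elim (<-irrefl refl (≤-<-trans (left-nonneg0 vl∈) g))

   module W = Weigh 2 2+n≤b lbT rbT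

   result : Range b → Concl k i b P
   result (none e) = ⊥-elim (b>0 2+n≤b e)
   result (high h h') = go (QP.<-cmp 0# (N - w)) where
    go : Tri (0# < N - w) (0# ≡ N - w) (N - w < 0#) → Concl k i b P
    go (tri< g _ _) = partial g h h'
    go (tri≈ _ g _) = full (snd zs) (fst zs) h h' where
     zs : N - xr ≡ 0# × xl ≡ 0#
     zs = W.zero-sum R-e≥0 (left-nonneg0 vl∈) (trans (id442 N xr xl) (sym g))
    go (tri> _ _ g) = ⊥-elim (<-irrefl refl (≤-<-trans N-w≥0 g))
   result (mid h h') = b≤bmax , W.mid-≤ h h' (as-nonneg weight2) , ext where
    ext : A ≡ rhs k i b → Extremal k i b P
    ext e = Pentagon.result 2+n≤b h' (fst ts) (snd ts)
      ([ id , (λ B → contra e (Weigh.mid-< 2 2+n≤b (0# , + 1 / 4 * κ , B , cost0') rbT h h' (subst (0# <_) (id486 K) (<-lit 0# (+ 1 / 4))))) ]′ Lk.tight-touching)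
      (from-ptR0 ([ id , (λ B → contra e (Weigh.mid-< 2 2+n≤b lbT (0# , + 1 / 4 * κ , B , cost0') h h' (subst (0# <_) (id487 K) (<-lit 0# (+ 1 / 4))))) ]′ Rk.tight-touching)) where
     ts = W.tight (as-nonneg weight2) (W.mid-eq h h') e

 -- All combinations of the two sides.

 module ApexResult {k i b : ℕ} {P : List Point} (pr : Prob k i b P) (4≤k : 4 N.≤ k) (1≤i : 1 N.≤ i) (b≤bmax : b N.≤ bmax k i) (F : Fine k i P)
          (q≡0 : FineFrame.q pr 4≤k 1≤i F ≡ 0#) where
  open FineCases pr 4≤k 1≤i b≤bmax F
  open Apex pr 4≤k 1≤i b≤bmax F q≡0
  open ApexCases pr 4≤k 1≤i b≤bmax F q≡0

  K-1>0 : 0# < K - 1#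
  K-1>0 = subst (0# <_) (id177 K) (diff≥ K≥4 ⊞≤< <-lit 0# (ν 3))

  pos : ∀ {x y} → 0# < x → y ≡ x → 0# < y
  pos h e = subst (0# <_) (sym e) h

  all-strict : ∀ t → t N.+ n N.≤ b → ∀ {c c'} → LB c → RB c' → (b ≡ 0 → 0# < K * ν t + (c + c') - ν 2 * K - 1#) → 0# < K * ν t + (c + c') - ν 2 * K → 0# < c + c' - 1# → Concl k i b P
  all-strict t hb {c} {c'} lb rb h0 h1 h2 = strictly (go (range b)) where
   module W = Weigh t hb {c} {c'} lb rb
   go : Range b → A < rhs k i b
   go (none e) = W.none-< e (h0 e)
   go (mid h h') = W.mid-< h h' h1
   go (high h h') = high-< {c} {c'} lb rb h h' h2

  lbS : ¬ Lk.Touch → L.e ≡ κ → LB K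
  lbS nt e = ρ , ρ , Lk.bound-sharp nt e ρ hρ , costS ρ hρ

  rbS : ¬ Rk.Touch → R.e ≡ κ → RB K
  rbS nt e = ρ , ρ , Rk.bound-sharp nt e ρ hρ , costS ρ hρ

  lbG : ¬ Lk.Touch → ν 2 * κ ≤ L.e → LB (K + 1#)
  lbG nt e = κ , κ , Lk.bound-gap nt e , costG

  rbG : ¬ Rk.Touch → ν 2 * κ ≤ R.e → RB (K + 1#)
  rbG nt e = κ , κ , Rk.bound-gap nt e , costG

  κ≡xl : L.e ≡ κ → κ ≡ xl
  κ≡xl e = trans (sym e) eL

  κ≡xr : R.e ≡ κ → κ ≡ N - xr
  κ≡xr e = trans (sym e) eR'

  w≡ : ν n + 1# - ν 2 * κ - w ≡ 0# → ν n + 1# - ν 2 * κ ≡ w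
  w≡ = flush {ν n + 1# - ν 2 * κ} {w}

  -- The bottom edge when its near end has coordinate κ and no room is left.
  far-end : ∀ t y → ν n + 1# - ν 2 * κ - w ≡ 0# → ν b - (ν t + ν n) ≡ 0# → y ≡ w + κ → ν b - ν t + 1# - κ ≡ y
  far-end t y s2 s3 e = trans (cong (λ z → z - ν t + 1# - κ) (flush {ν b} {ν t + ν n} s3)) (trans (id490 (ν t) (ν n) κ) (trans (cong (_+ κ) (w≡ s2)) (sym e)))

  far-id : κ ≡ xl → N - (N - xr) ≡ w + κ
  far-id e = trans (sym xr-back) (trans w-def (cong (λ y → w + y) (sym e)))

  far-rf : κ ≡ N - xr → N - xl ≡ w + κ
  far-rf e = trans (id491 N xr xl) (cong (λ y → w + y) (sym e))

  -- The counted end of the row and the sharp corner weigh 2 K together, exactly what the middle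
  -- range needs. Equality gives the quadrilateral (1a), seen through the reflection because the
  -- sharp corner is on the right.
  touch-sharp : Lk.Touch → ¬ Rk.Touch → R.e ≡ κ → Concl k i b P
  touch-sharp t nt e = go (range b) where
   hb = b≥1ˡ t
   rb = rbS nt e
   module W = Weigh 1 hb lbT rb
   weight : K * 1# + (0# + K) - ν 2 * K ≡ 0#
   weight = id492 K
   go : Range b → Concl k i b P
   go (none z) = ⊥-elim (b>0 hb z)
   go (high h h') = strictly (high-< lbT rb h h' (pos K-1>0 (cong (_- 1#) (QP.+-identityˡ K))))
   go (mid h h') = b≤bmax , W.mid-≤ h h' (as-nonneg weight) , ext where
    ext : A ≡ rhs k i b → Extremal k i b P
    ext eq = s1a b , (h , le) , refl , Rf.as-1a rf-apex rf-near rf-far rf-≤ ρ hρ (right-bound (Rk.bound-sharp nt e ρ hρ)) (left-bound' L.bound0)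
      (rf-lowX ([ id , (λ B → contra eq (Weigh.mid-< 1 hb (0# , + 1 / 4 * κ , B , cost0') rb h h' (pos (<-lit 0# (+ 1 / 4)) (id493 K)))) ]′ Lk.tight-touching)) b (h , le) (κ≡xr e) end where
     ts = W.tight (as-nonneg weight) (W.mid-eq h h') eq
     end : ν b - κ ≡ N - xl
     end = trans (drop1 (ν b) κ) (far-end 1 (N - xl) (fst ts) (snd ts) (far-rf (κ≡xr e)))
     le : b N.≤ bmax k i ∸ 3
     le = b≤∸3 (N - xl) (≤-by (left-nonneg0 vl∈) (sym (y-back N xl))) end

  sharp-touch : ¬ Lk.Touch → L.e ≡ κ → Rk.Touch → Concl k i b P
  sharp-touch nt e t = go (range b) where
   hb = b≥1ʳ t
   lb = lbS nt e
   module W = Weigh 1 hb lb rbT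
   weight : K * 1# + (K + 0#) - ν 2 * K ≡ 0#
   weight = id494 K
   go : Range b → Concl k i b P
   go (none z) = ⊥-elim (b>0 hb z)
   go (high h h') = strictly (high-< lb rbT h h' (pos K-1>0 (cong (_- 1#) (QP.+-identityʳ K))))
   go (mid h h') = b≤bmax , W.mid-≤ h h' (as-nonneg weight) , ext where
    ext : A ≡ rhs k i b → Extremal k i b P
    ext eq = s1a b , (h , le) , refl , Id.as-1a id-apex (via-id left-corner) id-far id-≤ ρ hρ (left-bound (Lk.bound-sharp nt e ρ hρ)) (right-bound R.bound0)
      (via-id (from-ptR0 ([ id , (λ B → contra eq (Weigh.mid-< 1 hb lb (0# , + 1 / 4 * κ , B , cost0') h h' (pos (<-lit 0# (+ 1 / 4)) (id495 K)))) ]′ Rk.tight-touching))) b (h , le) (κ≡xl e) end where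
     ts = W.tight (as-nonneg weight) (W.mid-eq h h') eq
     end : ν b - κ ≡ N - (N - xr)
     end = trans (drop1 (ν b) κ) (far-end 1 (N - (N - xr)) (fst ts) (snd ts) (far-id (κ≡xl e)))
     le : b N.≤ bmax k i ∸ 3
     le = b≤∸3 (N - (N - xr)) (subst (_≤ N) xr-back xr≤N) end

  -- Both corners are fixed, so the bottom edge has length N - 2 κ; in the middle range equality
  -- then determines b = bmax - 4 and the triangle (0a).
  sharp-sharp : ¬ Lk.Touch → L.e ≡ κ → ¬ Rk.Touch → R.e ≡ κ → Concl k i b P
  sharp-sharp nt e nt' e' = go (range b) where
   lb = lbS nt e
   rb = rbS nt' e'
   module W = Weigh 0 n≤b lb rb
   weight : K * 0# + (K + K) - ν 2 * K ≡ 0#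
   weight = id496 K
   w≡N : w ≡ N - κ - κ
   w≡N = trans (id497 N xr xl) (cong₂ (λ x y → N - x - y) (sym (κ≡xr e')) (sym (κ≡xl e)))
   go : Range b → Concl k i b P
   -- A bottom edge of length N - 2 κ carries at least N - 1 lattice points, and N ≥ 5, against b =
   -- 0.
   go (none z0) = absurd-by ((w≤ ⊞ diff≥ (ν-≤ n b n≤b)) ⊞ N≥5) (<-lit 0# (ν 4)) (trans (cong₂ (λ x y → (ν n + 1# - ν 2 * κ - x + (y - ν n)) + (N - ν 5) + ν 4) w≡N (cong ν z0)) (id498 (ν n) κ N))
   go (high h h') = strictly (high-< lb rb h h' (pos (K>0 ⊞< <⇒≤ K-1>0) (QP.+-assoc K K (- 1#))))
   go (mid h h') = b≤bmax , W.mid-≤ h h' (as-nonneg weight) , ext where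
    ext : A ≡ rhs k i b → Extremal k i b P
    ext eq = s0a , ≤bmax , b≡ , Id.as-0a id-apex (via-id left-corner) id-far id-≤ ρ hρ (left-bound (Lk.bound-sharp nt e ρ hρ)) (right-bound (Rk.bound-sharp nt' e' ρ hρ)) (κ≡xl e) (κ≡xr e') where
     ts = W.tight (as-nonneg weight) (W.mid-eq h h') eq
     b≡ : bmax k i ∸ 4 ≡ b
     b≡ = ν-inj (bmax k i ∸ 4) b (trans (ν-bmax∸ 4 ≤bmax) (trans (id499 N κ) (trans (cong (λ z → z - 1# + ν 2 * κ) (trans (sym w≡N) (sym (w≡ (fst ts))))) (trans (id500 (ν n) κ) (sym (flush {ν b} {0# + ν n} (snd ts)))))))

  weight-SG : K * 0# + (K + (K + 1#)) - ν 2 * K - 1# ≡ 0#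
  weight-SG = id501 K

  b-end : ∀ y → b ≡ 0 → ν b - 0# + 1# - κ ≡ y → 1# - κ ≡ y
  b-end y e h = trans (id502 κ) (trans (cong (λ m → ν m - 0# + 1# - κ) (sym e)) h)

  -- The weight is 2 K + 1. This is one more than the middle range needs, so the bound is strict
  -- there, and exactly enough for b = 0, where equality gives (0b).
  sharp-gap : ¬ Lk.Touch → L.e ≡ κ → ¬ Rk.Touch → ν 2 * κ ≤ R.e → Concl k i b P
  sharp-gap nt e nt' e' = go (range b) where
   lb = lbS nt e
   rb = rbG nt' e'
   module W = Weigh 0 n≤b lb rb
   go : Range b → Concl k i b P
   go (mid h h') = strictly (W.mid-< h h' (pos (<-lit 0# 1#) (id503 K)))
   go (high h h') = strictly (high-< lb rb h h' (pos (K>0 ⊞< K≥0) (id504 K)))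
   go (none z0) = b≤bmax , W.none-≤ z0 (as-nonneg weight-SG) , ext where
    ext : A ≡ rhs k i b → Extremal k i b P
    ext eq = s0b , tt , sym z0 , Id.as-0b id-apex (via-id left-corner) id-far id-≤ ρ hρ (left-bound (Lk.bound-sharp nt e ρ hρ)) (right-bound (Rk.bound-gap nt' e'))
      (via-id (from-ptR {κ} ([ id , (λ B → contra eq (Weigh.none-< 0 n≤b lb (κ , + 5 / 4 * κ , B , costG') z0 (pos (<-lit 0# (+ 1 / 4)) (id505 K)))) ]′ (Rk.tight-gap nt' e')))) (κ≡xl e)
      (b-end (N - (N - xr)) z0 (far-end 0 (N - (N - xr)) (fst ts) (snd ts) (far-id (κ≡xl e)))) where
     ts = W.tight (as-nonneg weight-SG) (W.none-eq z0) eq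

  gap-sharp : ¬ Lk.Touch → ν 2 * κ ≤ L.e → ¬ Rk.Touch → R.e ≡ κ → Concl k i b P
  gap-sharp nt e nt' e' = go (range b) where
   lb = lbG nt e
   rb = rbS nt' e'
   module W = Weigh 0 n≤b lb rb
   weight : K * 0# + (K + 1# + K) - ν 2 * K - 1# ≡ 0#
   weight = id506 K
   go : Range b → Concl k i b P
   go (mid h h') = strictly (W.mid-< h h' (pos (<-lit 0# 1#) (id507 K)))
   go (high h h') = strictly (high-< lb rb h h' (pos (K>0 ⊞< K≥0) (id508 K)))
   go (none z0) = b≤bmax , W.none-≤ z0 (as-nonneg weight) , ext where
    ext : A ≡ rhs k i b → Extremal k i b P
    ext eq = s0b , tt , sym z0 , Rf.as-0b rf-apex rf-near rf-far rf-≤ ρ hρ (right-bound (Rk.bound-sharp nt' e' ρ hρ)) (left-bound' (Lk.bound-gap nt e))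
      (rf-low {κ} ([ id , (λ B → contra eq (Weigh.none-< 0 n≤b (κ , + 5 / 4 * κ , B , costG') rb z0 (pos (<-lit 0# (+ 1 / 4)) (id509 K)))) ]′ (Lk.tight-gap nt e))) (κ≡xr e')
      (b-end (N - xl) z0 (far-end 0 (N - xl) (fst ts) (snd ts) (far-rf (κ≡xr e')))) where
     ts = W.tight (as-nonneg weight) (W.none-eq z0) eq

  -- The weight exceeds 2 K by 1 and the touched end of the row excludes b = 0, so equality never
  -- occurs.
  touch-gap : Lk.Touch → ¬ Rk.Touch → ν 2 * κ ≤ R.e → Concl k i b P
  touch-gap t nt e = all-strict 1 (b≥1ˡ t) lbT (rbG nt e) (λ z → ⊥-elim (b>0 (b≥1ˡ t) z)) (pos (<-lit 0# 1#) (id510 K)) (pos K>0 (id511 K))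

  gap-touch : ¬ Lk.Touch → ν 2 * κ ≤ L.e → Rk.Touch → Concl k i b P
  gap-touch nt e t = all-strict 1 (b≥1ʳ t) (lbG nt e) rbT (λ z → ⊥-elim (b>0 (b≥1ʳ t) z)) (pos (<-lit 0# 1#) (id512 K)) (pos K>0 (id513 K))

  gap-gap : ¬ Lk.Touch → ν 2 * κ ≤ L.e → ¬ Rk.Touch → ν 2 * κ ≤ R.e → Concl k i b P
  gap-gap nt e nt' e' = all-strict 0 n≤b (lbG nt e) (rbG nt' e') (λ _ → pos (<-lit 0# 1#) (id514 K)) (pos (<-lit 0# (ν 2)) (id515 K)) (pos ((K>0 ⊞< K≥0) ⊞< ≤-lit 0# 1#) (id516 K))

  result : Concl k i b P
  result = go Lk.kind Rk.kind where
   go : Lk.Kind → Rk.Kind → Concl k i b P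
   go (Lk.touching t) (Rk.touching t') = TouchTouch.result t t' (range b)
   go (Lk.touching t) (Rk.sharp nt e) = touch-sharp t nt e
   go (Lk.touching t) (Rk.gap nt e) = touch-gap t nt e
   go (Lk.sharp nt e) (Rk.touching t) = sharp-touch nt e t
   go (Lk.sharp nt e) (Rk.sharp nt' e') = sharp-sharp nt e nt' e'
   go (Lk.sharp nt e) (Rk.gap nt' e') = sharp-gap nt e nt' e'
   go (Lk.gap nt e) (Rk.touching t) = gap-touch nt e t
   go (Lk.gap nt e) (Rk.sharp nt' e') = gap-sharp nt e nt' e'
   go (Lk.gap nt e) (Rk.gap nt' e') = gap-gap nt e nt' e'

 fine-result : ∀ {k i b P} → Prob k i b P → 4 N.≤ k → 1 N.≤ i → b N.≤ bmax k i → Fine k i P → Concl k i b P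
 fine-result {k} {i} {b} {P} pr 4≤k 1≤i b≤ F = go (QP.<-cmp 0# q) where
  open FineFrame pr 4≤k 1≤i F using (q; q≥0)
  go : Tri (0# < q) (0# ≡ q) (q < 0#) → Concl k i b P
  go (tri< h _ _) = FineCases.second-top pr 4≤k 1≤i b≤ F h
  go (tri≈ _ h _) = ApexResult.result pr 4≤k 1≤i b≤ F (sym h)
  go (tri> _ _ h) = ⊥-elim (<-irrefl refl (≤-<-trans q≥0 h))

 -- Case distinction by the number of interior levels.

 some-levels : ∀ {P} → ConvexCCW P → ∃[ B ] ∃[ T ] Levels P B T
 some-levels {[]} (() , _)
 some-levels {p ∷ ps} _ = levels p ps

 -- The lowest integer level strictly above B is g + 1 and the highest one strictly below U is j;
 -- the level of the interior lattice point lies between them, so their difference is a natural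
 -- number.
 module Dispatch {k i b : ℕ} (4≤k : 4 N.≤ k) (1≤i : 1 N.≤ i) {P : List Point} (pr : Prob k i b P) (w : Wide k P) {B U : ℚ} (L : Levels P B U)
         (z0 : ℤ × ℤ) (hz0 : HInt P (lat z0)) (g : ℤ) (g≤ : ι g ≤ B) (<g : B < ι g + 1#) (j : ℤ) (<j : ι j < U) (j≤ : U ≤ ι j + 1#) where
  open Prob pr

  1≤k : 1 N.≤ k
  1≤k = NP.≤-trans (N.s≤s N.z≤n) 4≤k

  J : ℤ
  J = Z.suc g

  J≤j : J Z.≤ j
  J≤j = ZP.≤-trans (ZP.i<j⇒suc[i]≤j (ι-<⁻ g (snd z0) (≤-<-trans g≤ (fst (HInt-levels cv L hz0)))))
   (ZP.≤-trans (ZP.i<j⇒i≤pred[j] (ι-<⁻ (snd z0) (Z.suc j) (subst (ι (snd z0) <_) (sym (ι-suc j)) (<-≤-trans (snd (HInt-levels cv L hz0)) j≤)))) (ZP.≤-reflexive (ZP.pred-suc j)))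

  hB1 : B < ι J
  hB1 = subst (B <_) (sym (ι-suc g)) <g

  hB2 : ι J ≤ B + 1#
  hB2 = subst (_≤ B + 1#) (sym (ι-suc g)) (QP.+-monoˡ-≤ 1# g≤)

  top-level : J Z.+ + Z.∣ j Z.- J ∣ ≡ j
  top-level = trans (cong (λ x → J Z.+ x) (ZP.0≤i⇒+∣i∣≡i (ZP.i≤j⇒0≤j-i J≤j))) (l J j) where
   l : ∀ a b → a Z.+ (b Z.- a) ≡ b
   l = ℤS.solve-∀

  result : Concl k i b P
  result = go Z.∣ j Z.- J ∣ (subst (λ x → ι x < U) (sym top-level) <j) (subst (λ x → U ≤ ι x + 1#) (sym top-level) j≤) where
   go : ∀ n → ι (J Z.+ + n) < U → U ≤ ι (J Z.+ + n) + 1# → Concl k i b P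
   go 0 h h' = OneLevel.result pr w 4≤k 1≤i L z0 hz0 J hB1 hB2 h h' (λ pr' b≤ th → normalise pr' 1≤k 1≤i th (λ pr″ F → fine-result pr″ 4≤k 1≤i b≤ F))
   go 1 h h' = TwoLevels.result pr w 4≤k L z0 hz0 J hB1 hB2 h h'
   go 2 h h' = ThreeLevels.result pr w 4≤k L z0 hz0 J hB1 hB2 h h'
   go (suc (suc (suc n))) h h' = ManyLevels.result pr w 4≤k L z0 hz0 J n hB1 hB2 h h'

 area-bound-and-equality : ∀ {k i b P} → 4 N.≤ k → 1 N.≤ i → Prob k i b P → Concl k i b P
 area-bound-and-equality {k} {i} {b} {P} 4≤k 1≤i pr = reduce-to-wide (NP.≤-trans (N.s≤s N.z≤n) 4≤k) 1≤i pr wide where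
  wide : ∀ {P'} → Prob k i b P' → Wide k P' → Concl k i b P'
  wide {P'} pr' w = go (some-levels (Prob.cv pr')) (interior-lattice-point pr' 1≤i) where
   go : ∃[ B ] ∃[ U ] Levels P' B U → ∃[ z ] HInt P' (lat z) → Concl k i b P'
   go (B , U , L) (z0 , hz0) = go' (floorℚ B) (strictly-below U) where
    go' : ∃[ z ] (ι z ≤ B × B < ι z + 1#) → ∃[ z ] (ι z < U × U ≤ ι z + 1#) → Concl k i b P'
    go' (g , g≤ , <g) (j , <j , j≤) = Dispatch.result 4≤k 1≤i pr' w L z0 hz0 g g≤ <g j <j j≤

 -- Return to convex combinations and the Euclidean interior.

 HasCard-cong : ∀ {Q Q' : ℤ × ℤ → Set} {n} → (∀ z → Q z → Q' z) → (∀ z → Q' z → Q z) → HasCard Q n → HasCard Q' n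
 HasCard-cong f g (zs , un , len , h) = zs , un , len , λ z → (λ m → f z (fst (h z) m)) , (λ q → snd (h z) (g z q))

 problem : ∀ {k i b P} → ConvexCCW P → Denominator P k → HasCard (λ z → Interior P (lat z)) i → HasCard (λ z → Boundary P (lat z)) b → Prob k i b P
 problem cv (_ , int , _) ci cb = record
  { cv = cv
  ; integral = λ m → All.lookup int m
  ; ints = HasCard-cong (λ z → Interior⇒HInt cv) (λ z → HInt⇒Interior cv) ci
  ; bds = HasCard-cong (λ z (c , n) → InConv⇒HIn cv c , λ h → n (HInt⇒Interior cv h)) (λ z (c , n) → HIn⇒InConv cv c , λ h → n (Interior⇒HInt cv h)) cb }

 scaled-area2 : ∀ k P → (ν 2 * ν (k N.* k)) * area P ≡ ν (k N.* k) * area2 P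
 scaled-area2 k P = id517 (ν (k N.* k)) (area2 P)

 bound-and-classification : ∀ P → ConvexCCW P → ∀ k i b → Denominator P k → 4 N.≤ k → 1 N.≤ i →
  HasCard (λ z → Interior P (lat z)) i → HasCard (λ z → Boundary P (lat z)) b →
  b N.≤ bmax k i × (ν 2 * ν (k N.* k)) * area P ≤ rhs k i b
   × ((ν 2 * ν (k N.* k)) * area P ≡ rhs k i b → Extremal k i b P) × (Extremal k i b P → (ν 2 * ν (k N.* k)) * area P ≡ rhs k i b)
 bound-and-classification P cv k i b den 4≤k 1≤i ci cb = from (area-bound-and-equality 4≤k 1≤i (problem cv den ci cb)) where
  from : Concl k i b P → _
  from (h1 , h2 , h3) = h1 , subst (_≤ rhs k i b) (sym (scaled-area2 k P)) h2 , (λ e → h3 (trans (sym (scaled-area2 k P)) e))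
   , λ (s , ad , e , eq) → trans (scaled-area2 k P) (trans (ShapeFacts.equivalent⇒rhs k i 4≤k cv s ad eq) (cong (rhs k i) e))

open import Defs
open import Data.Nat using (ℕ; _≤_; _∸_)
open import Data.Rational using (ℚ; _*_) renaming (_≤_ to _≤ℚ_)
open import Data.Product using (∃-syntax; _×_; _,_)
open import Data.List using (List)
open import Relation.Binary.PropositionalEquality using (_≡_; _≢_)
open import Relation.Nullary using (¬_)

theorem1p3 : (P : List Point) → ConvexCCW P →
    (k i b : ℕ) → Denominator P k → 4 ≤ k → 1 ≤ i →
    HasCard (λ z → Interior P (lat z)) i → HasCard (λ z → Boundary P (lat z)) b →
    (b ≤ bmax k i
    × ((ℕ→ℚ 2 * ℕ→ℚ (k Data.Nat.* k)) * area P) ≤ℚ rhs k i b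
    × ((((ℕ→ℚ 2 * ℕ→ℚ (k Data.Nat.* k)) * area P) ≡ rhs k i b)
    → ∃[ s ] (Admissible k i s × bOf k i s ≡ b × Equivalent P (shape k i s)))
    × (∃[ s ] (Admissible k i s × bOf k i s ≡ b × Equivalent P (shape k i s))
    → ((ℕ→ℚ 2 * ℕ→ℚ (k Data.Nat.* k)) * area P) ≡ rhs k i b))
    × ((s t : Shape) → Admissible k i s → Admissible k i t → s ≢ t →
    ¬ Equivalent (shape k i s) (shape k i t))
theorem1p3 P cv k i b den 4≤k 1≤i ci cb = ThinPolygons.bound-and-classification P cv k i b den 4≤k 1≤i ci cb , ThinPolygons.ShapeFacts.non-equivalent k i 4≤k
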